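{- For every $\alpha>0$ and $\Delta\in\mathbb{N}$ there is $C_0$ such that for every $C_*\ge C_0$ there is $n_0$ such that for all $n\ge n_0$ the following holds. Let $G$ be an $n$-vertex graph with $\delta(G)\ge(1/2+\alpha)n$, let $T$ be a tree on $n$ vertices with $\Delta(T)\le\Delta$, let $t\in V(T)$ and $v\in V(G)$. Then there exists a random embedding $\phi$ of $T$ into $G$ such that $\phi(t)=v$ with probability $1$ and the distribution of $\phi$ restricted to $V(T)\setminus\{t\}$ is $\frac{C_*}{n}$-spread.
   Context: An embedding of $T$ into $G$ is an injective map $V(T)\to V(G)$ sending edges of $T$ to edges of $G$. A probability distribution $\mu$ on injections $\varphi:X\to Y$ is $q$-spread if for all sequences of distinct $x_1,\ldots,x_s\in X$ and distinct $y_1,\ldots,y_s\in Y$, $\mu(\{\varphi:\varphi(x_i)=y_i\ \forall i\in[s]\})\le q^s$. $\delta(G)$ denotes minimum degree and $\Delta(T)$ maximum degree. -}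

module Defs where

open import Data.Nat using (ℕ; zero; suc; _≥_; NonZero)
open import Data.Fin using (Fin)
open import Data.Fin.Properties using (_≟_)
open import Data.Bool using (Bool; true; false; _∧_; if_then_else_)
open import Data.List using (List; []; _∷_; allFin)
import Data.List as List
open import Data.List.Relation.Unary.AllPairs using (AllPairs)
open import Data.List.Relation.Unary.All using (All)
open import Data.Product using (Σ; _×_; _,_; proj₁; proj₂; ∃-syntax)
open import Data.Integer using (+_)
open import Data.Rational using (ℚ; 0ℚ; 1ℚ; _+_; _*_; _≤_; _/_)
open import Relation.Binary.PropositionalEquality using (_≡_; _≢_)
open import Relation.Nullary using (¬_)
open import Data.Bool.ListAction using (and)
open import Data.Unit using (⊤)
open import Data.Empty using (⊥)
open import Relation.Nullary.Decidable using (⌊_⌋)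
open import Function.Definitions using (Injective)

record Graph (n : ℕ) : Set where
  field
    adj     : Fin n → Fin n → Bool
    adj-sym : ∀ u v → adj u v ≡ adj v u
    adj-irr : ∀ v → adj v v ≡ false
open Graph public

countTrue : List Bool → ℕ
countTrue []            = 0
countTrue (true  ∷ bs)  = suc (countTrue bs)
countTrue (false ∷ bs)  = countTrue bs

deg : ∀ {n} → Graph n → Fin n → ℕ
deg {n} G v = countTrue (List.map (adj G v) (allFin n))

MinDegreeAtLeast : ∀ {n} → Graph n → ℚ → Set
MinDegreeAtLeast G d = ∀ v → d ≤ (+ deg G v / 1)

MaxDegreeAtMost : ∀ {n} → Graph n → ℕ → Set
MaxDegreeAtMost T D = ∀ v → deg T v Data.Nat.≤ D

data Walk {n} (G : Graph n) : Fin n → Fin n → Set where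
  here : ∀ {u} → Walk G u u
  step : ∀ {u w v} → adj G u w ≡ true → Walk G w v → Walk G u v

Connected : ∀ {n} → Graph n → Set
Connected G = ∀ u v → Walk G u v

ConsecAdj : ∀ {n} → Graph n → List (Fin n) → Set
ConsecAdj G []               = ⊤
ConsecAdj G (x ∷ [])         = ⊤
ConsecAdj G (x ∷ y ∷ zs)     = (adj G x y ≡ true) × ConsecAdj G (y ∷ zs)

lastOr : ∀ {A : Set} → A → List A → A
lastOr x []       = x
lastOr x (y ∷ ys) = lastOr y ys

IsCycle : ∀ {n} → Graph n → List (Fin n) → Set
IsCycle G []                 = ⊥
IsCycle G (v₀ ∷ rest) =
  3 Data.Nat.≤ List.length (v₀ ∷ rest)
  × AllPairs _≢_ (v₀ ∷ rest)
  × ConsecAdj G (v₀ ∷ rest)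
  × (adj G (lastOr v₀ rest) v₀ ≡ true)

Acyclic : ∀ {n} → Graph n → Set
Acyclic G = ∀ cs → ¬ IsCycle G cs

IsTree : ∀ {n} → Graph n → Set
IsTree G = Connected G × Acyclic G

IsEmbedding : ∀ {n} → Graph n → Graph n → (Fin n → Fin n) → Set
IsEmbedding T G φ =
  Injective _≡_ _≡_ φ × (∀ x y → adj T x y ≡ true → adj G (φ x) (φ y) ≡ true)

Embedding : ∀ {n} → Graph n → Graph n → Set
Embedding T G = Σ _ (IsEmbedding T G)

record Distribution (A : Set) : Set where
  field
    support  : List (A × ℚ)
    nonneg   : All (λ p → 0ℚ ≤ proj₂ p) support
    total    : List.foldr (λ p s → proj₂ p + s) 0ℚ support ≡ 1ℚ
open Distribution public

Pr : ∀ {A} → Distribution A → (A → Bool) → ℚ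
Pr D E = List.foldr (λ p s → (if E (proj₁ p) then proj₂ p else 0ℚ) + s) 0ℚ (support D)

_^ℚ_ : ℚ → ℕ → ℚ
q ^ℚ zero  = 1ℚ
q ^ℚ suc s = q * (q ^ℚ s)

AllMapped : ∀ {n s} → (Fin s → Fin n) → (Fin s → Fin n) → (Fin n → Fin n) → Bool
AllMapped {s = s} xs ys φ = and (List.map (λ i → ⌊ φ (xs i) ≟ ys i ⌋) (allFin s))

SpreadAway : ∀ {n} (T G : Graph n) → Distribution (Embedding T G) → Fin n → ℚ → Set
SpreadAway {n} T G D t q =
  ∀ (s : ℕ) (xs ys : Fin s → Fin n) →
  Injective _≡_ _≡_ xs → (∀ i → xs i ≢ t) → Injective _≡_ _≡_ ys →
  Pr D (λ e → AllMapped xs ys (proj₁ e)) ≤ (q ^ℚ s)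

MapsWithProbOne : ∀ {n} (T G : Graph n) → Distribution (Embedding T G) → Fin n → Fin n → Set
MapsWithProbOne T G D t v = Pr D (λ e → ⌊ proj₁ e t ≟ v ⌋) ≡ 1ℚ

{-# OPTIONS --safe #-}
-- Start from a uniformly random bijection V(T) → V(G) with t ↦ v and treat the other vertices x of T
-- one by one: pick y uniformly among g = Ω(n) admissible vertices and exchange the images of x and y.
-- Each step increases the probability that s given images are prescribed by a factor of at most
-- (1 + 1/g)^s, so whatever the admissible sets are, the result is O(1/n)-spread.
--
-- The admissible sets come from a deterministic strategy.  T is cut into blocks of bounded size
-- at the depths ≡ -σ modulo H.  While the set U of unused vertices is large, G[U] has minimum degree
-- above |U|/2 and hence carries symmetric edge weights with constant row sums; the corresponding
-- random walk mixes in boundedly many steps, and a block is embedded along it while the conditional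
-- expectation of a potential Σ (1 + 1/b)^test is kept from growing.  A bounded potential means that
-- every vertex keeps degree above |U|/2 into U, and that for all u, w a constant fraction of the embedded
-- vertices y are mapped into N(w) with all their neighbours mapped into N(u).  Once |U| is a small
-- fraction of n, a vertex x currently sent to u, whose parent is sent to w, takes over the image
-- of such a y, while y moves to u.
module Submission where

-- The spread bound never looks at the admissible sets, so the strategy has to succeed for every
-- sequence of choices: what a random embedding satisfies only with high probability must be
-- enforced surely. Concentration is therefore replaced by a potential, and images at which its
-- conditional expectation grows by more than a factor 1 + 1/κ are forbidden; Markov's inequality
-- leaves Ω(n) others. A single vertex gives no control, since its image is confined to the
-- neighbourhood of its parent's image. Only after many steps of the walk is a position nearly
-- uniform, so potentials are compared from block to block. Constant row sums make the uniform law
-- stationary; a plain walk would use up vertices in proportion to their degree. Vertices near the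
-- root of a block or on its lower boundary are charged at the worst case, and the shift σ makes
-- them rare. The constants are not circular: `c` comes from k and Δ, then the fraction 1/`ē` left
-- to the end, the drift `z`, the mixing time `h`, the period 1 + `H'`, the block size `M`, the base
-- `b` of the weights, and last g = Ω(n).

module Development where

  open import Defs hiding (here; step; total)
  open import Data.Nat using (ℕ; zero; suc; _+_; _*_; _∸_; _^_; _≤_; _<_; _≥_; z≤n; s≤s; NonZero; >-nonZero; _!)
  open import Data.Nat.Properties
  open import Data.Nat.Tactic.RingSolver using (solve-∀)
  open import Data.Fin using (Fin; zero; suc)
  import Data.Fin.Properties as F
  open import Data.Bool.Properties using (∧-comm)
  open import Data.Bool using (Bool; true; false; _∧_; _∨_; not; if_then_else_)
  open import Data.List using (List; []; _∷_; length; _++_; map; filterᵇ; concatMap; allFin)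
  open import Data.List.Membership.Propositional using (_∈_; _∉_)
  open import Data.List.Relation.Unary.Any using (here; there)
  open import Data.List.Relation.Unary.All as All using (All; []; _∷_)
  open import Data.List.Relation.Unary.AllPairs using (AllPairs; []; _∷_)
  open import Data.List.Relation.Unary.Unique.Propositional using (Unique)
  open import Data.Product using (Σ; ∃; _×_; _,_; proj₁; proj₂)
  open import Data.Sum using (_⊎_; inj₁; inj₂; [_,_]′)
  open import Data.Empty using (⊥; ⊥-elim)
  open import Data.Unit using (⊤; tt)
  open import Function using (_∘_; id; case_of_)
  open import Relation.Nullary using (¬_; Dec; yes; no; does; contradiction)
  open import Relation.Binary.PropositionalEquality using (_≡_; _≢_; refl; sym; trans; cong; cong₂; subst; subst₂; module ≡-Reasoning)
  open import Algebra.Properties.Semiring.Sum +-*-semiring using (sum; sum-cong-≗; ∑-distrib-+; ∑-comm; *-distribˡ-sum; *-distribʳ-sum; sum-permute)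
  import Data.Fin.Permutation as Perm
  import Defs
  open import Data.List.Membership.Propositional.Properties using (∈-allFin)
  open import Data.List.Relation.Unary.Unique.Propositional.Properties using (allFin⁺)
  open import Data.Nat.DivMod using (_/_; _%_; m≡m%n+[m/n]*n; m%n<n)
  open import Data.List.Properties using (length-map)

  -- Linear arithmetic, indicators, finite sums and powers.

  -- All linear arithmetic below is done by exhibiting such a certificate.
  certify : ∀ {A B X Y} → A ≤ B → ∀ s → X + B + s ≡ Y + A → X ≤ Y
  certify {A} {B} {X} {Y} h s e = +-cancelʳ-≤ A X Y (begin
    X + A      ≤⟨ +-monoʳ-≤ X h ⟩
    X + B      ≤⟨ m≤m+n (X + B) s ⟩
    X + B + s  ≡⟨ e ⟩
    Y + A      ∎)
    where open ≤-Reasoning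

  _⟨+⟩_ : ∀ {a b c d} → a ≤ b → c ≤ d → a + c ≤ b + d
  _⟨+⟩_ = +-mono-≤

  _⟨*⟩_ : ∀ {a b c d} → a ≤ b → c ≤ d → a * c ≤ b * d
  _⟨*⟩_ = *-mono-≤

  infixr 6 _⟨+⟩_
  infixr 7 _⟨*⟩_

  _⊛_ : ∀ k {a b} → a ≤ b → k * a ≤ k * b
  k ⊛ h = *-monoʳ-≤ k h
  infixr 7 _⊛_

  𝟙 : Bool → ℕ
  𝟙 true  = 1
  𝟙 false = 0

  𝟙≤1 : ∀ b → 𝟙 b ≤ 1
  𝟙≤1 true  = ≤-refl
  𝟙≤1 false = z≤n

  𝟙-∧ : ∀ a b → 𝟙 (a ∧ b) ≡ 𝟙 a * 𝟙 b
  𝟙-∧ true  true  = refl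
  𝟙-∧ true  false = refl
  𝟙-∧ false b     = refl

  𝟙-not : ∀ a → 𝟙 a + 𝟙 (not a) ≡ 1
  𝟙-not true  = refl
  𝟙-not false = refl

  𝟙-mono : ∀ {a b} → (a ≡ true → b ≡ true) → 𝟙 a ≤ 𝟙 b
  𝟙-mono {true}  h rewrite h refl = ≤-refl
  𝟙-mono {false} h = z≤n

  𝟙-true : ∀ {a} → 1 ≤ 𝟙 a → a ≡ true
  𝟙-true {true} _ = refl

  true≢false : ∀ {a : Bool} → a ≡ true → a ≡ false → ⊥
  true≢false refl ()

  ∧-true : ∀ {a b} → (a ∧ b) ≡ true → a ≡ true × b ≡ true
  ∧-true {true} {true} refl = refl , refl

  ∧-intro : ∀ {a b} → a ≡ true → b ≡ true → (a ∧ b) ≡ true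
  ∧-intro refl refl = refl

  not-true : ∀ {a} → not a ≡ true → a ≡ false
  not-true {false} refl = refl

  does-true : ∀ {P : Set} (d : Dec P) → does d ≡ true → P
  does-true (yes p) _ = p

  true-does : ∀ {P : Set} (d : Dec P) → P → does d ≡ true
  true-does (yes _) _ = refl
  true-does (no ¬p) p = ⊥-elim (¬p p)

  false-does : ∀ {P : Set} (d : Dec P) → ¬ P → does d ≡ false
  false-does (no _)  _ = refl
  false-does (yes p) ¬p = ⊥-elim (¬p p)

  _==_ : ∀ {n} → Fin n → Fin n → Bool
  i == j = does (i F.≟ j)

  ==-refl : ∀ {n} (i : Fin n) → (i == i) ≡ true
  ==-refl i = true-does (i F.≟ i) refl

  ==⇒≡ : ∀ {n} {i j : Fin n} → (i == j) ≡ true → i ≡ j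
  ==⇒≡ {i = i} {j} = does-true (i F.≟ j)

  ≢⇒== : ∀ {n} {i j : Fin n} → i ≢ j → (i == j) ≡ false
  ≢⇒== {i = i} {j} = false-does (i F.≟ j)

  opaque
    ∑ : ∀ {n} → (Fin n → ℕ) → ℕ
    ∑ = sum

    ∑-mono : ∀ {n} {f g : Fin n → ℕ} → (∀ i → f i ≤ g i) → ∑ f ≤ ∑ g
    ∑-mono {zero}  h = z≤n
    ∑-mono {suc n} h = h zero ⟨+⟩ ∑-mono (h ∘ suc)

    ∑-cong : ∀ {n} {f g : Fin n → ℕ} → (∀ i → f i ≡ g i) → ∑ f ≡ ∑ g
    ∑-cong = sum-cong-≗

    ∑-+ : ∀ {n} (f g : Fin n → ℕ) → ∑ (λ i → f i + g i) ≡ ∑ f + ∑ g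
    ∑-+ = ∑-distrib-+

    ∑-*ˡ : ∀ {n} c (f : Fin n → ℕ) → ∑ (λ i → c * f i) ≡ c * ∑ f
    ∑-*ˡ c f = sym (*-distribˡ-sum c f)

    ∑-*ʳ : ∀ {n} c (f : Fin n → ℕ) → ∑ (λ i → f i * c) ≡ ∑ f * c
    ∑-*ʳ c f = sym (*-distribʳ-sum c f)

    ∑-swap : ∀ {m n} (f : Fin m → Fin n → ℕ) → ∑ (λ i → ∑ (f i)) ≡ ∑ (λ j → ∑ (λ i → f i j))
    ∑-swap = ∑-comm

    ∑-const : ∀ n c → ∑ {n} (λ _ → c) ≡ n * c
    ∑-const zero    c = refl
    ∑-const (suc n) c = cong (c +_) (∑-const n c)

    ∑-zero : ∀ n → ∑ {n} (λ _ → 0) ≡ 0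
    ∑-zero n = trans (∑-const n 0) (*-zeroʳ n)

    ∑-≤const : ∀ {n} {f : Fin n → ℕ} c → (∀ i → f i ≤ c) → ∑ f ≤ n * c
    ∑-≤const {n} c h = ≤-trans (∑-mono h) (≤-reflexive (∑-const n c))

    ∑-term : ∀ {n} (f : Fin n → ℕ) i → f i ≤ ∑ f
    ∑-term f zero    = m≤m+n _ _
    ∑-term f (suc i) = ≤-trans (∑-term (f ∘ suc) i) (m≤n+m _ _)

    ∑-point : ∀ {n} (j : Fin n) (f : Fin n → ℕ) → ∑ (λ i → 𝟙 (i == j) * f i) ≡ f j
    ∑-point {suc n} zero f = trans (cong₂ _+_ (*-identityˡ (f zero)) (∑-zero n)) (+-identityʳ _)
    ∑-point {suc n} (suc j) f = trans (∑-cong (λ i → cong (λ z → 𝟙 z * f (suc i)) (==-suc i j))) (∑-point j (f ∘ suc))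
      where
      ==-suc : ∀ {n} (i j : Fin n) → (suc i == suc j) ≡ (i == j)
      ==-suc i j with i F.≟ j
      ... | yes _ = refl
      ... | no  _ = refl

  cnt : ∀ {n} → (Fin n → Bool) → ℕ
  cnt p = ∑ (λ i → 𝟙 (p i))

  cnt-mono : ∀ {n} {p q : Fin n → Bool} → (∀ i → p i ≡ true → q i ≡ true) → cnt p ≤ cnt q
  cnt-mono h = ∑-mono (λ i → 𝟙-mono (h i))

  cnt≤n : ∀ {n} (p : Fin n → Bool) → cnt p ≤ n
  cnt≤n {n} p = ≤-trans (∑-≤const 1 (λ i → 𝟙≤1 (p i))) (≤-reflexive (*-identityʳ n))

  cnt-point : ∀ {n} (j : Fin n) → cnt (_== j) ≡ 1
  cnt-point j = trans (∑-cong (λ i → sym (*-identityʳ _))) (∑-point j (λ _ → 1))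

  opaque
    unfolding ∑

    -- Exactly g elements are kept, so that all states of the process have equally many successors
    -- and counting outcomes amounts to computing probabilities.
    shrink : ∀ {n} (p : Fin n → Bool) g → g ≤ cnt p →
             Σ (Fin n → Bool) λ q → (cnt q ≡ g) × (∀ i → q i ≡ true → p i ≡ true)
    shrink {zero}  p .zero z≤n = p , refl , λ ()
    shrink {suc n} p zero h = (λ _ → false) , ∑-zero (suc n) , λ _ ()
    shrink {suc n} p (suc g) h with p zero in eq
    ... | true with shrink (p ∘ suc) g (≤-pred h)
    ...   | q , e , s = (λ { zero → true ; (suc i) → q i }) , cong suc e , λ { zero _ → eq ; (suc i) → s i }
    shrink {suc n} p (suc g) h | false with shrink (p ∘ suc) (suc g) h
    ...   | q , e , s = (λ { zero → false ; (suc i) → q i }) , e , λ { zero () ; (suc i) → s i }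

  sumL : ∀ {A : Set} → (A → ℕ) → List A → ℕ
  sumL f []       = 0
  sumL f (x ∷ xs) = f x + sumL f xs

  sumL-mono : ∀ {A : Set} {f g : A → ℕ} xs → (∀ x → x ∈ xs → f x ≤ g x) → sumL f xs ≤ sumL g xs
  sumL-mono []       h = z≤n
  sumL-mono (x ∷ xs) h = h x (here refl) ⟨+⟩ sumL-mono xs (λ y y∈ → h y (there y∈))

  sumL-cong : ∀ {A : Set} {f g : A → ℕ} xs → (∀ x → x ∈ xs → f x ≡ g x) → sumL f xs ≡ sumL g xs
  sumL-cong []       h = refl
  sumL-cong (x ∷ xs) h = cong₂ _+_ (h x (here refl)) (sumL-cong xs (λ y y∈ → h y (there y∈)))

  sumL-++ : ∀ {A : Set} (f : A → ℕ) xs ys → sumL f (xs ++ ys) ≡ sumL f xs + sumL f ys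
  sumL-++ f []       ys = refl
  sumL-++ f (x ∷ xs) ys = trans (cong (f x +_) (sumL-++ f xs ys)) (sym (+-assoc (f x) _ _))

  sumL-+ : ∀ {A : Set} (f g : A → ℕ) xs → sumL (λ x → f x + g x) xs ≡ sumL f xs + sumL g xs
  sumL-+ f g []       = refl
  sumL-+ f g (x ∷ xs) = trans (cong (f x + g x +_) (sumL-+ f g xs)) (shuffle (f x) (g x) _ _)
    where
    shuffle : ∀ a b c d → a + b + (c + d) ≡ a + c + (b + d)
    shuffle = solve-∀

  sumL-*ˡ : ∀ {A : Set} c (f : A → ℕ) xs → sumL (λ x → c * f x) xs ≡ c * sumL f xs
  sumL-*ˡ c f []       = sym (*-zeroʳ c)
  sumL-*ˡ c f (x ∷ xs) = trans (cong (c * f x +_) (sumL-*ˡ c f xs)) (sym (*-distribˡ-+ c _ _))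

  sumL-const : ∀ {A : Set} c (xs : List A) → sumL (λ _ → c) xs ≡ length xs * c
  sumL-const c []       = refl
  sumL-const c (x ∷ xs) = cong (c +_) (sumL-const c xs)

  sumL-≤const : ∀ {A : Set} {f : A → ℕ} c (xs : List A) → (∀ x → f x ≤ c) → sumL f xs ≤ length xs * c
  sumL-≤const c xs h = ≤-trans (sumL-mono xs (λ x _ → h x)) (≤-reflexive (sumL-const c xs))

  elem : ∀ {n} → Fin n → List (Fin n) → Bool
  elem i []       = false
  elem i (x ∷ xs) = (i == x) ∨ elem i xs

  elem⇒∈ : ∀ {n} {i : Fin n} xs → elem i xs ≡ true → i ∈ xs
  elem⇒∈ {i = i} (x ∷ xs) h with i F.≟ x
  ... | yes refl = here refl
  ... | no  _    = there (elem⇒∈ xs h)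

  ∈⇒elem : ∀ {n} {i : Fin n} {xs} → i ∈ xs → elem i xs ≡ true
  ∈⇒elem {i = i} (here refl) rewrite ==-refl i = refl
  ∈⇒elem {i = i} {x ∷ xs} (there h) with i F.≟ x
  ... | yes _ = refl
  ... | no  _ = ∈⇒elem h

  ∉⇒elem : ∀ {n} {i : Fin n} {xs} → i ∉ xs → elem i xs ≡ false
  ∉⇒elem {i = i} {xs} h with elem i xs in eq
  ... | true  = ⊥-elim (h (elem⇒∈ xs eq))
  ... | false = refl

  elem-false : ∀ {n} {i : Fin n} {xs} → elem i xs ≡ false → i ∉ xs
  elem-false h h' = true≢false (∈⇒elem h') h

  ∉-All : ∀ {n} {x : Fin n} {xs} → x ∉ xs → All (x ≢_) xs
  ∉-All {xs = []}     h = []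
  ∉-All {xs = y ∷ ys} h = (λ e → h (here e)) ∷ ∉-All (λ p → h (there p))

  All-∉ : ∀ {n} {x : Fin n} {xs} → All (x ≢_) xs → x ∉ xs
  All-∉ (p ∷ ps) (here e)  = p e
  All-∉ (p ∷ ps) (there h) = All-∉ ps h

  ∑-elem≤ : ∀ {n} (xs : List (Fin n)) (f : Fin n → ℕ) → ∑ (λ i → 𝟙 (elem i xs) * f i) ≤ sumL f xs
  ∑-elem≤ {n} []       f = ≤-reflexive (∑-zero n)
  ∑-elem≤ (x ∷ xs) f = begin
    ∑ (λ i → 𝟙 ((i == x) ∨ elem i xs) * f i)               ≤⟨ ∑-mono (λ i → ptw (i == x) (elem i xs) (f i)) ⟩
    ∑ (λ i → 𝟙 (i == x) * f i + 𝟙 (elem i xs) * f i)       ≡⟨ ∑-+ (λ i → 𝟙 (i == x) * f i) _ ⟩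
    ∑ (λ i → 𝟙 (i == x) * f i) + ∑ (λ i → 𝟙 (elem i xs) * f i) ≤⟨ ≤-reflexive (∑-point x f) ⟨+⟩ ∑-elem≤ xs f ⟩
    f x + sumL f xs                                         ∎
    where
    open ≤-Reasoning
    ptw : ∀ a b y → 𝟙 (a ∨ b) * y ≤ 𝟙 a * y + 𝟙 b * y
    ptw true  b y = m≤m+n _ _
    ptw false b y = ≤-refl

  ∑-elem : ∀ {n} {xs : List (Fin n)} → Unique xs → (f : Fin n → ℕ) → ∑ (λ i → 𝟙 (elem i xs) * f i) ≡ sumL f xs
  ∑-elem {n} {[]}     u f = ∑-zero n
  ∑-elem {xs = x ∷ xs} (x∉ ∷ u) f = begin
    ∑ (λ i → 𝟙 ((i == x) ∨ elem i xs) * f i)               ≡⟨ ∑-cong ptw ⟩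
    ∑ (λ i → 𝟙 (i == x) * f i + 𝟙 (elem i xs) * f i)       ≡⟨ ∑-+ (λ i → 𝟙 (i == x) * f i) _ ⟩
    ∑ (λ i → 𝟙 (i == x) * f i) + ∑ (λ i → 𝟙 (elem i xs) * f i) ≡⟨ cong₂ _+_ (∑-point x f) (∑-elem u f) ⟩
    f x + sumL f xs                                         ∎
    where
    open Relation.Binary.PropositionalEquality.≡-Reasoning
    ptw : ∀ i → 𝟙 ((i == x) ∨ elem i xs) * f i ≡ 𝟙 (i == x) * f i + 𝟙 (elem i xs) * f i
    ptw i with i F.≟ x
    ... | yes refl rewrite ∉⇒elem (All-∉ x∉) = sym (+-identityʳ _)
    ... | no  _    = refl

  cnt-elem : ∀ {n} {xs : List (Fin n)} → Unique xs → cnt (λ i → elem i xs) ≡ length xs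
  cnt-elem {xs = xs} u = trans (∑-cong (λ i → sym (*-identityʳ _)))
    (trans (∑-elem u (λ _ → 1)) (trans (sumL-const 1 xs) (*-identityʳ _)))

  cnt-elem≤ : ∀ {n} (xs : List (Fin n)) → cnt (λ i → elem i xs) ≤ length xs
  cnt-elem≤ xs = ≤-trans (≤-reflexive (∑-cong (λ i → sym (*-identityʳ _))))
    (≤-trans (∑-elem≤ xs (λ _ → 1)) (≤-reflexive (trans (sumL-const 1 xs) (*-identityʳ _))))

  <ᵇ-true : ∀ {m n} → (m Data.Nat.<ᵇ n) ≡ true → m < n
  <ᵇ-true {m} {n} h = <ᵇ⇒< m n (subst Data.Bool.T (sym h) tt)

  true-<ᵇ : ∀ {m n} → m < n → (m Data.Nat.<ᵇ n) ≡ true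
  true-<ᵇ {m} {n} h with m Data.Nat.<ᵇ n in eq
  ... | true  = refl
  ... | false = ⊥-elim (subst Data.Bool.T eq (<⇒<ᵇ h))

  <ᵇ-false : ∀ {m n} → (m Data.Nat.<ᵇ n) ≡ false → n ≤ m
  <ᵇ-false h = ≮⇒≥ (λ p → true≢false (true-<ᵇ p) h)

  ≤ᵇ-true : ∀ {m n} → (m Data.Nat.≤ᵇ n) ≡ true → m ≤ n
  ≤ᵇ-true {m} {n} h = ≤ᵇ⇒≤ m n (subst Data.Bool.T (sym h) tt)

  -- With denominators cleared this is 1 + r/b ≤ (1 + 1/b)^r; the surplus b^r * r of the induction
  -- step is the discarded term r/b².
  bernoulli : ∀ b r → b ^ r * (b + r) ≤ suc b ^ r * b
  bernoulli b zero    = ≤-reflexive (e b)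
    where
    e : ∀ b → 1 * (b + 0) ≡ 1 * b
    e = solve-∀
  bernoulli b (suc r) = certify (suc b ⊛ bernoulli b r) (b ^ r * r) (e b r (b ^ r) (suc b ^ r))
    where
    e : ∀ b r p q → b * p * (b + suc r) + suc b * (q * b) + p * r ≡ suc b * q * b + suc b * (p * (b + r))
    e = solve-∀

  -- This is (1 + 1/b)^x ≤ 1 + x/b + (x/b)². In the induction step the third-order term x²/b³ is at
  -- most x/b², which the passage from x² to (x + 1)² has to spare.
  pow-upper : ∀ b x → x ≤ b → suc b ^ x * (b * b) ≤ b ^ x * (b * b + x * b + x * x)
  pow-upper b zero    h = ≤-reflexive (e b)
    where
    e : ∀ b → 1 * (b * b) ≡ 1 * (b * b + 0 * b + 0 * 0)
    e = solve-∀
  pow-upper b (suc x) h = certify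
    ((suc b ⊛ pow-upper b x (<⇒≤ h)) ⟨+⟩ ((b ^ x * x) ⊛ <⇒≤ h))
    (b ^ x * b)
    (e b x (b ^ x) (suc b ^ x))
    where
    e : ∀ b x p q → suc b * q * (b * b) + (suc b * (p * (b * b + x * b + x * x)) + p * x * b) + p * b
        ≡ b * p * (b * b + suc x * b + suc x * suc x) + (suc b * (q * (b * b)) + p * x * x)
    e = solve-∀

  ^-dist : ∀ s a b → (a * b) ^ s ≡ a ^ s * b ^ s
  ^-dist zero    a b = refl
  ^-dist (suc s) a b = trans (cong (a * b *_) (^-dist s a b)) (e a b (a ^ s) (b ^ s))
    where
    e : ∀ a b c d → a * b * (c * d) ≡ a * c * (b * d)
    e = solve-∀

  ∑-tight : ∀ {n} {f g : Fin n → ℕ} → (∀ i → f i ≤ g i) → ∑ g ≤ ∑ f → ∀ i → f i ≡ g i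
  ∑-tight {f = f} {g} h e i with ∑-+ f (λ j → g j ∸ f j)
  ... | p = ≤-antisym (h i) (m∸n≡0⇒m≤n (n≤0⇒n≡0 (≤-trans (∑-term (λ j → g j ∸ f j) i)
     (certify {∑ g} {∑ f} {∑ (λ j → g j ∸ f j)} {0} e 0 (trans (+-identityʳ _) (trans (+-comm _ (∑ f)) (trans (sym p) (∑-cong (λ j → m+[n∸m]≡n (h j)))))))) ))

  ∑-<-find : ∀ {n} (f g : Fin n → ℕ) → ∑ f < ∑ g → ∃ λ i → f i < g i
  ∑-<-find f g h with F.any? (λ i → f i <? g i)
  ... | yes p = p
  ... | no ¬p = contradiction (≤-trans h (∑-mono (λ i → ≮⇒≥ (λ q → ¬p (i , q))))) (<-irrefl refl)

  -- Edge weights with constant row sums on dense graphs, by augmenting paths.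

  -- Weights on the edges of a graph of minimum degree above N/2 whose row and column sums are
  -- prescribed: while some row a and some column b are deficient, the degree condition yields an
  -- alternating path a → y ← x → b along which one more unit can be pushed.
  module Flow {n} (A : Fin n → Fin n → Bool) (A-sym : ∀ a b → A a b ≡ A b a)
              (U : Fin n → Bool) (A⇒U : ∀ a b → A a b ≡ true → U a ≡ true)
              (k N : ℕ) (0<k : 1 ≤ k) (0<N : 1 ≤ N) (|U| : cnt U ≡ N)
              (deg≥ : ∀ a → U a ≡ true → (k + 2) * N ≤ 2 * k * cnt (A a)) where

    d : Fin n → ℕ
    d a = cnt (A a)

    -- `κ` caps the entries. A row of sum at most `L₀` has at most `L₀`/`κ` = N/(2k) entries at the
    -- cap, so a vertex keeps half of its degree surplus N/k over N/2 for augmentations.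
    κ L₀ : ℕ
    κ  = 4 * k * k
    L₀ = 2 * k * N

    A⇒Uʳ : ∀ a b → A a b ≡ true → U b ≡ true
    A⇒Uʳ a b h = A⇒U b a (trans (A-sym b a) h)

    d≤N : ∀ a → d a ≤ N
    d≤N a = ≤-trans (cnt-mono (A⇒Uʳ a)) (≤-reflexive |U|)

    N≤L₀ : N ≤ L₀
    N≤L₀ = ≤-trans (≤-reflexive (sym (*-identityˡ N))) (≤-trans 0<k (m≤n*m k 2) ⟨*⟩ ≤-refl)

    -- Prescribing `L₀` minus the degree leaves room for one unit on every edge: the adjacency
    -- matrix plus a matrix with these row sums has row sums `L₀` on U.
    D : Fin n → ℕ
    D a = 𝟙 (U a) * (L₀ ∸ d a)

    D≤L₀ : ∀ a → D a ≤ 𝟙 (U a) * L₀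
    D≤L₀ a = 𝟙 (U a) ⊛ m∸n≤m L₀ (d a)

    row col : (Fin n → Fin n → ℕ) → Fin n → ℕ
    row M a = ∑ (M a)
    col M b = ∑ (λ a → M a b)

    record Admissible (M : Fin n → Fin n → ℕ) : Set where
      field
        supp : ∀ a b → 1 ≤ M a b → A a b ≡ true
        cap  : ∀ a b → M a b ≤ κ
        row≤ : ∀ a → row M a ≤ D a
        col≤ : ∀ b → col M b ≤ D b
    open Admissible

    δ : Fin n → Fin n → Fin n → Fin n → ℕ
    δ a b i j = 𝟙 (i == a) * 𝟙 (j == b)

    δ-row : ∀ a b i → ∑ (δ a b i) ≡ 𝟙 (i == a)
    δ-row a b i = trans (∑-*ˡ (𝟙 (i == a)) _) (trans (cong (𝟙 (i == a) *_) (cnt-point b)) (*-identityʳ _))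

    δ-col : ∀ a b j → ∑ (λ i → δ a b i j) ≡ 𝟙 (j == b)
    δ-col a b j = trans (∑-*ʳ (𝟙 (j == b)) (λ i → 𝟙 (i == a))) (trans (cong (_* 𝟙 (j == b)) (cnt-point a)) (*-identityˡ _))

    δ≤ : ∀ a b i j x → (i ≡ a → j ≡ b → 1 ≤ x) → δ a b i j ≤ x
    δ≤ a b i j x h with i F.≟ a | j F.≟ b
    ... | yes p | yes q = h p q
    ... | yes p | no  q = z≤n
    ... | no  p | q     = z≤n

    record Augmented (M : Fin n → Fin n → ℕ) (a : Fin n) : Set where
      field
        M'  : Fin n → Fin n → ℕ
        adm : Admissible M'
        inc : ∀ i → row M' i ≡ row M i + 𝟙 (i == a)

    below' : ∀ (x y : Fin n → ℕ) i j → x i ≤ y i → x j < y j → x i + 𝟙 (i == j) ≤ y i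
    below' x y i j h h' with i F.≟ j
    ... | yes refl = ≤-trans (≤-reflexive (+-comm (x i) 1)) h'
    ... | no  _    = ≤-trans (≤-reflexive (+-identityʳ _)) h

    -- Only row a and column b grow: row x and column y gain a unit and lose it again at (x, y). The
    -- condition x ≢ a keeps the two gains in different rows, so no entry can rise by 2 past the
    -- cap.
    push : ∀ M → Admissible M → ∀ a b x y → row M a < D a → col M b < D b →
           A a y ≡ true → M a y < κ → A x b ≡ true → M x b < κ → 1 ≤ M x y → x ≢ a →
           Augmented M a
    push M ad a b x y ra cb Aay May Axb Mxb Mxy x≢a = record
      { M' = M' ; inc = rowEq
      ; adm = record
          { supp = supp' ; cap = cap'
          ; row≤ = λ i → ≤-trans (≤-reflexive (rowEq i)) (below' (row M) D i a (row≤ ad i) ra)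
          ; col≤ = λ j → ≤-trans (≤-reflexive (colEq j)) (below' (col M) D j b (col≤ ad j) cb) } }
      where
      M⁺ M' : Fin n → Fin n → ℕ
      M⁺ i j = M i j + (δ a y i j + δ x b i j)
      M' i j = M⁺ i j ∸ δ x y i j
      back : ∀ i j → M' i j + δ x y i j ≡ M⁺ i j
      back i j = m∸n+n≡m (≤-trans (δ≤ x y i j (M i j) (λ { refl refl → Mxy })) (m≤m+n _ _))
      rowEq : ∀ i → row M' i ≡ row M i + 𝟙 (i == a)
      rowEq i = +-cancelʳ-≡ (𝟙 (i == x)) _ _ (begin
        row M' i + 𝟙 (i == x)               ≡⟨ cong (row M' i +_) (sym (δ-row x y i)) ⟩
        row M' i + ∑ (δ x y i)              ≡⟨ sym (∑-+ (M' i) _) ⟩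
        ∑ (λ j → M' i j + δ x y i j)        ≡⟨ ∑-cong (back i) ⟩
        ∑ (M⁺ i)                            ≡⟨ ∑-+ (M i) _ ⟩
        row M i + ∑ (λ j → δ a y i j + δ x b i j) ≡⟨ cong (row M i +_) (∑-+ (δ a y i) _) ⟩
        row M i + (∑ (δ a y i) + ∑ (δ x b i)) ≡⟨ cong₂ (λ u v → row M i + (u + v)) (δ-row a y i) (δ-row x b i) ⟩
        row M i + (𝟙 (i == a) + 𝟙 (i == x))  ≡⟨ sym (+-assoc (row M i) _ _) ⟩
        row M i + 𝟙 (i == a) + 𝟙 (i == x)   ∎)
        where open Relation.Binary.PropositionalEquality.≡-Reasoning
      colEq : ∀ j → col M' j ≡ col M j + 𝟙 (j == b)
      colEq j = +-cancelʳ-≡ (𝟙 (j == y)) _ _ (begin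
        col M' j + 𝟙 (j == y)               ≡⟨ cong (col M' j +_) (sym (δ-col x y j)) ⟩
        col M' j + ∑ (λ i → δ x y i j)      ≡⟨ sym (∑-+ (λ i → M' i j) _) ⟩
        ∑ (λ i → M' i j + δ x y i j)        ≡⟨ ∑-cong (λ i → back i j) ⟩
        ∑ (λ i → M⁺ i j)                    ≡⟨ ∑-+ (λ i → M i j) _ ⟩
        col M j + ∑ (λ i → δ a y i j + δ x b i j) ≡⟨ cong (col M j +_) (∑-+ (λ i → δ a y i j) _) ⟩
        col M j + (∑ (λ i → δ a y i j) + ∑ (λ i → δ x b i j)) ≡⟨ cong₂ (λ u v → col M j + (u + v)) (δ-col a y j) (δ-col x b j) ⟩
        col M j + (𝟙 (j == y) + 𝟙 (j == b))  ≡⟨ cong (col M j +_) (+-comm (𝟙 (j == y)) _) ⟩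
        col M j + (𝟙 (j == b) + 𝟙 (j == y))  ≡⟨ sym (+-assoc (col M j) _ _) ⟩
        col M j + 𝟙 (j == b) + 𝟙 (j == y)   ∎)
        where open Relation.Binary.PropositionalEquality.≡-Reasoning
      supp' : ∀ i j → 1 ≤ M' i j → A i j ≡ true
      supp' i j h = go (≤-trans h (m∸n≤m _ (δ x y i j)))
        where
        go : 1 ≤ M⁺ i j → A i j ≡ true
        go h with i F.≟ a | j F.≟ y | i F.≟ x | j F.≟ b
        ... | yes refl | yes refl | _ | _ = Aay
        ... | yes _ | no _ | yes refl | yes refl = Axb
        ... | yes _ | no _ | yes _ | no _ = supp ad i j (subst (1 ≤_) (+-identityʳ _) h)
        ... | yes _ | no _ | no _ | _ = supp ad i j (subst (1 ≤_) (+-identityʳ _) h)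
        ... | no _ | _ | yes refl | yes refl = Axb
        ... | no _ | _ | yes _ | no _ = supp ad i j (subst (1 ≤_) (+-identityʳ _) h)
        ... | no _ | _ | no _ | _ = supp ad i j (subst (1 ≤_) (+-identityʳ _) h)
      cap' : ∀ i j → M' i j ≤ κ
      cap' i j = ≤-trans (m∸n≤m _ (δ x y i j)) go
        where
        go : M⁺ i j ≤ κ
        go with i F.≟ a | j F.≟ y | i F.≟ x | j F.≟ b
        ... | yes refl | _ | yes refl | _ = ⊥-elim (x≢a refl)
        ... | yes refl | yes refl | no _ | _ = ≤-trans (≤-reflexive (+-comm _ 1)) May
        ... | yes _ | no _ | no _ | _ = ≤-trans (≤-reflexive (+-identityʳ _)) (cap ad i j)
        ... | no _ | _ | yes refl | yes refl = ≤-trans (≤-reflexive (+-comm _ 1)) Mxb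
        ... | no _ | _ | yes _ | no _ = ≤-trans (≤-reflexive (+-identityʳ _)) (cap ad i j)
        ... | no _ | _ | no _ | _ = ≤-trans (≤-reflexive (+-identityʳ _)) (cap ad i j)

    pushDirect : ∀ M → Admissible M → ∀ a y → row M a < D a → col M y < D y →
                 A a y ≡ true → M a y < κ → Augmented M a
    pushDirect M ad a y ra cy Aay May = record
      { M' = M' ; inc = rowEq
      ; adm = record
          { supp = supp' ; cap = cap'
          ; row≤ = λ i → ≤-trans (≤-reflexive (rowEq i)) (below' (row M) D i a (row≤ ad i) ra)
          ; col≤ = λ j → ≤-trans (≤-reflexive (colEq j)) (below' (col M) D j y (col≤ ad j) cy) } }
      where
      M' : Fin n → Fin n → ℕ
      M' i j = M i j + δ a y i j
      rowEq : ∀ i → row M' i ≡ row M i + 𝟙 (i == a)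
      rowEq i = trans (∑-+ (M i) _) (cong (row M i +_) (δ-row a y i))
      colEq : ∀ j → col M' j ≡ col M j + 𝟙 (j == y)
      colEq j = trans (∑-+ (λ i → M i j) _) (cong (col M j +_) (δ-col a y j))
      supp' : ∀ i j → 1 ≤ M' i j → A i j ≡ true
      supp' i j h with i F.≟ a | j F.≟ y
      ... | yes refl | yes refl = Aay
      ... | yes _ | no _ = supp ad i j (subst (1 ≤_) (+-identityʳ _) h)
      ... | no _ | _ = supp ad i j (subst (1 ≤_) (+-identityʳ _) h)
      cap' : ∀ i j → M' i j ≤ κ
      cap' i j with i F.≟ a | j F.≟ y
      ... | yes refl | yes refl = ≤-trans (≤-reflexive (+-comm _ 1)) May
      ... | yes _ | no _ = ≤-trans (≤-reflexive (+-identityʳ _)) (cap ad i j)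
      ... | no _ | _ = ≤-trans (≤-reflexive (+-identityʳ _)) (cap ad i j)

    -- `Y` holds the columns that a can still feed, `X` the rows that can still feed b. If nothing
    -- can be pushed, `X` and `Y` span no weight and every column of `Y` is full, with sum at least
    -- `L₀` - N. These |Y|(`L₀` - N) units lie in at most N - |X| rows of sum at most `L₀`. As |X| +
    -- |Y| ≥ N + N/k and `L₀` = 2kN, this would give 2N² ≤ N².
    module Stuck (M : Fin n → Fin n → ℕ) (ad : Admissible M) (a b : Fin n)
                 (ra : row M a < D a) (cb : col M b < D b)
                 (no-direct : ∀ y → A a y ≡ true → M a y < κ → ¬ (col M y < D y))
                 (no-path : ∀ x y → A a y ≡ true → M a y < κ → A x b ≡ true → M x b < κ → ¬ (1 ≤ M x y)) where

      X Y : Fin n → Bool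
      X x = A x b ∧ (M x b Data.Nat.<ᵇ κ)
      Y y = A a y ∧ (M a y Data.Nat.<ᵇ κ)

      unpack : ∀ {p m} → (p ∧ (m Data.Nat.<ᵇ κ)) ≡ true → p ≡ true × m < κ
      unpack {p} {m} h with ∧-true {p} h
      ... | q , r = q , <ᵇ-true r

      U-deficient : ∀ z {m} → m < D z → U z ≡ true
      U-deficient z h with U z
      ... | true  = refl
      U-deficient z () | false

      split≤ : ∀ p m → κ * 𝟙 p ≤ κ * 𝟙 (p ∧ (m Data.Nat.<ᵇ κ)) + m
      split≤ false m = ≤-trans (≤-reflexive (*-zeroʳ κ)) z≤n
      split≤ true  m with m Data.Nat.<ᵇ κ in eq
      ... | true  = m≤m+n _ _
      ... | false = ≤-trans (≤-reflexive (*-identityʳ κ)) (≤-trans (<ᵇ-false eq) (m≤n+m m _))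

      D≤ : ∀ z → D z ≤ L₀
      D≤ z = ≤-trans (D≤L₀ z) (≤-trans (𝟙≤1 (U z) ⟨*⟩ ≤-refl) (≤-reflexive (*-identityˡ L₀)))

      |Y|≥ : κ * d a ≤ κ * cnt Y + L₀
      |Y|≥ = begin
        κ * d a                                   ≡⟨ sym (∑-*ˡ κ _) ⟩
        ∑ (λ y → κ * 𝟙 (A a y))                   ≤⟨ ∑-mono (λ y → split≤ (A a y) (M a y)) ⟩
        ∑ (λ y → κ * 𝟙 (Y y) + M a y)             ≡⟨ ∑-+ _ (M a) ⟩
        ∑ (λ y → κ * 𝟙 (Y y)) + row M a           ≤⟨ ≤-reflexive (∑-*ˡ κ _) ⟨+⟩ ≤-trans (row≤ ad a) (D≤ a) ⟩
        κ * cnt Y + L₀                            ∎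
        where open ≤-Reasoning

      |X|≥ : κ * d b ≤ κ * cnt X + L₀
      |X|≥ = begin
        κ * d b                                   ≡⟨ sym (∑-*ˡ κ _) ⟩
        ∑ (λ x → κ * 𝟙 (A b x))                   ≡⟨ ∑-cong (λ x → cong (λ z → κ * 𝟙 z) (A-sym b x)) ⟩
        ∑ (λ x → κ * 𝟙 (A x b))                   ≤⟨ ∑-mono (λ x → split≤ (A x b) (M x b)) ⟩
        ∑ (λ x → κ * 𝟙 (X x) + M x b)             ≡⟨ ∑-+ _ (λ x → M x b) ⟩
        ∑ (λ x → κ * 𝟙 (X x)) + col M b           ≤⟨ ≤-reflexive (∑-*ˡ κ _) ⟨+⟩ ≤-trans (col≤ ad b) (D≤ b) ⟩
        κ * cnt X + L₀                            ∎
        where open ≤-Reasoning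

      YM : Fin n → ℕ
      YM x = ∑ (λ y → 𝟙 (Y y) * M x y)

      YM≤ : ∀ x → YM x + 𝟙 (X x) * L₀ ≤ 𝟙 (U x) * L₀
      YM≤ x with X x in eq
      ... | true = ≤-trans (≤-reflexive (cong (_+ 1 * L₀) zero-sum))
                     (≤-reflexive (cong (λ z → 𝟙 z * L₀) (sym (A⇒U x b (proj₁ (unpack eq))))))
        where
        zero-sum : YM x ≡ 0
        zero-sum = trans (∑-cong z) (∑-zero n)
          where
          z : ∀ y → 𝟙 (Y y) * M x y ≡ 0
          z y with Y y in eqY | M x y in eqM
          ... | false | _     = refl
          ... | true  | zero  = refl
          ... | true  | suc m = ⊥-elim (no-path x y (proj₁ (unpack eqY)) (proj₂ (unpack eqY))
                                  (proj₁ (unpack eq)) (proj₂ (unpack eq)) (subst (1 ≤_) (sym eqM) (s≤s z≤n)))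
      ... | false = begin
        YM x + 0            ≡⟨ +-identityʳ _ ⟩
        YM x                ≤⟨ ∑-mono (λ y → ≤-trans (𝟙≤1 (Y y) ⟨*⟩ ≤-refl) (≤-reflexive (*-identityˡ _))) ⟩
        row M x             ≤⟨ row≤ ad x ⟩
        D x                 ≤⟨ D≤L₀ x ⟩
        𝟙 (U x) * L₀        ∎
        where open ≤-Reasoning

      massY≤ : ∑ YM + cnt X * L₀ ≤ N * L₀
      massY≤ = begin
        ∑ YM + cnt X * L₀                    ≡⟨ cong (∑ YM +_) (sym (∑-*ʳ L₀ (λ x → 𝟙 (X x)))) ⟩
        ∑ YM + ∑ (λ x → 𝟙 (X x) * L₀)        ≡⟨ sym (∑-+ YM _) ⟩
        ∑ (λ x → YM x + 𝟙 (X x) * L₀)        ≤⟨ ∑-mono YM≤ ⟩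
        ∑ (λ x → 𝟙 (U x) * L₀)               ≡⟨ ∑-*ʳ L₀ (λ x → 𝟙 (U x)) ⟩
        cnt U * L₀                           ≡⟨ cong (_* L₀) |U| ⟩
        N * L₀                               ∎
        where open ≤-Reasoning

      massY≥ : cnt Y * L₀ ≤ ∑ YM + cnt Y * N
      massY≥ = begin
        cnt Y * L₀                                          ≡⟨ sym (∑-*ʳ L₀ (λ y → 𝟙 (Y y))) ⟩
        ∑ (λ y → 𝟙 (Y y) * L₀)                              ≤⟨ ∑-mono ptw ⟩
        ∑ (λ y → 𝟙 (Y y) * col M y + 𝟙 (Y y) * N)           ≡⟨ ∑-+ (λ y → 𝟙 (Y y) * col M y) _ ⟩
        ∑ (λ y → 𝟙 (Y y) * col M y) + ∑ (λ y → 𝟙 (Y y) * N) ≡⟨ cong₂ _+_ (trans (∑-cong (λ y → sym (∑-*ˡ (𝟙 (Y y)) (λ x → M x y)))) (∑-swap _)) (∑-*ʳ N (λ y → 𝟙 (Y y))) ⟩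
        ∑ YM + cnt Y * N                                    ∎
        where
        open ≤-Reasoning
        ptw : ∀ y → 𝟙 (Y y) * L₀ ≤ 𝟙 (Y y) * col M y + 𝟙 (Y y) * N
        ptw y with Y y in eq
        ... | false = z≤n
        ... | true  = ≤-trans (≤-reflexive (*-identityˡ L₀)) (begin
          L₀                          ≤⟨ m≤n+m∸n L₀ (d y) ⟩
          d y + (L₀ ∸ d y)            ≤⟨ d≤N y ⟨+⟩ ≤-trans (≤-reflexive Dy) (≮⇒≥ (no-direct y (proj₁ (unpack eq)) (proj₂ (unpack eq)))) ⟩
          N + col M y                 ≡⟨ +-comm N _ ⟩
          col M y + N                 ≡⟨ cong₂ _+_ (sym (*-identityˡ (col M y))) (sym (*-identityˡ N)) ⟩
          1 * col M y + 1 * N         ∎)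
          where
          Dy : L₀ ∸ d y ≡ D y
          Dy = trans (sym (*-identityˡ _)) (cong (λ z → 𝟙 z * (L₀ ∸ d y)) (sym (A⇒Uʳ a y (proj₁ (unpack eq)))))

      absurd : ⊥
      absurd = <-irrefl refl (≤-trans (pos (pos (≤-trans 0<k (m≤n*m k 2)) 0<N) 0<N) zeroed)
        where
        pos : ∀ {x y} → 1 ≤ x → 1 ≤ y → 1 ≤ x * y
        pos p q = p ⟨*⟩ q
        |Y|≤N : cnt Y ≤ N
        |Y|≤N = ≤-trans (cnt-mono (λ y h → A⇒Uʳ a y (proj₁ (unpack h)))) (≤-reflexive |U|)
        e : ∀ k N da db x y s →
            2 * k * N * N +
            (2 * k * N * (2 * k * da) + (2 * k * N * (2 * k * db) +
            (N * (4 * k * k * y + 2 * k * N) + (N * (4 * k * k * x + 2 * k * N) +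
            (2 * k * (N * (2 * k * N)) + (2 * k * (s + y * N) + 2 * k * (N * N))))))) + 0
            ≡ 0 +
            (2 * k * N * ((k + 2) * N) + (2 * k * N * ((k + 2) * N) +
            (N * (4 * k * k * da) + (N * (4 * k * k * db) +
            (2 * k * (s + x * (2 * k * N)) + (2 * k * (y * (2 * k * N)) + 2 * k * (y * N)))))))
        e = solve-∀
        zeroed : 2 * k * N * N ≤ 0
        zeroed = certify
          ((2 * k * N) ⊛ deg≥ a (U-deficient a ra) ⟨+⟩ (2 * k * N) ⊛ deg≥ b (U-deficient b cb) ⟨+⟩
           N ⊛ |Y|≥ ⟨+⟩ N ⊛ |X|≥ ⟨+⟩
           (2 * k) ⊛ massY≤ ⟨+⟩ (2 * k) ⊛ massY≥ ⟨+⟩ (2 * k) ⊛ (|Y|≤N ⟨*⟩ ≤-refl {N}))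
          0 (e k N (d a) (d b) (cnt X) (cnt Y) (∑ YM))

    rows≡cols : ∀ M → ∑ (row M) ≡ ∑ (col M)
    rows≡cols M = ∑-swap M

    augment : ∀ M → Admissible M → ∀ a → row M a < D a → Augmented M a
    -- Rows and columns have the same total and the same prescription, so a deficient row forces a
    -- deficient column.
    augment M ad a ra with ∑-<-find (col M) D (subst (_< ∑ D) (rows≡cols M) (≰⇒> (λ h → <-irrefl (∑-tight (row≤ ad) h a) ra)))
    ... | b , cb with F.any? (λ y → direct? y)
      where
      direct? : ∀ y → Dec ((A a y ≡ true) × (M a y < κ) × (col M y < D y))
      direct? y with A a y Data.Bool.≟ true | M a y <? κ | col M y <? D y
      ... | yes p | yes q | yes r = yes (p , q , r)
      ... | no p  | _ | _ = no (λ z → p (proj₁ z))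
      ... | yes _ | no q | _ = no (λ z → q (proj₁ (proj₂ z)))
      ... | yes _ | yes _ | no r = no (λ z → r (proj₂ (proj₂ z)))
    ... | yes (y , p , q , r) = pushDirect M ad a y ra r p q
    ... | no ¬direct with F.any? (λ x → F.any? (λ y → path? x y))
      where
      path? : ∀ x y → Dec ((A a y ≡ true × M a y < κ) × (A x b ≡ true × M x b < κ) × (1 ≤ M x y))
      path? x y with A a y Data.Bool.≟ true | M a y <? κ | A x b Data.Bool.≟ true | M x b <? κ | 1 ≤? M x y
      ... | yes p | yes q | yes r | yes s | yes t = yes ((p , q) , (r , s) , t)
      ... | no p  | _ | _ | _ | _ = no (λ z → p (proj₁ (proj₁ z)))
      ... | yes _ | no q | _ | _ | _ = no (λ z → q (proj₂ (proj₁ z)))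
      ... | yes _ | yes _ | no r | _ | _ = no (λ z → r (proj₁ (proj₁ (proj₂ z))))
      ... | yes _ | yes _ | yes _ | no s | _ = no (λ z → s (proj₂ (proj₁ (proj₂ z))))
      ... | yes _ | yes _ | yes _ | yes _ | no t = no (λ z → t (proj₂ (proj₂ z)))
    ... | no ¬path = ⊥-elim (Stuck.absurd M ad a b ra cb (λ y p q r → ¬direct (y , p , q , r))
                       (λ x y p q r s t → ¬path (x , y , (p , q) , (r , s) , t)))
    ... | yes (x , y , (p , q) , (r , s) , t) = push M ad a b x y ra cb p q r s t
            -- If x were a, the entry (a, b) itself could be raised, which has been excluded.
            (λ { refl → ¬direct (b , r , s , cb) })

    -- The fuel bounds the total deficiency, which drops by 1 with each augmentation.
    saturate : ∀ fuel M → Admissible M → ∑ D ≤ ∑ (row M) + fuel →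
               Σ (Fin n → Fin n → ℕ) λ M' → Admissible M' × (∑ D ≤ ∑ (row M'))
    saturate zero       M ad h = M , ad , ≤-trans h (≤-reflexive (+-identityʳ _))
    saturate (suc fuel) M ad h with F.any? (λ a → row M a <? D a)
    ... | no ¬p = M , ad , ∑-mono (λ a → ≮⇒≥ (λ q → ¬p (a , q)))
    ... | yes (a , ra) = saturate fuel M' adm (≤-trans h (≤-reflexive (begin
          ∑ (row M) + suc fuel                       ≡⟨ +-suc _ fuel ⟩
          suc (∑ (row M)) + fuel                     ≡⟨ cong (_+ fuel) (+-comm 1 _) ⟩
          ∑ (row M) + 1 + fuel                       ≡⟨ cong (λ z → ∑ (row M) + z + fuel) (sym (cnt-point a)) ⟩
          ∑ (row M) + cnt (_== a) + fuel             ≡⟨ cong (_+ fuel) (sym (∑-+ (row M) _)) ⟩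
          ∑ (λ i → row M i + 𝟙 (i == a)) + fuel      ≡⟨ cong (_+ fuel) (∑-cong (λ i → sym (inc i))) ⟩
          ∑ (row M') + fuel                          ∎)))
      where
      open Augmented (augment M ad a ra)
      open Relation.Binary.PropositionalEquality.≡-Reasoning

    saturated : Σ (Fin n → Fin n → ℕ) λ M → Admissible M × (∑ D ≤ ∑ (row M))
    saturated = saturate (∑ D) (λ _ _ → 0)
      (record { supp = λ _ _ () ; cap = λ _ _ → z≤n
              ; row≤ = λ _ → ≤-trans (≤-reflexive (∑-zero n)) z≤n ; col≤ = λ _ → ≤-trans (≤-reflexive (∑-zero n)) z≤n })
      (m≤n+m _ _)

    M* : Fin n → Fin n → ℕ
    M* = proj₁ saturated

    M*-adm : Admissible M*
    M*-adm = proj₁ (proj₂ saturated)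

    M*-row : ∀ a → row M* a ≡ D a
    M*-row = ∑-tight (row≤ M*-adm) (proj₂ (proj₂ saturated))

    M*-col : ∀ a → col M* a ≡ D a
    M*-col = ∑-tight (col≤ M*-adm) (≤-trans (proj₂ (proj₂ saturated)) (≤-reflexive (rows≡cols M*)))

    -- `M*` may vanish on edges; the 2 on every edge is what gives positive weight to all two-step
    -- walks through common neighbours. Adding the transpose makes the weights symmetric, at the
    -- price of doubling the row sums to `L` = 2`L₀`.
    m : Fin n → Fin n → ℕ
    m a b = 2 * 𝟙 (A a b) + (M* a b + M* b a)

    L : ℕ
    L = 4 * k * N

    m-sym : ∀ a b → m a b ≡ m b a
    m-sym a b = cong₂ (λ x y → 2 * 𝟙 x + y) (A-sym a b) (+-comm (M* a b) _)

    m-row : ∀ a → ∑ (m a) ≡ 𝟙 (U a) * L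
    m-row a = begin
      ∑ (m a)                                       ≡⟨ ∑-+ (λ b → 2 * 𝟙 (A a b)) _ ⟩
      ∑ (λ b → 2 * 𝟙 (A a b)) + ∑ (λ b → M* a b + M* b a) ≡⟨ cong₂ _+_ (∑-*ˡ 2 _) (trans (∑-+ (M* a) _) (cong₂ _+_ (M*-row a) (M*-col a))) ⟩
      2 * d a + (D a + D a)                         ≡⟨ go ⟩
      𝟙 (U a) * L                                   ∎
      where
      open Relation.Binary.PropositionalEquality.≡-Reasoning
      e : ∀ x y → 2 * x + (1 * y + 1 * y) ≡ 2 * (x + y)
      e = solve-∀
      e' : ∀ k N → 2 * (2 * k * N) ≡ 1 * (4 * k * N)
      e' = solve-∀
      go : 2 * d a + (D a + D a) ≡ 𝟙 (U a) * L
      go with U a in eq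
      ... | true  = trans (e (d a) (L₀ ∸ d a)) (trans (cong (2 *_) (m+[n∸m]≡n (≤-trans (d≤N a) N≤L₀))) (e' k N))
      ... | false = trans (+-identityʳ _) (cong (2 *_) (trans (∑-cong zro) (∑-zero n)))
        where
        zro : ∀ b → 𝟙 (A a b) ≡ 0
        zro b with A a b in q
        ... | true  = ⊥-elim (true≢false (A⇒U a b q) eq)
        ... | false = refl

    m-supp : ∀ a b → 1 ≤ m a b → A a b ≡ true
    m-supp a b h with A a b in eq
    ... | true  = refl
    ... | false with M* a b in e₁ | M* b a in e₂
    ...   | suc _ | _ = trans (sym eq) (supp M*-adm a b (subst (1 ≤_) (sym e₁) (s≤s z≤n)))
    ...   | zero  | suc _ = trans (sym eq) (trans (A-sym a b) (supp M*-adm b a (subst (1 ≤_) (sym e₂) (s≤s z≤n))))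
    m-supp a b () | false | zero | zero

    m-edge : ∀ a b → 2 * 𝟙 (A a b) ≤ m a b
    m-edge a b = m≤m+n _ _

    m-cap : ∀ a b → m a b ≤ 2 + 8 * k * k
    m-cap a b = ≤-trans ((2 ⊛ 𝟙≤1 (A a b)) ⟨+⟩ (cap M*-adm a b ⟨+⟩ cap M*-adm b a)) (≤-reflexive (e k))
      where
      e : ∀ k → 2 * 1 + (4 * k * k + 4 * k * k) ≡ 2 + 8 * k * k
      e = solve-∀

  record Regular {n} (A : Fin n → Fin n → Bool) (U : Fin n → Bool) (L C : ℕ) : Set where
    field
      m      : Fin n → Fin n → ℕ
      m-sym  : ∀ a b → m a b ≡ m b a
      m-row  : ∀ a → ∑ (m a) ≡ 𝟙 (U a) * L
      m-supp : ∀ a b → 1 ≤ m a b → A a b ≡ true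
      m-edge : ∀ a b → 2 * 𝟙 (A a b) ≤ m a b
      m-cap  : ∀ a b → m a b ≤ C

  regular : ∀ {n} (A : Fin n → Fin n → Bool) → (∀ a b → A a b ≡ A b a) →
            ∀ U → (∀ a b → A a b ≡ true → U a ≡ true) → ∀ k N → 1 ≤ k → 1 ≤ N → cnt U ≡ N →
            (∀ a → U a ≡ true → (k + 2) * N ≤ 2 * k * cnt (A a)) → Regular A U (4 * k * N) (2 + 8 * k * k)
  regular A A-sym U A⇒U k N 0<k 0<N |U| deg≥ = record
    { m = Fl.m ; m-sym = Fl.m-sym ; m-row = Fl.m-row ; m-supp = Fl.m-supp ; m-edge = Fl.m-edge ; m-cap = Fl.m-cap }
    where module Fl = Flow A A-sym U A⇒U k N 0<k 0<N |U| deg≥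

  -- Tree-indexed random walks: expectations, mixing, and the probability of a star.

  _[_≔_] : ∀ {n} {B : Set} → (Fin n → B) → Fin n → B → Fin n → B
  (φ [ x ≔ b ]) z = if z == x then b else φ z

  ≔-same : ∀ {n} {B : Set} (φ : Fin n → B) x {b} → (φ [ x ≔ b ]) x ≡ b
  ≔-same φ x rewrite ==-refl x = refl

  ≔-other : ∀ {n} {B : Set} (φ : Fin n → B) {x b z} → z ≢ x → (φ [ x ≔ b ]) z ≡ φ z
  ≔-other φ h rewrite ≢⇒== h = refl

  -- Parents come first: S is the set of vertices already placed.
  data Ok {n} (par : Fin n → Fin n) : List (Fin n) → List (Fin n) → Set where
    nil   : ∀ {S} → Ok par S []
    place : ∀ {S x xs} → par x ∈ S → x ∉ S → Ok par (x ∷ S) xs → Ok par S (x ∷ xs)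

  Ok-fresh : ∀ {n} {par : Fin n → Fin n} {S xs z} → Ok par S xs → z ∈ S → z ∉ xs
  Ok-fresh (place p x∉ ok) z∈ (here refl) = x∉ z∈
  Ok-fresh (place p x∉ ok) z∈ (there z∈') = Ok-fresh ok (there z∈) z∈'

  data Path {n} (par : Fin n → Fin n) (xs : List (Fin n)) (ρ : Fin n) : ℕ → Fin n → Set where
    stop : Path par xs ρ zero ρ
    up   : ∀ {j x} → x ∈ xs → Path par xs ρ j (par x) → Path par xs ρ (suc j) x

  -- The indicator that all children of y in the list go into B, kept as a product so that it can be
  -- integrated one vertex at a time.
  childProd : ∀ {n} (par : Fin n → Fin n) (y : Fin n) (B : Fin n → Bool) → List (Fin n) → (Fin n → Fin n) → ℕ
  childProd par y B []       χ = 1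
  childProd par y B (c ∷ zs) χ = (if par c == y then 𝟙 (B (χ c)) else 1) * childProd par y B zs χ

  childProd≤1 : ∀ {n} (par : Fin n → Fin n) y B zs χ → childProd par y B zs χ ≤ 1
  childProd≤1 par y B []       χ = ≤-refl
  childProd≤1 par y B (c ∷ zs) χ with par c == y
  ... | true  = 𝟙≤1 (B (χ c)) ⟨*⟩ childProd≤1 par y B zs χ
  ... | false = ≤-refl {1} ⟨*⟩ childProd≤1 par y B zs χ

  pos-l : ∀ p {q} → 1 ≤ p * q → 1 ≤ p
  pos-l (suc p) _ = s≤s z≤n

  pos-r : ∀ p {q} → 1 ≤ p * q → 1 ≤ q
  pos-r p {zero}  h = ⊥-elim (<-irrefl refl (≤-trans h (≤-reflexive (*-zeroʳ p))))
  pos-r p {suc q} h = s≤s z≤n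

  childProd-at : ∀ {n} (par : Fin n → Fin n) y B zs χ → 1 ≤ childProd par y B zs χ → ∀ c → c ∈ zs → par c ≡ y → B (χ c) ≡ true
  childProd-at par y B (c ∷ zs) χ h .c (here refl) refl rewrite ==-refl (par c) = 𝟙-true (pos-l (𝟙 (B (χ c))) h)
  childProd-at par y B (d ∷ zs) χ h c (there c∈) e = childProd-at par y B zs χ (pos-r (if par d == y then 𝟙 (B (χ d)) else 1) h) c c∈ e

  𝟙³≤ : ∀ a a' p {r} → p ≤ 1 → (a ≡ true → a' ≡ true → 1 ≤ p → r ≡ true) → 𝟙 a * 𝟙 a' * p ≤ 𝟙 r
  𝟙³≤ false a'    p h q = z≤n
  𝟙³≤ true  false p h q = z≤n
  𝟙³≤ true  true  zero h q = z≤n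
  𝟙³≤ true  true  (suc p) h q rewrite q refl refl (s≤s z≤n) = ≤-trans (≤-reflexive (*-identityˡ (suc p))) h

  -- The random walk with symmetric weights m of row sum L on the vertex set U, and its extension
  -- to tree-indexed walks; all expectations are left unnormalised.
  module RandomWalk {n} (m : Fin n → Fin n → ℕ) (U : Fin n → Bool) (L : ℕ)
              (m-sym : ∀ a b → m a b ≡ m b a)
              (m-row : ∀ a → ∑ (m a) ≡ 𝟙 (U a) * L) where

    m-off : ∀ a b → U b ≡ false → m a b ≡ 0
    m-off a b h = n≤0⇒n≡0 (≤-trans (≤-reflexive (m-sym a b)) (≤-trans (∑-term (m b) a)
      (≤-reflexive (trans (m-row b) (cong (λ z → 𝟙 z * L) h)))))

    row-L : ∀ {a} → U a ≡ true → ∑ (m a) ≡ L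
    row-L {a} h = trans (m-row a) (trans (cong (λ z → 𝟙 z * L) h) (*-identityˡ L))

    ∑m-mono : ∀ a {f g : Fin n → ℕ} → (∀ b → U b ≡ true → f b ≤ g b) →
              ∑ (λ b → m a b * f b) ≤ ∑ (λ b → m a b * g b)
    ∑m-mono a {f} {g} h = ∑-mono ptw
      where
      ptw : ∀ b → m a b * f b ≤ m a b * g b
      ptw b with U b in eq
      ... | true  = m a b ⊛ h b eq
      ... | false rewrite m-off a b eq = z≤n

    ∑m-cong : ∀ a {f g : Fin n → ℕ} → (∀ b → U b ≡ true → f b ≡ g b) →
              ∑ (λ b → m a b * f b) ≡ ∑ (λ b → m a b * g b)
    ∑m-cong a h = ≤-antisym (∑m-mono a (λ b u → ≤-reflexive (h b u)))
                            (∑m-mono a (λ b u → ≤-reflexive (sym (h b u))))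

    P : (Fin n → ℕ) → Fin n → ℕ
    P f a = ∑ (λ b → m a b * f b)

    P^ : ℕ → (Fin n → ℕ) → Fin n → ℕ
    P^ zero    f = f
    P^ (suc j) f = P (P^ j f)

    P-cong : ∀ {f g} → (∀ a → f a ≡ g a) → ∀ a → P f a ≡ P g a
    P-cong h a = ∑-cong (λ b → cong (m a b *_) (h b))

    P^-comm : ∀ j f a → P^ j (P f) a ≡ P (P^ j f) a
    P^-comm zero    f a = refl
    P^-comm (suc j) f a = P-cong (P^-comm j f) a

    P^-+ : ∀ i j f a → P^ (i + j) f a ≡ P^ i (P^ j f) a
    P^-+ zero    j f a = refl
    P^-+ (suc i) j f a = P-cong (P^-+ i j f) a

    ∫ : (Fin n → ℕ) → ℕ
    ∫ f = ∑ (λ a → 𝟙 (U a) * f a)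

    P-const : ∀ c a → P (λ _ → c) a ≡ 𝟙 (U a) * (L * c)
    P-const c a = trans (∑-*ʳ c (m a)) (trans (cong (_* c) (m-row a)) (*-assoc (𝟙 (U a)) L c))

    P≤ : ∀ {f F} → (∀ a → f a ≤ F) → ∀ a → P f a ≤ L * F
    P≤ {f} {F} h a = ≤-trans (∑m-mono a (λ b _ → h b)) (≤-trans (≤-reflexive (P-const F a))
      (≤-trans (𝟙≤1 (U a) ⟨*⟩ ≤-refl) (≤-reflexive (*-identityˡ _))))

    P^≤ : ∀ j {f F} → (∀ a → f a ≤ F) → ∀ a → P^ j f a ≤ L ^ j * F
    P^≤ zero    h a = ≤-trans (h a) (≤-reflexive (sym (*-identityˡ _)))
    P^≤ (suc j) {f} {F} h a = ≤-trans (P≤ (P^≤ j h) a) (≤-reflexive (sym (*-assoc L (L ^ j) F)))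

    P-on-U : ∀ f a → 𝟙 (U a) * P f a ≡ P f a
    P-on-U f a with U a in eq
    ... | true  = *-identityˡ _
    ... | false = sym (trans (∑-cong (λ b → cong (_* f b) (trans (m-sym a b) (m-off b a eq)))) (∑-zero n))

    -- The uniform measure on `U` is stationary: by symmetry the columns sum to `L` on `U` as well.
    ∫-P : ∀ f → ∫ (P f) ≡ L * ∫ f
    ∫-P f = begin
      ∫ (P f)                                    ≡⟨ ∑-cong (P-on-U f) ⟩
      ∑ (λ a → ∑ (λ b → m a b * f b))            ≡⟨ ∑-swap _ ⟩
      ∑ (λ b → ∑ (λ a → m a b * f b))            ≡⟨ ∑-cong (λ b → trans (∑-*ʳ (f b) (λ a → m a b))
                                                     (trans (cong (_* f b) (trans (∑-cong (λ a → m-sym a b)) (m-row b))) (e (𝟙 (U b)) L (f b)))) ⟩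
      ∑ (λ b → L * (𝟙 (U b) * f b))              ≡⟨ ∑-*ˡ L _ ⟩
      L * ∫ f                                    ∎
      where
      open Relation.Binary.PropositionalEquality.≡-Reasoning
      e : ∀ u l x → u * l * x ≡ l * (u * x)
      e = solve-∀

    ∫-P^ : ∀ j f → ∫ (P^ j f) ≡ L ^ j * ∫ f
    ∫-P^ zero    f = sym (*-identityˡ _)
    ∫-P^ (suc j) f = trans (∫-P (P^ j f)) (trans (cong (L *_) (∫-P^ j f)) (sym (*-assoc L (L ^ j) _)))

    -- The image of x is drawn with weights `m` from the image of its parent, so the total mass is
    -- L^(length xs) from a start in `U`. Images may coincide; injectivity is imposed only when
    -- actual images are chosen.
    EE : (Fin n → Fin n) → List (Fin n) → (Fin n → Fin n) → ((Fin n → Fin n) → ℕ) → ℕ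
    EE par []       φ F = F φ
    EE par (x ∷ xs) φ F = ∑ (λ b → m (φ (par x)) b * EE par xs (φ [ x ≔ b ]) F)

    Env : List (Fin n) → (Fin n → Fin n) → Set
    Env S φ = ∀ z → z ∈ S → U (φ z) ≡ true

    Env-step : ∀ {S φ x b} → x ∉ S → U b ≡ true → Env S φ → Env (x ∷ S) (φ [ x ≔ b ])
    Env-step {φ = φ} {x} x∉ u env z (here refl) = trans (cong U (≔-same φ x)) u
    Env-step {φ = φ} x∉ u env z (there p) = trans (cong U (≔-other φ (λ { refl → x∉ p }))) (env z p)

    module _ {par : Fin n → Fin n} where

      Agree : List (Fin n) → (φ φ' : Fin n → Fin n) → Set
      Agree xs φ φ' = ∀ z → z ∉ xs → φ' z ≡ φ z

      Agree-step : ∀ {x xs φ b φ'} → Agree xs (φ [ x ≔ b ]) φ' → Agree (x ∷ xs) φ φ'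
      Agree-step {φ = φ} h z z∉ = trans (h z (λ p → z∉ (there p))) (≔-other φ (λ e → z∉ (here e)))

      EE-mono : ∀ xs {φ F G} → (∀ φ' → Agree xs φ φ' → F φ' ≤ G φ') → EE par xs φ F ≤ EE par xs φ G
      EE-mono []       h = h _ (λ _ _ → refl)
      EE-mono (x ∷ xs) h = ∑-mono (λ b → m _ b ⊛ EE-mono xs (λ φ' ag → h φ' (Agree-step ag)))

      EE-cong : ∀ xs {φ F G} → (∀ φ' → Agree xs φ φ' → F φ' ≡ G φ') → EE par xs φ F ≡ EE par xs φ G
      EE-cong xs h = ≤-antisym (EE-mono xs (λ φ' a → ≤-reflexive (h φ' a))) (EE-mono xs (λ φ' a → ≤-reflexive (sym (h φ' a))))

      -- Values outside S and xs are never read. An exchange also changes the image of an unplaced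
      -- vertex, and the expectation has to be blind to that.
      EE-local : ∀ xs {S φ φ' F} → Ok par S xs → (∀ z → z ∈ S → φ z ≡ φ' z) →
                 (∀ χ χ' → (∀ z → z ∈ S ⊎ z ∈ xs → χ z ≡ χ' z) → F χ ≡ F χ') →
                 EE par xs φ F ≡ EE par xs φ' F
      EE-local []       ok h loc = loc _ _ (λ { z (inj₁ p) → h z p ; z (inj₂ ()) })
      EE-local (x ∷ xs) {S} {φ} {φ'} {F} (place p x∉ ok) h loc = ∑-cong (λ b → cong₂ _*_ (cong (λ a → m a b) (h _ p))
        (EE-local xs ok (agree b) (λ χ χ' q → loc χ χ' (λ { z (inj₁ r) → q z (inj₁ (there r)) ; z (inj₂ (here refl)) → q z (inj₁ (here refl)) ; z (inj₂ (there r)) → q z (inj₂ r) }))))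
        where
        agree : ∀ b z → z ∈ x ∷ S → (φ [ x ≔ b ]) z ≡ (φ' [ x ≔ b ]) z
        agree b z (here refl) = trans (≔-same φ z) (sym (≔-same φ' z))
        agree b z (there q)   = trans (≔-other φ (λ { refl → x∉ q })) (trans (h z q) (sym (≔-other φ' (λ { refl → x∉ q }))))

      EE-* : ∀ xs {φ} c F → EE par xs φ (λ χ → c * F χ) ≡ c * EE par xs φ F
      EE-* []       c F = refl
      EE-* (x ∷ xs) {φ} c F = trans (∑-cong (λ b → trans (cong (m _ b *_) (EE-* xs c F)) (e (m (φ (par x)) b) c _)))
                                    (∑-*ˡ c _)
        where
        e : ∀ x c y → x * (c * y) ≡ c * (x * y)
        e = solve-∀

      EE-+ : ∀ xs {φ} F G → EE par xs φ (λ χ → F χ + G χ) ≡ EE par xs φ F + EE par xs φ G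
      EE-+ []       F G = refl
      EE-+ (x ∷ xs) F G = trans (∑-cong (λ b → trans (cong (m _ b *_) (EE-+ xs F G)) (*-distribˡ-+ (m _ b) _ _)))
                                (∑-+ (λ b → m _ b * EE par xs _ F) _)

      EE-∑ : ∀ xs {φ k} (F : Fin k → (Fin n → Fin n) → ℕ) →
             EE par xs φ (λ χ → ∑ (λ i → F i χ)) ≡ ∑ (λ i → EE par xs φ (F i))
      EE-∑ []       F = refl
      EE-∑ (x ∷ xs) {φ} F = trans (∑-cong (λ b → trans (cong (m _ b *_) (EE-∑ xs F)) (sym (∑-*ˡ (m _ b) _)))) (∑-swap _)

      EE-mass : ∀ {S xs φ} → Ok par S xs → Env S φ → ∀ c → EE par xs φ (λ _ → c) ≡ L ^ length xs * c
      EE-mass nil            env c = sym (*-identityˡ c)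
      EE-mass {φ = φ} (place {x = x} {xs} p x∉ ok) env c = begin
        ∑ (λ b → m (φ (par x)) b * EE par xs (φ [ x ≔ b ]) (λ _ → c))
          ≡⟨ ∑m-cong _ (λ b u → EE-mass ok (Env-step x∉ u env) c) ⟩
        ∑ (λ b → m (φ (par x)) b * (L ^ length xs * c))
          ≡⟨ ∑-*ʳ (L ^ length xs * c) (m (φ (par x))) ⟩
        ∑ (m (φ (par x))) * (L ^ length xs * c)
          ≡⟨ cong (_* (L ^ length xs * c)) (row-L (env _ p)) ⟩
        L * (L ^ length xs * c)
          ≡⟨ sym (*-assoc L _ c) ⟩
        L ^ suc (length xs) * c  ∎
        where open Relation.Binary.PropositionalEquality.≡-Reasoning

      EE-const : ∀ {S xs φ F} → Ok par S xs → Env S φ → ∀ c → (∀ φ' → Agree xs φ φ' → F φ' ≡ c) →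
                 EE par xs φ F ≡ L ^ length xs * c
      EE-const {xs = xs} ok env c h = trans (EE-cong xs h) (EE-mass ok env c)

      -- On the right the image of x is still drawn but ignored, which contributes a factor `L`;
      -- hence the `L` on the left. What is drawn before x acts only through the image of par x, and
      -- what is drawn later integrates out.
      EE-resample : ∀ {S xs φ x} → Ok par S xs → Env S φ → x ∈ xs → (h : Fin n → Fin n → ℕ) →
                    L * EE par xs φ (λ χ → h (χ (par x)) (χ x)) ≡
                    EE par xs φ (λ χ → ∑ (λ b → m (χ (par x)) b * h (χ (par x)) b))
      EE-resample {S} {_} {φ} {x} (place {xs = xs} p x∉ ok) env (here refl) h = begin
        L * ∑ (λ b → m a b * EE par xs (φ [ x ≔ b ]) (λ χ → h (χ (par x)) (χ x)))
          ≡⟨ cong (L *_) (∑m-cong a (λ b u → EE-const ok (Env-step x∉ u env) (h a b)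
               (λ φ' ag → cong₂ h (at-par b φ' ag) (trans (ag x x∉xs) (≔-same φ x))))) ⟩
        L * ∑ (λ b → m a b * (ℒ * h a b))
          ≡⟨ cong (L *_) (trans (∑-cong (λ b → e (m a b) ℒ (h a b))) (∑-*ˡ ℒ _)) ⟩
        L * (ℒ * H)
          ≡⟨ cong (_* (ℒ * H)) (sym (row-L (env _ p))) ⟩
        ∑ (m a) * (ℒ * H)
          ≡⟨ sym (∑-*ʳ (ℒ * H) (m a)) ⟩
        ∑ (λ b → m a b * (ℒ * H))
          ≡⟨ ∑m-cong a (λ b u → sym (EE-const ok (Env-step x∉ u env) H
               (λ φ' ag → cong (λ a' → ∑ (λ b → m a' b * h a' b)) (at-par b φ' ag)))) ⟩
        ∑ (λ b → m a b * EE par xs (φ [ x ≔ b ]) (λ χ → ∑ (λ b → m (χ (par x)) b * h (χ (par x)) b))) ∎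
        where
        open Relation.Binary.PropositionalEquality.≡-Reasoning
        a = φ (par x)
        ℒ = L ^ length xs
        H = ∑ (λ b → m a b * h a b)
        x∉xs : x ∉ xs
        x∉xs = Ok-fresh ok (here refl)
        at-par : ∀ b φ' → Agree xs (φ [ x ≔ b ]) φ' → φ' (par x) ≡ a
        at-par b φ' ag = trans (ag (par x) (Ok-fresh ok (there p))) (≔-other φ (λ q → x∉ (subst (_∈ S) q p)))
        e : ∀ x y z → x * (y * z) ≡ y * (x * z)
        e = solve-∀
      EE-resample {φ = φ} {x} (place {x = z} {xs} p x∉ ok) env (there x∈) h =
        trans (sym (∑-*ˡ L _)) (trans (∑-cong (λ b → e L (m (φ (par z)) b) _))
          (∑m-cong (φ (par z)) (λ b u → EE-resample ok (Env-step x∉ u env) x∈ h)))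
        where
        e : ∀ x y z → x * (y * z) ≡ y * (x * z)
        e = solve-∀

      -- Resampling x replaces f by P f at its parent. Iterated up to ρ, this shows that the image
      -- of x is distributed as the j-th position of the walk started at φ ρ.
      EE-path : ∀ {ρ xs φ j x} → Ok par (ρ ∷ []) xs → Env (ρ ∷ []) φ → Path par xs ρ j x → ∀ f →
                L ^ j * EE par xs φ (λ χ → f (χ x)) ≡ L ^ length xs * P^ j f (φ ρ)
      EE-path {ρ} {xs} {φ} ok env stop f = trans (*-identityˡ _)
        (EE-const ok env (f (φ ρ)) (λ φ' ag → cong f (ag ρ (Ok-fresh ok (here refl)))))
      EE-path {ρ} {xs} {φ} {suc j} {x} ok env (up x∈ π) f = begin
        L * L ^ j * EE par xs φ (λ χ → f (χ x))     ≡⟨ e L (L ^ j) _ ⟩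
        L ^ j * (L * EE par xs φ (λ χ → f (χ x)))   ≡⟨ cong (L ^ j *_) (EE-resample ok env x∈ (λ _ → f)) ⟩
        L ^ j * EE par xs φ (λ χ → P f (χ (par x))) ≡⟨ EE-path ok env π (P f) ⟩
        L ^ length xs * P^ j (P f) (φ ρ)            ≡⟨ cong (L ^ length xs *_) (P^-comm j f (φ ρ)) ⟩
        L ^ length xs * P (P^ j f) (φ ρ)            ∎
        where
        open Relation.Binary.PropositionalEquality.≡-Reasoning
        e : ∀ x y z → x * y * z ≡ y * (x * z)
        e = solve-∀

    -- Two steps of the walk dominate a multiple of the uniform distribution, so the walk mixes
    -- at a rate that does not depend on the size of U.
    module Mixing (k ℓ' N : ℕ) (0<k : 1 ≤ k) (|U| : cnt U ≡ N) (ratio : 8 * N * N * suc ℓ' ≡ k * (L * L))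
                  (two-step : ∀ a c → U a ≡ true → U c ≡ true → 8 * N ≤ k * ∑ (λ b → m a b * m b c)) where

      ℓ : ℕ
      ℓ = suc ℓ'

      module Step (a : Fin n) (Ua : U a ≡ true) where
        q e : Fin n → ℕ
        q c = ∑ (λ b → m a b * m b c)
        -- Doeblin splitting: up to scaling, the two-step law is 1/ℓ times the uniform law on `U`
        -- plus this nonnegative remainder, of mass 1 - 1/ℓ.
        e c = k * q c ∸ 8 * N * 𝟙 (U c)

        q-off : ∀ c → U c ≡ false → q c ≡ 0
        q-off c h = trans (∑-cong (λ b → trans (cong (m a b *_) (m-off b c h)) (*-zeroʳ (m a b)))) (∑-zero n)

        q-split : ∀ c → k * q c ≡ 8 * N * 𝟙 (U c) + e c
        q-split c = sym (m+[n∸m]≡n ge)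
          where
          ge : 8 * N * 𝟙 (U c) ≤ k * q c
          ge with U c in eq
          ... | true  = ≤-trans (≤-reflexive (*-identityʳ _)) (two-step a c Ua eq)
          ... | false = ≤-trans (≤-reflexive (*-zeroʳ (8 * N))) z≤n

        e-off : ∀ c → U c ≡ false → e c ≡ 0
        e-off c h = trans (cong (λ z → k * z ∸ 8 * N * 𝟙 (U c)) (q-off c h)) (trans (cong (_∸ 8 * N * 𝟙 (U c)) (*-zeroʳ k)) (0∸n≡0 (8 * N * 𝟙 (U c))))

        q-sum : ∑ q ≡ L * L
        q-sum = begin
          ∑ q                                    ≡⟨ ∑-swap _ ⟩
          ∑ (λ b → ∑ (λ c → m a b * m b c))      ≡⟨ ∑-cong (λ b → ∑-*ˡ (m a b) _) ⟩
          ∑ (λ b → m a b * ∑ (m b))              ≡⟨ ∑m-cong a (λ b u → row-L u) ⟩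
          ∑ (λ b → m a b * L)                    ≡⟨ ∑-*ʳ L (m a) ⟩
          ∑ (m a) * L                            ≡⟨ cong (_* L) (row-L Ua) ⟩
          L * L                                  ∎
          where open Relation.Binary.PropositionalEquality.≡-Reasoning

        e-sum : ∑ e ≡ 8 * N * N * ℓ'
        e-sum = +-cancelˡ-≡ (8 * N * N) _ _ (begin
          8 * N * N + ∑ e                         ≡⟨ cong (λ z → 8 * N * z + ∑ e) (sym |U|) ⟩
          8 * N * cnt U + ∑ e                     ≡⟨ cong (_+ ∑ e) (sym (∑-*ˡ (8 * N) _)) ⟩
          ∑ (λ c → 8 * N * 𝟙 (U c)) + ∑ e         ≡⟨ sym (∑-+ _ e) ⟩
          ∑ (λ c → 8 * N * 𝟙 (U c) + e c)         ≡⟨ ∑-cong (λ c → sym (q-split c)) ⟩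
          ∑ (λ c → k * q c)                       ≡⟨ trans (∑-*ˡ k q) (cong (k *_) q-sum) ⟩
          k * (L * L)                             ≡⟨ sym ratio ⟩
          8 * N * N * suc ℓ'                      ≡⟨ *-suc (8 * N * N) ℓ' ⟩
          8 * N * N + 8 * N * N * ℓ'              ∎)
          where open Relation.Binary.PropositionalEquality.≡-Reasoning

        PP : ∀ G → k * P (P G) a ≡ 8 * N * ∫ G + ∑ (λ c → e c * G c)
        PP G = begin
          k * P (P G) a                                           ≡⟨ cong (k *_) (∑-cong (λ b → sym (∑-*ˡ (m a b) _))) ⟩
          k * ∑ (λ b → ∑ (λ c → m a b * (m b c * G c)))           ≡⟨ cong (k *_) (∑-swap _) ⟩
          k * ∑ (λ c → ∑ (λ b → m a b * (m b c * G c)))           ≡⟨ sym (∑-*ˡ k _) ⟩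
          ∑ (λ c → k * ∑ (λ b → m a b * (m b c * G c)))           ≡⟨ ∑-cong (λ c → cong (k *_) (trans (∑-cong (λ b → sym (*-assoc (m a b) _ _))) (∑-*ʳ (G c) _))) ⟩
          ∑ (λ c → k * (q c * G c))                               ≡⟨ ∑-cong (λ c → trans (sym (*-assoc k (q c) (G c))) (cong (_* G c) (q-split c))) ⟩
          ∑ (λ c → (8 * N * 𝟙 (U c) + e c) * G c)                 ≡⟨ ∑-cong (λ c → f (8 * N) (𝟙 (U c)) (e c) (G c)) ⟩
          ∑ (λ c → 8 * N * (𝟙 (U c) * G c) + e c * G c)           ≡⟨ ∑-+ (λ c → 8 * N * (𝟙 (U c) * G c)) _ ⟩
          ∑ (λ c → 8 * N * (𝟙 (U c) * G c)) + ∑ (λ c → e c * G c) ≡⟨ cong (_+ ∑ (λ c → e c * G c)) (∑-*ˡ (8 * N) _) ⟩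
          8 * N * ∫ G + ∑ (λ c → e c * G c)                       ∎
          where
          open Relation.Binary.PropositionalEquality.≡-Reasoning
          f : ∀ x u e g → (x * u + e) * g ≡ x * (u * g) + e * g
          f = solve-∀

      -- The uniform part of the split kernel integrates g exactly, and the remainder inherits the
      -- error of the previous index scaled by 1 - 1/ℓ; so the error after 2j steps is F(1 - 1/ℓ)^j.
      -- Only lower bounds are proved, upper ones follow by taking complements.
      mix-even : ∀ j {g F} → (∀ c → g c ≤ F) → ∀ a → U a ≡ true →
                 ℓ ^ j * (L * L) ^ j * ∫ g ≤ N * ℓ ^ j * P^ (2 * j) g a + (L * L) ^ j * N * F * ℓ' ^ j
      mix-even zero {g} {F} h a Ua = begin
        1 * 1 * ∫ g                    ≤⟨ ≤-reflexive (*-identityˡ _) ⟩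
        ∫ g                            ≤⟨ ∑-mono (λ c → 𝟙 (U c) ⊛ h c) ⟩
        ∑ (λ c → 𝟙 (U c) * F)          ≡⟨ trans (∑-*ʳ F _) (cong (_* F) |U|) ⟩
        N * F                          ≤⟨ m≤n+m _ _ ⟩
        N * 1 * g a + N * F            ≡⟨ cong (N * 1 * g a +_) (f N F) ⟩
        N * 1 * g a + 1 * N * F * 1    ∎
        where
        open ≤-Reasoning
        f : ∀ N F → N * F ≡ 1 * N * F * 1
        f = solve-∀
      mix-even (suc j) {g} {F} h a Ua = *-cancelˡ-≤ k {{>-nonZero 0<k}} (begin
        k * (ℓ * ℓʲ * (L * L * Lʲ) * I)
          ≡⟨ e₁ k ℓ ℓʲ (L * L) Lʲ I ⟩
        (k * (L * L)) * (ℓ * (ℓʲ * Lʲ * I))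
          ≡⟨ cong (_* (ℓ * (ℓʲ * Lʲ * I))) (sym ratio) ⟩
        8 * N * N * ℓ * (ℓ * (ℓʲ * Lʲ * I))
          ≤⟨ certify (ℓ ⊛ summed) 0 (e₂ N ℓ' (ℓʲ * Lʲ * I) (ℓʲ * Σe) (Lʲ * N * F * ℓ'ʲ)) ⟩
        8 * N * N * ℓ * (ℓʲ * Lʲ * I) + (ℓ * N * (ℓʲ * Σe) + 8 * N * N * ℓ * (ℓ' * (Lʲ * N * F * ℓ'ʲ)))
          ≡⟨ e₃ N ℓ ℓʲ Lʲ I Σe (8 * N * N * ℓ * (ℓ' * (Lʲ * N * F * ℓ'ʲ))) ⟩
        N * (ℓ * ℓʲ) * (8 * N * (Lʲ * I) + Σe) + 8 * N * N * ℓ * (ℓ' * (Lʲ * N * F * ℓ'ʲ))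
          ≡⟨ cong₂ _+_ (cong (N * (ℓ * ℓʲ) *_) (sym PPG)) (cong (_* (ℓ' * (Lʲ * N * F * ℓ'ʲ))) ratio) ⟩
        N * (ℓ * ℓʲ) * (k * P (P G) a) + k * (L * L) * (ℓ' * (Lʲ * N * F * ℓ'ʲ))
          ≡⟨ e₄ k (N * (ℓ * ℓʲ)) (P (P G) a) (L * L) ℓ' Lʲ ℓ'ʲ N F ⟩
        k * (N * (ℓ * ℓʲ) * P (P G) a + L * L * Lʲ * N * F * (ℓ' * ℓ'ʲ))
          ≡⟨ cong (λ z → k * (N * (ℓ * ℓʲ) * z + L * L * Lʲ * N * F * (ℓ' * ℓ'ʲ))) idx ⟩
        k * (N * (ℓ * ℓʲ) * P^ (2 * suc j) g a + L * L * Lʲ * N * F * (ℓ' * ℓ'ʲ)) ∎)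
        where
        open ≤-Reasoning
        open Step a Ua
        G = P^ (2 * j) g
        I = ∫ g
        ℓʲ = ℓ ^ j
        ℓ'ʲ = ℓ' ^ j
        Lʲ = (L * L) ^ j
        Σe = ∑ (λ c → e c * G c)
        idx : P (P G) a ≡ P^ (2 * suc j) g a
        idx = cong (λ i → P^ i g a) (two j)
          where
          two : ∀ j → suc (suc (2 * j)) ≡ 2 * suc j
          two = solve-∀
        L² : ∀ j → L ^ (2 * j) ≡ (L * L) ^ j
        L² j = trans (sym (^-*-assoc L 2 j)) (cong (λ z → (L * z) ^ j) (*-identityʳ L))
        PPG : k * P (P G) a ≡ 8 * N * (Lʲ * I) + Σe
        PPG = trans (PP G) (cong (λ z → 8 * N * z + Σe) (trans (∫-P^ (2 * j) g) (cong (_* I) (L² j))))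
        term : ∀ c → e c * (ℓʲ * Lʲ * I) ≤ N * ℓʲ * (e c * G c) + e c * (Lʲ * N * F * ℓ'ʲ)
        term c = byCase (U c) refl
         where
         byCase : ∀ u → U c ≡ u → e c * (ℓʲ * Lʲ * I) ≤ N * ℓʲ * (e c * G c) + e c * (Lʲ * N * F * ℓ'ʲ)
         byCase false eq = ≤-trans (≤-reflexive (cong (_* (ℓʲ * Lʲ * I)) (e-off c eq))) z≤n
         byCase true  eq = ≤-trans (e c ⊛ mix-even j h c eq) (≤-reflexive (f (e c) (N * ℓʲ) (G c) (Lʲ * N * F * ℓ'ʲ)))
          where
          f : ∀ e x y z → e * (x * y + z) ≡ x * (e * y) + e * z
          f = solve-∀
        summed : 8 * N * N * ℓ' * (ℓʲ * Lʲ * I) ≤ N * (ℓʲ * Σe) + 8 * N * N * ℓ' * (Lʲ * N * F * ℓ'ʲ)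
        summed = begin
          8 * N * N * ℓ' * (ℓʲ * Lʲ * I)        ≡⟨ cong (_* (ℓʲ * Lʲ * I)) (sym e-sum) ⟩
          ∑ e * (ℓʲ * Lʲ * I)                   ≡⟨ sym (∑-*ʳ _ e) ⟩
          ∑ (λ c → e c * (ℓʲ * Lʲ * I))         ≤⟨ ∑-mono term ⟩
          ∑ (λ c → N * ℓʲ * (e c * G c) + e c * (Lʲ * N * F * ℓ'ʲ)) ≡⟨ ∑-+ (λ c → N * ℓʲ * (e c * G c)) _ ⟩
          ∑ (λ c → N * ℓʲ * (e c * G c)) + ∑ (λ c → e c * (Lʲ * N * F * ℓ'ʲ))
            ≡⟨ cong₂ _+_ (trans (∑-*ˡ (N * ℓʲ) _) (*-assoc N ℓʲ Σe)) (trans (∑-*ʳ _ e) (cong (_* (Lʲ * N * F * ℓ'ʲ)) e-sum)) ⟩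
          N * (ℓʲ * Σe) + 8 * N * N * ℓ' * (Lʲ * N * F * ℓ'ʲ) ∎
        e₁ : ∀ k l lj L Lj I → k * (l * lj * (L * Lj) * I) ≡ k * L * (l * (lj * Lj * I))
        e₁ = solve-∀
        e₂ : ∀ N l α E β →
             8 * N * N * suc l * (suc l * α) + suc l * (N * E + 8 * N * N * l * β) + 0
             ≡ 8 * N * N * suc l * α + (suc l * N * E + 8 * N * N * suc l * (l * β)) + suc l * (8 * N * N * l * α)
        e₂ = solve-∀
        e₃ : ∀ N l lj Lj I E z → 8 * N * N * l * (lj * Lj * I) + (l * N * (lj * E) + z) ≡ N * (l * lj) * (8 * N * (Lj * I) + E) + z
        e₃ = solve-∀
        e₄ : ∀ k x y L l Lj lj N F → x * (k * y) + k * L * (l * (Lj * N * F * lj)) ≡ k * (x * y + L * Lj * N * F * (l * lj))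
        e₄ = solve-∀

      -- Lengths of either parity are covered by applying the i extra steps to f first, which scales
      -- its integral and its bound alike by L^i.
      mix : ∀ h i {f F} → (∀ c → f c ≤ F) → ∀ a → U a ≡ true →
            ℓ ^ h * L ^ (2 * h + i) * ∫ f ≤ N * ℓ ^ h * P^ (2 * h + i) f a + L ^ (2 * h + i) * N * F * ℓ' ^ h
      mix h i {f} {F} f≤F a Ua = begin
        ℓ ^ h * L ^ (2 * h + i) * ∫ f                 ≡⟨ cong (λ z → ℓ ^ h * z * ∫ f) Lexp ⟩
        ℓ ^ h * ((L * L) ^ h * L ^ i) * ∫ f           ≡⟨ e₁ (ℓ ^ h) ((L * L) ^ h) (L ^ i) (∫ f) ⟩
        ℓ ^ h * (L * L) ^ h * (L ^ i * ∫ f)           ≡⟨ cong (ℓ ^ h * (L * L) ^ h *_) (sym (∫-P^ i f)) ⟩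
        ℓ ^ h * (L * L) ^ h * ∫ (P^ i f)              ≤⟨ mix-even h (P^≤ i f≤F) a Ua ⟩
        N * ℓ ^ h * P^ (2 * h) (P^ i f) a + (L * L) ^ h * N * (L ^ i * F) * ℓ' ^ h
          ≡⟨ cong₂ _+_ (cong (N * ℓ ^ h *_) (sym (P^-+ (2 * h) i f a))) (trans (e₂ ((L * L) ^ h) N (L ^ i) F (ℓ' ^ h)) (cong (λ z → z * N * F * ℓ' ^ h) (sym Lexp))) ⟩
        N * ℓ ^ h * P^ (2 * h + i) f a + L ^ (2 * h + i) * N * F * ℓ' ^ h ∎
        where
        open ≤-Reasoning
        Lexp : L ^ (2 * h + i) ≡ (L * L) ^ h * L ^ i
        Lexp = trans (^-distribˡ-+-* L (2 * h) i) (cong (_* L ^ i) (trans (sym (^-*-assoc L 2 h)) (cong (λ z → (L * z) ^ h) (*-identityʳ L))))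
        e₁ : ∀ a b c d → a * (b * c) * d ≡ a * b * (c * d)
        e₁ = solve-∀
        e₂ : ∀ a b c d e → a * b * (c * d) * e ≡ a * c * b * d * e
        e₂ = solve-∀

      module Deep {par : Fin n → Fin n} {ρ xs φ} (ok : Ok par (ρ ∷ []) xs) (env : Env (ρ ∷ []) φ)
                  (0<L : 1 ≤ L) (0<N : 1 ≤ N) (h : ℕ) where

        T₀ : ℕ
        T₀ = L ^ length xs

        E⟨_⟩ : ((Fin n → Fin n) → ℕ) → ℕ
        E⟨ F ⟩ = EE par xs φ F

        EE-low : ∀ {i x} → Path par xs ρ (2 * h + i) x → ∀ {f F} → (∀ c → f c ≤ F) →
                 ℓ ^ h * T₀ * ∫ f ≤ N * ℓ ^ h * E⟨ (λ χ → f (χ x)) ⟩ + T₀ * N * F * ℓ' ^ h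
        EE-low {i} {x} π {f} {F} f≤F = *-cancelˡ-≤ (L ^ (2 * h + i)) {{m^n≢0 L (2 * h + i) {{>-nonZero 0<L}}}} (begin
          Lʲ * (ℓ ^ h * T₀ * ∫ f)       ≡⟨ e₁ Lʲ (ℓ ^ h) T₀ (∫ f) ⟩
          T₀ * (ℓ ^ h * Lʲ * ∫ f)       ≤⟨ T₀ ⊛ mix h i f≤F (φ ρ) (env ρ (here refl)) ⟩
          T₀ * (N * ℓ ^ h * P^ (2 * h + i) f (φ ρ) + Lʲ * N * F * ℓ' ^ h)
            ≡⟨ e₂ T₀ (N * ℓ ^ h) (P^ (2 * h + i) f (φ ρ)) Lʲ N F (ℓ' ^ h) ⟩
          N * ℓ ^ h * (T₀ * P^ (2 * h + i) f (φ ρ)) + Lʲ * (T₀ * N * F * ℓ' ^ h)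
            ≡⟨ cong (λ z → N * ℓ ^ h * z + Lʲ * (T₀ * N * F * ℓ' ^ h)) (sym (EE-path ok env π f)) ⟩
          N * ℓ ^ h * (Lʲ * E⟨ (λ χ → f (χ x)) ⟩) + Lʲ * (T₀ * N * F * ℓ' ^ h)
            ≡⟨ e₃ (N * ℓ ^ h) Lʲ E⟨ (λ χ → f (χ x)) ⟩ (T₀ * N * F * ℓ' ^ h) ⟩
          Lʲ * (N * ℓ ^ h * E⟨ (λ χ → f (χ x)) ⟩ + T₀ * N * F * ℓ' ^ h) ∎)
          where
          open ≤-Reasoning
          Lʲ = L ^ (2 * h + i)
          e₁ : ∀ a b c d → a * (b * c * d) ≡ c * (b * a * d)
          e₁ = solve-∀
          e₂ : ∀ t a p l N F x → t * (a * p + l * N * F * x) ≡ a * (t * p) + l * (t * N * F * x)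
          e₂ = solve-∀
          e₃ : ∀ a l x y → a * (l * x) + l * y ≡ l * (a * x + y)
          e₃ = solve-∀

        mass-1 : ∀ {F G} → (∀ χ → F χ + G χ ≡ 1) → E⟨ F ⟩ + E⟨ G ⟩ ≡ T₀
        mass-1 {F} {G} e = trans (sym (EE-+ xs F G)) (trans (EE-cong xs (λ χ _ → e χ)) (trans (EE-mass ok env 1) (*-identityʳ _)))

        -- The lower bound is applied to the complement of A. The density of A in `U` is at most r/q
        -- + M/N, and the last two hypotheses make M/N and the mixing error at most 1/(2zq) each.
        EE-hit : ∀ {i x} → Path par xs ρ (2 * h + i) x → ∀ (A : Fin n → Bool) z q r M →
                 q * cnt (λ c → U c ∧ A c) ≤ r * N + q * M → 2 * z * q * M ≤ N → 2 * z * q * ℓ' ^ h ≤ ℓ ^ h →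
                 z * q * E⟨ (λ χ → 𝟙 (A (χ x))) ⟩ ≤ T₀ * (z * r + 1)
        EE-hit {i} {x} π A z q r M hD hM hℓ = *-cancelˡ-≤ (2 * N * ℓ ^ h) {{m*n≢0 _ _ {{m*n≢0 2 N {{_}} {{>-nonZero 0<N}}}} {{m^n≢0 ℓ h}}}}
          (certify ((2 * z * q) ⊛ upper ⟨+⟩ (2 * z * ℓ ^ h * T₀) ⊛ hD ⟨+⟩ (T₀ * ℓ ^ h) ⊛ hM ⟨+⟩ (T₀ * N) ⊛ hℓ)
            0 (e z q r M N (ℓ ^ h) (ℓ' ^ h) T₀ E⟨ (λ χ → 𝟙 (A (χ x))) ⟩ (cnt (λ c → U c ∧ A c))))
          where
          EA = E⟨ (λ χ → 𝟙 (A (χ x))) ⟩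
          EB = E⟨ (λ χ → 𝟙 (not (A (χ x)))) ⟩
          D = cnt (λ c → U c ∧ A c)
          full : ∫ (λ c → 𝟙 (not (A c))) + D ≡ N
          full = trans (sym (∑-+ (λ a → 𝟙 (U a) * 𝟙 (not (A a))) _)) (trans (∑-cong (λ c → p (U c) (A c))) |U|)
            where
            p : ∀ u a → 𝟙 u * 𝟙 (not a) + 𝟙 (u ∧ a) ≡ 𝟙 u
            p true true = refl
            p true false = refl
            p false a = refl
          low = EE-low π {λ c → 𝟙 (not (A c))} {1} (λ c → 𝟙≤1 (not (A c)))
          upper : N * ℓ ^ h * EA ≤ ℓ ^ h * T₀ * D + T₀ * N * ℓ' ^ h
          upper = +-cancelʳ-≤ (ℓ ^ h * T₀ * ∫ (λ c → 𝟙 (not (A c)))) _ _ (begin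
            N * ℓ ^ h * EA + ℓ ^ h * T₀ * ∫ (λ c → 𝟙 (not (A c)))          ≤⟨ ≤-refl ⟨+⟩ low ⟩
            N * ℓ ^ h * EA + (N * ℓ ^ h * EB + T₀ * N * 1 * ℓ' ^ h)        ≡⟨ u₁ N (ℓ ^ h) EA EB (T₀ * N) (ℓ' ^ h) ⟩
            N * ℓ ^ h * (EA + EB) + T₀ * N * ℓ' ^ h                        ≡⟨ cong₂ (λ a b → a * ℓ ^ h * b + T₀ * N * ℓ' ^ h) (sym full) (mass-1 (λ χ → 𝟙-not (A (χ x)))) ⟩
            (∫ (λ c → 𝟙 (not (A c))) + D) * ℓ ^ h * T₀ + T₀ * N * ℓ' ^ h    ≡⟨ u₂ (∫ (λ c → 𝟙 (not (A c)))) D (ℓ ^ h) T₀ (T₀ * N * ℓ' ^ h) ⟩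
            ℓ ^ h * T₀ * D + T₀ * N * ℓ' ^ h + ℓ ^ h * T₀ * ∫ (λ c → 𝟙 (not (A c))) ∎)
            where
            open ≤-Reasoning
            u₁ : ∀ N l a b t x → N * l * a + (N * l * b + t * 1 * x) ≡ N * l * (a + b) + t * x
            u₁ = solve-∀
            u₂ : ∀ i d l t x → (i + d) * l * t + x ≡ l * t * d + x + l * t * i
            u₂ = solve-∀
          e : ∀ z q r M N l l' T E D →
              2 * N * l * (z * q * E) + (2 * z * q * (l * T * D + T * N * l') + (2 * z * l * T * (r * N + q * M) + (T * l * N + T * N * l))) + 0
              ≡ 2 * N * l * (T * (z * r + 1)) + (2 * z * q * (N * l * E) + (2 * z * l * T * (q * D) + (T * l * (2 * z * q * M) + T * N * (2 * z * q * l'))))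
          e = solve-∀

        -- Whether y could give its place to a vertex with neighbourhood B, moving itself into A:
        -- Jensen's inequality in disguise, via the set A' of those b ∈ A with many neighbours in B.
        module Star (A B : Fin n → Bool) (A⊂U : ∀ a → A a ≡ true → U a ≡ true) (B⊂U : ∀ a → B a ≡ true → U a ≡ true)
                    (|A| : (k + 2) * N ≤ 2 * k * cnt A) (|B| : (k + 2) * N ≤ 2 * k * cnt B)
                    (hℓ : 2 * k * k * ℓ' ^ h ≤ ℓ ^ h) where
          PB : Fin n → ℕ
          PB = P (λ b → 𝟙 (B b))

          A' : Fin n → Bool
          A' b = A b ∧ (L Data.Nat.≤ᵇ k * PB b)

          A'-many : ∀ b → A' b ≡ true → L ≤ k * PB b
          A'-many b h = ≤ᵇ⇒≤ L _ (subst Data.Bool.T (sym (proj₂ (∧-true {A b} h))) tt)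

          -- A total weight L|A| leaves A, and at most L(N - |B|) of it can avoid B because columns
          -- sum to at most L.
          meet : L * cnt A + L * cnt B ≤ ∑ (λ b → 𝟙 (A b) * PB b) + L * N
          meet = begin
            L * cnt A + L * cnt B                                             ≡⟨ cong (_+ L * cnt B) (trans (sym (∑-*ˡ L _)) (∑-cong sp)) ⟩
            ∑ (λ b → 𝟙 (A b) * PB b + 𝟙 (A b) * P C b) + L * cnt B            ≡⟨ cong (_+ L * cnt B) (∑-+ (λ b → 𝟙 (A b) * PB b) _) ⟩
            ∑ (λ b → 𝟙 (A b) * PB b) + ∑ (λ b → 𝟙 (A b) * P C b) + L * cnt B  ≤⟨ (≤-refl {∑ (λ b → 𝟙 (A b) * PB b)} ⟨+⟩ ∑-mono (λ b → 𝟙-mono (A⊂U b) ⟨*⟩ ≤-refl)) ⟨+⟩ ≤-refl ⟩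
            ∑ (λ b → 𝟙 (A b) * PB b) + ∫ (P C) + L * cnt B                    ≡⟨ cong (λ z → ∑ (λ b → 𝟙 (A b) * PB b) + z + L * cnt B) (∫-P C) ⟩
            ∑ (λ b → 𝟙 (A b) * PB b) + L * ∫ C + L * cnt B                    ≡⟨ f (∑ (λ b → 𝟙 (A b) * PB b)) L (∫ C) (cnt B) ⟩
            ∑ (λ b → 𝟙 (A b) * PB b) + L * (∫ C + cnt B)                      ≡⟨ cong (λ z → ∑ (λ b → 𝟙 (A b) * PB b) + L * z) (trans (sym (∑-+ (λ a → 𝟙 (U a) * C a) _)) (trans (∑-cong CB) |U|)) ⟩
            ∑ (λ b → 𝟙 (A b) * PB b) + L * N                                  ∎
            where
            open ≤-Reasoning
            C : Fin n → ℕ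
            C b = 𝟙 (not (B b))
            f : ∀ s l i b → s + l * i + l * b ≡ s + l * (i + b)
            f = solve-∀
            CB : ∀ b → 𝟙 (U b) * 𝟙 (not (B b)) + 𝟙 (B b) ≡ 𝟙 (U b)
            CB b with B b in eq
            ... | true  rewrite B⊂U b eq = refl
            ... | false = trans (+-identityʳ _) (*-identityʳ _)
            sp : ∀ b → L * 𝟙 (A b) ≡ 𝟙 (A b) * PB b + 𝟙 (A b) * P C b
            sp b with A b in eq
            ... | false = *-zeroʳ L
            ... | true  = sym (trans (cong₂ _+_ (*-identityˡ (PB b)) (*-identityˡ (P C b)))
                    (trans (sym (∑-+ (λ c → m b c * 𝟙 (B c)) _))
                    (trans (∑-cong (λ c → trans (sym (*-distribˡ-+ (m b c) _ _)) (cong (m b c *_) (𝟙-not (B c)))))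
                    (trans (P-const 1 b) (trans (cong (λ z → 𝟙 z * (L * 1)) (A⊂U b eq)) (*-identityˡ _))))))

          restrict : k * ∑ (λ b → 𝟙 (A b) * PB b) ≤ k * L * cnt A' + L * N
          restrict = begin
            k * ∑ (λ b → 𝟙 (A b) * PB b)                            ≡⟨ sym (∑-*ˡ k _) ⟩
            ∑ (λ b → k * (𝟙 (A b) * PB b))                          ≤⟨ ∑-mono ptw ⟩
            ∑ (λ b → k * L * 𝟙 (A' b) + L * 𝟙 (U b))                ≡⟨ trans (∑-+ (λ b → k * L * 𝟙 (A' b)) _) (cong₂ _+_ (∑-*ˡ (k * L) _) (trans (∑-*ˡ L _) (cong (L *_) |U|))) ⟩
            k * L * cnt A' + L * N                                  ∎
            where
            open ≤-Reasoning
            ptw : ∀ b → k * (𝟙 (A b) * PB b) ≤ k * L * 𝟙 (A' b) + L * 𝟙 (U b)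
            ptw b with A b in eq
            ... | false = ≤-trans (≤-reflexive (*-zeroʳ k)) z≤n
            ... | true with L Data.Nat.≤ᵇ k * PB b in eq'
            ...   | true  = ≤-trans (≤-trans (k ⊛ ≤-trans (≤-reflexive (*-identityˡ _)) (≤-trans (P≤ (λ c → 𝟙≤1 (B c)) b) (≤-reflexive (*-identityʳ L)))) (≤-reflexive (sym (*-identityʳ (k * L))))) (m≤m+n _ _)
            ...   | false = ≤-trans (≤-trans (≤-reflexive (cong (k *_) (*-identityˡ (PB b)))) (<⇒≤ (≰⇒> (λ q → subst Data.Bool.T eq' (≤⇒≤ᵇ q)))))
                              (≤-trans (≤-reflexive (trans (sym (*-identityʳ L)) (cong (λ z → L * 𝟙 z) (sym (A⊂U b eq))))) (m≤n+m _ _))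

          -- From |A| + |B| ≥ (1 + 2/k)N the weight from A to B is at least 2LN/k. Vertices outside
          -- `A'` contribute less than L/k each, hence at most LN/k together, and those in `A'` at
          -- most L each.
          |A'| : N ≤ k * cnt A'
          |A'| = *-cancelˡ-≤ (2 * L) {{m*n≢0 2 L {{_}} {{>-nonZero 0<L}}}} (certify
            ((2 * k) ⊛ meet ⟨+⟩ 2 ⊛ restrict ⟨+⟩ L ⊛ |A| ⟨+⟩ L ⊛ |B|) 0
            (e k L N (cnt A) (cnt B) (∑ (λ b → 𝟙 (A b) * PB b)) (cnt A')))
            where
            e : ∀ k L N a b s a' →
                2 * L * N + (2 * k * (s + L * N) + (2 * (k * L * a' + L * N) + (L * (2 * k * a) + L * (2 * k * b)))) + 0
                ≡ 2 * L * (k * a') + (2 * k * (L * a + L * b) + (2 * (k * s) + (L * ((k + 2) * N) + L * ((k + 2) * N))))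
            e = solve-∀

          -- For images a of par y and b of y: the parent is in B, and y is in A at a place from
          -- which each child has a chance of at least 1/k to land in B.
          w : Fin n → Fin n → ℕ
          w a b = 𝟙 (B a) * 𝟙 (A' b)

          f : Fin n → ℕ
          f a = ∑ (λ b → m a b * w a b)

          f≤L : ∀ a → f a ≤ L
          f≤L a = ≤-trans (∑-mono (λ b → m a b ⊛ (𝟙≤1 (B a) ⟨*⟩ 𝟙≤1 (A' b)))) (≤-trans (P≤ (λ _ → ≤-refl) a) (≤-reflexive (*-identityʳ L)))

          ∫f : k * ∫ f ≥ L * cnt A'
          ∫f = begin
            L * cnt A'                                  ≡⟨ sym (∑-*ˡ L _) ⟩
            ∑ (λ b → L * 𝟙 (A' b))                      ≤⟨ ∑-mono ptw ⟩
            ∑ (λ b → k * (𝟙 (A' b) * PB b))             ≡⟨ ∑-*ˡ k _ ⟩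
            k * ∑ (λ b → 𝟙 (A' b) * PB b)               ≡⟨ cong (k *_) (∑-cong (λ b → sym (∑-*ˡ (𝟙 (A' b)) _))) ⟩
            k * ∑ (λ b → ∑ (λ a → 𝟙 (A' b) * (m b a * 𝟙 (B a)))) ≡⟨ cong (k *_) (∑-swap _) ⟩
            k * ∑ (λ a → ∑ (λ b → 𝟙 (A' b) * (m b a * 𝟙 (B a)))) ≤⟨ k ⊛ ∑-mono back ⟩
            k * ∫ f                                     ∎
            where
            open ≤-Reasoning
            ptw : ∀ b → L * 𝟙 (A' b) ≤ k * (𝟙 (A' b) * PB b)
            ptw b with A' b in eq
            ... | false = ≤-trans (≤-reflexive (*-zeroʳ L)) z≤n
            ... | true  = ≤-trans (≤-reflexive (*-identityʳ L)) (≤-trans (A'-many b eq) (≤-reflexive (cong (k *_) (sym (*-identityˡ (PB b))))))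
            r : ∀ x y z → x * (y * z) ≡ y * (z * x)
            r = solve-∀
            back : ∀ a → ∑ (λ b → 𝟙 (A' b) * (m b a * 𝟙 (B a))) ≤ 𝟙 (U a) * f a
            back a with B a in eq
            ... | false = ≤-trans (≤-reflexive (trans (∑-cong (λ b → trans (cong (𝟙 (A' b) *_) (*-zeroʳ (m b a))) (*-zeroʳ (𝟙 (A' b))))) (∑-zero n))) z≤n
            ... | true  rewrite B⊂U a eq = ≤-reflexive (trans (∑-cong (λ b → trans (r (𝟙 (A' b)) (m b a) 1) (cong (_* (1 * 𝟙 (A' b))) (m-sym b a)))) (sym (*-identityˡ _)))

          module _ {i : ℕ} {y : Fin n} (y∈ : y ∈ xs) (π : Path par xs ρ (2 * h + i) (par y)) where
            -- The parent of y is at least 2h steps from the root, so its image is nearly uniform.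
            -- The mean of `f` over `U` is at least L/k², and `hℓ` lets the mixing error consume at
            -- most half of it.
            pair : T₀ ≤ 2 * k * k * E⟨ (λ χ → w (χ (par y)) (χ y)) ⟩
            pair = *-cancelˡ-≤ (N * ℓ ^ h * L) {{m*n≢0 _ _ {{m*n≢0 _ _ {{>-nonZero 0<N}} {{m^n≢0 ℓ h}}}} {{>-nonZero 0<L}}}}
              (certify ((2 * k * k) ⊛ EE-low π {f} {L} f≤L ⟨+⟩ (2 * k * ℓ ^ h * T₀) ⊛ ∫f ⟨+⟩ (2 * ℓ ^ h * T₀ * L) ⊛ |A'| ⟨+⟩ (T₀ * N * L) ⊛ hℓ
                        ⟨+⟩ (2 * k * k * N * ℓ ^ h) ⊛ ≤-reflexive (sym (EE-resample ok env y∈ w)))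
                0 (e k N (ℓ ^ h) (ℓ' ^ h) L T₀ (cnt A') (∫ f) E⟨ (λ χ → f (χ (par y))) ⟩ E⟨ (λ χ → w (χ (par y)) (χ y)) ⟩))
              where
              e : ∀ k N l l' L T a' I Ef E →
                  N * l * L * T + (2 * k * k * (N * l * Ef + T * N * L * l') + (2 * k * l * T * (k * I) + (2 * l * T * L * (k * a') + (T * N * L * l + 2 * k * k * N * l * (L * E))))) + 0
                  ≡ N * l * L * (2 * k * k * E) + (2 * k * k * (l * T * I) + (2 * k * l * T * (L * a') + (2 * l * T * L * N + (T * N * L * (2 * k * k * l') + 2 * k * k * N * l * Ef))))
              e = solve-∀

            nch : List (Fin n) → ℕ
            nch = sumL (λ c → 𝟙 (par c == y))

            -- Once y sits at a vertex whose step into B has probability at least 1/k, every child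
            -- loses at most a factor k, independently of the others; the remaining vertices
            -- integrate to full mass.
            below : ∀ {S zs φ} → Ok par S zs → Env S φ → y ∈ S → L ≤ k * PB (φ y) →
                    L ^ length zs ≤ k ^ nch zs * EE par zs φ (childProd par y B zs)
            below nil env y∈ h = ≤-refl
            below {S} {_} {φ} (place {x = c} {zs} p c∉ ok) env y∈ h with par c F.≟ y
            ... | yes refl = begin
              L * Lz                                          ≤⟨ h ⟨*⟩ ≤-refl ⟩
              k * PB a * Lz                                   ≡⟨ trans (*-assoc k _ Lz) (cong (k *_) (sym (∑-*ʳ Lz _))) ⟩
              k * ∑ (λ b → m a b * 𝟙 (B b) * Lz)              ≡⟨ cong (k *_) (∑-cong (λ b → *-assoc (m a b) _ Lz)) ⟩
              k * ∑ (λ b → m a b * (𝟙 (B b) * Lz))            ≤⟨ k ⊛ ∑m-mono a (λ b u → 𝟙 (B b) ⊛ below ok (Env-step c∉ u env) (there y∈)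
                                                                    (subst (λ v → L ≤ k * PB v) (sym (≔-other φ (λ { e → c∉ (subst (_∈ S) e y∈) }))) h)) ⟩
              k * ∑ (λ b → m a b * (𝟙 (B b) * (K * EE par zs (φ [ c ≔ b ]) (childProd par y B zs))))
                ≡⟨ trans (cong (k *_) (trans (∑-cong (λ b → r (m a b) (𝟙 (B b)) K _)) (∑-*ˡ K _))) (sym (*-assoc k K _)) ⟩
              k * K * ∑ (λ b → m a b * (𝟙 (B b) * EE par zs (φ [ c ≔ b ]) (childProd par y B zs)))
                ≡⟨ cong (k * K *_) (∑-cong (λ b → cong (m a b *_) (trans (sym (EE-* zs (𝟙 (B b)) (childProd par y B zs)))
                     (EE-cong zs (λ χ ag → cong (λ v → 𝟙 (B v) * childProd par y B zs χ) (sym (trans (ag c (Ok-fresh ok (here refl))) (≔-same φ c)))))))) ⟩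
              k * K * ∑ (λ b → m a b * EE par zs (φ [ c ≔ b ]) (λ χ → 𝟙 (B (χ c)) * childProd par y B zs χ)) ∎
              where
              open ≤-Reasoning
              a = φ (par c)
              Lz = L ^ length zs
              K = k ^ nch zs
              r : ∀ x y z w → x * (y * (z * w)) ≡ z * (x * (y * w))
              r = solve-∀
            ... | no _ = begin
              L * Lz                                          ≡⟨ cong (_* Lz) (sym (row-L (env _ p))) ⟩
              ∑ (m a) * Lz                                    ≡⟨ sym (∑-*ʳ Lz (m a)) ⟩
              ∑ (λ b → m a b * Lz)                            ≤⟨ ∑m-mono a (λ b u → below ok (Env-step c∉ u env) (there y∈)
                                                                    (subst (λ v → L ≤ k * PB v) (sym (≔-other φ (λ { e → c∉ (subst (_∈ S) e y∈) }))) h)) ⟩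
              ∑ (λ b → m a b * (K * EE par zs (φ [ c ≔ b ]) (childProd par y B zs))) ≡⟨ trans (∑-cong (λ b → r (m a b) K _)) (∑-*ˡ K _) ⟩
              K * ∑ (λ b → m a b * EE par zs (φ [ c ≔ b ]) (childProd par y B zs)) ≡⟨ cong (K *_) (∑-cong (λ b → cong (m a b *_) (EE-cong zs (λ χ _ → sym (*-identityˡ _))))) ⟩
              K * ∑ (λ b → m a b * EE par zs (φ [ c ≔ b ]) (λ χ → 1 * childProd par y B zs χ)) ∎
              where
              open ≤-Reasoning
              a = φ (par c)
              Lz = L ^ length zs
              K = k ^ nch zs
              r : ∀ x y z → x * (y * z) ≡ y * (x * z)
              r = solve-∀

            W : (Fin n → Fin n) → ℕ
            W χ = w (χ (par y)) (χ y)

            -- Vertices drawn before y carry the inequality along. When y is drawn, `w` is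
            -- determined: either it vanishes or y lies in `A'`, and then `below` applies to the
            -- rest.
            whole : ∀ {S zs φ} → Ok par S zs → Env S φ → y ∉ S → y ∈ zs →
                    EE par zs φ W ≤ k ^ nch zs * EE par zs φ (λ χ → W χ * childProd par y B zs χ)
            whole {S} {_} {φ} (place {x = .y} {zs} p _ ok) env y∉ (here refl)
              rewrite ≢⇒== {i = par y} {y} (λ e → y∉ (subst (_∈ S) e p)) =
              ≤-trans (∑m-mono a ptw) (≤-reflexive (trans (∑-cong (λ b → r (m a b) K _)) (∑-*ˡ K _)))
              where
              a = φ (par y)
              K = k ^ nch zs
              r : ∀ x y z → x * (y * z) ≡ y * (x * z)
              r = solve-∀
              at : ∀ b χ → Agree {par} zs (φ [ y ≔ b ]) χ → W χ ≡ w a b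
              at b χ ag = cong₂ w (trans (ag (par y) (Ok-fresh ok (there p))) (≔-other φ (λ e → y∉ (subst (_∈ S) e p))))
                                  (trans (ag y (Ok-fresh ok (here refl))) (≔-same φ y))
              ptw : ∀ b → U b ≡ true → EE par zs (φ [ y ≔ b ]) W ≤ K * EE par zs (φ [ y ≔ b ]) (λ χ → W χ * (1 * childProd par y B zs χ))
              ptw b u = begin
                EE par zs (φ [ y ≔ b ]) W                                   ≡⟨ EE-const ok (Env-step y∉ u env) (w a b) (at b) ⟩
                L ^ length zs * w a b                                       ≤⟨ scaled (w a b) refl ⟩
                K * (w a b * EE par zs (φ [ y ≔ b ]) (childProd par y B zs))         ≡⟨ cong (K *_) (trans (sym (EE-* zs (w a b) (childProd par y B zs)))
                                                                                (EE-cong zs (λ χ ag → cong₂ _*_ (sym (at b χ ag)) (sym (*-identityˡ _))))) ⟩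
                K * EE par zs (φ [ y ≔ b ]) (λ χ → W χ * (1 * childProd par y B zs χ)) ∎
                where
                open ≤-Reasoning
                scaled : ∀ v → w a b ≡ v → L ^ length zs * v ≤ K * (v * EE par zs (φ [ y ≔ b ]) (childProd par y B zs))
                scaled zero    _ = ≤-trans (≤-reflexive (*-zeroʳ (L ^ length zs))) z≤n
                scaled (suc v) e = ≤-trans (below ok (Env-step y∉ u env) (here refl)
                    (subst (λ v → L ≤ k * PB v) (sym (≔-same φ y)) (A'-many b inA')) ⟨*⟩ ≤-refl {suc v})
                    (≤-reflexive (r' K _ (suc v)))
                  where
                  r' : ∀ x y z → x * y * z ≡ x * (z * y)
                  r' = solve-∀
                  inA' : A' b ≡ true
                  inA' with A' b
                  ... | true  = refl
                  ... | false = ⊥-elim (case trans (sym e) (*-zeroʳ (𝟙 (B a))) of λ ())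
            whole {S} {_} {φ} (place {x = z} {zs} p z∉ ok) env y∉ (there y∈) with par z F.≟ y
            ... | yes e = ⊥-elim (y∉ (subst (_∈ S) e p))
            ... | no _ = ≤-trans (∑m-mono a (λ b u → ≤-trans (whole ok (Env-step z∉ u env) y∉' y∈)
                            (K ⊛ EE-mono zs (λ χ _ → W χ ⊛ ≤-reflexive (sym (*-identityˡ _))))))
                          (≤-reflexive (trans (∑-cong (λ b → r (m a b) K _)) (∑-*ˡ K _)))
              where
              a = φ (par z)
              K = k ^ nch zs
              r : ∀ x y z → x * (y * z) ≡ y * (x * z)
              r = solve-∀
              y∉' : y ∉ z ∷ S
              y∉' (here refl) = Ok-fresh ok (here refl) y∈
              y∉' (there q)   = y∉ q

            starE : y ≢ ρ → ∀ Δ → nch xs ≤ Δ → ∀ (G : (Fin n → Fin n) → ℕ) →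
                    (∀ χ → 𝟙 (B (χ (par y))) * 𝟙 (A (χ y)) * childProd par y B xs χ ≤ G χ) →
                    T₀ ≤ 2 * k * k * k ^ Δ * E⟨ G ⟩
            starE y≢ρ Δ hΔ G hG = begin
              T₀                                                        ≤⟨ pair ⟩
              2 * k * k * E⟨ W ⟩                                        ≤⟨ (2 * k * k) ⊛ whole ok env (λ { (here e) → y≢ρ e }) y∈ ⟩
              2 * k * k * (k ^ nch xs * E⟨ (λ χ → W χ * childProd par y B xs χ) ⟩)  ≤⟨ (2 * k * k) ⊛ (^-monoʳ-≤ k {{>-nonZero 0<k}} hΔ ⟨*⟩ EE-mono xs (λ χ _ →
                                                                              ≤-trans ((𝟙 (B (χ (par y))) ⊛ 𝟙-mono {A' (χ y)} (λ e → proj₁ (∧-true e))) ⟨*⟩ ≤-refl) (hG χ))) ⟩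
              2 * k * k * (k ^ Δ * E⟨ G ⟩)                              ≡⟨ sym (*-assoc (2 * k * k) (k ^ Δ) E⟨ G ⟩) ⟩
              2 * k * k * k ^ Δ * E⟨ G ⟩                                ∎
              where open ≤-Reasoning

  -- Exponential weights with truncated exponents, and their drift.

  pow-ratio : ∀ b {i j} → i ≤ j → suc b ^ i * b ^ j ≤ suc b ^ j * b ^ i
  pow-ratio b {i} {j} i≤j = begin
    suc b ^ i * b ^ j                  ≡⟨ cong (λ z → suc b ^ i * b ^ z) (sym (m∸n+n≡m i≤j)) ⟩
    suc b ^ i * b ^ (j ∸ i + i)        ≡⟨ cong (suc b ^ i *_) (^-distribˡ-+-* b (j ∸ i) i) ⟩
    suc b ^ i * (b ^ (j ∸ i) * b ^ i)  ≤⟨ (suc b ^ i) ⊛ (^-monoˡ-≤ (j ∸ i) (n≤1+n b) ⟨*⟩ ≤-refl) ⟩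
    suc b ^ i * (suc b ^ (j ∸ i) * b ^ i) ≡⟨ sym (*-assoc (suc b ^ i) _ _) ⟩
    suc b ^ i * suc b ^ (j ∸ i) * b ^ i ≡⟨ cong (_* b ^ i) (trans (sym (^-distribˡ-+-* (suc b) i (j ∸ i))) (cong (suc b ^_) (m+[n∸m]≡n i≤j))) ⟩
    suc b ^ j * b ^ i                  ∎
    where open ≤-Reasoning

  ^-pos : ∀ {b} r → 1 ≤ b → 1 ≤ b ^ r
  ^-pos {suc b} r h = m^n>0 (suc b) r

  *-pos : ∀ {x y} → 1 ≤ x → 1 ≤ y → 1 ≤ x * y
  *-pos p q = p ⟨*⟩ q

  cancelˡ : ∀ {k x y} → 1 ≤ k → k * x ≤ k * y → x ≤ y
  cancelˡ {k} h = *-cancelˡ-≤ k {{>-nonZero h}}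

  -- The weight (1 + 1/b)^y, multiplied by b^Q.
  module Weight (b Q : ℕ) (0<b : 1 ≤ b) where

    wt : ℕ → ℕ
    wt y = suc b ^ y * b ^ (Q ∸ y)

    wt-0 : wt 0 ≡ b ^ Q
    wt-0 = *-identityˡ _

    wt-shift : ∀ {y y' x R} → y ≤ Q → y' ≤ Q → y' + R ≤ y + x →
               wt y' * (suc b ^ R * b ^ x) ≤ wt y * (suc b ^ x * b ^ R)
    wt-shift {y} {y'} {x} {R} y≤ y'≤ le = cancelˡ (^-pos (y + R) 0<b) (begin
      b ^ (y + R) * (suc b ^ y' * b ^ (Q ∸ y') * (suc b ^ R * b ^ x))
        ≡⟨ cong (λ z → z * (suc b ^ y' * b ^ (Q ∸ y') * (suc b ^ R * b ^ x))) (^-distribˡ-+-* b y R) ⟩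
      b ^ y * b ^ R * (suc b ^ y' * b ^ (Q ∸ y') * (suc b ^ R * b ^ x))
        ≡⟨ e₁ (b ^ y) (b ^ R) (suc b ^ y') (b ^ (Q ∸ y')) (suc b ^ R) (b ^ x) ⟩
      suc b ^ y' * suc b ^ R * (b ^ y * b ^ x) * (b ^ (Q ∸ y') * b ^ R)
        ≡⟨ cong₂ (λ u v → u * v * (b ^ (Q ∸ y') * b ^ R)) (sym (^-distribˡ-+-* (suc b) y' R)) (sym (^-distribˡ-+-* b y x)) ⟩
      suc b ^ (y' + R) * b ^ (y + x) * (b ^ (Q ∸ y') * b ^ R)
        ≤⟨ pow-ratio b le ⟨*⟩ ≤-refl ⟩
      suc b ^ (y + x) * b ^ (y' + R) * (b ^ (Q ∸ y') * b ^ R)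
        ≡⟨ cong₂ (λ u v → u * v * (b ^ (Q ∸ y') * b ^ R)) (^-distribˡ-+-* (suc b) y x) (^-distribˡ-+-* b y' R) ⟩
      suc b ^ y * suc b ^ x * (b ^ y' * b ^ R) * (b ^ (Q ∸ y') * b ^ R)
        ≡⟨ e₂ (suc b ^ y) (suc b ^ x) (b ^ y') (b ^ R) (b ^ (Q ∸ y')) ⟩
      b ^ y' * b ^ (Q ∸ y') * b ^ R * (suc b ^ y * (suc b ^ x * b ^ R))
        ≡⟨ cong (λ z → z * b ^ R * (suc b ^ y * (suc b ^ x * b ^ R))) (trans (whole y' y'≤) (sym (whole y y≤))) ⟩
      b ^ y * b ^ (Q ∸ y) * b ^ R * (suc b ^ y * (suc b ^ x * b ^ R))
        ≡⟨ e₃ (b ^ y) (b ^ (Q ∸ y)) (b ^ R) (suc b ^ y) (suc b ^ x) ⟩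
      b ^ y * b ^ R * (suc b ^ y * b ^ (Q ∸ y) * (suc b ^ x * b ^ R))
        ≡⟨ cong (λ z → z * (suc b ^ y * b ^ (Q ∸ y) * (suc b ^ x * b ^ R))) (sym (^-distribˡ-+-* b y R)) ⟩
      b ^ (y + R) * (suc b ^ y * b ^ (Q ∸ y) * (suc b ^ x * b ^ R)) ∎)
      where
      open ≤-Reasoning
      whole : ∀ y → y ≤ Q → b ^ y * b ^ (Q ∸ y) ≡ b ^ Q
      whole y h = trans (sym (^-distribˡ-+-* b y (Q ∸ y))) (cong (b ^_) (m+[n∸m]≡n h))
      e₁ : ∀ a r y' q R x → a * r * (y' * q * (R * x)) ≡ y' * R * (a * x) * (q * r)
      e₁ = solve-∀
      e₂ : ∀ y x y' r q → y * x * (y' * r) * (q * r) ≡ y' * q * r * (y * (x * r))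
      e₂ = solve-∀
      e₃ : ∀ a q r y x → a * q * r * (y * (x * r)) ≡ a * r * (y * q * (x * r))
      e₃ = solve-∀

    -- If the new exponent is truncated to 0, its weight is the additive b^Q. Otherwise the exponent
    -- grows by at most x - R, and (1 + 1/b)^x ≤ 1 + x(b + X)/b² makes the bound linear in x, which
    -- is what an expectation can be applied to.
    wt-step : ∀ P Q' x R X → P ∸ Q' ≤ Q → (P + x) ∸ (Q' + R) ≤ Q → x ≤ X → X ≤ b →
              wt ((P + x) ∸ (Q' + R)) * (suc b ^ R * (b * b)) ≤
              wt (P ∸ Q') * (b ^ R * (b * b + x * (b + X))) + b ^ Q * (suc b ^ R * (b * b))
    wt-step P Q' x R X y≤ y'≤ x≤X X≤b with (P + x) ∸ (Q' + R) in eq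
    ... | zero = ≤-trans (≤-reflexive (cong (_* (suc b ^ R * (b * b))) wt-0)) (m≤n+m _ _)
    ... | suc y″ = ≤-trans (cancelˡ (^-pos x 0<b) (begin
        b ^ x * (wt y' * (suc b ^ R * (b * b)))            ≡⟨ e₁ (b ^ x) (wt y') (suc b ^ R) (b * b) ⟩
        wt y' * (suc b ^ R * b ^ x) * (b * b)              ≤⟨ wt-shift {y} {y'} {x} {R} y≤ y'≤ le ⟨*⟩ ≤-refl ⟩
        wt y * (suc b ^ x * b ^ R) * (b * b)               ≡⟨ e₂ (wt y) (suc b ^ x) (b ^ R) (b * b) ⟩
        wt y * b ^ R * (suc b ^ x * (b * b))               ≤⟨ (wt y * b ^ R) ⊛ pow-upper b x (≤-trans x≤X X≤b) ⟩
        wt y * b ^ R * (b ^ x * (b * b + x * b + x * x))   ≤⟨ (wt y * b ^ R) ⊛ (b ^ x) ⊛ (≤-refl ⟨+⟩ x ⊛ x≤X) ⟩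
        wt y * b ^ R * (b ^ x * (b * b + x * b + x * X))   ≡⟨ e₃ (wt y) (b ^ R) (b ^ x) b x X ⟩
        b ^ x * (wt y * (b ^ R * (b * b + x * (b + X))))   ∎)) (m≤m+n _ _)
      where
      open ≤-Reasoning
      y = P ∸ Q'
      y' = suc y″
      le : y' + R ≤ y + x
      le = +-cancelʳ-≤ Q' _ _ (begin
        y' + R + Q'               ≡⟨ trans (+-assoc y' R Q') (cong₂ _+_ (sym eq) (+-comm R Q')) ⟩
        (P + x) ∸ (Q' + R) + (Q' + R) ≡⟨ m∸n+n≡m {P + x} {Q' + R} (<⇒≤ (m<n⇒0<n∸m⁻ {P + x} {Q' + R} eq)) ⟩
        P + x                     ≤⟨ m≤n+m∸n P Q' ⟨+⟩ ≤-refl ⟩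
        Q' + y + x                ≡⟨ e₀ Q' y x ⟩
        y + x + Q'                ∎)
        where
        m<n⇒0<n∸m⁻ : ∀ {p q r} → p ∸ q ≡ suc r → q < p
        m<n⇒0<n∸m⁻ {p} {q} e = ≰⇒> (λ h → case trans (sym e) (m≤n⇒m∸n≡0 h) of λ ())
        e₀ : ∀ a b c → a + b + c ≡ b + c + a
        e₀ = solve-∀
      e₁ : ∀ x w r b → x * (w * (r * b)) ≡ w * (r * x) * b
      e₁ = solve-∀
      e₂ : ∀ w x r b → w * (x * r) * b ≡ w * r * (x * b)
      e₂ = solve-∀
      e₃ : ∀ w r p b x X → w * r * (p * (b * b + x * b + x * X)) ≡ p * (w * (r * (b * b + x * (b + X))))
      e₃ = solve-∀

    -- Ex and Ew stand for the (unnormalised, total mass T) expectations of x and of the new weight.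
    wt-mean : ∀ z R f s X y T Ex Ew → 1 ≤ z → X ≤ b → 3 * z * R * X ≤ b * f →
              3 * z * Ex ≤ T * (3 * z * R + f + 3 * z * s) →
              Ew * (suc b ^ R * (b * b)) ≤ wt y * (b ^ R * (b * b * T + Ex * (b + X))) + T * (b ^ Q * (suc b ^ R * (b * b))) →
              Ew * ((z * b) ^ f * b ^ (2 * s)) ≤
              T * (b ^ Q * ((z * b) ^ f * b ^ (2 * s)) + wt y * (suc (z * b) ^ f * suc b ^ (2 * s)))
    wt-mean z R f s X y T Ex Ew 0<z X≤b hR hx hw =
      cancelˡ {suc b ^ R * (b * b) * κ} (*-pos (*-pos (^-pos R (s≤s z≤n)) (*-pos 0<b 0<b)) (*-pos 0<z 0<b)) (begin
        p' * (b * b) * κ * (Ew * (k₁ * s₁))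
          ≡⟨ e₁ p' (b * b) κ Ew (k₁ * s₁) ⟩
        Ew * (p' * (b * b)) * (κ * (k₁ * s₁))
          ≤⟨ hw ⟨*⟩ ≤-refl ⟩
        (wt y * (p * (b * b * T + Ex * (b + X))) + T * (b ^ Q * (p' * (b * b)))) * (κ * (k₁ * s₁))
          ≡⟨ e₂ (wt y) p (b * b * T + Ex * (b + X)) (T * (b ^ Q * (p' * (b * b)))) κ (k₁ * s₁) ⟩
        wt y * p * (k₁ * s₁) * ((b * b * T + Ex * (b + X)) * κ) + T * (b ^ Q * (p' * (b * b))) * (κ * (k₁ * s₁))
          ≤⟨ ((wt y * p * (k₁ * s₁)) ⊛ key) ⟨+⟩ ≤-refl ⟩
        wt y * p * (k₁ * s₁) * (T * ((b + R) * (κ + f) * (b + 2 * s))) + T * (b ^ Q * (p' * (b * b))) * (κ * (k₁ * s₁))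
          ≡⟨ cong (_+ T * (b ^ Q * (p' * (b * b))) * (κ * (k₁ * s₁))) (e₃ (wt y) p k₁ s₁ T (b + R) (κ + f) (b + 2 * s)) ⟩
        wt y * T * (p * (b + R) * (k₁ * (κ + f)) * (s₁ * (b + 2 * s))) + T * (b ^ Q * (p' * (b * b))) * (κ * (k₁ * s₁))
          ≤⟨ ((wt y * T) ⊛ (bernoulli b R ⟨*⟩ bernoulli κ f) ⟨*⟩ bernoulli b (2 * s)) ⟨+⟩ ≤-refl ⟩
        wt y * T * (p' * b * (k₂ * κ) * (s₂ * b)) + T * (b ^ Q * (p' * (b * b))) * (κ * (k₁ * s₁))
          ≡⟨ e₄ (wt y) T p' b k₂ κ s₂ (b ^ Q) (k₁ * s₁) ⟩
        p' * (b * b) * κ * (T * (b ^ Q * (k₁ * s₁) + wt y * (k₂ * s₂))) ∎)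
      where
      open ≤-Reasoning
      κ = z * b
      p = b ^ R
      p' = suc b ^ R
      k₁ = κ ^ f
      k₂ = suc κ ^ f
      s₁ = b ^ (2 * s)
      s₂ = suc b ^ (2 * s)
      -- The mean satisfies Ex/T ≤ R + f/(3z) + s. The factor (b + X)/b² ≤ 2/b doubles f/(3z) + s,
      -- and the term RX/b² costs another f/(3zb). The total R/b + f/(zb) + 2s/b is dominated by the
      -- product of three factors, to which Bernoulli's inequality applies separately.
      key : (b * b * T + Ex * (b + X)) * κ ≤ T * ((b + R) * (κ + f) * (b + 2 * s))
      key = cancelˡ {3 * z} (*-pos {3} (s≤s z≤n) 0<z) (certify
        ((z * b * (b + X)) ⊛ hx ⟨+⟩ (T * (z * b)) ⊛ hR ⟨+⟩ (T * (z * b) * (f + 3 * z * s)) ⊛ X≤b)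
        (3 * z * T * (R * f * b + 2 * s * (R * (z * b) + b * f + R * f)))
        (e z b T Ex X R f s))
        where
        e : ∀ z b T Ex X R f s →
            3 * z * ((b * b * T + Ex * (b + X)) * (z * b)) + (z * b * (b + X) * (T * (3 * z * R + f + 3 * z * s)) + (T * (z * b) * (b * f) + T * (z * b) * (f + 3 * z * s) * b))
            + 3 * z * T * (R * f * b + 2 * s * (R * (z * b) + b * f + R * f))
            ≡ 3 * z * (T * ((b + R) * (z * b + f) * (b + 2 * s))) + (z * b * (b + X) * (3 * z * Ex) + (T * (z * b) * (3 * z * R * X) + T * (z * b) * (f + 3 * z * s) * X))
        e = solve-∀
      e₁ : ∀ p b k w s → p * b * k * (w * s) ≡ w * (p * b) * (k * s)
      e₁ = solve-∀
      e₂ : ∀ w p i t k s → (w * (p * i) + t) * (k * s) ≡ w * p * s * (i * k) + t * (k * s)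
      e₂ = solve-∀
      e₃ : ∀ w p k s T a b c → w * p * (k * s) * (T * (a * b * c)) ≡ w * T * (p * a * (k * b) * (s * c))
      e₃ = solve-∀
      e₄ : ∀ w T p b k₂ κ s₂ q s → w * T * (p * b * (k₂ * κ) * (s₂ * b)) + T * (q * (p * (b * b))) * (κ * s) ≡ p * (b * b) * κ * (T * (q * s + w * (k₂ * s₂)))
      e₄ = solve-∀

    -- At exponent `Y₀` a single weight already exceeds the largest budget the potential ever has,
    -- the one for e = n and S = `S̄`; budgets are monotone in e and S. So a potential within its
    -- budget admits no larger exponent.
    wt-bound : ∀ κ K n S̄ Y₀ → 1 ≤ κ →
               K * suc n * (suc κ ^ (2 * n) * suc b ^ (2 * S̄)) * b ^ Y₀ < suc b ^ Y₀ * (κ ^ (2 * n) * b ^ (2 * S̄)) →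
               ∀ {y e S} → y ≤ Q → e ≤ n → S ≤ S̄ →
               wt y * (κ ^ (2 * e) * b ^ (2 * S)) ≤ K * suc e * (suc κ ^ (2 * e) * suc b ^ (2 * S)) * b ^ Q → y ≤ Y₀
    wt-bound κ K n S̄ Y₀ 0<κ big {y} {e} {S} y≤Q e≤n S≤S̄ h with y ≤? Y₀
    ... | yes p = p
    ... | no ¬p = ⊥-elim (<-irrefl refl (≤-trans big small))
      where
      open ≤-Reasoning
      κe = κ ^ (2 * e)
      κn = κ ^ (2 * n)
      κe⁺ = suc κ ^ (2 * e)
      κn⁺ = suc κ ^ (2 * n)
      bS = b ^ (2 * S)
      bT = b ^ (2 * S̄)
      bS⁺ = suc b ^ (2 * S)
      bT⁺ = suc b ^ (2 * S̄)
      Z = b ^ y * κe * bS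
      h' : suc b ^ y * (κe * bS) ≤ K * suc e * (κe⁺ * bS⁺) * b ^ y
      h' = cancelˡ (^-pos (Q ∸ y) 0<b) (begin
        b ^ (Q ∸ y) * (suc b ^ y * (κe * bS))        ≡⟨ e₁ (b ^ (Q ∸ y)) (suc b ^ y) (κe * bS) ⟩
        wt y * (κe * bS)                             ≤⟨ h ⟩
        K * suc e * (κe⁺ * bS⁺) * b ^ Q              ≡⟨ cong (λ z → K * suc e * (κe⁺ * bS⁺) * b ^ z) (sym (m+[n∸m]≡n y≤Q)) ⟩
        K * suc e * (κe⁺ * bS⁺) * b ^ (y + (Q ∸ y))  ≡⟨ cong (K * suc e * (κe⁺ * bS⁺) *_) (^-distribˡ-+-* b y (Q ∸ y)) ⟩
        K * suc e * (κe⁺ * bS⁺) * (b ^ y * b ^ (Q ∸ y)) ≡⟨ e₂ (K * suc e * (κe⁺ * bS⁺)) (b ^ y) (b ^ (Q ∸ y)) ⟩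
        b ^ (Q ∸ y) * (K * suc e * (κe⁺ * bS⁺) * b ^ y) ∎)
        where
        e₁ : ∀ a b c → a * (b * c) ≡ b * a * c
        e₁ = solve-∀
        e₂ : ∀ a b c → a * (b * c) ≡ c * (a * b)
        e₂ = solve-∀
      small : suc b ^ Y₀ * (κn * bT) ≤ K * suc n * (κn⁺ * bT⁺) * b ^ Y₀
      small = cancelˡ {Z} (*-pos (*-pos (^-pos y 0<b) (^-pos (2 * e) 0<κ)) (^-pos (2 * S) 0<b)) (begin
        b ^ y * κe * bS * (suc b ^ Y₀ * (κn * bT))
          ≡⟨ e₁ (b ^ y) κe bS (suc b ^ Y₀) κn bT ⟩
        suc b ^ Y₀ * b ^ y * (κe * bS * (κn * bT))
          ≤⟨ pow-ratio b (<⇒≤ (≰⇒> ¬p)) ⟨*⟩ ≤-refl ⟩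
        suc b ^ y * b ^ Y₀ * (κe * bS * (κn * bT))
          ≡⟨ e₂ (suc b ^ y) (b ^ Y₀) (κe * bS) (κn * bT) ⟩
        suc b ^ y * (κe * bS) * (b ^ Y₀ * (κn * bT))
          ≤⟨ h' ⟨*⟩ ≤-refl ⟩
        K * suc e * (κe⁺ * bS⁺) * b ^ y * (b ^ Y₀ * (κn * bT))
          ≡⟨ e₃ K (suc e) κe⁺ bS⁺ (b ^ y) (b ^ Y₀) κn bT ⟩
        K * suc e * (b ^ y * b ^ Y₀) * (κe⁺ * κn * (bS⁺ * bT))
          ≤⟨ ((K ⊛ s≤s e≤n) ⟨*⟩ ≤-refl {b ^ y * b ^ Y₀}) ⟨*⟩ (pow-ratio κ (2 ⊛ e≤n) ⟨*⟩ pow-ratio b (2 ⊛ S≤S̄)) ⟩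
        K * suc n * (b ^ y * b ^ Y₀) * (κn⁺ * κe * (bT⁺ * bS))
          ≡⟨ e₄ K (suc n) (b ^ y) (b ^ Y₀) κn⁺ κe bT⁺ bS ⟩
        b ^ y * κe * bS * (K * suc n * (κn⁺ * bT⁺) * b ^ Y₀) ∎)
        where
        e₁ : ∀ y k s Y κ t → y * k * s * (Y * (κ * t)) ≡ Y * y * (k * s * (κ * t))
        e₁ = solve-∀
        e₂ : ∀ a b c d → a * b * (c * d) ≡ a * c * (b * d)
        e₂ = solve-∀
        e₃ : ∀ K e a s y Y κ t → K * e * (a * s) * y * (Y * (κ * t)) ≡ K * e * (y * Y) * (a * κ * (s * t))
        e₃ = solve-∀
        e₄ : ∀ K e y Y a k t s → K * e * (y * Y) * (a * k * (t * s)) ≡ y * k * s * (K * e * (a * t) * Y)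
        e₄ = solve-∀

  -- Bijections, exchanges and strategies.

  allF : ∀ {n} → (Fin n → Bool) → Bool
  allF p = does (F.all? (λ z → p z Data.Bool.≟ true))

  allF-elim : ∀ {n} {p : Fin n → Bool} → allF p ≡ true → ∀ z → p z ≡ true
  allF-elim {p = p} = does-true (F.all? (λ z → p z Data.Bool.≟ true))

  allF-intro : ∀ {n} {p : Fin n → Bool} → (∀ z → p z ≡ true) → allF p ≡ true
  allF-intro {p = p} = true-does (F.all? (λ z → p z Data.Bool.≟ true))

  _⇒ᵇ_ : Bool → Bool → Bool
  a ⇒ᵇ b = not a ∨ b

  ⇒ᵇ-elim : ∀ {a b} → (a ⇒ᵇ b) ≡ true → a ≡ true → b ≡ true
  ⇒ᵇ-elim h refl = h

  ⇒ᵇ-intro : ∀ {a b} → (a ≡ true → b ≡ true) → (a ⇒ᵇ b) ≡ true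
  ⇒ᵇ-intro {true}  h = h refl
  ⇒ᵇ-intro {false} h = refl

  -- Outside four exceptional events the property survives. Summed over all vertices, this bounds
  -- the number of candidates destroyed by an exchange.
  unless : ∀ {s s'} a b c d → (a ≡ false → b ≡ false → c ≡ false → d ≡ false → s ≡ true → s' ≡ true) →
           𝟙 s ≤ 𝟙 s' + ((𝟙 a + 𝟙 b) + (𝟙 c + 𝟙 d))
  unless {false} _ _ _ _ h = z≤n
  unless {true} {s'} true  b c d h = ≤-trans (s≤s z≤n) (m≤n+m _ (𝟙 s'))
  unless {true} {s'} false true c d h = ≤-trans (s≤s z≤n) (m≤n+m _ (𝟙 s'))
  unless {true} {s'} false false true d h = ≤-trans (s≤s z≤n) (m≤n+m _ (𝟙 s'))
  unless {true} {s'} false false false true h = ≤-trans (s≤s z≤n) (m≤n+m _ (𝟙 s'))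
  unless {true} false false false false h rewrite h refl refl refl refl refl = s≤s z≤n

  record Bij (n : ℕ) : Set where
    field
      to from : Fin n → Fin n
      from-to : ∀ x → from (to x) ≡ x
      to-from : ∀ w → to (from w) ≡ w
  open Bij public

  to-inj : ∀ {n} (ψ : Bij n) {x y} → to ψ x ≡ to ψ y → x ≡ y
  to-inj ψ {x} {y} e = trans (sym (from-to ψ x)) (trans (cong (from ψ) e) (from-to ψ y))

  opaque
    unfolding ∑

    ∑-to : ∀ {n} (ψ : Bij n) (f : Fin n → ℕ) → ∑ (λ x → f (to ψ x)) ≡ ∑ f
    ∑-to ψ f = sym (sum-permute f (Perm.permutation (to ψ) (from ψ) (to-from ψ) (from-to ψ)))

  opaque
    sw : ∀ {n} → Fin n → Fin n → Fin n → Fin n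
    sw x y z = if z == x then y else (if z == y then x else z)

    sw-l : ∀ {n} (x y : Fin n) → sw x y x ≡ y
    sw-l x y rewrite ==-refl x = refl

    sw-r : ∀ {n} (x y : Fin n) → sw x y y ≡ x
    sw-r x y with y F.≟ x
    ... | yes e = e
    ... | no _ rewrite ==-refl y = refl

    sw-o : ∀ {n} {x y z : Fin n} → z ≢ x → z ≢ y → sw x y z ≡ z
    sw-o p q rewrite ≢⇒== p | ≢⇒== q = refl

    sw-sw : ∀ {n} (x y z : Fin n) → sw x y (sw x y z) ≡ z
    sw-sw x y z with z F.≟ x
    ... | yes refl = sw-r x y
    ... | no p with z F.≟ y
    ...   | yes refl = sw-l x y
    ...   | no q = sw-o p q

  swapB : ∀ {n} → Bij n → Fin n → Fin n → Bij n
  swapB ψ x y = record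
    { to = λ z → to ψ (sw x y z) ; from = λ w → sw x y (from ψ w)
    ; from-to = λ z → trans (cong (sw x y) (from-to ψ _)) (sw-sw x y z)
    ; to-from = λ w → trans (cong (to ψ) (sw-sw x y (from ψ w))) (to-from ψ w) }

  -- Vertices are embedded one at a time: x receives its image by a transposition with one of at
  -- least g admissible vertices y.  Every sequence of choices must lead to a good bijection.
  module Strategy {n} (g : ℕ) (Good : Bij n → Set) where

    Strat : List (Fin n) → Bij n → Set
    Strat []       ψ = Good ψ
    Strat (x ∷ xs) ψ = Σ (Fin n → Bool) λ O → (cnt O ≡ g) × (∀ y → O y ≡ true → Strat xs (swapB ψ x y))

    play : ∀ {x xs ψ} (p : Fin n → Bool) → g ≤ cnt p → (∀ y → p y ≡ true → Strat xs (swapB ψ x y)) → Strat (x ∷ xs) ψ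
    play p h k with shrink p g h
    ... | O , e , O⊆p = O , e , λ y o → k y (O⊆p y o)

  -- The end phase: the last vertices take over images of stars.

  record Rooted {n} (T : Graph n) (t : Fin n) : Set where
    field
      par      : Fin n → Fin n
      depth    : Fin n → ℕ
      dep-t    : depth t ≡ 0
      par-adj  : ∀ x → x ≢ t → adj T x (par x) ≡ true
      par-dep  : ∀ x → x ≢ t → depth x ≡ suc (depth (par x))
      edge-par : ∀ x y → adj T x y ≡ true → (x ≢ t × par x ≡ y) ⊎ (y ≢ t × par y ≡ x)

  module Finish {n} (G T : Graph n) (t v : Fin n) (R : Rooted T t) (Δ g : ℕ) (deg≤ : ∀ x → cnt (adj T x) ≤ Δ) where
    open Rooted R

    Good : Bij n → Set
    Good ψ = (to ψ t ≡ v) × (∀ x → x ≢ t → adj G (to ψ x) (to ψ (par x)) ≡ true)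

    open Strategy g Good

    adj≢ : ∀ (H : Graph n) {x y} → adj H x y ≡ true → x ≢ y
    adj≢ H {x} h refl = true≢false h (adj-irr H x)

    -- y may move to a vertex with neighbourhood N(u), freeing a neighbour of w.
    star : Fin n → Fin n → Bij n → List (Fin n) → Fin n → Bool
    star u w ψ S y = (elem y S ∧ not (y == t)) ∧ (adj G w (to ψ y) ∧ allF (λ z → (adj T y z ∧ elem z S) ⇒ᵇ adj G u (to ψ z)))

    -- Stars are demanded for all pairs (u, w), because the current image of the next vertex is
    -- arbitrary. An exchange of x and y can spoil only neighbours of x or y and these two vertices,
    -- that is 2Δ + 2 stars, so the stock lasts for all remaining steps.
    finish : ∀ {S} rem ψ → t ∈ S → Ok par S rem → (∀ z → z ∈ S ⊎ z ∈ rem) → (∀ z → z ∈ S → z ≢ t → par z ∈ S) →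
             to ψ t ≡ v → (∀ x → x ∈ S → x ≢ t → adj G (to ψ x) (to ψ (par x)) ≡ true) →
             (∀ u w → g + (2 * Δ + 2) * length rem ≤ cnt (star u w ψ S)) → Strat rem ψ
    finish [] ψ t∈ ok all cl ψt edges en = ψt , λ x x≢ → edges x (case all x of λ { (inj₁ p) → p ; (inj₂ ()) }) x≢
    finish {S} (x ∷ rem) ψ t∈ (place px∈ x∉ ok) all cl ψt edges en =
      play {x} {rem} {ψ} (star (to ψ x) (to ψ (par x)) ψ S) (≤-trans (m≤m+n g _) (en _ _)) next
      where
      next : ∀ y → star (to ψ x) (to ψ (par x)) ψ S y ≡ true → Strat rem (swapB ψ x y)
      next y o = finish rem ψ' (there t∈) ok all' cl' (trans (same t (λ e → x∉ (subst (_∈ S) e t∈)) (λ e → y≢t (sym e))) ψt) edges' en'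
        where
        ψ' = swapB ψ x y
        o₁ = ∧-true {elem y S ∧ not (y == t)} o
        y∈ : y ∈ S
        y∈ = elem⇒∈ S (proj₁ (∧-true {elem y S} (proj₁ o₁)))
        y≢t : y ≢ t
        y≢t refl = true≢false (==-refl t) (not-true (proj₂ (∧-true {elem y S} (proj₁ o₁))))
        wy : adj G (to ψ (par x)) (to ψ y) ≡ true
        wy = proj₁ (∧-true {adj G (to ψ (par x)) (to ψ y)} (proj₂ o₁))
        nbr : ∀ z → adj T y z ≡ true → z ∈ S → adj G (to ψ x) (to ψ z) ≡ true
        nbr z a z∈ = ⇒ᵇ-elim (allF-elim (proj₂ (∧-true {adj G (to ψ (par x)) (to ψ y)} (proj₂ o₁))) z) (∧-intro a (∈⇒elem z∈))
        same : ∀ z → z ≢ x → z ≢ y → to ψ' z ≡ to ψ z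
        same z p q = cong (to ψ) (sw-o p q)
        ∈≢x : ∀ {z} → z ∈ S → z ≢ x
        ∈≢x z∈ refl = x∉ z∈
        ψ'x : to ψ' x ≡ to ψ y
        ψ'x = cong (to ψ) (sw-l x y)
        ψ'y : to ψ' y ≡ to ψ x
        ψ'y = cong (to ψ) (sw-r x y)
        -- The image of y is adjacent to that of par x and G has no loops; hence the exchange leaves
        -- par x in place.
        px≢y : par x ≢ y
        px≢y e = true≢false wy (trans (cong (λ a → adj G (to ψ a) (to ψ y)) e) (adj-irr G _))
        all' : ∀ z → z ∈ x ∷ S ⊎ z ∈ rem
        all' z with all z
        ... | inj₁ p = inj₁ (there p)
        ... | inj₂ (here e) = inj₁ (here e)
        ... | inj₂ (there p) = inj₂ p
        cl' : ∀ z → z ∈ x ∷ S → z ≢ t → par z ∈ x ∷ S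
        cl' z (here refl) _ = there px∈
        cl' z (there p) q = there (cl z p q)
        edges' : ∀ z → z ∈ x ∷ S → z ≢ t → adj G (to ψ' z) (to ψ' (par z)) ≡ true
        edges' z (here refl) q = trans (cong₂ (adj G) ψ'x (same (par x) (∈≢x px∈) px≢y)) (trans (adj-sym G _ _) wy)
        edges' z (there z∈) q with z F.≟ y | par z F.≟ y
        ... | yes refl | _ = trans (cong₂ (adj G) ψ'y (same (par y) (∈≢x (cl y y∈ q)) (λ e → adj≢ T (par-adj y q) (sym e))))
                               (nbr (par y) (par-adj y q) (cl y y∈ q))
        ... | no z≢ | yes refl = trans (cong₂ (adj G) (same z (∈≢x z∈) z≢) ψ'y)
                               (trans (adj-sym G _ _) (nbr z (trans (adj-sym T _ _) (par-adj z q)) z∈))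
        ... | no z≢ | no pz≢ = trans (cong₂ (adj G) (same z (∈≢x z∈) z≢) (same (par z) (∈≢x (cl z z∈ q)) pz≢)) (edges z z∈ q)
        drop : ∀ u w → cnt (star u w ψ S) ≤ cnt (star u w ψ' (x ∷ S)) + (2 * Δ + 2)
        drop u w = begin
          cnt (star u w ψ S)
            ≤⟨ ∑-mono ptw ⟩
          ∑ (λ z → 𝟙 (star u w ψ' (x ∷ S) z) + ((𝟙 (adj T y z) + 𝟙 (adj T x z)) + (𝟙 (z == y) + 𝟙 (z == x))))
            ≡⟨ trans (∑-+ (λ z → 𝟙 (star u w ψ' (x ∷ S) z)) _) (cong (cnt (star u w ψ' (x ∷ S)) +_)
                 (trans (∑-+ (λ z → 𝟙 (adj T y z) + 𝟙 (adj T x z)) _) (cong₂ _+_ (∑-+ (λ z → 𝟙 (adj T y z)) _)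
                   (trans (∑-+ (λ z → 𝟙 (z == y)) _) (cong₂ _+_ (cnt-point y) (cnt-point x)))))) ⟩
          cnt (star u w ψ' (x ∷ S)) + ((cnt (adj T y) + cnt (adj T x)) + 2)
            ≤⟨ ≤-refl {cnt (star u w ψ' (x ∷ S))} ⟨+⟩ (deg≤ y ⟨+⟩ deg≤ x) ⟨+⟩ ≤-refl {2} ⟩
          cnt (star u w ψ' (x ∷ S)) + ((Δ + Δ) + 2)
            ≡⟨ cong (λ d → cnt (star u w ψ' (x ∷ S)) + (Δ + d + 2)) (sym (+-identityʳ Δ)) ⟩
          cnt (star u w ψ' (x ∷ S)) + (2 * Δ + 2) ∎
          where
          open ≤-Reasoning
          ptw : ∀ z → 𝟙 (star u w ψ S z) ≤ 𝟙 (star u w ψ' (x ∷ S) z) + ((𝟙 (adj T y z) + 𝟙 (adj T x z)) + (𝟙 (z == y) + 𝟙 (z == x)))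
          ptw z = unless (adj T y z) (adj T x z) (z == y) (z == x) λ ay ax zy zx →
            keep ay ax (λ { refl → true≢false (==-refl y) zy }) (λ { refl → true≢false (==-refl x) zx })
            where
            keep : adj T y z ≡ false → adj T x z ≡ false → z ≢ y → z ≢ x → star u w ψ S z ≡ true → star u w ψ' (x ∷ S) z ≡ true
            keep ay ax z≢y z≢x h = ∧-intro (∧-intro (∈⇒elem (there (elem⇒∈ S (proj₁ (∧-true {elem z S} (proj₁ h₁)))))) (proj₂ (∧-true {elem z S} (proj₁ h₁))))
                       (∧-intro (trans (cong (adj G w) (same z z≢x z≢y)) (proj₁ h₂)) (allF-intro (λ z' → ⇒ᵇ-intro (nb z'))))
              where
              h₁ = ∧-true {elem z S ∧ not (z == t)} h
              h₂ = ∧-true {adj G w (to ψ z)} (proj₂ h₁)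
              nb : ∀ z' → (adj T z z' ∧ elem z' (x ∷ S)) ≡ true → adj G u (to ψ' z') ≡ true
              nb z' p = trans (cong (adj G u) (same z' z'≢x z'≢y)) (⇒ᵇ-elim (allF-elim (proj₂ h₂) z') (∧-intro a z'∈))
                where
                a = proj₁ (∧-true {adj T z z'} p)
                z'≢x : z' ≢ x
                z'≢x refl = true≢false (trans (adj-sym T _ _) a) ax
                z'≢y : z' ≢ y
                z'≢y refl = true≢false (trans (adj-sym T _ _) a) ay
                z'∈ : elem z' S ≡ true
                z'∈ with elem⇒∈ (x ∷ S) (proj₂ (∧-true {adj T z z'} p))
                ... | here e  = ⊥-elim (z'≢x e)
                ... | there q = ∈⇒elem q
        en' : ∀ u w → g + (2 * Δ + 2) * length rem ≤ cnt (star u w ψ' (x ∷ S))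
        en' u w = +-cancelʳ-≤ (2 * Δ + 2) _ _ (≤-trans (≤-reflexive (e g (2 * Δ + 2) (length rem))) (≤-trans (en u w) (drop u w)))
          where
          e : ∀ g d l → g + d * l + d ≡ g + d * suc l
          e = solve-∀

  -- Lists of placed vertices, and Markov's inequality for edge weights.

  Ok-unique : ∀ {n} {par : Fin n → Fin n} {S xs} → Ok par S xs → Unique xs
  Ok-unique nil = []
  Ok-unique (place p x∉ ok) = ∉-All (Ok-fresh ok (here refl)) ∷ Ok-unique ok

  ∑-split : ∀ {n} (S xs : List (Fin n)) → (∀ z → z ∈ S ⊎ z ∈ xs) → n ≤ length S + length xs
  ∑-split {n} S xs h = begin
    n                                                    ≡⟨ sym (trans (∑-const n 1) (*-identityʳ n)) ⟩
    ∑ {n} (λ _ → 1)                                      ≤⟨ ∑-mono ptw ⟩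
    ∑ (λ z → 𝟙 (elem z S) + 𝟙 (elem z xs))               ≡⟨ ∑-+ (λ z → 𝟙 (elem z S)) _ ⟩
    cnt (λ z → elem z S) + cnt (λ z → elem z xs)         ≤⟨ cnt-elem≤ S ⟨+⟩ cnt-elem≤ xs ⟩
    length S + length xs                                 ∎
    where
    open ≤-Reasoning
    ptw : ∀ z → 1 ≤ 𝟙 (elem z S) + 𝟙 (elem z xs)
    ptw z with h z
    ... | inj₁ p rewrite ∈⇒elem p = s≤s z≤n
    ... | inj₂ p rewrite ∈⇒elem p = m≤n+m 1 _

  unique-length : ∀ {n} {xs : List (Fin n)} → Unique xs → length xs ≤ n
  unique-length {xs = xs} u = ≤-trans (≤-reflexive (sym (cnt-elem u))) (cnt≤n (λ z → elem z xs))

  unique-pre : ∀ {A : Set} (xs : List A) {ys} → Unique (xs ++ ys) → Unique xs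
  unique-pre []       u       = []
  unique-pre (x ∷ xs) (p ∷ u) = pre xs p ∷ unique-pre xs u
    where
    pre : ∀ {A : Set} {P : A → Set} (xs : List A) {ys} → All P (xs ++ ys) → All P xs
    pre []       _       = []
    pre (x ∷ xs) (p ∷ q) = p ∷ pre xs q

  sw-elem : ∀ {n} {x y : Fin n} {xs} → x ∈ xs → y ∈ xs → ∀ z → elem (sw x y z) xs ≡ elem z xs
  sw-elem {x = x} {y} {xs} x∈ y∈ z with z F.≟ x | z F.≟ y
  ... | yes refl | _        = trans (cong (λ w → elem w xs) (sw-l z y)) (trans (∈⇒elem y∈) (sym (∈⇒elem x∈)))
  ... | no _     | yes refl = trans (cong (λ w → elem w xs) (sw-r x z)) (trans (∈⇒elem x∈) (sym (∈⇒elem y∈)))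
  ... | no p     | no q     = cong (λ w → elem w xs) (sw-o p q)

  ∈-++ˡ : ∀ {A : Set} {x : A} {xs ys} → x ∈ xs → x ∈ xs ++ ys
  ∈-++ˡ (here e)  = here e
  ∈-++ˡ (there p) = there (∈-++ˡ p)

  ∈-++ʳ : ∀ {A : Set} {x : A} xs {ys} → x ∈ ys → x ∈ xs ++ ys
  ∈-++ʳ []       p = p
  ∈-++ʳ (_ ∷ xs) p = there (∈-++ʳ xs p)

  ∈-++⁻ : ∀ {A : Set} {x : A} xs {ys} → x ∈ xs ++ ys → x ∈ xs ⊎ x ∈ ys
  ∈-++⁻ []       p = inj₂ p
  ∈-++⁻ (x ∷ xs) (here e) = inj₁ (here e)
  ∈-++⁻ (x ∷ xs) (there p) with ∈-++⁻ xs p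
  ... | inj₁ q = inj₁ (there q)
  ... | inj₂ q = inj₂ q

  length-++' : ∀ {A : Set} (xs ys : List A) → length (xs ++ ys) ≡ length xs + length ys
  length-++' []       ys = refl
  length-++' (x ∷ xs) ys = cong suc (length-++' xs ys)

  -- Values above (1 + 1/κ) times the mean carry at most κ/(κ + 1) of the mass. The remaining mass,
  -- at least L/(κ + 1), is spread over entries of size at most cap, hence over many indices.
  markov : ∀ {n} (m E : Fin n → ℕ) (κ L cap : ℕ) → 1 ≤ L → ∑ m ≡ L → (∀ b → m b ≤ cap) →
           L ≤ cap * suc κ * cnt (λ b → (1 Data.Nat.≤ᵇ m b) ∧ (κ * (L * E b) Data.Nat.≤ᵇ suc κ * ∑ (λ b → m b * E b)))
  markov {n} m E κ L cap 0<L ∑m m≤ = begin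
    L                                             ≤⟨ light (∑ (λ b → m b * E b)) refl ⟩
    suc κ * ∑ (λ b → m b * 𝟙 (ok b))              ≤⟨ suc κ ⊛ ∑-mono ptw ⟩
    suc κ * ∑ (λ b → cap * 𝟙 (good b))            ≡⟨ cong (suc κ *_) (∑-*ˡ cap _) ⟩
    suc κ * (cap * cnt good)                      ≡⟨ e (suc κ) cap (cnt good) ⟩
    cap * suc κ * cnt good                        ∎
    where
    open ≤-Reasoning
    EE₀ = ∑ (λ b → m b * E b)
    ok good : _ → Bool
    ok b = κ * (L * E b) Data.Nat.≤ᵇ suc κ * EE₀
    good b = (1 Data.Nat.≤ᵇ m b) ∧ ok b
    e : ∀ a b c → a * (b * c) ≡ b * a * c
    e = solve-∀
    ptw : ∀ b → m b * 𝟙 (ok b) ≤ cap * 𝟙 (good b)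
    ptw b with m b in eq | ok b
    ... | zero  | _     = z≤n
    ... | suc j | false = ≤-trans (≤-reflexive (*-zeroʳ (suc j))) z≤n
    ... | suc j | true  = subst (_≤ cap) eq (m≤ b) ⟨*⟩ ≤-refl
    Bad : ℕ
    Bad = ∑ (λ b → m b * 𝟙 (not (ok b)))
    heavy : Bad * suc (suc κ * EE₀) ≤ κ * L * EE₀
    heavy = begin
      Bad * suc (suc κ * EE₀)                                     ≡⟨ sym (∑-*ʳ _ (λ b → m b * 𝟙 (not (ok b)))) ⟩
      ∑ (λ b → m b * 𝟙 (not (ok b)) * suc (suc κ * EE₀))          ≤⟨ ∑-mono p ⟩
      ∑ (λ b → κ * L * (m b * E b))                               ≡⟨ ∑-*ˡ (κ * L) _ ⟩
      κ * L * EE₀                                                 ∎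
      where
      r : ∀ m k l e → m * (k * (l * e)) ≡ k * l * (m * e)
      r = solve-∀
      p : ∀ b → m b * 𝟙 (not (ok b)) * suc (suc κ * EE₀) ≤ κ * L * (m b * E b)
      p b with κ * (L * E b) Data.Nat.≤ᵇ suc κ * EE₀ in eq
      ... | true  = ≤-trans (≤-reflexive (cong (_* suc (suc κ * EE₀)) (*-zeroʳ (m b)))) z≤n
      ... | false = ≤-trans (≤-reflexive (cong (_* suc (suc κ * EE₀)) (*-identityʳ (m b))))
                      (≤-trans (m b ⊛ ≰⇒> (λ q → subst Data.Bool.T eq (≤⇒≤ᵇ q))) (≤-reflexive (r (m b) κ L (E b))))
    sum-total : ∑ (λ b → m b * 𝟙 (ok b)) + Bad ≡ L
    sum-total = trans (sym (∑-+ (λ b → m b * 𝟙 (ok b)) _)) (trans (∑-cong (λ b → trans (sym (*-distribˡ-+ (m b) _ _)) (trans (cong (m b *_) (𝟙-not (ok b))) (*-identityʳ _)))) ∑m)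
    bad≤ : ∀ x → EE₀ ≡ x → suc κ * Bad ≤ κ * L
    -- For mean 0 there is nothing to cancel by, but then `heavy` leaves no bad mass at all.
    bad≤ zero    eq = ≤-trans (≤-reflexive (cong (suc κ *_) B0)) (≤-trans (≤-reflexive (*-zeroʳ (suc κ))) z≤n)
      where
      B0 : Bad ≡ 0
      B0 = n≤0⇒n≡0 (begin
        Bad                          ≡⟨ sym (*-identityʳ Bad) ⟩
        Bad * 1                      ≤⟨ Bad ⊛ s≤s z≤n ⟩
        Bad * suc (suc κ * EE₀)      ≤⟨ heavy ⟩
        κ * L * EE₀                  ≡⟨ trans (cong (κ * L *_) eq) (*-zeroʳ (κ * L)) ⟩
        0                            ∎)
    bad≤ (suc x) eq = *-cancelʳ-≤ _ _ (suc x) (begin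
      suc κ * Bad * suc x          ≡⟨ r (suc κ) Bad (suc x) ⟩
      Bad * (suc κ * suc x)        ≤⟨ Bad ⊛ n≤1+n _ ⟩
      Bad * suc (suc κ * suc x)    ≡⟨ cong (λ z → Bad * suc (suc κ * z)) (sym eq) ⟩
      Bad * suc (suc κ * EE₀)      ≤⟨ heavy ⟩
      κ * L * EE₀                  ≡⟨ cong (κ * L *_) eq ⟩
      κ * L * suc x                ∎)
      where
      r : ∀ a b c → a * b * c ≡ b * (a * c)
      r = solve-∀
    light : ∀ x → EE₀ ≡ x → L ≤ suc κ * ∑ (λ b → m b * 𝟙 (ok b))
    light x eq = +-cancelʳ-≤ (κ * L) _ _ (begin
      L + κ * L                                              ≡⟨ cong (suc κ *_) (sym sum-total) ⟩
      suc κ * (∑ (λ b → m b * 𝟙 (ok b)) + Bad)               ≡⟨ *-distribˡ-+ (suc κ) _ Bad ⟩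
      suc κ * ∑ (λ b → m b * 𝟙 (ok b)) + suc κ * Bad         ≤⟨ ≤-refl {suc κ * ∑ (λ b → m b * 𝟙 (ok b))} ⟨+⟩ bad≤ x eq ⟩
      suc κ * ∑ (λ b → m b * 𝟙 (ok b)) + κ * L               ∎)

  -- Conditional expectations: placing one block.

  -- Images are chosen one vertex at a time while the conditional expectation of F stays under control.
  module Steering {n} (G : Graph n) (par : Fin n → Fin n) (g κ M L cap : ℕ) (Good : Bij n → Set) (S block rest : List (Fin n))
                  (U : Fin n → Bool) (m : Fin n → Fin n → ℕ) (m-sym : ∀ a b → m a b ≡ m b a) (m-row : ∀ a → ∑ (m a) ≡ 𝟙 (U a) * L)
                  (m-cap : ∀ a b → m a b ≤ cap) (m-adj : ∀ a d → 1 ≤ m a d → U d ≡ true × adj G d a ≡ true)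
                  (0<L : 1 ≤ L) (0<cap : 1 ≤ cap) (enough : cap * suc κ * (g + M) ≤ L) (size : length block ≤ M)
                  (S∉rem : ∀ {x} → x ∈ S → x ∉ block ++ rest) (ψ : Fin n → Fin n)
                  (F : (Fin n → Fin n) → ℕ) (F-local : ∀ χ χ' → (∀ x → x ∈ block → χ x ≡ χ' x) → F χ ≡ F χ') where

    open Strategy g Good
    module RW = RandomWalk m U L m-sym m-row
    open RW using (EE)

    rem : List (Fin n)
    rem = block ++ rest

    -- P is the part of the block already placed, `xs'` the part to come. `U` remains the set of
    -- images of all of `rem`, those of P included: exchanges only permute it, so the walk keeps its
    -- weights throughout the block.
    record Mid (P xs' : List (Fin n)) (χ : Bij n) : Set where
      field
        mU    : ∀ x → U (to χ x) ≡ elem x rem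
        mS    : ∀ x → x ∈ S → to χ x ≡ ψ x
        mP    : ∀ x → x ∈ P → x ∈ rem
        mOk   : Ok par P xs'
        mOkG  : Ok par (P ++ S) (xs' ++ rest)
        mUniq : Unique (P ++ S)
        mEdge : ∀ x → x ∈ P → adj G (to χ x) (to χ (par x)) ≡ true
        mPar  : ∀ x → x ∈ P → par x ∈ P ++ S
        mMem  : ∀ x → x ∈ block → x ∈ P ⊎ x ∈ xs'
        mMem' : ∀ x → x ∈ P ⊎ x ∈ xs' → x ∈ block
        mSum  : ∀ (q : Fin n → ℕ) → sumL q P + sumL q xs' ≡ sumL q block

    ∈rem : ∀ (χ : Bij n) → (∀ x → U (to χ x) ≡ elem x rem) → ∀ y → U (to χ y) ≡ true → y ∈ rem
    ∈rem χ h y u = elem⇒∈ rem (trans (sym (h y)) u)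

    advance : ∀ {P x xs' χ} → Mid P (x ∷ xs') χ → ∀ y → y ∈ rem → y ∉ P → adj G (to χ y) (to χ (par x)) ≡ true →
              Mid (x ∷ P) xs' (swapB χ x y)
    advance {P} {x} {xs'} {χ} mid y y∈ y∉P ay with Mid.mOk mid | Mid.mOkG mid
    ... | place px∈ x∉ ok₁ | place px∈' x∉' ok₂ = record
      { mU = λ z → trans (mU (sw x y z)) (sw-elem x∈rem y∈ z)
      ; mS = λ z z∈ → trans (same z (λ { refl → S∉rem z∈ x∈rem }) (λ { refl → S∉rem z∈ y∈ })) (mS z z∈)
      ; mP = λ { z (here refl) → x∈rem ; z (there p) → mP z p }
      ; mOk = ok₁ ; mOkG = ok₂
      ; mUniq = ∉-All x∉' ∷ mUniq
      ; mEdge = edge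
      ; mPar = λ { z (here refl) → there px∈' ; z (there p) → there (mPar z p) }
      ; mMem = λ z z∈ → case mMem z z∈ of λ { (inj₁ p) → inj₁ (there p) ; (inj₂ (here e)) → inj₁ (here e) ; (inj₂ (there p)) → inj₂ p }
      ; mMem' = λ { z (inj₁ (here e)) → mMem' z (inj₂ (here e)) ; z (inj₁ (there p)) → mMem' z (inj₁ p) ; z (inj₂ p) → mMem' z (inj₂ (there p)) }
      ; mSum = λ q → trans (r (q x) (sumL q P) (sumL q xs')) (mSum q) }
      where
      open Mid mid
      x∈rem : x ∈ rem
      x∈rem = ∈-++ˡ (mMem' x (inj₂ (here refl)))
      r : ∀ a b c → a + b + c ≡ b + (a + c)
      r = solve-∀
      same : ∀ z → z ≢ x → z ≢ y → to (swapB χ x y) z ≡ to χ z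
      same z p q = cong (to χ) (sw-o p q)
      edge : ∀ z → z ∈ x ∷ P → adj G (to (swapB χ x y) z) (to (swapB χ x y) (par z)) ≡ true
      edge z (here refl) = trans (cong₂ (adj G) (cong (to χ) (sw-l z y)) (same (par z) (λ e → x∉ (subst (_∈ P) e px∈)) (λ e → y∉P (subst (_∈ P) e px∈)))) ay
      edge z (there z∈) = trans (cong₂ (adj G) (same z (λ { refl → x∉ z∈ }) (λ { refl → y∉P z∈ })) (same (par z) pz≢x pz≢y)) (mEdge z z∈)
        where
        pz≢x : par z ≢ x
        pz≢x e = x∉' (subst (_∈ P ++ S) e (mPar z z∈))
        pz≢y : par z ≢ y
        pz≢y e with ∈-++⁻ P (mPar z z∈)
        ... | inj₁ p = y∉P (subst (_∈ P) e p)
        ... | inj₂ p = S∉rem (subst (_∈ S) e p) y∈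

    -- The root of a block is exceptional: its parent lies in S with an image outside `U`, where the
    -- walk has no transitions.
    first : ∀ {ρ xs χ} → block ≡ ρ ∷ xs → (∀ x → U (to χ x) ≡ elem x rem) → (∀ x → x ∈ S → to χ x ≡ ψ x) → Unique S →
            Ok par (ρ ∷ []) xs → Ok par S (ρ ∷ xs ++ rest) → ∀ y → y ∈ rem → adj G (to χ y) (to χ (par ρ)) ≡ true →
            Mid (ρ ∷ []) xs (swapB χ ρ y)
    first {ρ} {xs} {χ} refl mU mS uniq okL (place pρ∈ ρ∉ ok) y y∈ ay = record
      { mU = λ z → trans (mU (sw ρ y z)) (sw-elem (here refl) y∈ z)
      ; mS = λ z z∈ → trans (same z∈) (mS z z∈)
      ; mP = λ { z (here refl) → here refl }
      ; mOk = okL ; mOkG = ok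
      ; mUniq = ∉-All ρ∉ ∷ uniq
      ; mEdge = λ { z (here refl) → trans (cong₂ (adj G) (cong (to χ) (sw-l z y)) (same pρ∈)) ay }
      ; mPar = λ { z (here refl) → there pρ∈ }
      ; mMem = λ { z (here e) → inj₁ (here e) ; z (there p) → inj₂ p }
      ; mMem' = λ { z (inj₁ (here e)) → here e ; z (inj₂ p) → there p }
      ; mSum = λ q → cong (_+ sumL q xs) (+-identityʳ (q ρ)) }
      where
      same : ∀ {z} → z ∈ S → to (swapB χ ρ y) z ≡ to χ z
      same z∈ = cong (to χ) (sw-o (λ { refl → ρ∉ z∈ }) (λ { refl → S∉rem z∈ y∈ }))

    -- Each choice may raise the conditional expectation by a factor 1 + 1/κ; `c₁` and `c₂` collect
    -- the powers of κ and κ + 1. When the block is exhausted, the expectation is the value of F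
    -- itself.
    steer : ∀ xs' {P χ} c₁ c₂ → Mid P xs' χ → (∀ x → x ∈ P → U (to χ x) ≡ true) → length P + length xs' ≡ length block →
            EE par xs' (to χ) F * c₁ ≤ L ^ length xs' * c₂ →
            (∀ {P χ} → Mid P [] χ → F (to χ) * (κ ^ length xs' * c₁) ≤ suc κ ^ length xs' * c₂ → Strat rest χ) →
            Strat (xs' ++ rest) χ
    steer [] {P} {χ} c₁ c₂ mid env len h kont = kont mid (≤-trans (≤-reflexive (cong (F (to χ) *_) (*-identityˡ c₁))) h)
    steer (x ∷ xs') {P} {χ} c₁ c₂ mid env len h kont = play {x} {xs' ++ rest} {χ} O O≥ next
      where
      open Mid mid
      a = to χ (par x)
      E' : Fin n → ℕ
      E' d = EE par xs' (to χ [ x ≔ d ]) F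
      good O : Fin n → Bool
      good d = (1 Data.Nat.≤ᵇ m a d) ∧ (κ * (L * E' d) Data.Nat.≤ᵇ suc κ * ∑ (λ d → m a d * E' d))
      -- The walk may return to images already used in this block. At most M are excluded here,
      -- which is why g + M good images are required.
      O y = good (to χ y) ∧ not (elem y P)
      px∈ : par x ∈ P
      px∈ with mOk
      ... | place p _ _ = p
      |P|≤M : length P ≤ M
      |P|≤M = ≤-trans (≤-trans (m≤m+n _ _) (≤-reflexive len)) size
      good≥ : g + M ≤ cnt good
      good≥ = cancelˡ {cap * suc κ} (*-pos 0<cap (s≤s z≤n))
        (≤-trans enough (markov (m a) E' κ L cap 0<L (RW.row-L (env (par x) px∈)) (m-cap a)))
      O≥ : g ≤ cnt O
      O≥ = +-cancelʳ-≤ M g _ (begin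
        g + M                                          ≤⟨ good≥ ⟩
        cnt good                                       ≡⟨ sym (∑-to χ (λ d → 𝟙 (good d))) ⟩
        ∑ (λ y → 𝟙 (good (to χ y)))                    ≤⟨ ∑-mono (λ y → p (good (to χ y)) (elem y P)) ⟩
        ∑ (λ y → 𝟙 (O y) + 𝟙 (elem y P))               ≡⟨ ∑-+ (λ y → 𝟙 (O y)) _ ⟩
        cnt O + cnt (λ y → elem y P)                   ≤⟨ ≤-refl {cnt O} ⟨+⟩ ≤-trans (cnt-elem≤ P) |P|≤M ⟩
        cnt O + M                                      ∎)
        where
        open ≤-Reasoning
        p : ∀ u e → 𝟙 u ≤ 𝟙 (u ∧ not e) + 𝟙 e
        p true true = ≤-refl
        p true false = ≤-refl
        p false _ = z≤n
      next : ∀ y → O y ≡ true → Strat (xs' ++ rest) (swapB χ x y)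
      next y o = steer xs' (κ * c₁) (suc κ * c₂) mid' env' (trans (sym (+-suc (length P) (length xs'))) len) h'
                   (λ {P'} {χ″} m' q → kont m' (≤-trans (≤-reflexive (cong (F (to χ″) *_) (r₁ κ (κ ^ length xs') c₁))) (≤-trans q (≤-reflexive (r₂ (suc κ) (suc κ ^ length xs') c₂)))))
        where
        r₁ : ∀ a b c → a * b * c ≡ b * (a * c)
        r₁ = solve-∀
        r₂ : ∀ a b c → b * (a * c) ≡ a * b * c
        r₂ = solve-∀
        d = to χ y
        o₁ = ∧-true {good d} o
        o₂ = ∧-true {1 Data.Nat.≤ᵇ m a d} (proj₁ o₁)
        Ud×adj : U d ≡ true × adj G d a ≡ true
        Ud×adj = m-adj a d (≤ᵇ-true (proj₁ o₂))
        y∈ : y ∈ rem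
        y∈ = ∈rem χ mU y (proj₁ Ud×adj)
        y∉P : y ∉ P
        y∉P = elem-false (not-true (proj₂ o₁))
        χ' = swapB χ x y
        mid' : Mid (x ∷ P) xs' χ'
        mid' = advance mid y y∈ y∉P (proj₂ Ud×adj)
        env' : ∀ z → z ∈ x ∷ P → U (to χ' z) ≡ true
        env' z z∈ = trans (Mid.mU mid' z) (∈⇒elem (Mid.mP mid' z z∈))
        x∉P : x ∉ P
        x∉P with mOk
        ... | place _ q _ = q
        agree : ∀ z → z ∈ x ∷ P → to χ' z ≡ (to χ [ x ≔ d ]) z
        agree z (here refl) = trans (cong (to χ) (sw-l x y)) (sym (≔-same (to χ) x))
        agree z (there q) = trans (cong (to χ) (sw-o (λ { refl → x∉P q }) (λ { refl → y∉P q }))) (sym (≔-other (to χ) (λ { refl → x∉P q })))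
        -- The exchange and the mere update at x agree on the placed vertices; the image of y is
        -- either overwritten later or never read.
        E≡ : EE par xs' (to χ') F ≡ E' d
        E≡ = RW.EE-local xs' (Mid.mOk mid') agree (λ χ χ' ag → F-local χ χ' (λ x x∈ → ag x (Mid.mMem mid' x x∈)))
        h' : EE par xs' (to χ') F * (κ * c₁) ≤ L ^ length xs' * (suc κ * c₂)
        h' = cancelˡ {L} 0<L (begin
          L * (EE par xs' (to χ') F * (κ * c₁))    ≡⟨ cong (λ e → L * (e * (κ * c₁))) E≡ ⟩
          L * (E' d * (κ * c₁))                     ≡⟨ e₁ L (E' d) κ c₁ ⟩
          κ * (L * E' d) * c₁                       ≤⟨ ≤ᵇ-true {κ * (L * E' d)} {suc κ * ∑ (λ d → m a d * E' d)} (proj₂ o₂) ⟨*⟩ ≤-refl {c₁} ⟩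
          suc κ * EE par (x ∷ xs') (to χ) F * c₁   ≡⟨ *-assoc (suc κ) (EE par (x ∷ xs') (to χ) F) c₁ ⟩
          suc κ * (EE par (x ∷ xs') (to χ) F * c₁) ≤⟨ suc κ ⊛ h ⟩
          suc κ * (L * L ^ length xs' * c₂)         ≡⟨ e₂ (suc κ) L (L ^ length xs') c₂ ⟩
          L * (L ^ length xs' * (suc κ * c₂))       ∎)
          where
          open ≤-Reasoning
          e₁ : ∀ l e k c → l * (e * (k * c)) ≡ k * (l * e) * c
          e₁ = solve-∀
          e₂ : ∀ k l p c → k * (l * p * c) ≡ l * (p * (k * c))
          e₂ = solve-∀

  -- The expected potential after one block.

  record Mean (A : Set) : Set where
    field
      E       : (A → ℕ) → ℕ
      mass    : ℕ
      E-mono  : ∀ {F H} → (∀ χ → F χ ≤ H χ) → E F ≤ E H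
      E-*     : ∀ c F → E (λ χ → c * F χ) ≡ c * E F
      E-+     : ∀ F H → E (λ χ → F χ + H χ) ≡ E F + E H
      E-const : ∀ c → E (λ _ → c) ≡ mass * c

    E-sumL : ∀ {B : Set} (F : B → A → ℕ) ys → E (λ χ → sumL (λ y → F y χ) ys) ≡ sumL (λ y → E (F y)) ys
    E-sumL F []       = trans (E-const 0) (*-zeroʳ mass)
    E-sumL F (y ∷ ys) = trans (E-+ (F y) _) (cong (E (F y) +_) (E-sumL F ys))

    E-𝟙≤ : ∀ (p : A → Bool) → E (λ χ → 𝟙 (p χ)) ≤ mass
    E-𝟙≤ p = ≤-trans (E-mono (λ χ → 𝟙≤1 (p χ))) (≤-reflexive (trans (E-const 1) (*-identityʳ mass)))

  module _ {A : Set} (μ : Mean A) {b Q : ℕ} (0<b : 1 ≤ b) where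
    open Mean μ
    open Weight b Q 0<b

    -- A deep x passes p with probability about r/q, so the test has no drift; shallow x are paid for by the factor with exponent s.
    test-mean : ∀ {B : Set} (block : List B) {deep : B → Bool} {f s} → length block ≡ f → sumL (λ x → 𝟙 (not (deep x))) block ≡ s →
                ∀ (p : B → A → Bool) z c M q r P₀ Q₀ → 1 ≤ z → c * M ≤ b → f ≤ M → q ≤ c → 3 * z * r * (c * M) ≤ b → P₀ + q * f ≤ Q →
                (∀ x → x ∈ block → deep x ≡ true → 3 * z * q * E (λ χ → 𝟙 (p x χ)) ≤ mass * (3 * z * r + 1)) →
                E (λ χ → wt ((P₀ + q * sumL (λ x → 𝟙 (p x χ)) block) ∸ (Q₀ + r * f))) * ((z * b) ^ f * b ^ (2 * (c * s))) ≤
                mass * (b ^ Q * ((z * b) ^ f * b ^ (2 * (c * s))) + wt (P₀ ∸ Q₀) * (suc (z * b) ^ f * suc b ^ (2 * (c * s))))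
    test-mean block {deep} {f} {s} |block| |shallow| p z c M q r P₀ Q₀ 0<z X≤b size q≤c hr hQ hdeep =
      wt-mean z (r * f) f (c * s) (c * M) (P₀ ∸ Q₀) mass (E (λ χ → q * Z χ)) (E (λ χ → wt (y' χ))) 0<z X≤b hR hx hw
      where
      open ≤-Reasoning
      Z y' : A → ℕ
      Z χ = sumL (λ x → 𝟙 (p x χ)) block
      y' χ = (P₀ + q * Z χ) ∸ (Q₀ + r * f)
      Z≤f : ∀ χ → Z χ ≤ f
      Z≤f χ = ≤-trans (sumL-≤const 1 block (λ x → 𝟙≤1 (p x χ))) (≤-reflexive (trans (*-identityʳ _) |block|))
      hR : 3 * z * (r * f) * (c * M) ≤ b * f
      hR = ≤-trans (≤-reflexive (e z r f (c * M))) (hr ⟨*⟩ ≤-refl)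
        where
        e : ∀ z r f x → 3 * z * (r * f) * x ≡ 3 * z * r * x * f
        e = solve-∀
      one : ∀ x → x ∈ block → 3 * z * q * E (λ χ → 𝟙 (p x χ)) ≤ mass * (3 * z * r + 1) + mass * (3 * z * c) * 𝟙 (not (deep x))
      one x x∈ with deep x in eq
      ... | false = ≤-trans (((3 * z) ⊛ q≤c) ⟨*⟩ E-𝟙≤ (p x)) (≤-trans (≤-reflexive (e z c mass)) (m≤n+m _ _))
        where
        e : ∀ z c t → 3 * z * c * t ≡ t * (3 * z * c) * 1
        e = solve-∀
      ... | true  = ≤-trans (hdeep x x∈ eq) (m≤m+n _ _)
      hx : 3 * z * E (λ χ → q * Z χ) ≤ mass * (3 * z * (r * f) + f + 3 * z * (c * s))
      hx = begin
        3 * z * E (λ χ → q * Z χ)                                   ≡⟨ cong (3 * z *_) (E-* q Z) ⟩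
        3 * z * (q * E Z)                                           ≡⟨ sym (*-assoc (3 * z) q (E Z)) ⟩
        3 * z * q * E Z                                             ≡⟨ cong (3 * z * q *_) (E-sumL (λ x χ → 𝟙 (p x χ)) block) ⟩
        3 * z * q * sumL (λ x → E (λ χ → 𝟙 (p x χ))) block          ≡⟨ sym (sumL-*ˡ (3 * z * q) _ block) ⟩
        sumL (λ x → 3 * z * q * E (λ χ → 𝟙 (p x χ))) block          ≤⟨ sumL-mono block one ⟩
        sumL (λ x → mass * (3 * z * r + 1) + mass * (3 * z * c) * 𝟙 (not (deep x))) block
          ≡⟨ trans (sumL-+ (λ _ → mass * (3 * z * r + 1)) _ block) (cong₂ _+_ (trans (sumL-const (mass * (3 * z * r + 1)) block) (cong (_* (mass * (3 * z * r + 1))) |block|)) (trans (sumL-*ˡ (mass * (3 * z * c)) _ block) (cong (mass * (3 * z * c) *_) |shallow|))) ⟩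
        f * (mass * (3 * z * r + 1)) + mass * (3 * z * c) * s       ≡⟨ e f mass z r c s ⟩
        mass * (3 * z * (r * f) + f + 3 * z * (c * s))              ∎
        where
        e : ∀ f T z r c s → f * (T * (3 * z * r + 1)) + T * (3 * z * c) * s ≡ T * (3 * z * (r * f) + f + 3 * z * (c * s))
        e = solve-∀
      w₀ pR pR⁺ α β : ℕ
      w₀ = wt (P₀ ∸ Q₀)
      pR = b ^ (r * f)
      pR⁺ = suc b ^ (r * f)
      α = w₀ * pR * (b + c * M)
      β = w₀ * pR * (b * b) + b ^ Q * (pR⁺ * (b * b))
      pointwise : ∀ χ → pR⁺ * (b * b) * wt (y' χ) ≤ α * (q * Z χ) + β
      pointwise χ = begin
        pR⁺ * (b * b) * wt (y' χ)     ≡⟨ *-comm (pR⁺ * (b * b)) (wt (y' χ)) ⟩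
        wt (y' χ) * (pR⁺ * (b * b))   ≤⟨ wt-step P₀ Q₀ (q * Z χ) (r * f) (c * M) (≤-trans (m∸n≤m P₀ Q₀) (≤-trans (m≤m+n P₀ _) hQ))
                                           (≤-trans (m∸n≤m (P₀ + q * Z χ) (Q₀ + r * f)) (≤-trans (≤-refl {P₀} ⟨+⟩ q ⊛ Z≤f χ) hQ))
                                           (q≤c ⟨*⟩ ≤-trans (Z≤f χ) size) X≤b ⟩
        w₀ * (pR * (b * b + q * Z χ * (b + c * M))) + b ^ Q * (pR⁺ * (b * b))
          ≡⟨ e w₀ pR (b * b) (q * Z χ) (b + c * M) (b ^ Q * (pR⁺ * (b * b))) ⟩
        α * (q * Z χ) + β ∎
        where
        e : ∀ w p b x y o → w * (p * (b + x * y)) + o ≡ w * p * y * x + (w * p * b + o)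
        e = solve-∀
      hw : E (λ χ → wt (y' χ)) * (pR⁺ * (b * b)) ≤
           w₀ * (pR * (b * b * mass + E (λ χ → q * Z χ) * (b + c * M))) + mass * (b ^ Q * (pR⁺ * (b * b)))
      hw = begin
        E (λ χ → wt (y' χ)) * (pR⁺ * (b * b))           ≡⟨ *-comm (E (λ χ → wt (y' χ))) (pR⁺ * (b * b)) ⟩
        pR⁺ * (b * b) * E (λ χ → wt (y' χ))             ≡⟨ sym (E-* (pR⁺ * (b * b)) (λ χ → wt (y' χ))) ⟩
        E (λ χ → pR⁺ * (b * b) * wt (y' χ))             ≤⟨ E-mono pointwise ⟩
        E (λ χ → α * (q * Z χ) + β)                     ≡⟨ E-+ (λ χ → α * (q * Z χ)) (λ _ → β) ⟩
        E (λ χ → α * (q * Z χ)) + E (λ _ → β)           ≡⟨ cong₂ _+_ (E-* α (λ χ → q * Z χ)) (E-const β) ⟩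
        α * E (λ χ → q * Z χ) + mass * β                ≡⟨ e w₀ pR (b + c * M) (E (λ χ → q * Z χ)) mass (b * b) (b ^ Q * (pR⁺ * (b * b))) ⟩
        w₀ * (pR * (b * b * mass + E (λ χ → q * Z χ) * (b + c * M))) + mass * (b ^ Q * (pR⁺ * (b * b))) ∎
        where
        e : ∀ w p y E T b o → w * p * y * E + T * (w * p * b + o) ≡ w * (p * (b * T + E * y)) + T * o
        e = solve-∀

  double-sum : ∀ {n} (A a : Fin n → Fin n → ℕ) U₁ U₂ T β → (∀ u w → A u w * U₁ ≤ T * (2 * β * U₁ + a u w * U₂)) →
               ∑ (λ u → ∑ (A u)) * U₁ ≤ T * (2 * n * n * β * U₁ + ∑ (λ u → ∑ (a u)) * U₂)
  double-sum {n} A a U₁ U₂ T β h = begin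
    ∑ (λ u → ∑ (A u)) * U₁                                    ≡⟨ trans (sym (∑-*ʳ U₁ _)) (∑-cong (λ u → sym (∑-*ʳ U₁ (A u)))) ⟩
    ∑ (λ u → ∑ (λ w → A u w * U₁))                            ≤⟨ ∑-mono (λ u → ∑-mono (h u)) ⟩
    ∑ (λ u → ∑ (λ w → T * (2 * β * U₁ + a u w * U₂)))         ≡⟨ ∑-cong (λ u → trans (∑-*ˡ T _) (cong (T *_) (trans (∑-+ (λ _ → 2 * β * U₁) _) (cong₂ _+_ (∑-const n _) (∑-*ʳ U₂ (a u)))))) ⟩
    ∑ (λ u → T * (n * (2 * β * U₁) + ∑ (a u) * U₂))           ≡⟨ trans (∑-*ˡ T _) (cong (T *_) (trans (∑-+ (λ _ → n * (2 * β * U₁)) _) (cong₂ _+_ (∑-const n _) (∑-*ʳ U₂ (λ u → ∑ (a u)))))) ⟩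
    T * (n * (n * (2 * β * U₁)) + ∑ (λ u → ∑ (a u)) * U₂)     ≡⟨ cong (λ z → T * (z + ∑ (λ u → ∑ (a u)) * U₂)) (e n β U₁) ⟩
    T * (2 * n * n * β * U₁ + ∑ (λ u → ∑ (a u)) * U₂)         ∎
    where
    open ≤-Reasoning
    e : ∀ n β u → n * (n * (2 * β * u)) ≡ 2 * n * n * β * u
    e = solve-∀

  -- One block of f = 1 + l vertices, s of them shallow, turns the potential bound for e vertices into the one for f + e.
  pot-step : ∀ {Φ' Φ₀ κ b B K l c s e S₀} →
             Φ' * (κ ^ l * (κ ^ suc l * b ^ (2 * (c * s)))) ≤
               suc κ ^ l * (K * B * (κ ^ suc l * b ^ (2 * (c * s))) + Φ₀ * (suc κ ^ suc l * suc b ^ (2 * (c * s)))) →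
             Φ₀ * (κ ^ (2 * e) * b ^ (2 * (c * S₀))) ≤ K * suc e * (suc κ ^ (2 * e) * suc b ^ (2 * (c * S₀))) * B →
             Φ' * (κ ^ (2 * (suc l + e)) * b ^ (2 * (c * (s + S₀)))) ≤
               K * suc (suc l + e) * (suc κ ^ (2 * (suc l + e)) * suc b ^ (2 * (c * (s + S₀)))) * B
  pot-step {Φ'} {Φ₀} {κ} {b} {B} {K} {l} {c} {s} {e} {S₀} h pot = begin
    Φ' * (κ ^ (2 * (suc l + e)) * b ^ (2 * (c * (s + S₀))))      ≡⟨ cong (Φ' *_) (split κ b) ⟩
    Φ' * (κ * x * (κ * x) * bs * (de * dS))                      ≡⟨ e₁ Φ' κ x bs (de * dS) ⟩
    Φ' * (x * (κ * x * bs)) * (κ * (de * dS))                    ≤⟨ h ⟨*⟩ ≤-refl ⟩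
    X * (K * B * (κ * x * bs) + Φ₀ * (suc κ * X * Bs)) * (κ * (de * dS))
      ≡⟨ e₂ X (K * B) (κ * x * bs) Φ₀ (suc κ * X * Bs) κ (de * dS) ⟩
    κ * X * (K * B * (κ * x * bs * (de * dS)) + suc κ * X * Bs * (Φ₀ * (de * dS)))
      ≤⟨ (n≤1+n κ ⟨*⟩ ≤-refl {X}) ⟨*⟩ ((K * B) ⊛ ((n≤1+n κ ⟨*⟩ ^-monoˡ-≤ l (n≤1+n κ)) ⟨*⟩ ^-monoˡ-≤ (2 * (c * s)) (n≤1+n b)) ⟨*⟩ (^-monoˡ-≤ (2 * e) (n≤1+n κ) ⟨*⟩ ^-monoˡ-≤ (2 * (c * S₀)) (n≤1+n b)) ⟨+⟩ (suc κ * X * Bs) ⊛ pot) ⟩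
    suc κ * X * (K * B * (suc κ * X * Bs * (nu * nS)) + suc κ * X * Bs * (K * suc e * (nu * nS) * B))
      ≡⟨ e₃ (suc κ * X) K B Bs (nu * nS) e ⟩
    K * suc (1 + e) * (suc κ * X * (suc κ * X) * Bs * (nu * nS)) * B
      ≤⟨ ((K ⊛ s≤s (s≤s (m≤n+m e l))) ⟨*⟩ ≤-refl) ⟨*⟩ ≤-refl ⟩
    K * suc (suc l + e) * (suc κ * X * (suc κ * X) * Bs * (nu * nS)) * B
      ≡⟨ cong (λ z → K * suc (suc l + e) * z * B) (sym (split (suc κ) (suc b))) ⟩
    K * suc (suc l + e) * (suc κ ^ (2 * (suc l + e)) * suc b ^ (2 * (c * (s + S₀)))) * B ∎
    where
    open ≤-Reasoning
    x = κ ^ l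
    X = suc κ ^ l
    bs = b ^ (2 * (c * s))
    Bs = suc b ^ (2 * (c * s))
    de = κ ^ (2 * e)
    nu = suc κ ^ (2 * e)
    dS = b ^ (2 * (c * S₀))
    nS = suc b ^ (2 * (c * S₀))
    split : ∀ κ b → κ ^ (2 * (suc l + e)) * b ^ (2 * (c * (s + S₀))) ≡ κ * κ ^ l * (κ * κ ^ l) * b ^ (2 * (c * s)) * (κ ^ (2 * e) * b ^ (2 * (c * S₀)))
    split κ b = trans (cong₂ _*_
        (trans (cong (κ ^_) (q l e)) (trans (^-distribˡ-+-* κ (suc l + suc l) (2 * e)) (cong (_* κ ^ (2 * e)) (^-distribˡ-+-* κ (suc l) (suc l)))))
        (trans (cong (b ^_) (q' c s S₀)) (^-distribˡ-+-* b (2 * (c * s)) (2 * (c * S₀)))))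
        (r (κ * κ ^ l * (κ * κ ^ l)) (κ ^ (2 * e)) (b ^ (2 * (c * s))) (b ^ (2 * (c * S₀))))
      where
      q : ∀ l e → 2 * (suc l + e) ≡ suc l + suc l + 2 * e
      q = solve-∀
      q' : ∀ c s S → 2 * (c * (s + S)) ≡ 2 * (c * s) + 2 * (c * S)
      q' = solve-∀
      r : ∀ a b c d → a * b * (c * d) ≡ a * c * (b * d)
      r = solve-∀
    e₁ : ∀ p k x b d → p * (k * x * (k * x) * b * d) ≡ p * (x * (k * x * b)) * (k * d)
    e₁ = solve-∀
    e₂ : ∀ X a y p Y k d → X * (a * y + p * Y) * (k * d) ≡ k * X * (a * (y * d) + Y * (p * d))
    e₂ = solve-∀
    e₃ : ∀ Y K B b n e → Y * (K * B * (Y * b * n) + Y * b * (K * suc e * n * B)) ≡ K * suc (1 + e) * (Y * Y * b * n) * B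
    e₃ = solve-∀

  -- Deep vertices have all neighbours inside the block, so their tests are decided within it; and
  -- their parents lie at least 2h steps below ρ, where positions are nearly uniform.
  record Block {n} {T : Graph n} {t : Fin n} (R : Rooted T t) (deep : Fin n → Bool) (h M : ℕ) (ρ : Fin n) (xs : List (Fin n)) : Set where
    open Rooted R
    field
      local-ok   : Ok par (ρ ∷ []) xs
      root       : deep ρ ≡ false
      deep-path  : ∀ y → y ∈ xs → deep y ≡ true → ∃ λ i → Path par xs ρ (2 * h + i) (par y)
      deep-child : ∀ y → y ∈ xs → deep y ≡ true → ∀ c → c ≢ t → par c ≡ y → c ∈ xs
      size       : suc (length xs) ≤ M

  module Tests {n} (G T : Graph n) (deep : Fin n → Bool) where

    -- Shallow vertices are declared bad outright, so that the verdict on a vertex never depends on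
    -- images outside its own block.
    bad : Fin n → Fin n → (Fin n → Fin n) → Fin n → Bool
    bad u w χ y = not (deep y ∧ (adj G w (χ y) ∧ allF (λ x → adj T y x ⇒ᵇ adj G u (χ x))))

    hits : (Fin n → Fin n) → List (Fin n) → Fin n → ℕ
    hits χ xs w = sumL (λ x → 𝟙 (adj G w (χ x))) xs

    bads : (Fin n → Fin n) → List (Fin n) → Fin n → Fin n → ℕ
    bads χ xs u w = sumL (λ x → 𝟙 (bad u w χ x)) xs

    shallow : List (Fin n) → ℕ
    shallow = sumL (λ y → 𝟙 (not (deep y)))

    bads≤ : ∀ χ xs u w → bads χ xs u w ≤ length xs
    bads≤ χ xs u w = ≤-trans (sumL-≤const 1 xs (λ x → 𝟙≤1 (bad u w χ x))) (≤-reflexive (*-identityʳ _))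

    hits≤ : ∀ χ xs w → hits χ xs w ≤ length xs
    hits≤ χ xs w = ≤-trans (sumL-≤const 1 xs (λ x → 𝟙≤1 (adj G w (χ x)))) (≤-reflexive (*-identityʳ _))

    bad-cong : ∀ u w {χ χ' : Fin n → Fin n} y → χ y ≡ χ' y → (deep y ≡ true → ∀ x → adj T y x ≡ true → χ x ≡ χ' x) → bad u w χ y ≡ bad u w χ' y
    bad-cong u w {χ} {χ'} y e nb = byCase (deep y) refl
      where
      bool-ext : ∀ {a b} → (a ≡ true → b ≡ true) → (b ≡ true → a ≡ true) → a ≡ b
      bool-ext {true}  {true}  _ _ = refl
      bool-ext {true}  {false} p _ = sym (p refl)
      bool-ext {false} {true}  _ q = q refl
      bool-ext {false} {false} _ _ = refl
      sub : ∀ χ χ' → (∀ x → adj T y x ≡ true → χ' x ≡ χ x) →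
            allF (λ x → adj T y x ⇒ᵇ adj G u (χ x)) ≡ true → allF (λ x → adj T y x ⇒ᵇ adj G u (χ' x)) ≡ true
      sub χ χ' ag p = allF-intro (λ x → ⇒ᵇ-intro (λ a → trans (cong (adj G u) (ag x a)) (⇒ᵇ-elim (allF-elim p x) a)))
      byCase : ∀ d → deep y ≡ d → bad u w χ y ≡ bad u w χ' y
      byCase false d rewrite d = refl
      byCase true  d = cong (λ r → not (deep y ∧ r)) (cong₂ _∧_ (cong (adj G w) e)
        (bool-ext (sub χ χ' (λ x a → sym (nb d x a))) (sub χ' χ (nb d))))

  record Params : Set where
    field
      n k Δ h M z b g Y₀ S̄ ē : ℕ

    -- 1/`kk` is the part of the degree surplus 1/k that survives while blocks are embedded. A deep
    -- vertex is a star for a given pair (u, w) with probability at least 1/`c`. `Q` bounds all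
    -- exponents, `K` is the number of tests, and 1/ℓ is the mass of the uniform part of two steps.
    kk c X κ Q K ℓ' ℓ : ℕ
    kk = 2 * k
    c  = 2 * kk * kk * kk ^ Δ
    X  = c * M
    κ  = z * b
    Q  = (3 * k + 2 + c) * n
    K  = 2 * n * n
    ℓ' = 2 * kk * kk * kk ∸ 1
    ℓ  = suc ℓ'

  -- `hN` is what a block needs while at least n/`ē` vertices are unplaced, `hend` what the end
  -- phase needs afterwards. `hfin` says that the weight at exponent `Y₀` exceeds every budget.
  record Valid (p : Params) : Set where
    open Params p
    field
      0<k   : 1 ≤ k
      0<z   : 1 ≤ z
      0<b   : 1 ≤ b
      X≤b   : X ≤ b
      hr₁   : 3 * z * (k + 2) * X ≤ b
      hr₂   : 3 * z * c * X ≤ b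
      hmix  : 2 * (3 * z) * (2 * k) * ℓ' ^ h ≤ ℓ ^ h
      hmix' : 2 * kk * kk * ℓ' ^ h ≤ ℓ ^ h
      hfin  : K * suc n * (suc κ ^ (2 * n) * suc b ^ (2 * (c * S̄))) * b ^ Y₀ < suc b ^ Y₀ * (κ ^ (2 * n) * b ^ (2 * (c * S̄)))
      hN    : ∀ N → n ≤ ē * N → (1 ≤ N) × (2 * (3 * z) * (2 * k) * M ≤ N) × (Y₀ + 2 * k ≤ N) ×
                                (2 * g ≤ N) × ((2 + 8 * kk * kk) * suc κ * (g + M) ≤ 4 * kk * N)
      hend  : ∀ e N st → n ≤ e + N → ē * N < n → e ≤ c * st + Y₀ → g + (2 * Δ + 2) * N ≤ st

  record Setting : Set where
    field
      params : Params
    open Params params public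
    field
      valid     : Valid params
      G T       : Graph n
      t v       : Fin n
      R         : Rooted T t
      deg≤      : ∀ x → cnt (adj T x) ≤ Δ
      deep      : Fin n → Bool
      t-shallow : deep t ≡ false
      |shallow| : cnt (λ y → not (deep y)) ≤ S̄
    open Valid valid public
    open Rooted R public

  record AvgData (𝒮 : Setting) : Set where
    open Setting 𝒮
    field
      ρ     : Fin n
      xs    : List (Fin n)
      blk   : Block R deep h M ρ xs
      t∉    : t ∉ xs
      U     : Fin n → Bool
      N     : ℕ
      0<N   : 1 ≤ N
      hM    : 2 * (3 * z) * (2 * k) * M ≤ N
      |U|   : cnt U ≡ N
      D≥    : ∀ w → (k + 1) * N ≤ 2 * k * cnt (λ a → U a ∧ adj G w a)

  -- Expectations over a single block of the tree, placed into the set U of unused vertices.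
  module Averages (𝒮 : Setting) (𝒜 : AvgData 𝒮) where
    open Setting 𝒮
    open AvgData 𝒜
    open Block blk
    open Tests G T deep
    open Weight b Q 0<b

    block : List (Fin n)
    block = ρ ∷ xs

    f s : ℕ
    f = length block
    s = shallow block

    D : Fin n → ℕ
    D w = cnt (λ a → U a ∧ adj G w a)

    0<kk : 1 ≤ kk
    0<kk = *-pos {2} (s≤s z≤n) 0<k

    ℓ-eq : ℓ ≡ 2 * kk * kk * kk
    ℓ-eq = m+[n∸m]≡n (*-pos (*-pos (*-pos {2} (s≤s z≤n) 0<kk) 0<kk) 0<kk)

    2k≤c : 2 * k ≤ c
    2k≤c = ≤-trans (≤-reflexive (e kk)) (((s≤s {0} {1} z≤n ⟨*⟩ ≤-refl {kk}) ⟨*⟩ 0<kk) ⟨*⟩ ^-pos Δ 0<kk)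
      where
      e : ∀ x → x ≡ 1 * x * 1 * 1
      e = solve-∀

    0<c : 1 ≤ c
    0<c = ≤-trans 0<kk 2k≤c

    -- The surplus guaranteed inside `U` is only 1/(2k) = 1/`kk`; hence the walk is run with `kk` in
    -- place of k.
    D≥' : ∀ w → (kk + 2) * N ≤ 2 * kk * D w
    D≥' w = certify (2 ⊛ D≥ w) 0 (e k N (D w))
      where
      e : ∀ k N D → (2 * k + 2) * N + 2 * (2 * k * D) + 0 ≡ 2 * (2 * k) * D + 2 * ((k + 1) * N)
      e = solve-∀

    A : Fin n → Fin n → Bool
    A a c' = (U a ∧ U c') ∧ adj G a c'

    A-sym : ∀ a c' → A a c' ≡ A c' a
    A-sym a c' = cong₂ _∧_ (∧-comm (U a) (U c')) (adj-sym G a c')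

    A⇒U : ∀ a c' → A a c' ≡ true → U a ≡ true
    A⇒U a c' h = proj₁ (∧-true {U a} (proj₁ (∧-true {U a ∧ U c'} h)))

    cntA : ∀ a → U a ≡ true → cnt (A a) ≡ D a
    cntA a h = ∑-cong (λ c' → cong (λ u → 𝟙 ((u ∧ U c') ∧ adj G a c')) h)

    reg : Regular A U (4 * kk * N) (2 + 8 * kk * kk)
    reg = regular A A-sym U A⇒U kk N 0<kk 0<N |U| (λ a h → ≤-trans (D≥' a) (≤-reflexive (cong (2 * kk *_) (sym (cntA a h)))))

    open Regular reg public

    L : ℕ
    L = 4 * kk * N

    open RandomWalk m U L m-sym m-row

    0<L : 1 ≤ L
    0<L = *-pos (*-pos {4} (s≤s z≤n) 0<kk) 0<N

    ratio : 8 * N * N * ℓ ≡ kk * (L * L)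
    ratio = trans (cong (8 * N * N *_) ℓ-eq) (e kk N)
      where
      e : ∀ k N → 8 * N * N * (2 * k * k * k) ≡ k * (4 * k * N * (4 * k * N))
      e = solve-∀

    -- Two sets of (1/2 + 1/`kk`)N neighbours share at least 2N/`kk` vertices, and each common
    -- neighbour contributes at least 2 · 2 because every edge weighs at least 2.
    two-step : ∀ a d → U a ≡ true → U d ≡ true → 8 * N ≤ kk * ∑ (λ b → m a b * m b d)
    two-step a d Ua Ud = cancelˡ {2} (s≤s z≤n) (certify (4 ⊛ D≥' a ⟨+⟩ 4 ⊛ D≥' d ⟨+⟩ (8 * kk) ⊛ meet ⟨+⟩ (2 * kk) ⊛ weigh) 0 (e kk N (D a) (D d) J Q₂))
      where
      J = cnt (λ b → A a b ∧ A d b)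
      Q₂ = ∑ (λ b → m a b * m b d)
      e : ∀ k N x y j q → 2 * (8 * N) + (4 * (2 * k * x) + (4 * (2 * k * y) + (8 * k * (N + j) + 2 * k * q))) + 0
          ≡ 2 * (k * q) + (4 * ((k + 2) * N) + (4 * ((k + 2) * N) + (8 * k * (x + y) + 2 * k * (4 * j))))
      e = solve-∀
      meet : D a + D d ≤ N + J
      meet = begin
        D a + D d                                     ≡⟨ cong₂ _+_ (sym (cntA a Ua)) (sym (cntA d Ud)) ⟩
        cnt (A a) + cnt (A d)                         ≡⟨ sym (∑-+ (λ b → 𝟙 (A a b)) _) ⟩
        ∑ (λ b → 𝟙 (A a b) + 𝟙 (A d b))               ≤⟨ ∑-mono (λ b → p (A a b) (A d b) (U b) (λ q → A⇒U b a (trans (A-sym b a) q)) (λ q → A⇒U b d (trans (A-sym b d) q))) ⟩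
        ∑ (λ b → 𝟙 (U b) + 𝟙 (A a b ∧ A d b))         ≡⟨ trans (∑-+ (λ b → 𝟙 (U b)) _) (cong (_+ J) |U|) ⟩
        N + J                                         ∎
        where
        open ≤-Reasoning
        p : ∀ x y u → (x ≡ true → u ≡ true) → (y ≡ true → u ≡ true) → 𝟙 x + 𝟙 y ≤ 𝟙 u + 𝟙 (x ∧ y)
        p true  true  u hx hy rewrite hx refl = ≤-refl
        p true  false u hx hy rewrite hx refl = ≤-refl
        p false true  u hx hy rewrite hy refl = ≤-refl
        p false false u hx hy = z≤n
      weigh : 4 * J ≤ Q₂
      weigh = ≤-trans (≤-reflexive (sym (∑-*ˡ 4 _))) (∑-mono (λ b → ≤-trans (≤-reflexive (trans (cong (4 *_) (𝟙-∧ (A a b) (A d b))) (r (𝟙 (A a b)) (𝟙 (A d b)))))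
                (m-edge a b ⟨*⟩ ≤-trans (m-edge d b) (≤-reflexive (m-sym d b)))))
        where
        r : ∀ x y → 4 * (x * y) ≡ 2 * x * (2 * y)
        r = solve-∀

    open Mixing kk ℓ' N 0<kk |U| ratio two-step using (module Deep)

    module Start {φ : Fin n → Fin n} (Uρ : U (φ ρ) ≡ true) where

      env : Env (ρ ∷ []) φ
      env x (here refl) = Uρ

      open Deep local-ok env 0<L 0<N h

      U₁ U₂ : ℕ
      U₁ = κ ^ f * b ^ (2 * (c * s))
      U₂ = suc κ ^ f * suc b ^ (2 * (c * s))

      mean : Mean (Fin n → Fin n)
      mean = record
        { E = E⟨_⟩ ; mass = T₀
        ; E-mono = λ h → EE-mono xs (λ χ _ → h χ) ; E-* = EE-* xs ; E-+ = EE-+ xs ; E-const = EE-mass local-ok env }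

      hdeep' : ∀ {P : Fin n → Set} → (∀ x → x ∈ xs → deep x ≡ true → P x) → ∀ x → x ∈ block → deep x ≡ true → P x
      hdeep' hd x (here refl) dx = ⊥-elim (true≢false dx root)
      hdeep' hd x (there x∈)  dx = hd x x∈ dx

      -- If the truncated exponent is far from positive it stays 0; otherwise the degree of w is small.
      deg-mean : ∀ w → (k + 2) * N + 2 * k * f ≤ Q →
                 E⟨ (λ χ → wt (((k + 2) * N + 2 * k * hits χ block w) ∸ ((2 * k * D w + 2 * k) + (k + 2) * f))) ⟩ * U₁ ≤
                 T₀ * (b ^ Q * U₁ + wt ((k + 2) * N ∸ (2 * k * D w + 2 * k)) * U₂)
      deg-mean w hQ = byCase ((k + 2) * N + 2 * k * M ≤? 2 * k * D w)
       where
       Claim : Set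
       Claim = E⟨ (λ χ → wt (((k + 2) * N + 2 * k * hits χ block w) ∸ ((2 * k * D w + 2 * k) + (k + 2) * f))) ⟩ * U₁ ≤
               T₀ * (b ^ Q * U₁ + wt ((k + 2) * N ∸ (2 * k * D w + 2 * k)) * U₂)
       byCase : Dec ((k + 2) * N + 2 * k * M ≤ 2 * k * D w) → Claim
       byCase (yes p) = ≤-trans (≤-reflexive (trans (cong (_* U₁) (EE-const local-ok env (b ^ Q) (λ χ _ → trans (cong wt (m≤n⇒m∸n≡0 (le χ))) wt-0))) (*-assoc T₀ _ U₁)))
                       (T₀ ⊛ m≤m+n _ _)
         where
         le : ∀ χ → (k + 2) * N + 2 * k * hits χ block w ≤ (2 * k * D w + 2 * k) + (k + 2) * f
         le χ = ≤-trans (≤-refl {(k + 2) * N} ⟨+⟩ (2 * k) ⊛ ≤-trans (hits≤ χ block w) size) (≤-trans p (≤-trans (m≤m+n _ (2 * k)) (m≤m+n _ _)))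
       -- Now the neighbourhood of w has density below (k + 2)/(2k) + M/N in `U`. Up to the mixing
       -- error this is the hit rate (k + 2)/(2k) that the test subtracts per vertex.
       byCase (no ¬p) = test-mean mean 0<b block refl refl (λ x χ → adj G w (χ x)) z c M (2 * k) (k + 2) ((k + 2) * N) (2 * k * D w + 2 * k) 0<z X≤b size 2k≤c hr₁ hQ (hdeep' hdeep)
         where
         hdeep : ∀ x → x ∈ xs → deep x ≡ true → 3 * z * (2 * k) * E⟨ (λ χ → 𝟙 (adj G w (χ x))) ⟩ ≤ T₀ * (3 * z * (k + 2) + 1)
         hdeep x x∈ dx = EE-hit {suc i} (subst (λ j → Path par xs ρ j x) (sym (+-suc (2 * h) i)) (up x∈ (proj₂ (deep-path x x∈ dx)))) (adj G w) (3 * z) (2 * k) (k + 2) M (<⇒≤ (≰⇒> ¬p)) hM hmix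
          where i = proj₁ (deep-path x x∈ dx)

      -- A deep vertex is a star with probability at least 1/c, hence bad with probability at most
      -- (c - 1)/c: counting c for each bad vertex against c - 1 for each vertex leaves no drift.
      star-mean : ∀ u w n₀ e → c * n₀ + c * f ≤ Q →
                  E⟨ (λ χ → wt ((c * n₀ + c * bads χ block u w) ∸ ((c ∸ 1) * e + (c ∸ 1) * f))) ⟩ * U₁ ≤
                  T₀ * (b ^ Q * U₁ + wt (c * n₀ ∸ (c ∸ 1) * e) * U₂)
      star-mean u w n₀ e hQ = test-mean mean 0<b block refl refl (λ x χ → bad u w χ x) z c M c (c ∸ 1) (c * n₀) ((c ∸ 1) * e) 0<z X≤b size ≤-refl
          (≤-trans (((3 * z) ⊛ m∸n≤m c 1) ⟨*⟩ ≤-refl {X}) hr₂) hQ (hdeep' hdeep)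
        where
        hdeep : ∀ y → y ∈ xs → deep y ≡ true → 3 * z * c * E⟨ (λ χ → 𝟙 (bad u w χ y)) ⟩ ≤ T₀ * (3 * z * (c ∸ 1) + 1)
        hdeep y y∈ dy = ≤-trans (≤-reflexive (*-assoc (3 * z) c _)) (≤-trans ((3 * z) ⊛ few) (≤-trans (≤-reflexive (r (3 * z) (c ∸ 1) T₀)) (T₀ ⊛ m≤m+n _ 1)))
          where
          r : ∀ a c t → a * (c * t) ≡ t * (a * c)
          r = solve-∀
          π = proj₂ (deep-path y y∈ dy)
          good : (Fin n → Fin n) → Bool
          good χ = adj G w (χ y) ∧ allF (λ x → adj T y x ⇒ᵇ adj G u (χ x))
          open Star (λ a → U a ∧ adj G w a) (λ a → U a ∧ adj G u a) (λ a q → proj₁ (∧-true {U a} q)) (λ a q → proj₁ (∧-true {U a} q)) (D≥' w) (D≥' u) hmix' using (nch; starE)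
          y≢ρ : y ≢ ρ
          y≢ρ refl = true≢false dy root
          nch≤ : nch y∈ π xs ≤ Δ
          nch≤ = begin
            sumL (λ d → 𝟙 (par d == y)) xs                     ≡⟨ sym (∑-elem (Ok-unique local-ok) _) ⟩
            ∑ (λ d → 𝟙 (elem d xs) * 𝟙 (par d == y))           ≤⟨ ∑-mono (λ d → ≤-trans (≤-reflexive (sym (𝟙-∧ (elem d xs) (par d == y)))) (𝟙-mono (child d))) ⟩
            cnt (adj T y)                                      ≤⟨ deg≤ y ⟩
            Δ                                                  ∎
            where
            open ≤-Reasoning
            child : ∀ d → (elem d xs ∧ (par d == y)) ≡ true → adj T y d ≡ true
            child d q = trans (adj-sym T y d) (subst (λ a → adj T d a ≡ true) (==⇒≡ (proj₂ (∧-true {elem d xs} q))) (par-adj d (λ e → t∉ (subst (_∈ xs) e (elem⇒∈ xs (proj₁ (∧-true {elem d xs} q)))))))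
          B : Fin n → Bool
          B a = U a ∧ adj G u a
          nb : ∀ χ → B (χ (par y)) ≡ true → 1 ≤ childProd par y B xs χ → ∀ x → adj T y x ≡ true → adj G u (χ x) ≡ true
          nb χ e₁ e₃ x a = [ (λ { (_ , e) → subst (λ x → adj G u (χ x) ≡ true) e (proj₂ (∧-true {U (χ (par y))} e₁)) })
                           , (λ { (x≢t , e) → proj₂ (∧-true {U (χ x)} (childProd-at par y B xs χ e₃ x (deep-child y y∈ dy x x≢t e) e)) }) ]′ (edge-par y x a)
          sound : ∀ χ → 𝟙 (B (χ (par y))) * 𝟙 (U (χ y) ∧ adj G w (χ y)) * childProd par y B xs χ ≤ 𝟙 (good χ)
          sound χ = 𝟙³≤ (B (χ (par y))) (U (χ y) ∧ adj G w (χ y)) (childProd par y B xs χ) (childProd≤1 par y B xs χ) λ e₁ e₂ e₃ →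
              ∧-intro (proj₂ (∧-true {U (χ y)} e₂)) (allF-intro (λ x → ⇒ᵇ-intro (nb χ e₁ e₃ x)))
          many : T₀ ≤ c * E⟨ (λ χ → 𝟙 (good χ)) ⟩
          many = starE y∈ π y≢ρ Δ nch≤ (λ χ → 𝟙 (good χ)) sound
          few : c * E⟨ (λ χ → 𝟙 (bad u w χ y)) ⟩ ≤ (c ∸ 1) * T₀
          few = certify (many ⟨+⟩ c ⊛ ≤-reflexive both ⟨+⟩ ≤-reflexive csplit) 0
                  (r' c (c ∸ 1) T₀ E⟨ (λ χ → 𝟙 (good χ)) ⟩ E⟨ (λ χ → 𝟙 (bad u w χ y)) ⟩)
            where
            csplit : c * T₀ ≡ (1 + (c ∸ 1)) * T₀
            csplit = cong (_* T₀) (sym (m+[n∸m]≡n 0<c))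
            both : E⟨ (λ χ → 𝟙 (good χ)) ⟩ + E⟨ (λ χ → 𝟙 (bad u w χ y)) ⟩ ≡ T₀
            both = mass-1 (λ χ → trans (cong (λ d → 𝟙 (good χ) + 𝟙 (not (d ∧ good χ))) dy) (𝟙-not (good χ)))
            r' : ∀ c c' T g b → c * b + (c * g + (c * T + (1 + c') * T)) + 0 ≡ c' * T + (T + (c * (g + b) + c * T))
            r' = solve-∀

  -- The main phase: block after block under a bounded potential.

  module Bulk (𝒮 : Setting) where
    open Setting 𝒮
    open Finish G T t v R Δ g deg≤
    open Strategy g Good
    open Tests G T deep
    open Weight b Q 0<b

    degTest : (Fin n → Fin n) → List (Fin n) → Fin n → ℕ
    degTest χ rem w = (k + 2) * length rem ∸ (2 * k * hits χ rem w + 2 * k)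

    -- Before truncation this is |S| minus c times the number of vertices of S that are not bad, so
    -- it is positive when fewer than |S|/c of them are usable for (u, w).
    starTest : (Fin n → Fin n) → List (Fin n) → Fin n → Fin n → ℕ
    starTest χ S u w = c * bads χ S u w ∸ (c ∸ 1) * length S

    Φ : (Fin n → Fin n) → List (Fin n) → List (Fin n) → ℕ
    Φ χ S rem = ∑ (λ u → ∑ (λ w → wt (degTest χ rem w) + wt (starTest χ S u w)))

    Den Num : ℕ → ℕ → ℕ
    Den e s = κ ^ (2 * e) * b ^ (2 * (c * s))
    Num e s = suc κ ^ (2 * e) * suc b ^ (2 * (c * s))

    -- In `pot`, the factor suc (length S) counts the additive contributions K b^Q of the blocks,
    -- caused by truncation. `deepCl` freezes the verdicts on placed deep vertices, since their
    -- neighbours are placed too.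
    record Inv (S rem : List (Fin n)) (ψ : Bij n) : Set where
      field
        t∈     : t ∈ S
        ok     : Ok par S rem
        uniqS  : Unique S
        all    : ∀ x → x ∈ S ⊎ x ∈ rem
        closed : ∀ x → x ∈ S → x ≢ t → par x ∈ S
        ψt     : to ψ t ≡ v
        edges  : ∀ x → x ∈ S → x ≢ t → adj G (to ψ x) (to ψ (par x)) ≡ true
        deepCl : ∀ y → y ∈ S → deep y ≡ true → ∀ x → adj T y x ≡ true → x ∈ S
        pot    : Φ (to ψ) S rem * Den (length S) (shallow S) ≤ K * suc (length S) * Num (length S) (shallow S) * b ^ Q

    0<kk : 1 ≤ kk
    0<kk = *-pos {2} (s≤s z≤n) 0<k

    0<c : 1 ≤ c
    0<c = *-pos (*-pos (*-pos {2} (s≤s z≤n) 0<kk) 0<kk) (^-pos Δ 0<kk)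

    0<κ : 1 ≤ κ
    0<κ = *-pos 0<z 0<b

    shallow≤ : ∀ {S} → Unique S → shallow S ≤ S̄
    shallow≤ {S} u = ≤-trans (≤-reflexive (sym (∑-elem u _))) (≤-trans (∑-mono (λ y → ≤-trans (𝟙≤1 (elem y S) ⟨*⟩ ≤-refl) (≤-reflexive (*-identityˡ _)))) |shallow|)

    Φ-term : ∀ χ S rem u w → wt (degTest χ rem w) + wt (starTest χ S u w) ≤ Φ χ S rem
    Φ-term χ S rem u w = ≤-trans (∑-term (λ w → wt (degTest χ rem w) + wt (starTest χ S u w)) w)
      (∑-term (λ u → ∑ (λ w → wt (degTest χ rem w) + wt (starTest χ S u w))) u)

    module _ {S rem ψ} (inv : Inv S rem ψ) where
      open Inv inv

      small : ∀ {y} → y ≤ Q → wt y ≤ Φ (to ψ) S rem → y ≤ Y₀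
      small y≤ h = wt-bound κ K n (c * S̄) Y₀ 0<κ hfin y≤ (unique-length uniqS) (c ⊛ shallow≤ uniqS) (≤-trans (h ⟨*⟩ ≤-refl) pot)

      degTest≤ : ∀ w → degTest (to ψ) rem w ≤ Y₀
      degTest≤ w = small (≤-trans (m∸n≤m _ (2 * k * hits (to ψ) rem w + 2 * k)) (≤-trans ((k + 2) ⊛ unique-length (Ok-unique ok)) (≤-trans (m≤m+n _ ((2 * k + c) * n)) (≤-reflexive (f k c n)))))
        (≤-trans (m≤m+n _ _) (Φ-term (to ψ) S rem t w))
        where
        f : ∀ k c n → (k + 2) * n + (2 * k + c) * n ≡ (3 * k + 2 + c) * n
        f = solve-∀

      starTest≤ : ∀ u w → starTest (to ψ) S u w ≤ Y₀
      starTest≤ u w = small (≤-trans (m∸n≤m _ ((c ∸ 1) * length S)) (≤-trans (c ⊛ ≤-trans (bads≤ (to ψ) S u w) (unique-length uniqS)) (≤-trans (m≤n+m _ ((3 * k + 2) * n)) (≤-reflexive (f k c n)))))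
        (≤-trans (m≤n+m _ _) (Φ-term (to ψ) S rem u w))
        where
        f : ∀ k c n → (3 * k + 2) * n + c * n ≡ (3 * k + 2 + c) * n
        f = solve-∀

      -- The exponent is at most `Y₀`, and `Y₀` + 2k ≤ N as long as N is large. So one unit of the
      -- coefficient k + 2 is given up, half of the surplus over k.
      deg≥ : n ≤ ē * length rem → ∀ w → (k + 1) * length rem ≤ 2 * k * hits (to ψ) rem w
      deg≥ big w = certify (le ⟨+⟩ proj₁ (proj₂ (proj₂ (hN _ big)))) 0 (f k (length rem) (hits (to ψ) rem w) Y₀)
        where
        le : (k + 2) * length rem ≤ (2 * k * hits (to ψ) rem w + 2 * k) + Y₀
        le = ≤-trans (m≤n+m∸n _ (2 * k * hits (to ψ) rem w + 2 * k)) (≤-refl {2 * k * hits (to ψ) rem w + 2 * k} ⟨+⟩ degTest≤ w)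
        f : ∀ k N D Y → (k + 1) * N + (2 * k * D + 2 * k + Y + N) + 0 ≡ 2 * k * D + ((k + 2) * N + (Y + 2 * k))
        f = solve-∀

      -- A placed vertex that is not bad is a star: being deep it differs from t, and its test
      -- covers all neighbours, in particular those in S.
      stars : ∀ u w → length S ≤ c * cnt (star u w ψ S) + Y₀
      stars u w = certify (c ⊛ split ⟨+⟩ le ⟨+⟩ ≤-reflexive csplit) 0 (f c (c ∸ 1) (length S) (cnt (star u w ψ S)) (bads (to ψ) S u w) Y₀)
        where
        le : c * bads (to ψ) S u w ≤ (c ∸ 1) * length S + Y₀
        le = ≤-trans (m≤n+m∸n _ ((c ∸ 1) * length S)) (≤-refl {(c ∸ 1) * length S} ⟨+⟩ starTest≤ u w)
        csplit : (1 + (c ∸ 1)) * length S ≡ c * length S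
        csplit = cong (_* length S) (m+[n∸m]≡n 0<c)
        f : ∀ c c' e s B Y → e + (c * (s + B) + (c' * e + Y + c * e)) + 0 ≡ c * s + Y + (c * e + (c * B + (1 + c') * e))
        f = solve-∀
        split : length S ≤ cnt (star u w ψ S) + bads (to ψ) S u w
        split = begin
          length S                                                        ≡⟨ sym (cnt-elem uniqS) ⟩
          cnt (λ y → elem y S)                                            ≤⟨ ∑-mono ptw ⟩
          ∑ (λ y → 𝟙 (star u w ψ S y) + 𝟙 (elem y S) * 𝟙 (bad u w (to ψ) y)) ≡⟨ trans (∑-+ (λ y → 𝟙 (star u w ψ S y)) _) (cong (cnt (star u w ψ S) +_) (∑-elem uniqS _)) ⟩
          cnt (star u w ψ S) + bads (to ψ) S u w                          ∎
          where
          open ≤-Reasoning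
          dich : ∀ {e s b} → (e ≡ true → b ≡ false → s ≡ true) → 𝟙 e ≤ 𝟙 s + 𝟙 e * 𝟙 b
          dich {false} h = z≤n
          dich {true} {s} {true} h = m≤n+m 1 (𝟙 s)
          dich {true} {s} {false} h rewrite h refl refl = s≤s z≤n
          ptw : ∀ y → 𝟙 (elem y S) ≤ 𝟙 (star u w ψ S y) + 𝟙 (elem y S) * 𝟙 (bad u w (to ψ) y)
          ptw y = dich go
            where
            go : elem y S ≡ true → bad u w (to ψ) y ≡ false → star u w ψ S y ≡ true
            go y∈ nb = ∧-intro (∧-intro y∈ y≢t) (∧-intro (proj₁ p₂) (allF-intro (λ x → ⇒ᵇ-intro (λ q → ⇒ᵇ-elim (allF-elim (proj₂ p₂) x) (proj₁ (∧-true {adj T y x} q))))))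
              where
              not-false : ∀ {a} → not a ≡ false → a ≡ true
              not-false {true} _ = refl
              p₁ = ∧-true {deep y} (not-false nb)
              p₂ = ∧-true {adj G w (to ψ y)} (proj₂ p₁)
              y≢t : not (y == t) ≡ true
              y≢t with y F.≟ t
              ... | yes refl = ⊥-elim (true≢false (proj₁ p₁) t-shallow)
              ... | no _ = refl

      conclude : ē * length rem < n → Strat rem ψ
      conclude small = finish rem ψ t∈ ok all closed ψt edges (λ u w → hend (length S) (length rem) _ (∑-split S rem all) small (stars u w))

    data Blocks : List (Fin n) → Set where
      []  : Blocks []
      _∷_ : ∀ {ρ xs rest} → Block R deep h M ρ xs → Blocks rest → Blocks (ρ ∷ xs ++ rest)

    module Step {S ρ xs rest ψ} (inv : Inv S (ρ ∷ xs ++ rest) ψ) (blk : Block R deep h M ρ xs)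
                (big : n ≤ ē * length (ρ ∷ xs ++ rest)) where
      open Inv inv
      open Block blk

      rem block : List (Fin n)
      rem = ρ ∷ xs ++ rest
      block = ρ ∷ xs

      N f s : ℕ
      N = length rem
      f = length block
      s = shallow block

      0<N : 1 ≤ N
      0<N = proj₁ (hN N big)

      U : Fin n → Bool
      U w = elem (from ψ w) rem

      U-to : ∀ x → U (to ψ x) ≡ elem x rem
      U-to x = cong (λ y → elem y rem) (from-to ψ x)

      over-U : ∀ (χ : Bij n) → (∀ x → U (to χ x) ≡ elem x rem) → ∀ (F : Fin n → ℕ) → ∑ (λ w → 𝟙 (U w) * F w) ≡ sumL (λ x → F (to χ x)) rem
      over-U χ h F = trans (sym (∑-to χ _)) (trans (∑-cong (λ x → cong (λ u → 𝟙 u * F (to χ x)) (h x))) (∑-elem (Ok-unique ok) _))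

      |U| : cnt U ≡ N
      |U| = trans (∑-cong (λ w → sym (*-identityʳ _))) (trans (over-U ψ U-to (λ _ → 1)) (trans (sumL-const 1 rem) (*-identityʳ N)))

      D : Fin n → ℕ
      D w = cnt (λ a → U a ∧ adj G w a)

      -- `D` is fixed before the block, yet equals the count for every χ that permutes the images of
      -- `rem`. This expresses the degrees left after the block by the images chosen in it.
      D-hits : ∀ (χ : Bij n) → (∀ x → U (to χ x) ≡ elem x rem) → ∀ w → D w ≡ hits (to χ) rem w
      D-hits χ h w = trans (∑-cong (λ a → 𝟙-∧ (U a) (adj G w a))) (over-U χ h (λ a → 𝟙 (adj G w a)))

      D≥ : ∀ w → (k + 1) * N ≤ 2 * k * D w
      D≥ w = ≤-trans (deg≥ inv big w) (≤-reflexive (cong (2 * k *_) (sym (D-hits ψ U-to w))))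

      S∉rem : ∀ {x} → x ∈ S → x ∉ rem
      S∉rem = Ok-fresh ok

      𝒜 : AvgData 𝒮
      𝒜 = record { ρ = ρ ; xs = xs ; blk = blk ; t∉ = λ p → S∉rem t∈ (there (∈-++ˡ p)) ; U = U ; N = N ; 0<N = 0<N
                 ; hM = proj₁ (proj₂ (hN N big)) ; |U| = |U| ; D≥ = D≥ }

      module Av = Averages 𝒮 𝒜
      open RandomWalk Av.m U Av.L Av.m-sym Av.m-row using (EE; EE-∑; EE-+)

      -- The tests as they will read after the block, rewritten so that χ enters only through the
      -- images of the block.
      newDeg newStar : (Fin n → Fin n) → Fin n → Fin n → ℕ
      newDeg χ u w = ((k + 2) * N + 2 * k * hits χ block w) ∸ ((2 * k * D w + 2 * k) + (k + 2) * f)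
      newStar χ u w = (c * bads (to ψ) S u w + c * bads χ block u w) ∸ ((c ∸ 1) * length S + (c ∸ 1) * f)

      Φ' : (Fin n → Fin n) → ℕ
      Φ' χ = ∑ (λ u → ∑ (λ w → wt (newDeg χ u w) + wt (newStar χ u w)))

      U₁ U₂ : ℕ
      U₁ = κ ^ f * b ^ (2 * (c * s))
      U₂ = suc κ ^ f * suc b ^ (2 * (c * s))

      f≤N : f ≤ N
      f≤N = ≤-trans (m≤m+n f (length rest)) (≤-reflexive (sym (length-++' block rest)))

      N≤n : N ≤ n
      N≤n = unique-length (Ok-unique ok)

      e+f≤n : length S + f ≤ n
      e+f≤n = begin
        length S + f                             ≡⟨ cong₂ _+_ (sym (cnt-elem uniqS)) (sym (cnt-elem (unique-pre block (Ok-unique ok)))) ⟩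
        cnt (λ x → elem x S) + cnt (λ x → elem x block)  ≡⟨ sym (∑-+ (λ x → 𝟙 (elem x S)) _) ⟩
        ∑ (λ x → 𝟙 (elem x S) + 𝟙 (elem x block))        ≤⟨ ∑-≤const 1 (λ x → excl (elem x S) (elem x block) (λ p q → S∉rem (elem⇒∈ S p) (∈-++ˡ {ys = rest} (elem⇒∈ block q)))) ⟩
        n * 1                                    ≡⟨ *-identityʳ n ⟩
        n                                        ∎
        where
        open ≤-Reasoning
        excl : ∀ a b → (a ≡ true → b ≡ true → ⊥) → 𝟙 a + 𝟙 b ≤ 1
        excl true  true  h = ⊥-elim (h refl refl)
        excl true  false h = ≤-refl
        excl false b     h = 𝟙≤1 b

      Φ'-mean : ∀ {φ} → U (φ ρ) ≡ true → EE par xs φ Φ' * U₁ ≤ Av.L ^ length xs * (K * b ^ Q * U₁ + Φ (to ψ) S rem * U₂)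
      Φ'-mean {φ} Uρ = ≤-trans (≤-reflexive (cong (_* U₁) linear)) (double-sum A a U₁ U₂ (Av.L ^ length xs) (b ^ Q) bound)
        where
        module St = Av.Start {φ} Uρ
        Ed Es a A : Fin n → Fin n → ℕ
        Ed u w = EE par xs φ (λ χ → wt (newDeg χ u w))
        Es u w = EE par xs φ (λ χ → wt (newStar χ u w))
        A u w = Ed u w + Es u w
        a u w = wt (degTest (to ψ) rem w) + wt (starTest (to ψ) S u w)
        linear : EE par xs φ Φ' ≡ ∑ (λ u → ∑ (A u))
        linear = trans (EE-∑ xs _) (∑-cong (λ u → trans (EE-∑ xs _) (∑-cong (λ w → EE-+ xs (λ χ → wt (newDeg χ u w)) (λ χ → wt (newStar χ u w))))))
        hd : ∀ u w → Ed u w * U₁ ≤ Av.L ^ length xs * (b ^ Q * U₁ + wt (degTest (to ψ) rem w) * U₂)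
        hd u w = ≤-trans (St.deg-mean w (≤-trans (((k + 2) ⊛ N≤n) ⟨+⟩ (2 * k) ⊛ ≤-trans f≤N N≤n) (≤-trans (m≤m+n _ (c * n)) (≤-reflexive (r k c n)))))
                   (≤-reflexive (cong (λ d → Av.L ^ length xs * (b ^ Q * U₁ + wt ((k + 2) * N ∸ (2 * k * d + 2 * k)) * U₂)) (D-hits ψ U-to w)))
          where
          r : ∀ k c n → (k + 2) * n + 2 * k * n + c * n ≡ (3 * k + 2 + c) * n
          r = solve-∀
        hs : ∀ u w → Es u w * U₁ ≤ Av.L ^ length xs * (b ^ Q * U₁ + wt (starTest (to ψ) S u w) * U₂)
        hs u w = St.star-mean u w (bads (to ψ) S u w) (length S)
                   (≤-trans (((c ⊛ bads≤ (to ψ) S u w) ⟨+⟩ ≤-refl)) (≤-trans (≤-reflexive (sym (*-distribˡ-+ c (length S) f))) (≤-trans (c ⊛ e+f≤n) (*-monoˡ-≤ n (m≤n+m c (3 * k + 2))))))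
        bound : ∀ u w → A u w * U₁ ≤ Av.L ^ length xs * (2 * b ^ Q * U₁ + a u w * U₂)
        bound u w = certify (hd u w ⟨+⟩ hs u w) 0 (r (Ed u w) (Es u w) U₁ (Av.L ^ length xs) (b ^ Q) (wt (degTest (to ψ) rem w)) (wt (starTest (to ψ) S u w)) U₂)
          where
          r : ∀ d s u T β x y v → (d + s) * u + (T * (β * u + x * v) + T * (β * u + y * v)) + 0 ≡ T * (2 * β * u + (x + y) * v) + (d * u + s * u)
          r = solve-∀

      path-∈ : ∀ {j y} → Path par xs ρ j y → y ∈ block
      path-∈ stop = here refl
      path-∈ (up p _) = there p

      nbr∈ : ∀ {x} → x ∈ block → deep x ≡ true → ∀ x' → adj T x x' ≡ true → x' ∈ block
      nbr∈ (here refl) dx x' a = ⊥-elim (true≢false dx root)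
      nbr∈ {x} (there q) dx x' a with edge-par x x' a
      ... | inj₁ (_ , refl)   = path-∈ (proj₂ (deep-path x q dx))
      ... | inj₂ (x'≢t , e) = there (deep-child x q dx x' x'≢t e)

      -- Deep vertices of the block have all neighbours in the block, and shallow ones are bad for
      -- every χ.
      Φ'-local : ∀ χ χ' → (∀ x → x ∈ block → χ x ≡ χ' x) → Φ' χ ≡ Φ' χ'
      Φ'-local χ χ' agree = ∑-cong (λ u → ∑-cong (λ w → cong₂ _+_
        (cong (λ z → wt (((k + 2) * N + 2 * k * z) ∸ ((2 * k * D w + 2 * k) + (k + 2) * f))) (sumL-cong block (λ x x∈ → cong (λ a → 𝟙 (adj G w a)) (agree x x∈))))
        (cong (λ z → wt ((c * bads (to ψ) S u w + c * z) ∸ ((c ∸ 1) * length S + (c ∸ 1) * f)))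
          (sumL-cong block (λ x x∈ → cong 𝟙 (bad-cong u w x (agree x x∈) (λ d x' a → agree x' (nbr∈ x∈ d x' a))))))))

      m-adj : ∀ a d → 1 ≤ Av.m a d → U d ≡ true × adj G d a ≡ true
      m-adj a d h = Av.A⇒U d a (trans (Av.A-sym d a) (Av.m-supp a d h)) , trans (adj-sym G d a) (proj₂ (∧-true {U a ∧ U d} (Av.m-supp a d h)))

      module St = Steering G par g κ M Av.L (2 + 8 * kk * kk) Good S block rest U Av.m Av.m-sym Av.m-row Av.m-cap m-adj Av.0<L (s≤s z≤n)
                    (proj₂ (proj₂ (proj₂ (proj₂ (hN N big))))) size S∉rem (to ψ) Φ' Φ'-local

      Budget : (Fin n → Fin n) → Set
      Budget χ = Φ' χ * (κ ^ length xs * U₁) ≤ suc κ ^ length xs * (K * b ^ Q * U₁ + Φ (to ψ) S rem * U₂)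

      after : ∀ {P χ} → St.Mid P [] χ → Budget (to χ) → Inv (P ++ S) rest χ
      after {P} {χ} mid budget = record
        { t∈ = ∈-++ʳ P t∈
        ; ok = mOkG
        ; uniqS = mUniq
        ; all = λ x → [ (λ p → inj₁ (∈-++ʳ P p)) , (λ p → [ (λ q → inj₁ (∈-++ˡ (block∈P q))) , inj₂ ]′ (∈-++⁻ block p)) ]′ (all x)
        ; closed = λ x x∈ x≢t → [ mPar x , (λ p → ∈-++ʳ P (closed x p x≢t)) ]′ (∈-++⁻ P x∈)
        ; ψt = trans (mS t t∈) ψt
        ; edges = λ x x∈ x≢t → [ mEdge x , (λ p → trans (cong₂ (adj G) (mS x p) (mS (par x) (closed x p x≢t))) (edges x p x≢t)) ]′ (∈-++⁻ P x∈)
        ; deepCl = λ y y∈ d x a → [ (λ p → ∈-++ˡ (block∈P (nbr∈ (mMem' y (inj₁ p)) d x a))) , (λ p → ∈-++ʳ P (deepCl y p d x a)) ]′ (∈-++⁻ P y∈)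
        ; pot = subst₂ (λ e s' → Φ (to χ) (P ++ S) rest * Den e s' ≤ K * suc e * Num e s' * b ^ Q) (sym |P++S|) (sym shal)
                  (≤-trans (≤-reflexive (cong (_* Den (f + length S) (s + shallow S)) Φ≡))
                    (pot-step {Φ' (to χ)} {Φ (to ψ) S rem} {κ} {b} {b ^ Q} {K} {length xs} {c} {s} {length S} {shallow S} budget pot)) }
        where
        open St.Mid mid
        block∈P : ∀ {x} → x ∈ block → x ∈ P
        block∈P {x} p = [ id , (λ ()) ]′ (mMem x p)
        sumP : ∀ (q : Fin n → ℕ) → sumL q P ≡ sumL q block
        sumP q = trans (sym (+-identityʳ _)) (mSum q)
        |P| : length P ≡ f
        |P| = trans (sym (trans (sumL-const 1 P) (*-identityʳ _))) (trans (sumP (λ _ → 1)) (trans (sumL-const 1 block) (*-identityʳ _)))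
        |P++S| : length (P ++ S) ≡ f + length S
        |P++S| = trans (length-++' P S) (cong (_+ length S) |P|)
        shal : shallow (P ++ S) ≡ s + shallow S
        shal = trans (sumL-++ _ P S) (cong (_+ shallow S) (sumP _))
        deg-eq : ∀ w → degTest (to χ) rest w ≡ newDeg (to χ) w w
        deg-eq w = sym (trans (cong₂ _∸_
            (trans (cong (λ l → (k + 2) * l + 2 * k * Z) (length-++' block rest)) (r₁ k f (length rest) Z))
            (trans (cong (λ d → 2 * k * d + 2 * k + (k + 2) * f) (trans (D-hits χ mU w) (sumL-++ _ block rest))) (r₂ k f Z (hits (to χ) rest w))))
          ([m+n]∸[m+o]≡n∸o ((k + 2) * f + 2 * k * Z) _ _))
          where
          Z = hits (to χ) block w
          r₁ : ∀ k f r Z → (k + 2) * (f + r) + 2 * k * Z ≡ (k + 2) * f + 2 * k * Z + (k + 2) * r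
          r₁ = solve-∀
          r₂ : ∀ k f Z D → 2 * k * (Z + D) + 2 * k + (k + 2) * f ≡ (k + 2) * f + 2 * k * Z + (2 * k * D + 2 * k)
          r₂ = solve-∀
        star-eq : ∀ u w → starTest (to χ) (P ++ S) u w ≡ newStar (to χ) u w
        star-eq u w = cong₂ _∸_
          (trans (cong (c *_) (trans (sumL-++ _ P S) (cong₂ _+_ (sumP _) (sumL-cong S (λ y y∈ → cong 𝟙 (bad-cong u w y (mS y y∈) (λ d x a → mS x (deepCl y y∈ d x a))))))))
            (trans (*-distribˡ-+ c (bads (to χ) block u w) _) (+-comm (c * bads (to χ) block u w) _)))
          (trans (cong ((c ∸ 1) *_) |P++S|) (trans (*-distribˡ-+ (c ∸ 1) f _) (+-comm ((c ∸ 1) * f) _)))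
        Φ≡ : Φ (to χ) (P ++ S) rest ≡ Φ' (to χ)
        Φ≡ = ∑-cong (λ u → ∑-cong (λ w → cong₂ _+_ (cong wt (deg-eq w)) (cong wt (star-eq u w))))

      embedBlock : (∀ {P χ} → Inv (P ++ S) rest χ → Strat rest χ) → Strat rem ψ
      embedBlock kont = play {ρ} {xs ++ rest} {ψ} O O≥ next
        where
        a = to ψ (par ρ)
        O : Fin n → Bool
        O y = U (to ψ y) ∧ adj G a (to ψ y)
        O≥ : g ≤ cnt O
        O≥ = ≤-trans (cancelˡ {2 * k} 0<kk (certify ((k ⊛ proj₁ (proj₂ (proj₂ (proj₂ (hN N big))))) ⟨+⟩ D≥ a) N (r k g N (D a))))
               (≤-reflexive (sym (∑-to ψ (λ d → 𝟙 (U d ∧ adj G a d)))))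
          where
          r : ∀ k g N D → 2 * k * g + (k * N + 2 * k * D) + N ≡ 2 * k * D + (k * (2 * g) + (k + 1) * N)
          r = solve-∀
        next : ∀ y → O y ≡ true → Strat (xs ++ rest) (swapB ψ ρ y)
        next y o = St.steer xs {ρ ∷ []} {swapB ψ ρ y} U₁ (K * b ^ Q * U₁ + Φ (to ψ) S rem * U₂) mid env refl (Φ'-mean (env ρ (here refl))) (λ {P} {χ} m' q → kont {P} {χ} (after {P} {χ} m' q))
          where
          mid : St.Mid (ρ ∷ []) xs (swapB ψ ρ y)
          mid = St.first {χ = ψ} refl U-to (λ _ _ → refl) uniqS local-ok ok y
                  (elem⇒∈ rem (trans (sym (U-to y)) (proj₁ (∧-true {U (to ψ y)} o)))) (trans (adj-sym G _ _) (proj₂ (∧-true {U (to ψ y)} o)))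
          env : ∀ x → x ∈ ρ ∷ [] → U (to (swapB ψ ρ y) x) ≡ true
          env x x∈ = trans (St.Mid.mU mid x) (∈⇒elem (St.Mid.mP mid x x∈))

    embed : ∀ {S rem} ψ → Blocks rem → Inv S rem ψ → Strat rem ψ
    -- With all blocks placed the remainder is empty, hence below the threshold since n is positive.
    embed {S} ψ []                     inv = conclude {S} {[]} {ψ} inv (subst (_< n) (sym (*-zeroʳ ē)) (≤-trans (s≤s z≤n) (F.toℕ<n t)))
    embed {S} ψ (_∷_ {ρ} {xs} {rest} blk bs) inv = go (n ≤? ē * length (ρ ∷ xs ++ rest))
      where
      go : Dec (n ≤ ē * length (ρ ∷ xs ++ rest)) → Strat (ρ ∷ xs ++ rest) ψ
      go (yes big) = Step.embedBlock {S} {ρ} {xs} {rest} {ψ} inv blk big (λ {P} {χ} inv' → embed χ bs inv')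
      go (no ¬big) = conclude {S} {ρ ∷ xs ++ rest} {ψ} inv (≰⇒> ¬big)

  -- Rooting the tree by breadth-first search.

  module TreeRoot {n} (T : Graph n) (conn : Connected T) (acyc : Acyclic T) (t : Fin n) where

    within : ℕ → Fin n → Bool
    within zero    x = x == t
    within (suc j) x = within j x ∨ does (F.any? (λ y → (adj T y x ∧ within j y) Data.Bool.≟ true))

    within-step : ∀ {j x y} → adj T y x ≡ true → within j y ≡ true → within (suc j) x ≡ true
    within-step {j} {x} {y} a w with within j x
    ... | true  = refl
    ... | false = true-does (F.any? (λ y → (adj T y x ∧ within j y) Data.Bool.≟ true)) (y , ∧-intro a w)

    within-back : ∀ {j x} → within (suc j) x ≡ true → within j x ≡ false → ∃ λ y → adj T y x ≡ true × within j y ≡ true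
    within-back {j} {x} w e with within j x
    within-back {j} {x} w refl | false with does-true (F.any? (λ y → (adj T y x ∧ within j y) Data.Bool.≟ true)) w
    ... | y , p = y , ∧-true {adj T y x} p

    reach : ∀ {x} → Walk T x t → ∃ λ j → within j x ≡ true
    reach Defs.here = zero , ==-refl t
    reach (Defs.step {w = w} a p) with reach p
    ... | j , q = suc j , within-step {j} (trans (adj-sym T w _) a) q

    least : ∀ j {x} → within j x ≡ true → ∃ λ d → within d x ≡ true × (∀ i → i < d → within i x ≡ false)
    least zero    w = zero , w , λ i ()
    least (suc j) {x} w with within j x in e
    ... | true  = least j e
    ... | false = suc j , trans (cong (_∨ does (F.any? (λ y → (adj T y x ∧ within j y) Data.Bool.≟ true))) e) w , below j e
      where
      below : ∀ j → within j x ≡ false → ∀ i → i < suc j → within i x ≡ false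
      below j e i (s≤s i≤j) with i ≟ j
      ... | yes refl = e
      below zero    e .zero (s≤s z≤n) | no q = ⊥-elim (q refl)
      below (suc j) e i (s≤s i≤j) | no q = below j (shrink' (within j x) e) i (≤∧≢⇒< i≤j q)
        where
        shrink' : ∀ a {b} → (a ∨ b) ≡ false → a ≡ false
        shrink' false _ = refl

    bfs : ∀ x → ∃ λ d → within d x ≡ true × (∀ i → i < d → within i x ≡ false)
    bfs x = least (proj₁ (reach (conn x t))) {x} (proj₂ (reach (conn x t)))

    depth : Fin n → ℕ
    depth x = proj₁ (bfs x)

    depth≤ : ∀ {j x} → within j x ≡ true → depth x ≤ j
    depth≤ {j} {x} w = ≮⇒≥ (λ q → true≢false w (proj₂ (proj₂ (bfs x)) j q))

    parent : ∀ x → x ≢ t → ∃ λ y → adj T x y ≡ true × depth x ≡ suc (depth y)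
    parent x x≢t = go (depth x) refl
      where
      go : ∀ d → depth x ≡ d → ∃ λ y → adj T x y ≡ true × depth x ≡ suc (depth y)
      go zero    e = ⊥-elim (x≢t (==⇒≡ (subst (λ d → within d x ≡ true) e (proj₁ (proj₂ (bfs x))))))
      go (suc d) e with within-back {d} (subst (λ d → within d x ≡ true) e (proj₁ (proj₂ (bfs x)))) (proj₂ (proj₂ (bfs x)) d (≤-reflexive (sym e)))
      ... | y , a , w = y , trans (adj-sym T x y) a , trans e (cong suc (≤-antisym (≤-pred (≤-trans (≤-reflexive (sym e)) (depth≤ {suc (depth y)} (within-step {depth y} a (proj₁ (proj₂ (bfs y))))))) (depth≤ w)))

    opaque
      par : Fin n → Fin n
      par x with x F.≟ t
      -- A default value; the statements about `par` as an edge exclude the root.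
      ... | yes _ = t
      ... | no  q = proj₁ (parent x q)

      par-spec : ∀ x → x ≢ t → adj T x (par x) ≡ true × depth x ≡ suc (depth (par x))
      par-spec x q with x F.≟ t
      ... | yes e  = ⊥-elim (q e)
      ... | no  q' = proj₂ (parent x q')

    data Edge (a b : Fin n) : Set where
      up   : a ≢ t → par a ≡ b → Edge a b
      down : b ≢ t → par b ≡ a → Edge a b

    Edge-adj : ∀ {a b} → Edge a b → adj T a b ≡ true
    Edge-adj (up q refl)   = proj₁ (par-spec _ q)
    Edge-adj (down q refl) = trans (adj-sym T _ _) (proj₁ (par-spec _ q))

    Chain : List (Fin n) → Set
    Chain []           = ⊤
    Chain (a ∷ [])     = ⊤
    Chain (a ∷ b ∷ zs) = Edge a b × Chain (b ∷ zs)

    Simple : Fin n → Fin n → Set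
    Simple a b = ∃ λ zs → Unique (a ∷ zs) × Chain (a ∷ zs) × lastOr a zs ≡ b

    chain-tail : ∀ {a} zs → Chain (a ∷ zs) → Chain zs
    chain-tail []       c = tt
    chain-tail (_ ∷ _) (_ , c) = c

    suffix : ∀ {a} c zs → a ∈ c ∷ zs → Unique (c ∷ zs) → Chain (c ∷ zs) → Simple a (lastOr c zs)
    suffix c zs (here refl) u ch = zs , u , ch , refl
    suffix c (d ∷ zs) (there p) (_ ∷ u) ch = suffix d zs p u (chain-tail (d ∷ zs) ch)

    -- If a already lies on the path, the path is cut back to a; otherwise a is put in front. Either
    -- way no vertex repeats.
    extend : ∀ {a b c} → Edge a c → Simple c b → Simple a b
    extend {a} {b} {c} e (zs , u , ch , l) with elem a (c ∷ zs) in q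
    ... | true  = subst (Simple a) l (suffix c zs (elem⇒∈ (c ∷ zs) q) u ch)
    ... | false = c ∷ zs , ∉-All (elem-false q) ∷ u , (e , ch) , l

    -- Loop erasure of the walk from a up to the root and down again to b.
    toRoot : ∀ d a → depth a ≡ d → ∀ {b} → Simple t b → Simple a b
    toRoot d a e s with a F.≟ t
    ... | yes refl = s
    toRoot zero    a e s | no q = ⊥-elim (case trans (sym e) (proj₂ (par-spec a q)) of λ ())
    toRoot (suc d) a e s | no q = extend (up q refl) (toRoot d (par a) (suc-injective (trans (sym (proj₂ (par-spec a q))) e)) s)

    fromRoot : ∀ d b → depth b ≡ d → ∀ {c} → Simple b c → Simple t c
    fromRoot d b e s with b F.≟ t
    ... | yes refl = s
    fromRoot zero    b e s | no q = ⊥-elim (case trans (sym e) (proj₂ (par-spec b q)) of λ ())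
    fromRoot (suc d) b e s | no q = fromRoot d (par b) (suc-injective (trans (sym (proj₂ (par-spec b q))) e)) (extend (down q refl) s)

    join : ∀ a b → Simple a b
    join a b = toRoot (depth a) a refl (fromRoot (depth b) b refl ([] , [] ∷ [] , tt , refl))

    -- The simple path of parent edges from y to x has one vertex only if x = y and one edge only if
    -- x and y are parent and child. Any longer path is closed to a cycle by the edge xy.
    no-cross : ∀ x y → adj T x y ≡ true → ¬ Edge x y → ⊥
    no-cross x y a ne with join y x
    ... | [] , u , ch , refl = true≢false a (adj-irr T y)
    ... | z ∷ [] , u , (e , _) , refl = ne (flip-edge e)
      where
      flip-edge : ∀ {a b} → Edge a b → Edge b a
      flip-edge (up q e)   = down q e
      flip-edge (down q e) = up q e
    ... | z ∷ z' ∷ zs , u , ch , l = acyc (y ∷ z ∷ z' ∷ zs) (s≤s (s≤s (s≤s z≤n)) , u , consec (y ∷ z ∷ z' ∷ zs) ch , trans (cong (λ w → adj T w y) l) a)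
      where
      consec : ∀ zs → Chain zs → ConsecAdj T zs
      consec []           _       = tt
      consec (a ∷ [])     _       = tt
      consec (a ∷ b ∷ zs) (e , c) = Edge-adj e , consec (b ∷ zs) c

    rooted : Rooted T t
    rooted = record
      { par = par ; depth = depth ; dep-t = n≤0⇒n≡0 (depth≤ {0} (==-refl t)) ; par-adj = λ x q → proj₁ (par-spec x q) ; par-dep = λ x q → proj₂ (par-spec x q)
      ; edge-par = edge }
      where
      edge : ∀ x y → adj T x y ≡ true → (x ≢ t × par x ≡ y) ⊎ (y ≢ t × par y ≡ x)
      edge x y a with x F.≟ t | par x F.≟ y | y F.≟ t | par y F.≟ x
      ... | no p | yes e | _ | _ = inj₁ (p , e)
      ... | _ | _ | no p | yes e = inj₂ (p , e)
      ... | yes p | _ | yes q | _ = ⊥-elim (no-cross x y a λ { (up r _) → r p ; (down r _) → r q })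
      ... | yes p | _ | no _ | no q = ⊥-elim (no-cross x y a λ { (up r _) → r p ; (down _ e) → q e })
      ... | no _ | no p | yes q | _ = ⊥-elim (no-cross x y a λ { (up _ e) → p e ; (down r _) → r q })
      ... | no _ | no p | no _ | no q = ⊥-elim (no-cross x y a λ { (up _ e) → p e ; (down _ e) → q e })

  -- Cutting the tree into blocks of bounded size.

  Σℕ : ℕ → (ℕ → ℕ) → ℕ
  Σℕ zero    f = 0
  Σℕ (suc m) f = Σℕ m f + f m

  Σℕ-cong : ∀ m {f g} → (∀ i → i < m → f i ≡ g i) → Σℕ m f ≡ Σℕ m g
  Σℕ-cong zero    h = refl
  Σℕ-cong (suc m) h = cong₂ _+_ (Σℕ-cong m (λ i p → h i (m<n⇒m<1+n p))) (h m ≤-refl)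

  Σℕ-mono : ∀ m {f g} → (∀ i → f i ≤ g i) → Σℕ m f ≤ Σℕ m g
  Σℕ-mono zero    h = z≤n
  Σℕ-mono (suc m) h = Σℕ-mono m h ⟨+⟩ h m

  Σℕ-shift : ∀ m f → Σℕ (suc m) f ≡ f 0 + Σℕ m (f ∘ suc)
  Σℕ-shift zero    f = +-comm 0 (f 0)
  Σℕ-shift (suc m) f = trans (cong (_+ f (suc m)) (Σℕ-shift m f)) (+-assoc (f 0) _ _)

  Σℕ-∑ : ∀ {n} m (f : ℕ → Fin n → ℕ) → Σℕ m (λ i → ∑ (f i)) ≡ ∑ (λ x → Σℕ m (λ i → f i x))
  Σℕ-∑ {n} zero    f = sym (∑-zero n)
  Σℕ-∑ (suc m) f = trans (cong (_+ ∑ (f m)) (Σℕ-∑ m f)) (sym (∑-+ (λ x → Σℕ m (λ i → f i x)) (f m)))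

  Σℕ-hit : ∀ m j → j < m → 1 ≤ Σℕ m (λ i → 𝟙 (j Data.Nat.≡ᵇ i))
  Σℕ-hit (suc m) j (s≤s j≤m) with j ≟ m
  ... | yes refl = ≤-trans (≤-reflexive (cong 𝟙 (sym (≡ᵇ-refl m)))) (m≤n+m _ _)
    where
    ≡ᵇ-refl : ∀ m → (m Data.Nat.≡ᵇ m) ≡ true
    ≡ᵇ-refl zero    = refl
    ≡ᵇ-refl (suc m) = ≡ᵇ-refl m
  ... | no q = ≤-trans (Σℕ-hit m j (≤∧≢⇒< j≤m q)) (m≤m+n _ _)

  Σℕ-min : ∀ m (f : ℕ → ℕ) B → Σℕ (suc m) f ≤ B → ∃ λ i → i ≤ m × suc m * f i ≤ B
  Σℕ-min m f B h with go m
    where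
    go : ∀ m → ∃ λ i → i ≤ m × suc m * f i ≤ Σℕ (suc m) f
    go zero = 0 , z≤n , ≤-reflexive (+-identityʳ _)
    go (suc m) with go m
    ... | i , i≤m , p with f i ≤? f (suc m)
    ...   | yes q = i , m≤n⇒m≤1+n i≤m , ≤-trans (+-monoʳ-≤ (f i) p) (≤-trans (+-monoˡ-≤ _ q) (≤-reflexive (+-comm (f (suc m)) _)))
    ...   | no q = suc m , ≤-refl , ≤-trans (≤-reflexive (+-comm (f (suc m)) _)) (+-monoˡ-≤ (f (suc m)) (≤-trans ((suc m) ⊛ <⇒≤ (≰⇒> q)) p))
  ... | i , i≤m , p = i , i≤m , ≤-trans p h

  ≡ᵇ-true : ∀ {m n} → (m Data.Nat.≡ᵇ n) ≡ true → m ≡ n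
  ≡ᵇ-true {m} {n} h = ≡ᵇ⇒≡ m n (subst Data.Bool.T (sym h) tt)

  true-≡ᵇ : ∀ {m n} → m ≡ n → (m Data.Nat.≡ᵇ n) ≡ true
  true-≡ᵇ {zero}  refl = refl
  true-≡ᵇ {suc m} refl = true-≡ᵇ {m} refl

  ∨-false : ∀ {a b} → (a ∨ b) ≡ false → a ≡ false × b ≡ false
  ∨-false {false} {false} _ = refl , refl

  ∨-true : ∀ {a b} → (a ∨ b) ≡ true → a ≡ true ⊎ b ≡ true
  ∨-true {true}  _ = inj₁ refl
  ∨-true {false} h = inj₂ h

  ∈-filterᵇ⁺ : ∀ {A : Set} (p : A → Bool) {x xs} → x ∈ xs → p x ≡ true → x ∈ filterᵇ p xs
  ∈-filterᵇ⁺ p {xs = x ∷ xs} (here refl) h rewrite h = here refl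
  ∈-filterᵇ⁺ p {xs = y ∷ xs} (there q) h with p y
  ... | true  = there (∈-filterᵇ⁺ p q h)
  ... | false = ∈-filterᵇ⁺ p q h

  ∈-filterᵇ⁻ : ∀ {A : Set} (p : A → Bool) {x} xs → x ∈ filterᵇ p xs → x ∈ xs × p x ≡ true
  ∈-filterᵇ⁻ p (y ∷ xs) q with p y in e
  ∈-filterᵇ⁻ p (y ∷ xs) (here refl) | true = here refl , e
  ∈-filterᵇ⁻ p (y ∷ xs) (there q)   | true with ∈-filterᵇ⁻ p xs q
  ... | a , b = there a , b
  ∈-filterᵇ⁻ p (y ∷ xs) q | false with ∈-filterᵇ⁻ p xs q
  ... | a , b = there a , b

  AllPairs-filterᵇ : ∀ {A : Set} {R : A → A → Set} (p : A → Bool) {xs} → AllPairs R xs → AllPairs R (filterᵇ p xs)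
  AllPairs-filterᵇ p [] = []
  AllPairs-filterᵇ p {x ∷ xs} (r ∷ rs) with p x
  ... | true  = All.tabulate (λ {y} q → All.lookup r (proj₁ (∈-filterᵇ⁻ p xs q))) ∷ AllPairs-filterᵇ p rs
  ... | false = AllPairs-filterᵇ p rs

  module SortBy {n} (d : Fin n → ℕ) where
    -- Distinctness is part of the relation, so that a sorted list is automatically free of
    -- repetitions.
    _≺_ : Fin n → Fin n → Set
    a ≺ b = a ≢ b × d a ≤ d b

    insert : ∀ x ys → AllPairs _≺_ ys → x ∉ ys → ∃ λ zs → AllPairs _≺_ zs × (∀ z → z ≡ x ⊎ z ∈ ys → z ∈ zs) × (∀ z → z ∈ zs → z ≡ x ⊎ z ∈ ys)
    insert x [] _ _ = x ∷ [] , [] ∷ [] , (λ { z (inj₁ e) → here e ; z (inj₂ ()) }) , (λ { z (here e) → inj₁ e })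
    insert x (y ∷ ys) (r ∷ rs) x∉ with d x ≤? d y
    ... | yes p = x ∷ y ∷ ys , (((λ e → x∉ (here e)) , p) ∷ All.tabulate (λ q → (λ e → x∉ (there (subst (_∈ ys) (sym e) q))) , ≤-trans p (proj₂ (All.lookup r q)))) ∷ r ∷ rs
                , (λ { z (inj₁ e) → here e ; z (inj₂ q) → there q }) , (λ { z (here e) → inj₁ e ; z (there q) → inj₂ q })
    ... | no p with insert x ys rs (λ q → x∉ (there q))
    ...   | zs , s , into , from = y ∷ zs , All.tabulate (λ {z} q → [ (λ { refl → (λ e → x∉ (here (sym e))) , <⇒≤ (≰⇒> p) }) , All.lookup r ]′ (from z q)) ∷ s
                , (λ { z (inj₁ e) → there (into z (inj₁ e)) ; z (inj₂ (here e)) → here e ; z (inj₂ (there q)) → there (into z (inj₂ q)) })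
                , (λ { z (here e) → inj₂ (here e) ; z (there q) → [ inj₁ , (λ r → inj₂ (there r)) ]′ (from z q) })

    sortBy : ∀ xs → Unique xs → ∃ λ ys → AllPairs _≺_ ys × (∀ z → z ∈ xs → z ∈ ys) × (∀ z → z ∈ ys → z ∈ xs)
    sortBy [] _ = [] , [] , (λ z p → p) , (λ z p → p)
    sortBy (x ∷ xs) (u ∷ us) with sortBy xs us
    ... | ys , s , into , from with insert x ys s (λ q → All-∉ u (from x q))
    ...   | zs , s' , into' , from' = zs , s' , (λ { z (here e) → into' z (inj₁ e) ; z (there p) → into' z (inj₂ (into z p)) })
                                    , (λ z p → [ here , (λ q → there (from z q)) ]′ (from' z p))

  placed : ∀ {A : Set} → List A → List A → List A
  placed S []       = S
  placed S (x ∷ xs) = placed (x ∷ S) xs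

  ∈-placed⁺ : ∀ {A : Set} {z : A} S xs → z ∈ S ⊎ z ∈ xs → z ∈ placed S xs
  ∈-placed⁺ S []       (inj₁ p) = p
  ∈-placed⁺ S (x ∷ xs) (inj₁ p) = ∈-placed⁺ (x ∷ S) xs (inj₁ (there p))
  ∈-placed⁺ S (x ∷ xs) (inj₂ (here e)) = ∈-placed⁺ (x ∷ S) xs (inj₁ (here e))
  ∈-placed⁺ S (x ∷ xs) (inj₂ (there p)) = ∈-placed⁺ (x ∷ S) xs (inj₂ p)

  ∈-placed⁻ : ∀ {A : Set} {z : A} S xs → z ∈ placed S xs → z ∈ S ⊎ z ∈ xs
  ∈-placed⁻ S []       p = inj₁ p
  ∈-placed⁻ S (x ∷ xs) p with ∈-placed⁻ (x ∷ S) xs p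
  ... | inj₁ (here e)  = inj₂ (here e)
  ... | inj₁ (there q) = inj₁ q
  ... | inj₂ q         = inj₂ (there q)

  Ok-append : ∀ {n} {par : Fin n → Fin n} {A S xs rest} → Ok par A xs → (∀ z → z ∈ A → z ∈ S) → (∀ z → z ∈ xs → z ∉ S) →
              Ok par (placed S xs) rest → Ok par S (xs ++ rest)
  Ok-append nil sub dis ok = ok
  Ok-append {S = S} (place {x = x} {xs} p x∉ okA) sub dis ok =
    place (sub _ p) (dis x (here refl)) (Ok-append okA (λ { z (here e) → here e ; z (there q) → there (sub z q) })
      (λ { z q (here refl) → Ok-fresh okA (here refl) q ; z q (there r) → dis z (there q) r }) ok)

  -- The tree cut at the depths congruent to -σ modulo H = 1 + H'.
  module Decompose {n} {T : Graph n} {t : Fin n} (R : Rooted T t) (Δ : ℕ) (deg≤ : ∀ x → cnt (adj T x) ≤ Δ) (H' σ h : ℕ) (σ≤ : σ ≤ H') where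
    open Rooted R

    next : ℕ → ℕ
    next l = if l Data.Nat.≡ᵇ H' then 0 else suc l

    -- This is σ + d modulo 1 + `H'`, by recursion so that passing from a parent to a child is a
    -- single `next`.
    lev : ℕ → ℕ
    lev zero    = σ
    lev (suc d) = next (lev d)

    lv : Fin n → ℕ
    lv x = lev (depth x)

    lev≤ : ∀ d → lev d ≤ H'
    lev≤ zero    = σ≤
    lev≤ (suc d) with lev d Data.Nat.≡ᵇ H' in e
    ... | true  = z≤n
    ... | false = ≤∧≢⇒< (lev≤ d) (λ q → true≢false (true-≡ᵇ q) e)

    next≤ : ∀ l → next l ≤ suc l
    next≤ l with l Data.Nat.≡ᵇ H'
    ... | true  = z≤n
    ... | false = ≤-refl

    next-suc : ∀ l → (next l Data.Nat.≡ᵇ 0) ≡ false → next l ≡ suc l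
    next-suc l h with l Data.Nat.≡ᵇ H'
    ... | false = refl

    next-pos : ∀ l → (l Data.Nat.≡ᵇ H') ≡ false → (next l Data.Nat.≡ᵇ 0) ≡ false
    next-pos l h rewrite h = refl

    -- Children of t start blocks of their own, because t is placed in advance and belongs to no
    -- block.
    isTop : Fin n → Bool
    isTop x = (lv x Data.Nat.≡ᵇ 0) ∨ (par x == t)

    -- The number is fuel. The depth of x suffices: each step to the parent lowers the depth by 1,
    -- and at depth 1 a top is reached.
    topN : ℕ → Fin n → Fin n
    topN zero    x = x
    topN (suc d) x = if isTop x then x else topN d (par x)

    innerN : ℕ → Fin n → ℕ
    innerN zero    x = 0
    innerN (suc d) x = if isTop x then 0 else suc (innerN d (par x))

    top : Fin n → Fin n
    top x = topN (depth x) x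

    inner : Fin n → ℕ
    inner x = innerN (depth x) x

    top-yes : ∀ x → isTop x ≡ true → top x ≡ x
    top-yes x h = go (depth x)
      where
      go : ∀ d → topN d x ≡ x
      go zero = refl
      go (suc d) rewrite h = refl

    inner-yes : ∀ x → isTop x ≡ true → inner x ≡ 0
    inner-yes x h = go (depth x)
      where
      go : ∀ d → innerN d x ≡ 0
      go zero = refl
      go (suc d) rewrite h = refl

    top-no : ∀ x → x ≢ t → isTop x ≡ false → top x ≡ top (par x)
    top-no x q h = trans (cong (λ d → topN d x) (par-dep x q)) (cong (λ b → if b then x else top (par x)) h)

    inner-no : ∀ x → x ≢ t → isTop x ≡ false → inner x ≡ suc (inner (par x))
    inner-no x q h = trans (cong (λ d → innerN d x) (par-dep x q)) (cong (λ b → if b then 0 else suc (inner (par x))) h)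

    lv-par : ∀ x → x ≢ t → lv x ≡ next (lv (par x))
    lv-par x q = cong lev (par-dep x q)

    no-par : ∀ x → isTop x ≡ false → par x ≢ t
    no-par x h e = true≢false (trans (cong (_== t) e) (==-refl t)) (proj₂ (∨-false {lv x Data.Nat.≡ᵇ 0} h))

    block-ind : (P : Fin n → Set) → (∀ x → x ≢ t → isTop x ≡ true → P x) →
                (∀ x → x ≢ t → isTop x ≡ false → P (par x) → P x) → ∀ x → x ≢ t → P x
    block-ind P base step x = go (depth x) x refl
      where
      go : ∀ d x → depth x ≡ d → x ≢ t → P x
      go d x e q with isTop x in h
      ... | true  = base x q h
      go zero    x e q | false = ⊥-elim (case trans (sym e) (par-dep x q) of λ ())
      go (suc d) x e q | false = step x q h (go d (par x) (suc-injective (trans (sym (par-dep x q)) e)) (no-par x h))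

    top-top : ∀ x → x ≢ t → top x ≢ t × isTop (top x) ≡ true × depth (top x) ≤ depth x
    top-top = block-ind _ (λ x q h → subst (λ y → y ≢ t × isTop y ≡ true × depth y ≤ depth x) (sym (top-yes x h)) (q , h , ≤-refl))
      (λ x q h (a , b , c) → subst (λ y → y ≢ t × isTop y ≡ true × depth y ≤ depth x) (sym (top-no x q h))
        (a , b , ≤-trans c (≤-trans (n≤1+n _) (≤-reflexive (sym (par-dep x q))))))

    inner≤lv : ∀ x → x ≢ t → inner x ≤ lv x
    inner≤lv = block-ind _ (λ x q h → ≤-trans (≤-reflexive (inner-yes x h)) z≤n)
      (λ x q h ih → ≤-trans (≤-reflexive (inner-no x q h)) (≤-trans (s≤s ih) (≤-reflexive (sym (trans (lv-par x q)
        (next-suc (lv (par x)) (trans (cong (Data.Nat._≡ᵇ 0) (sym (lv-par x q))) (proj₁ (∨-false {lv x Data.Nat.≡ᵇ 0} h)))))))))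

    -- Inside a block, level and distance from the top grow together. The top has level 0, or else
    -- is a child of t and has depth 1; these are the two alternatives.
    shallow-level : ∀ x → x ≢ t → lv x ≤ inner x ⊎ depth x ≤ suc (inner x)
    shallow-level = block-ind _ base
      (λ x q h → [ (λ p → inj₁ (≤-trans (≤-reflexive (lv-par x q)) (≤-trans (next≤ _) (≤-trans (s≤s p) (≤-reflexive (sym (inner-no x q h)))))))
                 , (λ p → inj₂ (≤-trans (≤-reflexive (par-dep x q)) (s≤s (≤-trans p (≤-reflexive (sym (inner-no x q h))))))) ]′)
      where
      base : ∀ x → x ≢ t → isTop x ≡ true → lv x ≤ inner x ⊎ depth x ≤ suc (inner x)
      base x q h with ∨-true {lv x Data.Nat.≡ᵇ 0} h
      ... | inj₁ e = inj₁ (≤-trans (≤-reflexive (≡ᵇ-true e)) z≤n)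
      ... | inj₂ e = inj₂ (≤-trans (≤-reflexive (par-dep x q)) (s≤s (≤-trans (≤-reflexive (trans (cong depth (==⇒≡ e)) dep-t)) z≤n)))

    -- Distance 1 + 2h from the top leaves 2h steps for the parent. Level `H'` is excluded because
    -- it ends a period: children of such vertices start new blocks.
    deep : Fin n → Bool
    deep y = not (y == t) ∧ ((suc (2 * h) Data.Nat.≤ᵇ inner y) ∧ not (lv y Data.Nat.≡ᵇ H'))

    deep-t : deep t ≡ false
    deep-t rewrite ==-refl t = refl

    module _ {y} (dy : deep y ≡ true) where
      deep≢t : y ≢ t
      deep≢t refl = true≢false dy deep-t

      deep-inner : suc (2 * h) ≤ inner y
      deep-inner = ≤ᵇ-true (proj₁ (∧-true {suc (2 * h) Data.Nat.≤ᵇ inner y} (proj₂ (∧-true {not (y == t)} dy))))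

      deep-lv : (lv y Data.Nat.≡ᵇ H') ≡ false
      deep-lv = not-true (proj₂ (∧-true {suc (2 * h) Data.Nat.≤ᵇ inner y} (proj₂ (∧-true {not (y == t)} dy))))

      deep-notTop : isTop y ≡ false
      deep-notTop with isTop y in e
      ... | false = refl
      ... | true  = ⊥-elim (<-irrefl refl (≤-trans (s≤s z≤n) (≤-trans deep-inner (≤-reflexive (inner-yes y e)))))

    private module Sort = SortBy depth
    open Sort using (_≺_)

    sorted : ∃ λ ys → AllPairs _≺_ ys × (∀ z → z ∈ allFin n → z ∈ ys) × (∀ z → z ∈ ys → z ∈ allFin n)
    sorted = Sort.sortBy (allFin n) (allFin⁺ n)

    ord : List (Fin n)
    ord = proj₁ sorted

    ∈ord : ∀ x → x ∈ ord
    ∈ord x = proj₁ (proj₂ (proj₂ sorted)) x (∈-allFin x)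

    member : Fin n → Fin n → Bool
    member ρ x = not (x == t) ∧ (not (isTop x) ∧ (top x == ρ))

    not-≡t : ∀ {x} → not (x == t) ≡ true → x ≢ t
    not-≡t {x} h refl = true≢false (==-refl x) (not-true h)

    ≡t-not : ∀ {x} → x ≢ t → not (x == t) ≡ true
    ≡t-not q rewrite ≢⇒== q = refl

    member⁻ : ∀ {ρ x} → member ρ x ≡ true → x ≢ t × isTop x ≡ false × top x ≡ ρ
    member⁻ {ρ} {x} h = not-≡t (proj₁ (∧-true {not (x == t)} h)) , not-true (proj₁ (∧-true {not (isTop x)} r)) , ==⇒≡ (proj₂ (∧-true {not (isTop x)} r))
      where r = proj₂ (∧-true {not (x == t)} h)

    member⁺ : ∀ {ρ x} → x ≢ t → isTop x ≡ false → top x ≡ ρ → member ρ x ≡ true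
    member⁺ {x = x} q h refl = ∧-intro (≡t-not q) (∧-intro (cong not h) (==-refl (top x)))

    blockOf : Fin n → List (Fin n)
    blockOf ρ = filterᵇ (member ρ) ord

    tops : List (Fin n)
    tops = filterᵇ (λ x → not (x == t) ∧ isTop x) ord

    ∈-block⁻ : ∀ {ρ x} → x ∈ blockOf ρ → x ≢ t × isTop x ≡ false × top x ≡ ρ
    ∈-block⁻ {ρ} p = member⁻ (proj₂ (∈-filterᵇ⁻ (member ρ) ord p))

    ∈-block⁺ : ∀ {ρ x} → x ≢ t → isTop x ≡ false → top x ≡ ρ → x ∈ blockOf ρ
    ∈-block⁺ {ρ} {x} q h e = ∈-filterᵇ⁺ (member ρ) (∈ord x) (member⁺ q h e)

    flat : List (Fin n) → List (Fin n)
    flat []       = []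
    flat (ρ ∷ ρs) = ρ ∷ blockOf ρ ++ flat ρs

    par-before : ∀ {x zs} → x ≢ t → All (x ≺_) zs → par x ∉ x ∷ zs
    par-before {x} q all p = <-irrefl refl (≤-trans (≤-reflexive (sym (par-dep x q))) (go p))
      where
      go : par x ∈ x ∷ _ → depth x ≤ depth (par x)
      go (here e)  = ≤-reflexive (cong depth (sym e))
      go (there r) = proj₂ (All.lookup all r)

    -- In an order by depth a parent precedes its children; so when a member is reached, its parent
    -- is ρ or a member already placed.
    local : ∀ ρ → isTop ρ ≡ true → Ok par (ρ ∷ []) (blockOf ρ)
    local ρ topρ = go ord (proj₁ (proj₂ sorted)) (ρ ∷ []) (here refl) (λ x m q → ⊥-elim (q (∈ord x)))
        (λ { x (here refl) m → ⊥-elim (true≢false topρ (proj₁ (proj₂ (member⁻ m)))) })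
      where
      go : ∀ zs → AllPairs _≺_ zs → ∀ S → ρ ∈ S → (∀ x → member ρ x ≡ true → x ∉ zs → x ∈ S) →
           (∀ x → x ∈ S → member ρ x ≡ true → x ∉ zs) → Ok par S (filterᵇ (member ρ) zs)
      go [] _ S _ _ _ = nil
      go (z ∷ zs) (a ∷ as) S ρ∈ cover fresh with member ρ z in m
      ... | false = go zs as S ρ∈ (λ x mx q → cover x mx (λ { (here refl) → true≢false mx m ; (there r) → q r })) (λ x p mx q → fresh x p mx (there q))
      ... | true  = place par∈ (λ p → fresh z p m (here refl)) (go zs as (z ∷ S) (there ρ∈)
          (λ x mx q → case x F.≟ z of λ { (yes e) → here e ; (no ne) → there (cover x mx (λ { (here e) → ne e ; (there r) → q r })) })
          (λ { x (here refl) mx q → proj₁ (All.lookup a q) refl ; x (there p) mx q → fresh x p mx (there q) }))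
        where
        z≢t = proj₁ (member⁻ m)
        z-no = proj₁ (proj₂ (member⁻ m))
        top-par : top (par z) ≡ ρ
        top-par = trans (sym (top-no z z≢t z-no)) (proj₂ (proj₂ (member⁻ m)))
        par∈ : par z ∈ S
        par∈ = byCase (isTop (par z)) refl
          where
          byCase : ∀ b → isTop (par z) ≡ b → par z ∈ S
          byCase true  e = subst (_∈ S) (trans (sym top-par) (top-yes (par z) e)) ρ∈
          byCase false e = cover (par z) (member⁺ (no-par z z-no) e top-par) (par-before z≢t a)

    module _ {ρ} (topρ : isTop ρ ≡ true) where
      path : ∀ x → x ≢ t → top x ≡ ρ → Path par (blockOf ρ) ρ (inner x) x
      path = block-ind (λ x → top x ≡ ρ → Path par (blockOf ρ) ρ (inner x) x)
        (λ x q h e → subst₂ (Path par (blockOf ρ) ρ) (sym (inner-yes x h)) (trans (sym e) (top-yes x h)) stop)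
        (λ x q h ih e → subst (λ i → Path par (blockOf ρ) ρ i x) (sym (inner-no x q h)) (up (∈-block⁺ q h e) (ih (trans (sym (top-no x q h)) e))))

    -- Every vertex of class j + 1 has its parent in class j, and a vertex has at most Δ neighbours.
    level-count : ∀ (p : ℕ → Fin n → Bool) → cnt (p 0) ≤ 1 → (∀ j x → p (suc j) x ≡ true → x ≢ t × p j (par x) ≡ true) → ∀ j → cnt (p j) ≤ Δ ^ j
    level-count p h₀ hs zero    = h₀
    level-count p h₀ hs (suc j) = begin
      cnt (p (suc j))                                       ≤⟨ ∑-mono ptw ⟩
      ∑ (λ x → ∑ (λ y → 𝟙 (p j y) * 𝟙 (adj T y x)))         ≡⟨ ∑-swap _ ⟩
      ∑ (λ y → ∑ (λ x → 𝟙 (p j y) * 𝟙 (adj T y x)))         ≡⟨ ∑-cong (λ y → ∑-*ˡ (𝟙 (p j y)) _) ⟩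
      ∑ (λ y → 𝟙 (p j y) * cnt (adj T y))                   ≤⟨ ∑-mono (λ y → 𝟙 (p j y) ⊛ deg≤ y) ⟩
      ∑ (λ y → 𝟙 (p j y) * Δ)                               ≡⟨ ∑-*ʳ Δ _ ⟩
      cnt (p j) * Δ                                         ≤⟨ level-count p h₀ hs j ⟨*⟩ ≤-refl ⟩
      Δ ^ j * Δ                                             ≡⟨ *-comm (Δ ^ j) Δ ⟩
      Δ ^ suc j                                             ∎
      where
      open ≤-Reasoning
      ptw : ∀ x → 𝟙 (p (suc j) x) ≤ ∑ (λ y → 𝟙 (p j y) * 𝟙 (adj T y x))
      ptw x with p (suc j) x in e
      ... | false = z≤n
      ... | true with hs j x e
      ...   | q , r = ≤-trans (≤-reflexive (sym (cong₂ (λ a b → 𝟙 a * 𝟙 b) r (trans (adj-sym T _ _) (par-adj x q)))))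
                        (∑-term (λ y → 𝟙 (p j y) * 𝟙 (adj T y x)) (par x))

    geo : ℕ → ℕ
    geo J = Σℕ J (Δ ^_)

    by-levels : ∀ (q : Fin n → Bool) (r : Fin n → ℕ) J → (∀ x → q x ≡ true → r x < J) →
                (∀ j → cnt (λ x → q x ∧ (r x Data.Nat.≡ᵇ j)) ≤ Δ ^ j) → cnt q ≤ geo J
    by-levels q r J h hc = begin
      cnt q                                                  ≤⟨ ∑-mono ptw ⟩
      ∑ (λ x → Σℕ J (λ j → 𝟙 (q x ∧ (r x Data.Nat.≡ᵇ j))))   ≡⟨ sym (Σℕ-∑ J (λ j x → 𝟙 (q x ∧ (r x Data.Nat.≡ᵇ j)))) ⟩
      Σℕ J (λ j → cnt (λ x → q x ∧ (r x Data.Nat.≡ᵇ j)))     ≤⟨ Σℕ-mono J hc ⟩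
      geo J                                                  ∎
      where
      open ≤-Reasoning
      ptw : ∀ x → 𝟙 (q x) ≤ Σℕ J (λ j → 𝟙 (q x ∧ (r x Data.Nat.≡ᵇ j)))
      ptw x with q x in e
      ... | false = z≤n
      ... | true  = Σℕ-hit J (r x) (h x e)

    depth-count : ∀ J → cnt (λ x → depth x Data.Nat.<ᵇ J) ≤ geo J
    depth-count J = by-levels (λ x → depth x Data.Nat.<ᵇ J) depth J (λ x → <ᵇ-true) (λ j → ≤-trans (cnt-mono (λ x e → proj₂ (∧-true {depth x Data.Nat.<ᵇ J} e)))
        (level-count (λ j x → depth x Data.Nat.≡ᵇ j)
          (≤-trans (cnt-mono {q = _== t} (λ x e → case x F.≟ t of λ { (yes refl) → ==-refl x ; (no q) → ⊥-elim (case trans (sym (par-dep x q)) (≡ᵇ-true e) of λ ()) })) (≤-reflexive (cnt-point t)))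
          down j))
      where
      down : ∀ j x → (depth x Data.Nat.≡ᵇ suc j) ≡ true → x ≢ t × (depth (par x) Data.Nat.≡ᵇ j) ≡ true
      down j x e = q , true-≡ᵇ (suc-injective (trans (sym (par-dep x q)) (≡ᵇ-true e)))
        where
        q : x ≢ t
        q refl = case trans (sym (≡ᵇ-true {depth x} e)) dep-t of λ ()

    -- Members at distance j from the top number at most Δ^j, and distances are at most `H'` because
    -- they never exceed the level.
    block-size : ∀ ρ → isTop ρ ≡ true → ρ ≢ t → suc (length (blockOf ρ)) ≤ geo (suc H')
    block-size ρ topρ ρ≢t = begin
      length (ρ ∷ blockOf ρ)                       ≡⟨ sym (cnt-elem (∉-All (Ok-fresh (local ρ topρ) (here refl)) ∷ Ok-unique (local ρ topρ))) ⟩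
      cnt (λ x → elem x (ρ ∷ blockOf ρ))           ≤⟨ cnt-mono in-block ⟩
      cnt q                                        ≤⟨ by-levels q inner (suc H') (λ x e → s≤s (≤-trans (inner≤lv x (q-t x e)) (lev≤ (depth x)))) counts ⟩
      geo (suc H')                                 ∎
      where
      open ≤-Reasoning
      q : Fin n → Bool
      q x = not (x == t) ∧ (top x == ρ)
      q-t : ∀ x → q x ≡ true → x ≢ t
      q-t x e = not-≡t (proj₁ (∧-true {not (x == t)} e))
      q-top : ∀ x → q x ≡ true → top x ≡ ρ
      q-top x e = ==⇒≡ (proj₂ (∧-true {not (x == t)} e))
      q⁺ : ∀ {x} → x ≢ t → top x ≡ ρ → q x ≡ true
      q⁺ {x} p refl = ∧-intro (≡t-not p) (==-refl (top x))
      in-block : ∀ x → elem x (ρ ∷ blockOf ρ) ≡ true → q x ≡ true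
      in-block x e with elem⇒∈ {i = x} (ρ ∷ blockOf ρ) e
      ... | here refl = q⁺ ρ≢t (top-yes ρ topρ)
      ... | there p   = q⁺ (proj₁ (∈-block⁻ p)) (proj₂ (proj₂ (∈-block⁻ p)))
      inner-zero : ∀ x → x ≢ t → inner x ≡ 0 → isTop x ≡ true
      inner-zero x p e = byCase (isTop x) refl
        where
        byCase : ∀ b → isTop x ≡ b → isTop x ≡ true
        byCase true  h = h
        byCase false h = ⊥-elim (case trans (sym e) (inner-no x p h) of λ ())
      counts : ∀ j → cnt (λ x → q x ∧ (inner x Data.Nat.≡ᵇ j)) ≤ Δ ^ j
      counts = level-count (λ j x → q x ∧ (inner x Data.Nat.≡ᵇ j))
        (≤-trans (cnt-mono {q = _== ρ} zeroth) (≤-reflexive (cnt-point ρ))) step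
        where
        zeroth : ∀ x → (q x ∧ (inner x Data.Nat.≡ᵇ 0)) ≡ true → (x == ρ) ≡ true
        zeroth x e = true-does (x F.≟ ρ) (trans (sym (top-yes x (inner-zero x (q-t x (proj₁ (∧-true {q x} e))) (≡ᵇ-true (proj₂ (∧-true {q x} e)))))) (q-top x (proj₁ (∧-true {q x} e))))
        step : ∀ j x → (q x ∧ (inner x Data.Nat.≡ᵇ suc j)) ≡ true → x ≢ t × (q (par x) ∧ (inner (par x) Data.Nat.≡ᵇ j)) ≡ true
        step j x e = x≢t , byCase (isTop x) refl
          where
          x≢t = q-t x (proj₁ (∧-true {q x} e))
          inn : inner x ≡ suc j
          inn = ≡ᵇ-true (proj₂ (∧-true {q x} e))
          byCase : ∀ b → isTop x ≡ b → (q (par x) ∧ (inner (par x) Data.Nat.≡ᵇ j)) ≡ true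
          byCase true  h = ⊥-elim (case trans (sym (inner-yes x h)) inn of λ ())
          byCase false h = ∧-intro (q⁺ (no-par x h) (trans (sym (top-no x x≢t h)) (q-top x (proj₁ (∧-true {q x} e))))) (true-≡ᵇ (suc-injective (trans (sym (inner-no x x≢t h)) inn)))

    block : ∀ ρ → isTop ρ ≡ true → ρ ≢ t → Block R deep h (geo (suc H')) ρ (blockOf ρ)
    block ρ topρ ρ≢t = record
      { local-ok = local ρ topρ
      ; root = root
      ; deep-path = deep-path
      ; deep-child = λ y y∈ dy c c≢t e → child y y∈ dy c c≢t e
      ; size = block-size ρ topρ ρ≢t }
      where
      root : deep ρ ≡ false
      root = byCase (deep ρ) refl
        where
        byCase : ∀ b → deep ρ ≡ b → deep ρ ≡ false
        byCase false e = e
        byCase true  e = ⊥-elim (true≢false topρ (deep-notTop e))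
      deep-path : ∀ y → y ∈ blockOf ρ → deep y ≡ true → ∃ λ i → Path par (blockOf ρ) ρ (2 * h + i) (par y)
      deep-path y y∈ dy = inner (par y) ∸ 2 * h , subst (λ j → Path par (blockOf ρ) ρ j (par y)) (sym (m+[n∸m]≡n le)) (path topρ (par y) (no-par y h') (trans (sym (top-no y (deep≢t dy) h')) (proj₂ (proj₂ (∈-block⁻ y∈)))))
        where
        h' = deep-notTop dy
        le : 2 * h ≤ inner (par y)
        le = ≤-pred (≤-trans (deep-inner dy) (≤-reflexive (inner-no y (deep≢t dy) h')))
      child : ∀ y → y ∈ blockOf ρ → deep y ≡ true → ∀ c → c ≢ t → par c ≡ y → c ∈ blockOf ρ
      child y y∈ dy c c≢t refl = ∈-block⁺ c≢t noTop (trans (top-no c c≢t noTop) (proj₂ (proj₂ (∈-block⁻ y∈))))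
        where
        noTop : isTop c ≡ false
        noTop = cong₂ _∨_ (trans (cong (Data.Nat._≡ᵇ 0) (lv-par c c≢t)) (next-pos (lv (par c)) (deep-lv {par c} dy))) (≢⇒== {i = par c} (deep≢t {par c} dy))

    -- Tops are sorted by depth. The block containing par ρ has a top no deeper than par ρ, hence
    -- less deep than ρ, so it has been placed already.
    global : ∀ ρs → AllPairs _≺_ ρs → (∀ ρ → ρ ∈ ρs → ρ ≢ t × isTop ρ ≡ true) → ∀ S → t ∈ S →
             (∀ x → x ≢ t → top x ∉ ρs → x ∈ S) → (∀ x → x ∈ S → x ≡ t ⊎ top x ∉ ρs) → Ok par S (flat ρs)
    global [] _ _ S _ _ _ = nil
    global (ρ ∷ ρs) (a ∷ as) isT S t∈ cover fresh = place par∈ ρ∉ (Ok-append (local ρ topρ) (λ { z (here e) → here e }) dis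
        (global ρs as (λ r p → isT r (there p)) (placed (ρ ∷ S) (blockOf ρ)) (∈-placed⁺ (ρ ∷ S) (blockOf ρ) (inj₁ (there t∈))) cover' fresh'))
      where
      ρ≢t = proj₁ (isT ρ (here refl))
      topρ = proj₂ (isT ρ (here refl))
      ρ∉ρs : ρ ∉ ρs
      ρ∉ρs p = proj₁ (All.lookup a p) refl
      par∈ : par ρ ∈ S
      par∈ = byCase (par ρ F.≟ t)
        where
        byCase : Dec (par ρ ≡ t) → par ρ ∈ S
        byCase (yes e) = subst (_∈ S) (sym e) t∈
        byCase (no q)  = cover (par ρ) q (λ p → <-irrefl refl (≤-trans (≤-reflexive (sym (par-dep ρ ρ≢t))) (≤-trans (later p) (proj₂ (proj₂ (top-top (par ρ) q))))))
          where
          later : ∀ {r} → r ∈ ρ ∷ ρs → depth ρ ≤ depth r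
          later (here refl) = ≤-refl
          later (there p)   = proj₂ (All.lookup a p)
      ρ∉ : ρ ∉ S
      ρ∉ p = [ ρ≢t , (λ q → q (here (top-yes ρ topρ))) ]′ (fresh ρ p)
      dis : ∀ z → z ∈ blockOf ρ → z ∉ ρ ∷ S
      dis z p (here refl) = true≢false topρ (proj₁ (proj₂ (∈-block⁻ p)))
      dis z p (there q)   = [ proj₁ (∈-block⁻ p) , (λ r → r (here (proj₂ (proj₂ (∈-block⁻ p))))) ]′ (fresh z q)
      cover' : ∀ x → x ≢ t → top x ∉ ρs → x ∈ placed (ρ ∷ S) (blockOf ρ)
      cover' x x≢t q = ∈-placed⁺ (ρ ∷ S) (blockOf ρ) (byCase (top x F.≟ ρ) (isTop x) refl)
        where
        byCase : Dec (top x ≡ ρ) → ∀ b → isTop x ≡ b → x ∈ ρ ∷ S ⊎ x ∈ blockOf ρ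
        byCase (no ne) b     h = inj₁ (there (cover x x≢t (λ { (here e) → ne e ; (there p) → q p })))
        byCase (yes e) true  h = inj₁ (here (trans (sym (top-yes x h)) e))
        byCase (yes e) false h = inj₂ (∈-block⁺ x≢t h e)
      fresh' : ∀ x → x ∈ placed (ρ ∷ S) (blockOf ρ) → x ≡ t ⊎ top x ∉ ρs
      fresh' x p with ∈-placed⁻ (ρ ∷ S) (blockOf ρ) p
      ... | inj₁ (here refl) = inj₂ (λ q → ρ∉ρs (subst (_∈ ρs) (top-yes x topρ) q))
      ... | inj₁ (there q)   = [ inj₁ , (λ r → inj₂ (λ s → r (there s))) ]′ (fresh x q)
      ... | inj₂ q           = inj₂ (λ s → ρ∉ρs (subst (_∈ ρs) (proj₂ (proj₂ (∈-block⁻ q))) s))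

    tops-spec : ∀ ρ → ρ ∈ tops → ρ ≢ t × isTop ρ ≡ true
    tops-spec ρ p with ∈-filterᵇ⁻ (λ x → not (x == t) ∧ isTop x) ord p
    ... | _ , e = not-≡t (proj₁ (∧-true {not (ρ == t)} e)) , proj₂ (∧-true {not (ρ == t)} e)

    top∈tops : ∀ x → x ≢ t → top x ∈ tops
    top∈tops x q with top-top x q
    ... | a , b , _ = ∈-filterᵇ⁺ (λ x → not (x == t) ∧ isTop x) (∈ord (top x)) (∧-intro (≡t-not a) b)

    ordering : Ok par (t ∷ []) (flat tops)
    ordering = global tops (AllPairs-filterᵇ _ (proj₁ (proj₂ sorted))) tops-spec (t ∷ []) (here refl)
      (λ x q ne → ⊥-elim (ne (top∈tops x q))) (λ { x (here e) → inj₁ e })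

    exhaustive : ∀ x → x ∈ t ∷ [] ⊎ x ∈ flat tops
    exhaustive x with x F.≟ t
    ... | yes e = inj₁ (here e)
    ... | no q  = inj₂ (find tops (top∈tops x q))
      where
      find : ∀ ρs → top x ∈ ρs → x ∈ flat ρs
      find (ρ ∷ ρs) (there p) = there (∈-++ʳ (blockOf ρ) (find ρs p))
      find (ρ ∷ ρs) (here e)  = byCase (isTop x) refl
        where
        byCase : ∀ b → isTop x ≡ b → x ∈ flat (ρ ∷ ρs)
        byCase true  h = here (trans (sym (top-yes x h)) e)
        byCase false h = there (∈-++ˡ (∈-block⁺ q h e))

    badLevel : ℕ → Bool
    badLevel l = (l Data.Nat.<ᵇ suc (2 * h)) ∨ (l Data.Nat.≡ᵇ H')

    -- A shallow vertex is t, or on one of the first 2h + 1 levels or on the last, or close to t in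
    -- a block started early by a child of t.
    shallow-count : cnt (λ x → not (deep x)) ≤ 1 + cnt (λ x → badLevel (lv x)) + geo (suc (suc (2 * h)))
    shallow-count = begin
      cnt (λ x → not (deep x))
        ≤⟨ ∑-mono ptw ⟩
      ∑ (λ x → 𝟙 (x == t) + 𝟙 (badLevel (lv x)) + 𝟙 (depth x Data.Nat.<ᵇ suc (suc (2 * h))))
        ≡⟨ trans (∑-+ (λ x → 𝟙 (x == t) + 𝟙 (badLevel (lv x))) _) (cong (_+ cnt (λ x → depth x Data.Nat.<ᵇ suc (suc (2 * h)))) (trans (∑-+ (λ x → 𝟙 (x == t)) _) (cong (_+ cnt (λ x → badLevel (lv x))) (cnt-point t)))) ⟩
      1 + cnt (λ x → badLevel (lv x)) + cnt (λ x → depth x Data.Nat.<ᵇ suc (suc (2 * h)))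
        ≤⟨ ≤-refl {1 + cnt (λ x → badLevel (lv x))} ⟨+⟩ depth-count (suc (suc (2 * h))) ⟩
      1 + cnt (λ x → badLevel (lv x)) + geo (suc (suc (2 * h))) ∎
      where
      open ≤-Reasoning
      either : ∀ {d} a b c → (a ≡ false → b ≡ false → c ≡ false → d ≡ true) → 𝟙 (not d) ≤ 𝟙 a + 𝟙 b + 𝟙 c
      either {true}  _ _ _ _ = z≤n
      either {false} true  b c h = s≤s z≤n
      either {false} false true c h = s≤s z≤n
      either {false} false false true h = s≤s z≤n
      either {false} false false false h = ⊥-elim (case h refl refl refl of λ ())
      ptw : ∀ x → 𝟙 (not (deep x)) ≤ 𝟙 (x == t) + 𝟙 (badLevel (lv x)) + 𝟙 (depth x Data.Nat.<ᵇ suc (suc (2 * h)))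
      ptw x = either (x == t) (badLevel (lv x)) (depth x Data.Nat.<ᵇ suc (suc (2 * h))) λ a b c →
        ∧-intro (cong not a) (∧-intro (big a b c) (cong not (proj₂ (∨-false {lv x Data.Nat.<ᵇ suc (2 * h)} b))))
        where
        big : (x == t) ≡ false → badLevel (lv x) ≡ false → (depth x Data.Nat.<ᵇ suc (suc (2 * h))) ≡ false → (suc (2 * h) Data.Nat.≤ᵇ inner x) ≡ true
        big a b c = true-<ᵇ ([ (λ p → ≤-trans (<ᵇ-false (proj₁ (∨-false {lv x Data.Nat.<ᵇ suc (2 * h)} b))) p)
                             , (λ p → ≤-pred (≤-trans (<ᵇ-false c) p)) ]′ (shallow-level x (λ { refl → true≢false (==-refl x) a })))

  -- A vertex visits every level exactly once as the shift varies, so some shift makes the levels with p rare.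
  module Shift {n} {T : Graph n} {t : Fin n} (R : Rooted T t) (H' : ℕ) (p : ℕ → Bool) where
    open Rooted R

    nextℓ : ℕ → ℕ
    nextℓ l = if l Data.Nat.≡ᵇ H' then 0 else suc l

    levelAt : ℕ → ℕ → ℕ
    levelAt σ zero    = σ
    levelAt σ (suc d) = nextℓ (levelAt σ d)

    -- `nextℓ` is a cyclic permutation of the levels 0, ..., `H'`.
    rotate : ∀ (f : ℕ → ℕ) → Σℕ (suc H') (λ l → f (nextℓ l)) ≡ Σℕ (suc H') f
    rotate f = trans (cong₂ _+_ (Σℕ-cong H' low) (cong f high)) (trans (+-comm _ (f 0)) (sym (Σℕ-shift H' f)))
      where
      low : ∀ i → i < H' → f (nextℓ i) ≡ f (suc i)
      low i q with i Data.Nat.≡ᵇ H' in e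
      ... | true  = ⊥-elim (<-irrefl (≡ᵇ-true e) q)
      ... | false = refl
      high : nextℓ H' ≡ 0
      high rewrite true-≡ᵇ {H'} refl = refl

    rotateN : ∀ d (f : ℕ → ℕ) → Σℕ (suc H') (λ σ → f (levelAt σ d)) ≡ Σℕ (suc H') f
    rotateN zero    f = refl
    rotateN (suc d) f = trans (rotateN d (λ l → f (nextℓ l))) (rotate f)

    good-shift : ∃ λ σ → σ ≤ H' × suc H' * cnt (λ x → p (levelAt σ (depth x))) ≤ n * Σℕ (suc H') (λ l → 𝟙 (p l))
    good-shift = Σℕ-min H' (λ σ → cnt (λ x → p (levelAt σ (depth x)))) _ (≤-reflexive (begin
      Σℕ (suc H') (λ σ → cnt (λ x → p (levelAt σ (depth x))))       ≡⟨ Σℕ-∑ (suc H') (λ σ x → 𝟙 (p (levelAt σ (depth x)))) ⟩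
      ∑ {n} (λ x → Σℕ (suc H') (λ σ → 𝟙 (p (levelAt σ (depth x))))) ≡⟨ ∑-cong (λ x → rotateN (depth x) (λ l → 𝟙 (p l))) ⟩
      ∑ {n} (λ x → Σℕ (suc H') (λ l → 𝟙 (p l)))                     ≡⟨ ∑-const n _ ⟩
      n * Σℕ (suc H') (λ l → 𝟙 (p l))                               ∎))
      where open ≡-Reasoning

  -- Spreadness: partial assignments, and the cost of one exchange.

  sumL-allFin : ∀ {n} (f : Fin n → ℕ) → sumL f (allFin n) ≡ ∑ f
  sumL-allFin {n} f = trans (sym (∑-elem (allFin⁺ n) f)) (∑-cong (λ i → trans (cong (λ b → 𝟙 b * f i) (∈⇒elem (∈-allFin i))) (*-identityˡ _)))

  sumL-concatMap : ∀ {A B : Set} (F : B → ℕ) (f : A → List B) xs → sumL F (concatMap f xs) ≡ sumL (λ x → sumL F (f x)) xs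
  sumL-concatMap F f []       = refl
  sumL-concatMap F f (x ∷ xs) = trans (sumL-++ F (f x) (concatMap f xs)) (cong (sumL F (f x) +_) (sumL-concatMap F f xs))

  sumL-1 : ∀ {A : Set} (xs : List A) → sumL (λ _ → 1) xs ≡ length xs
  sumL-1 xs = trans (sumL-const 1 xs) (*-identityʳ _)

  Constraint : ℕ → Set
  Constraint n = List (Fin n × Fin n)

  sat : ∀ {n} → Bij n → Constraint n → Bool
  sat ψ []            = true
  sat ψ ((a , w) ∷ S) = (to ψ a == w) ∧ sat ψ S

  sat-elim : ∀ {n} (ψ : Bij n) S → sat ψ S ≡ true → ∀ {a w} → (a , w) ∈ S → to ψ a ≡ w
  sat-elim ψ ((a , w) ∷ S) h (here refl) = ==⇒≡ (proj₁ (∧-true {to ψ a == w} h))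
  sat-elim ψ ((a , w) ∷ S) h (there p)   = sat-elim ψ S (proj₂ (∧-true {to ψ a == w} h)) p

  sat-intro : ∀ {n} (ψ : Bij n) S → (∀ {a w} → (a , w) ∈ S → to ψ a ≡ w) → sat ψ S ≡ true
  sat-intro ψ []            h = refl
  sat-intro ψ ((a , w) ∷ S) h = ∧-intro (true-does (to ψ a F.≟ w) (h (here refl))) (sat-intro ψ S (λ p → h (there p)))

  swapS : ∀ {n} → Fin n → Fin n → Constraint n → Constraint n
  swapS x y = map (λ (a , w) → sw x y a , w)

  -- An exchange in the bijection becomes a relabelling of the constraint, to which the spread bound
  -- before the exchange applies.
  sat-swap : ∀ {n} (ψ : Bij n) x y S → sat (swapB ψ x y) S ≡ sat ψ (swapS x y S)
  sat-swap ψ x y []            = refl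
  sat-swap ψ x y ((a , w) ∷ S) = cong ((to ψ (sw x y a) == w) ∧_) (sat-swap ψ x y S)

  firsts seconds : ∀ {n} → Constraint n → List (Fin n)
  firsts  = map proj₁
  seconds = map proj₂

  ∈-firsts : ∀ {n} {S : Constraint n} {a w} → (a , w) ∈ S → a ∈ firsts S
  ∈-firsts (here refl) = here refl
  ∈-firsts (there p)   = there (∈-firsts p)

  firsts-∈ : ∀ {n} (S : Constraint n) {a} → a ∈ firsts S → ∃ λ w → (a , w) ∈ S
  firsts-∈ ((a , w) ∷ S) (here refl) = w , here refl
  firsts-∈ (_ ∷ S) (there p) with firsts-∈ S p
  ... | w , q = w , there q

  seconds-∈ : ∀ {n} (S : Constraint n) {w} → w ∈ seconds S → ∃ λ a → (a , w) ∈ S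
  seconds-∈ ((a , w) ∷ S) (here refl) = a , here refl
  seconds-∈ (_ ∷ S) (there p) with seconds-∈ S p
  ... | w , q = w , there q

  drop : ∀ {n} → Fin n → Constraint n → Constraint n
  drop x = filterᵇ (λ (a , _) → not (a == x))

  drop-∈ : ∀ {n} x (S : Constraint n) {a w} → (a , w) ∈ drop x S → (a , w) ∈ S × a ≢ x
  drop-∈ x S p with ∈-filterᵇ⁻ (λ (a , _) → not (a == x)) S p
  ... | q , e = q , λ { refl → true≢false (==-refl x) (not-true e) }

  drop-fresh : ∀ {n} x (S : Constraint n) → x ∉ firsts S → drop x S ≡ S
  drop-fresh x []            h = refl
  drop-fresh x ((a , w) ∷ S) h with a F.≟ x
  ... | yes refl = ⊥-elim (h (here refl))
  ... | no _     = cong ((a , w) ∷_) (drop-fresh x S (λ p → h (there p)))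

  drop-length : ∀ {n} x (S : Constraint n) → Unique (firsts S) → x ∈ firsts S → suc (length (drop x S)) ≡ length S
  drop-length x ((a , w) ∷ S) (u ∷ us) p with a F.≟ x
  ... | yes refl = cong (suc ∘ length) (drop-fresh x S (All-∉ u))
  drop-length x ((a , w) ∷ S) (u ∷ us) (here refl) | no q = ⊥-elim (q refl)
  drop-length x ((a , w) ∷ S) (u ∷ us) (there p)   | no q = cong suc (drop-length x S us p)

  All-filterᵇ-map : ∀ {A B : Set} {P : B → Set} (f : A → B) (p : A → Bool) {xs} → All P (map f xs) → All P (map f (filterᵇ p xs))
  All-filterᵇ-map f p {[]}     []       = []
  All-filterᵇ-map f p {x ∷ xs} (h ∷ hs) with p x
  ... | true  = h ∷ All-filterᵇ-map f p hs
  ... | false = All-filterᵇ-map f p hs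

  Unique-filterᵇ-map : ∀ {A B : Set} (f : A → B) (p : A → Bool) {xs} → Unique (map f xs) → Unique (map f (filterᵇ p xs))
  Unique-filterᵇ-map f p {[]}     []       = []
  Unique-filterᵇ-map f p {x ∷ xs} (u ∷ us) with p x
  ... | true  = All-filterᵇ-map f p u ∷ Unique-filterᵇ-map f p us
  ... | false = Unique-filterᵇ-map f p us

  record ValidC {n} (t : Fin n) (S : Constraint n) : Set where
    field
      uniq₁ : Unique (firsts S)
      uniq₂ : Unique (seconds S)
      avoid : t ∉ firsts S

  drop-valid : ∀ {n} {t : Fin n} x {S} → ValidC t S → ValidC t (drop x S)
  drop-valid x {S} V = record
    { uniq₁ = Unique-filterᵇ-map proj₁ _ uniq₁ ; uniq₂ = Unique-filterᵇ-map proj₂ _ uniq₂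
    ; avoid = λ p → avoid (∈-firsts (proj₁ (drop-∈ x S (proj₂ (firsts-∈ (drop x S) p))))) }
    where open ValidC V

  swapS-length : ∀ {n} (x y : Fin n) S → length (swapS x y S) ≡ length S
  swapS-length x y []      = refl
  swapS-length x y (_ ∷ S) = cong suc (swapS-length x y S)

  swapS-firsts : ∀ {n} (x y : Fin n) S → firsts (swapS x y S) ≡ map (sw x y) (firsts S)
  swapS-firsts x y []      = refl
  swapS-firsts x y (_ ∷ S) = cong (_ ∷_) (swapS-firsts x y S)

  swapS-seconds : ∀ {n} (x y : Fin n) S → seconds (swapS x y S) ≡ seconds S
  swapS-seconds x y []      = refl
  swapS-seconds x y (_ ∷ S) = cong (_ ∷_) (swapS-seconds x y S)

  sw-inj : ∀ {n} {x y a b : Fin n} → sw x y a ≡ sw x y b → a ≡ b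
  sw-inj {x = x} {y} {a} {b} e = trans (sym (sw-sw x y a)) (trans (cong (sw x y) e) (sw-sw x y b))

  Unique-map : ∀ {A B : Set} {f : A → B} → (∀ {a b} → f a ≡ f b → a ≡ b) → ∀ {xs} → Unique xs → Unique (map f xs)
  Unique-map inj [] = []
  Unique-map {f = f} inj (u ∷ us) = go u ∷ Unique-map inj us
    where
    go : ∀ {x xs} → All (x ≢_) xs → All (f x ≢_) (map f xs)
    go []       = []
    go (p ∷ ps) = (λ e → p (inj e)) ∷ go ps

  swapS-valid : ∀ {n} {t x y : Fin n} {S} → x ≢ t → y ≢ t → ValidC t S → ValidC t (swapS x y S)
  swapS-valid {t = t} {x} {y} {S} x≢t y≢t V = record
    { uniq₁ = subst Unique (sym (swapS-firsts x y S)) (Unique-map sw-inj uniq₁)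
    ; uniq₂ = subst Unique (sym (swapS-seconds x y S)) uniq₂
    ; avoid = λ p → avoid (back (firsts S) (subst (t ∈_) (swapS-firsts x y S) p)) }
    where
    open ValidC V
    back : ∀ zs → t ∈ map (sw x y) zs → t ∈ zs
    back (z ∷ zs) (here e)  = here (trans (sym (sw-o (λ e' → x≢t (sym e')) (λ e' → y≢t (sym e')))) (trans (cong (sw x y) e) (sw-sw x y z)))
    back (z ∷ zs) (there p) = there (back zs p)

  module Spread {n} (g : ℕ) (Good : Bij n → Set) (t : Fin n) where
    open Strategy g Good

    record State (xs : List (Fin n)) : Set where
      constructor state
      field
        bij   : Bij n
        strat : Strat xs bij
    open State public

    choice : ∀ {x xs} ψ (O : Fin n → Bool) → (∀ y → O y ≡ true → Strat xs (swapB ψ x y)) → ∀ y b → O y ≡ b → List (State xs)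
    choice {x} ψ O k y true  e = state (swapB ψ x y) (k y e) ∷ []
    choice     ψ O k y false e = []

    choices : ∀ {x xs} ψ (O : Fin n → Bool) → (∀ y → O y ≡ true → Strat xs (swapB ψ x y)) → List (Fin n) → List (State xs)
    choices {x} {xs} ψ O k = concatMap (λ y → choice {x} {xs} ψ O k y (O y) refl)

    expand : ∀ {x xs} → State (x ∷ xs) → List (State xs)
    expand {x} {xs} (state ψ (O , _ , k)) = choices {x} {xs} ψ O k (allFin n)

    sum-choices : ∀ {x xs} (F : Bij n → ℕ) ψ O (k : ∀ y → O y ≡ true → Strat xs (swapB ψ x y)) ys →
                  sumL (F ∘ bij) (choices {x} {xs} ψ O k ys) ≡ sumL (λ y → 𝟙 (O y) * F (swapB ψ x y)) ys
    sum-choices {x} {xs} F ψ O k ys = trans (sumL-concatMap (F ∘ bij) _ ys) (sumL-cong ys (λ y _ → one y (O y) refl))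
      where
      one : ∀ y b (e : O y ≡ b) → sumL (F ∘ bij) (choice {x} {xs} ψ O k y b e) ≡ 𝟙 b * F (swapB ψ x y)
      one y true  e = refl
      one y false e = refl

    sum-expand : ∀ {x xs} (F : Bij n → ℕ) (s : State (x ∷ xs)) →
                 sumL (F ∘ bij) (expand s) ≡ ∑ (λ y → 𝟙 (proj₁ (strat s) y) * F (swapB (bij s) x y))
    sum-expand {x} {xs} F (state ψ (O , _ , k)) = trans (sum-choices {x} {xs} F ψ O k (allFin n)) (sumL-allFin _)

    run : ∀ xs → List (State xs) → List (State [])
    run []       𝒟 = 𝒟
    run (x ∷ xs) 𝒟 = run xs (concatMap expand 𝒟)

    occ : ∀ {xs} → List (State xs) → Constraint n → ℕ
    occ 𝒟 S = sumL (λ s → 𝟙 (sat (bij s) S)) 𝒟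

    -- For an entry drawn uniformly from the list, with multiplicity, S is satisfied with
    -- probability at most (b/a)^(length S).
    Spreads : ∀ {xs} → ℕ → ℕ → List (State xs) → Set
    Spreads a b 𝒟 = ∀ S → ValidC t S → occ 𝒟 S * a ^ length S ≤ b ^ length S * length 𝒟

    length-expand : ∀ {x xs} (𝒟 : List (State (x ∷ xs))) → length (concatMap expand 𝒟) ≡ g * length 𝒟
    length-expand 𝒟 = trans (sym (sumL-1 (concatMap expand 𝒟))) (trans (sumL-concatMap (λ _ → 1) expand 𝒟)
      (trans (sumL-cong 𝒟 (λ s _ → trans (sum-expand (λ _ → 1) s) (trans (∑-cong (λ y → *-identityʳ _)) (proj₁ (proj₂ (strat s))))))
        (trans (sumL-const g 𝒟) (*-comm (length 𝒟) g))))

    -- Each of the s vertices y in the domain of S yields a relabelled constraint of the same size.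
    -- For other y there are two cases. If x is unconstrained, S is unaffected. Otherwise y must be
    -- the preimage of the value prescribed to x, a single choice, and the other s - 1 conditions
    -- have probability at most (b/a)^(s - 1) ≤ g(b/a)^s, by a ≤ bg. Dividing by the g choices gives
    -- the factor (g + s)/g ≤ (1 + 1/g)^s.
    one-step : ∀ {x xs} {𝒟 : List (State (x ∷ xs))} {a b} → x ≢ t → a ≤ b * g → Spreads a b 𝒟 → Spreads (a * g) (b * suc g) (concatMap expand 𝒟)
    one-step {x} {xs} {𝒟} {a} {b} x≢t a≤bg sp S V = begin
      occ (concatMap expand 𝒟) S * (a * g) ^ s            ≡⟨ cong (occ (concatMap expand 𝒟) S *_) (^-dist s a g) ⟩
      occ (concatMap expand 𝒟) S * (a ^ s * g ^ s)        ≡⟨ sym (*-assoc (occ (concatMap expand 𝒟) S) _ _) ⟩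
      occ (concatMap expand 𝒟) S * a ^ s * g ^ s          ≤⟨ bound ⟨*⟩ ≤-refl ⟩
      (g + s) * (b ^ s * length 𝒟) * g ^ s                ≡⟨ r₁ (g + s) (b ^ s) (length 𝒟) (g ^ s) ⟩
      g ^ s * (g + s) * (b ^ s * length 𝒟)                ≤⟨ bernoulli g s ⟨*⟩ ≤-refl ⟩
      suc g ^ s * g * (b ^ s * length 𝒟)                  ≡⟨ r₂ (suc g ^ s) g (b ^ s) (length 𝒟) ⟩
      b ^ s * suc g ^ s * (g * length 𝒟)                  ≡⟨ cong₂ _*_ (sym (^-dist s b (suc g))) (sym (length-expand 𝒟)) ⟩
      (b * suc g) ^ s * length (concatMap expand 𝒟)       ∎
      where
      open ≤-Reasoning
      open ValidC V
      s = length S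
      r₁ : ∀ a b c d → a * (b * c) * d ≡ d * a * (b * c)
      r₁ = solve-∀
      r₂ : ∀ a b c d → a * b * (c * d) ≡ c * a * (b * d)
      r₂ = solve-∀
      moved : Fin n → ℕ
      moved y = occ 𝒟 (swapS x y S)
      Y = firsts S
      movedSum : sumL moved Y * a ^ s ≤ s * (b ^ s * length 𝒟)
      movedSum = begin
        sumL moved Y * a ^ s                   ≡⟨ trans (*-comm _ (a ^ s)) (sym (sumL-*ˡ (a ^ s) moved Y)) ⟩
        sumL (λ y → a ^ s * moved y) Y         ≤⟨ sumL-mono Y each ⟩
        sumL (λ _ → b ^ s * length 𝒟) Y        ≡⟨ trans (sumL-const _ Y) (cong (_* (b ^ s * length 𝒟)) (len S)) ⟩
        s * (b ^ s * length 𝒟)                 ∎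
        where
        len : ∀ (S : Constraint n) → length (firsts S) ≡ length S
        len []      = refl
        len (_ ∷ S) = cong suc (len S)
        each : ∀ y → y ∈ Y → a ^ s * moved y ≤ b ^ s * length 𝒟
        each y y∈ = ≤-trans (≤-reflexive (*-comm (a ^ s) _)) (subst (λ l → moved y * a ^ l ≤ b ^ l * length 𝒟) (swapS-length x y S)
          (sp (swapS x y S) (swapS-valid x≢t (λ e → avoid (subst (_∈ Y) e y∈)) V)))
      -- It remains to bound, for each state, the choices y outside the domain of the constraint.
      reduce : (base : Bij n → ℕ) → (∀ ψ (O : Fin n → Bool) → cnt O ≡ g → ∑ (λ y → 𝟙 (not (elem y Y)) * (𝟙 (O y) * 𝟙 (sat ψ (swapS x y S)))) ≤ base ψ) →
               occ (concatMap expand 𝒟) S ≤ sumL (base ∘ bij) 𝒟 + sumL moved Y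
      reduce base h = begin
        occ (concatMap expand 𝒟) S                                        ≡⟨ sumL-concatMap _ expand 𝒟 ⟩
        sumL (λ st → sumL (λ s' → 𝟙 (sat (bij s') S)) (expand st)) 𝒟    ≤⟨ sumL-mono 𝒟 (λ st _ → per st) ⟩
        sumL (λ st → base (bij st) + sumL (λ y → 𝟙 (sat (bij st) (swapS x y S))) Y) 𝒟
          ≡⟨ trans (sumL-+ (base ∘ bij) _ 𝒟) (cong (sumL (base ∘ bij) 𝒟 +_) (exchange Y 𝒟)) ⟩
        sumL (base ∘ bij) 𝒟 + sumL moved Y                              ∎
        where
        exchange : ∀ Y (𝒟 : List (State (x ∷ xs))) → sumL (λ st → sumL (λ y → 𝟙 (sat (bij st) (swapS x y S))) Y) 𝒟 ≡ sumL (λ y → sumL (λ st → 𝟙 (sat (bij st) (swapS x y S))) 𝒟) Y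
        exchange []      𝒟 = trans (sumL-const 0 𝒟) (*-zeroʳ (length 𝒟))
        exchange (y ∷ Y) 𝒟 = trans (sumL-+ (λ st → 𝟙 (sat (bij st) (swapS x y S))) _ 𝒟) (cong (sumL (λ st → 𝟙 (sat (bij st) (swapS x y S))) 𝒟 +_) (exchange Y 𝒟))
        per : ∀ st → sumL (λ s' → 𝟙 (sat (bij s') S)) (expand st) ≤ base (bij st) + sumL (λ y → 𝟙 (sat (bij st) (swapS x y S))) Y
        per st@(state ψ (O , |O| , k)) = begin
          sumL (λ s' → 𝟙 (sat (bij s') S)) (expand st)        ≡⟨ sum-expand (λ ψ' → 𝟙 (sat ψ' S)) st ⟩
          ∑ (λ y → 𝟙 (O y) * 𝟙 (sat (swapB ψ x y) S))           ≤⟨ ∑-mono (λ y → ≤-trans (≤-reflexive (cong (λ b → 𝟙 (O y) * 𝟙 b) (sat-swap ψ x y S))) (parts (elem y Y) (O y) (𝟙 (sat ψ (swapS x y S))))) ⟩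
          ∑ (λ y → 𝟙 (not (elem y Y)) * (𝟙 (O y) * 𝟙 (sat ψ (swapS x y S))) + 𝟙 (elem y Y) * 𝟙 (sat ψ (swapS x y S)))
            ≡⟨ ∑-+ (λ y → 𝟙 (not (elem y Y)) * (𝟙 (O y) * 𝟙 (sat ψ (swapS x y S)))) _ ⟩
          ∑ (λ y → 𝟙 (not (elem y Y)) * (𝟙 (O y) * 𝟙 (sat ψ (swapS x y S)))) + ∑ (λ y → 𝟙 (elem y Y) * 𝟙 (sat ψ (swapS x y S)))
            ≤⟨ h ψ O |O| ⟨+⟩ ∑-elem≤ Y _ ⟩
          base ψ + sumL (λ y → 𝟙 (sat ψ (swapS x y S))) Y       ∎
          where
          parts : ∀ e o z → 𝟙 o * z ≤ 𝟙 (not e) * (𝟙 o * z) + 𝟙 e * z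
          parts true  o z = ≤-trans (𝟙≤1 o ⟨*⟩ ≤-refl) (≤-refl)
          parts false o z = ≤-trans (≤-reflexive (sym (*-identityˡ (𝟙 o * z)))) (m≤m+n _ _)
      finishBound : (base : Bij n → ℕ) → sumL (base ∘ bij) 𝒟 * a ^ s ≤ g * (b ^ s * length 𝒟) →
                    occ (concatMap expand 𝒟) S ≤ sumL (base ∘ bij) 𝒟 + sumL moved Y →
                    occ (concatMap expand 𝒟) S * a ^ s ≤ (g + s) * (b ^ s * length 𝒟)
      finishBound base hb hr = begin
        occ (concatMap expand 𝒟) S * a ^ s                             ≤⟨ hr ⟨*⟩ ≤-refl ⟩
        (sumL (base ∘ bij) 𝒟 + sumL moved Y) * a ^ s                 ≡⟨ *-distribʳ-+ (a ^ s) (sumL (base ∘ bij) 𝒟) _ ⟩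
        sumL (base ∘ bij) 𝒟 * a ^ s + sumL moved Y * a ^ s           ≤⟨ hb ⟨+⟩ movedSum ⟩
        g * (b ^ s * length 𝒟) + s * (b ^ s * length 𝒟)                ≡⟨ sym (*-distribʳ-+ (b ^ s * length 𝒟) g s) ⟩
        (g + s) * (b ^ s * length 𝒟)                                   ∎
      bound : occ (concatMap expand 𝒟) S * a ^ s ≤ (g + s) * (b ^ s * length 𝒟)
      bound = byCase (elem x Y) refl
        where
        byCase : ∀ e → elem x Y ≡ e → occ (concatMap expand 𝒟) S * a ^ s ≤ (g + s) * (b ^ s * length 𝒟)
        byCase false e = finishBound base hb (reduce base hr)
          where
          base : Bij n → ℕ
          base ψ = g * 𝟙 (sat ψ S)
          hb : sumL (base ∘ bij) 𝒟 * a ^ s ≤ g * (b ^ s * length 𝒟)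
          hb = ≤-trans (≤-reflexive (trans (cong (_* a ^ s) (sumL-*ˡ g (λ st → 𝟙 (sat (bij st) S)) 𝒟)) (*-assoc g _ (a ^ s)))) (g ⊛ sp S V)
          hr : ∀ ψ (O : Fin n → Bool) → cnt O ≡ g → ∑ (λ y → 𝟙 (not (elem y Y)) * (𝟙 (O y) * 𝟙 (sat ψ (swapS x y S)))) ≤ base ψ
          hr ψ O |O| = ≤-trans (∑-mono (λ y → ptw y (elem y Y) refl)) (≤-reflexive (trans (∑-*ʳ (𝟙 (sat ψ S)) (λ y → 𝟙 (O y))) (cong (_* 𝟙 (sat ψ S)) |O|)))
            where
            ptw : ∀ y b → elem y Y ≡ b → 𝟙 (not b) * (𝟙 (O y) * 𝟙 (sat ψ (swapS x y S))) ≤ 𝟙 (O y) * 𝟙 (sat ψ S)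
            ptw y true  _ = z≤n
            ptw y false q = ≤-trans (≤-reflexive (*-identityˡ _)) (𝟙 (O y) ⊛ 𝟙-mono (λ h → sat-intro ψ S (λ {a} {w} p →
              trans (cong (to ψ) (sym (sw-o {x = x} {y} (λ { refl → elem-false e (∈-firsts p) }) (λ { refl → elem-false q (∈-firsts p) }))))
                (sat-elim ψ (swapS x y S) h (swapS-∈ p)))))
              where
              swapS-∈ : ∀ {S : Constraint n} {a w} → (a , w) ∈ S → (sw x y a , w) ∈ swapS x y S
              swapS-∈ (here refl) = here refl
              swapS-∈ (there p)   = there (swapS-∈ p)
        byCase true e = finishBound base hb (reduce base hr)
          where
          x∈ = firsts-∈ S (elem⇒∈ Y e)
          z = proj₁ x∈
          base : Bij n → ℕ
          base ψ = 𝟙 (sat ψ (drop x S))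
          hb : sumL (base ∘ bij) 𝒟 * a ^ s ≤ g * (b ^ s * length 𝒟)
          hb = begin
            occ 𝒟 (drop x S) * a ^ s                             ≡⟨ cong (λ l → occ 𝒟 (drop x S) * a ^ l) (sym dl) ⟩
            occ 𝒟 (drop x S) * (a * a ^ s')                      ≡⟨ q₁ (occ 𝒟 (drop x S)) a (a ^ s') ⟩
            a * (occ 𝒟 (drop x S) * a ^ s')                      ≤⟨ a≤bg ⟨*⟩ sp (drop x S) (drop-valid x V) ⟩
            b * g * (b ^ s' * length 𝒟)                          ≡⟨ q₂ b g (b ^ s') (length 𝒟) ⟩
            g * (b * b ^ s' * length 𝒟)                          ≡⟨ cong (λ l → g * (b ^ l * length 𝒟)) dl ⟩
            g * (b ^ s * length 𝒟)                               ∎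
            where
            s' = length (drop x S)
            dl : suc s' ≡ s
            dl = drop-length x S uniq₁ (elem⇒∈ Y e)
            q₁ : ∀ a b c → a * (b * c) ≡ b * (a * c)
            q₁ = solve-∀
            q₂ : ∀ a b c d → a * b * (c * d) ≡ b * (a * c * d)
            q₂ = solve-∀
          hr : ∀ ψ (O : Fin n → Bool) → cnt O ≡ g → ∑ (λ y → 𝟙 (not (elem y Y)) * (𝟙 (O y) * 𝟙 (sat ψ (swapS x y S)))) ≤ base ψ
          hr ψ O _ = ≤-trans (∑-mono (λ y → ptw y (elem y Y) refl)) (≤-reflexive (trans (∑-*ʳ (base ψ) (λ y → 𝟙 (to ψ y == z)))
                       (trans (cong (_* base ψ) (trans (∑-to ψ (λ w → 𝟙 (w == z))) (cnt-point z))) (*-identityˡ _))))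
            where
            swapS-∈ : ∀ {y} {S : Constraint n} {a w} → (a , w) ∈ S → (sw x y a , w) ∈ swapS x y S
            swapS-∈ (here refl) = here refl
            swapS-∈ (there p)   = there (swapS-∈ p)
            ptw : ∀ y b → elem y Y ≡ b → 𝟙 (not b) * (𝟙 (O y) * 𝟙 (sat ψ (swapS x y S))) ≤ 𝟙 (to ψ y == z) * base ψ
            ptw y true  _ = z≤n
            ptw y false q = ≤-trans (≤-reflexive (*-identityˡ _)) (≤-trans (𝟙≤1 (O y) ⟨*⟩ ≤-refl) (≤-trans (≤-reflexive (*-identityˡ _))
              (≤-trans (𝟙-mono both) (≤-reflexive (𝟙-∧ (to ψ y == z) _)))))
              where
              both : sat ψ (swapS x y S) ≡ true → ((to ψ y == z) ∧ sat ψ (drop x S)) ≡ true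
              both h = ∧-intro (true-does (to ψ y F.≟ z) (trans (cong (to ψ) (sym (sw-l x y))) (sat-elim ψ (swapS x y S) h (swapS-∈ (proj₂ x∈)))))
                (sat-intro ψ (drop x S) (λ {a} {w} p → trans (cong (to ψ) (sym (sw-o {x = x} {y} (proj₂ (drop-∈ x S p)) (λ { refl → elem-false q (∈-firsts (proj₁ (drop-∈ x S p))) }))))
                  (sat-elim ψ (swapS x y S) h (swapS-∈ (proj₁ (drop-∈ x S p))))))

    run-spreads : ∀ xs {𝒟 : List (State xs)} {a b} → (∀ x → x ∈ xs → x ≢ t) → a ≤ b * g → Spreads a b 𝒟 →
                  Spreads (a * g ^ length xs) (b * suc g ^ length xs) (run xs 𝒟)
    run-spreads []       {𝒟} {a} {b} av h sp = subst₂ (λ a b → Spreads a b 𝒟) (sym (*-identityʳ a)) (sym (*-identityʳ b)) sp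
    run-spreads (x ∷ xs) {𝒟} {a} {b} av h sp = subst₂ (λ a b → Spreads a b (run (x ∷ xs) 𝒟)) (*-assoc a g _) (*-assoc b (suc g) _)
      (run-spreads xs {concatMap expand 𝒟} {a * g} {b * suc g} (λ y p → av y (there p)) (*-monoˡ-≤ g (≤-trans h (b ⊛ n≤1+n g))) (one-step {x} {xs} {𝒟} {a} {b} (av x (here refl)) h sp))

    length-run : ∀ xs (𝒟 : List (State xs)) → 1 ≤ g → 1 ≤ length 𝒟 → 1 ≤ length (run xs 𝒟)
    length-run []       𝒟 0<g h = h
    length-run (x ∷ xs) 𝒟 0<g h = length-run xs (concatMap expand 𝒟) 0<g (≤-trans (*-pos 0<g h) (≤-reflexive (sym (length-expand 𝒟))))

  -- The uniformly random bijection, listed by the Fisher-Yates shuffle.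

  fy : ∀ {n} → List (Fin n) → Bij n → List (Bij n)
  fy []       ψ = ψ ∷ []
  fy (x ∷ xs) ψ = concatMap (λ y → fy xs (swapB ψ x y)) (x ∷ xs)

  fy-length : ∀ {n} (xs : List (Fin n)) ψ → length (fy xs ψ) ≡ length xs !
  fy-length []       ψ = refl
  fy-length (x ∷ xs) ψ = trans (sym (sumL-1 (fy (x ∷ xs) ψ))) (trans (sumL-concatMap (λ _ → 1) (λ y → fy xs (swapB ψ x y)) (x ∷ xs))
    (trans (sumL-cong (x ∷ xs) (λ y _ → trans (sumL-1 (fy xs (swapB ψ x y))) (fy-length xs (swapB ψ x y)))) (sumL-const (length xs !) (x ∷ xs))))

  fy-mono : ∀ {n} (xs : List (Fin n)) ψ {F H : Bij n → ℕ} → (∀ ψ' → (∀ z → z ∉ xs → to ψ' z ≡ to ψ z) → F ψ' ≤ H ψ') →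
            sumL F (fy xs ψ) ≤ sumL H (fy xs ψ)
  fy-mono []       ψ h = h ψ (λ _ _ → refl) ⟨+⟩ z≤n
  fy-mono (x ∷ xs) ψ {F} {H} h = begin
    sumL F (fy (x ∷ xs) ψ)                                ≡⟨ sumL-concatMap F (λ y → fy xs (swapB ψ x y)) (x ∷ xs) ⟩
    sumL (λ y → sumL F (fy xs (swapB ψ x y))) (x ∷ xs)    ≤⟨ sumL-mono (x ∷ xs) (λ y y∈ → fy-mono xs (swapB ψ x y) (λ ψ' e → h ψ' (λ z z∉ →
                                                              trans (e z (λ p → z∉ (there p))) (cong (to ψ) (sw-o (λ { refl → z∉ (here refl) }) (λ { refl → z∉ y∈ })))))) ⟩
    sumL (λ y → sumL H (fy xs (swapB ψ x y))) (x ∷ xs)    ≡⟨ sym (sumL-concatMap H (λ y → fy xs (swapB ψ x y)) (x ∷ xs)) ⟩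
    sumL H (fy (x ∷ xs) ψ)                                ∎
    where open ≤-Reasoning

  length-firsts : ∀ {n} (S : Constraint n) → length (firsts S) ≡ length S
  length-firsts []      = refl
  length-firsts (_ ∷ S) = cong suc (length-firsts S)

  length-seconds : ∀ {n} (S : Constraint n) → length (seconds S) ≡ length S
  length-seconds []      = refl
  length-seconds (_ ∷ S) = cong suc (length-seconds S)

  sub-length : ∀ {n} {as xs : List (Fin n)} → Unique as → (∀ a → a ∈ as → a ∈ xs) → length as ≤ length xs
  sub-length {as = as} {xs} u h = ≤-trans (≤-reflexive (sym (cnt-elem u))) (≤-trans (cnt-mono (λ i e → ∈⇒elem (h i (elem⇒∈ as e)))) (cnt-elem≤ xs))

  -- If x is constrained, y must be the preimage of its value and s - 1 conditions remain for xs. If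
  -- not, x must avoid all s prescribed values, which leaves length ys - s choices of y; this
  -- presumes that the values are images of ys, and otherwise no shuffle satisfies S.
  fy-count : ∀ {n} (xs : List (Fin n)) ψ S → Unique xs → Unique (firsts S) → Unique (seconds S) → (∀ a → a ∈ firsts S → a ∈ xs) →
             sumL (λ ψ' → 𝟙 (sat ψ' S)) (fy xs ψ) ≤ (length xs ∸ length S) !
  fy-count [] ψ [] _ _ _ _ = ≤-refl
  fy-count [] ψ ((a , w) ∷ S) _ _ _ h = ⊥-elim (case h a (here refl) of λ ())
  fy-count (x ∷ xs) ψ S (x∉ ∷ uxs) u₁ u₂ sub = byCase (elem x (firsts S)) refl
    where
    open ≤-Reasoning
    ys = x ∷ xs
    Z = seconds S
    s = length S
    sum-y : sumL (λ ψ' → 𝟙 (sat ψ' S)) (fy ys ψ) ≡ sumL (λ y → sumL (λ ψ' → 𝟙 (sat ψ' S)) (fy xs (swapB ψ x y))) ys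
    sum-y = sumL-concatMap (λ ψ' → 𝟙 (sat ψ' S)) (λ y → fy xs (swapB ψ x y)) ys
    at-x : ∀ y {ψ'} → (∀ z → z ∉ xs → to ψ' z ≡ to (swapB ψ x y) z) → to ψ' x ≡ to ψ y
    at-x y e = trans (e x (All-∉ x∉)) (cong (to ψ) (sw-l x y))
    byCase : ∀ e → elem x (firsts S) ≡ e → sumL (λ ψ' → 𝟙 (sat ψ' S)) (fy ys ψ) ≤ (length ys ∸ s) !
    byCase true e = begin
      sumL (λ ψ' → 𝟙 (sat ψ' S)) (fy ys ψ)                ≡⟨ sum-y ⟩
      sumL (λ y → sumL (λ ψ' → 𝟙 (sat ψ' S)) (fy xs (swapB ψ x y))) ys   ≤⟨ sumL-mono ys (λ y _ → each y) ⟩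
      sumL (λ y → c * 𝟙 (to ψ y == z)) ys                 ≡⟨ sumL-*ˡ c _ ys ⟩
      c * sumL (λ y → 𝟙 (to ψ y == z)) ys                 ≡⟨ cong (c *_) (sym (∑-elem (x∉ ∷ uxs) _)) ⟩
      c * ∑ (λ y → 𝟙 (elem y ys) * 𝟙 (to ψ y == z))       ≤⟨ c ⊛ ∑-mono (λ y → ≤-trans (𝟙≤1 (elem y ys) ⟨*⟩ ≤-refl) (≤-reflexive (*-identityˡ _))) ⟩
      c * ∑ (λ y → 𝟙 (to ψ y == z))                       ≡⟨ cong (c *_) (trans (∑-to ψ (λ w → 𝟙 (w == z))) (cnt-point z)) ⟩
      c * 1                                               ≡⟨ *-identityʳ c ⟩
      (length xs ∸ s') !                                  ≡⟨ cong (λ l → (suc (length xs) ∸ l) !) dl ⟩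
      (length ys ∸ s) !                                   ∎
      where
      x∈ = firsts-∈ S (elem⇒∈ (firsts S) e)
      z = proj₁ x∈
      s' = length (drop x S)
      c = (length xs ∸ s') !
      dl : suc s' ≡ s
      dl = drop-length x S u₁ (elem⇒∈ (firsts S) e)
      sub' : ∀ a → a ∈ firsts (drop x S) → a ∈ xs
      sub' a p with firsts-∈ (drop x S) p
      ... | w , q with drop-∈ x S q
      ...   | r , a≢x with sub a (∈-firsts r)
      ...     | here e  = ⊥-elim (a≢x e)
      ...     | there t = t
      each : ∀ y → sumL (λ ψ' → 𝟙 (sat ψ' S)) (fy xs (swapB ψ x y)) ≤ c * 𝟙 (to ψ y == z)
      each y = begin
        sumL (λ ψ' → 𝟙 (sat ψ' S)) (fy xs (swapB ψ x y))
          ≤⟨ fy-mono xs (swapB ψ x y) (λ ψ' fix → ≤-trans (𝟙-mono (λ h → ∧-intro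
               (true-does (to ψ y F.≟ z) (trans (sym (at-x y {ψ'} fix)) (sat-elim ψ' S h (proj₂ x∈))))
               (sat-intro ψ' (drop x S) (λ p → sat-elim ψ' S h (proj₁ (drop-∈ x S p)))))) (≤-reflexive (𝟙-∧ (to ψ y == z) _))) ⟩
        sumL (λ ψ' → 𝟙 (to ψ y == z) * 𝟙 (sat ψ' (drop x S))) (fy xs (swapB ψ x y))
          ≡⟨ sumL-*ˡ (𝟙 (to ψ y == z)) _ (fy xs (swapB ψ x y)) ⟩
        𝟙 (to ψ y == z) * sumL (λ ψ' → 𝟙 (sat ψ' (drop x S))) (fy xs (swapB ψ x y))
          ≤⟨ 𝟙 (to ψ y == z) ⊛ fy-count xs (swapB ψ x y) (drop x S) uxs (Unique-filterᵇ-map proj₁ _ u₁) (Unique-filterᵇ-map proj₂ _ u₂) sub' ⟩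
        𝟙 (to ψ y == z) * c ≡⟨ *-comm (𝟙 (to ψ y == z)) c ⟩
        c * 𝟙 (to ψ y == z) ∎
    byCase false e = byTargets (All.all? (λ w → elem (from ψ w) ys Data.Bool.≟ true) Z)
      where
      x∉S : x ∉ firsts S
      x∉S = elem-false e
      sub' : ∀ a → a ∈ firsts S → a ∈ xs
      sub' a p with sub a p
      ... | here refl = ⊥-elim (x∉S p)
      ... | there q   = q
      s≤ : s ≤ length xs
      s≤ = ≤-trans (≤-reflexive (sym (length-firsts S))) (sub-length u₁ sub')
      byTargets : Dec (All (λ w → elem (from ψ w) ys ≡ true) Z) → sumL (λ ψ' → 𝟙 (sat ψ' S)) (fy ys ψ) ≤ (length ys ∸ s) !
      byTargets (no ¬all) = begin
        sumL (λ ψ' → 𝟙 (sat ψ' S)) (fy ys ψ)   ≤⟨ fy-mono ys ψ (λ ψ' fix → never ψ' fix) ⟩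
        sumL (λ _ → 0) (fy ys ψ)               ≡⟨ trans (sumL-const 0 (fy ys ψ)) (*-zeroʳ (length (fy ys ψ))) ⟩
        0                                      ≤⟨ z≤n ⟩
        (length ys ∸ s) !                      ∎
        where
        never : ∀ ψ' → (∀ z → z ∉ ys → to ψ' z ≡ to ψ z) → 𝟙 (sat ψ' S) ≤ 0
        never ψ' fix with sat ψ' S in h
        ... | false = z≤n
        ... | true  = ⊥-elim (¬all (All.tabulate (λ {w} w∈ → inside w (seconds-∈ S w∈))))
          where
          inside : ∀ w → (∃ λ a → (a , w) ∈ S) → elem (from ψ w) ys ≡ true
          inside w (a , p) with elem (from ψ w) ys in q
          ... | true  = refl
          ... | false = ⊥-elim (elem-false q (subst (_∈ ys) (to-inj ψ' (trans (sat-elim ψ' S h p) (sym (trans (fix (from ψ w) (elem-false q)) (to-from ψ w))))) (sub a (∈-firsts p))))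
      byTargets (yes all) = begin
        sumL (λ ψ' → 𝟙 (sat ψ' S)) (fy ys ψ)   ≡⟨ sum-y ⟩
        sumL (λ y → sumL (λ ψ' → 𝟙 (sat ψ' S)) (fy xs (swapB ψ x y))) ys   ≤⟨ sumL-mono ys (λ y _ → each y) ⟩
        sumL (λ y → c * 𝟙 (not (elem (to ψ y) Z))) ys   ≡⟨ sumL-*ˡ c _ ys ⟩
        c * free                                        ≤⟨ c ⊛ free≤ ⟩
        c * suc (length xs ∸ s)                         ≡⟨ *-comm c _ ⟩
        (suc (length xs ∸ s)) !                         ≡⟨ cong _! (sym (+-∸-assoc 1 s≤)) ⟩
        (length ys ∸ s) !                               ∎
        where
        c = (length xs ∸ s) !
        free used : ℕ
        free = sumL (λ y → 𝟙 (not (elem (to ψ y) Z))) ys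
        used = sumL (λ y → 𝟙 (elem (to ψ y) Z)) ys
        used≥ : s ≤ used
        used≥ = begin
          s                                                  ≡⟨ sym (trans (cnt-elem u₂) (length-seconds S)) ⟩
          cnt (λ w → elem w Z)                               ≤⟨ ∑-mono (λ w → ptw w (elem w Z) refl) ⟩
          ∑ (λ w → 𝟙 (elem (from ψ w) ys) * 𝟙 (elem w Z))    ≡⟨ sym (∑-to ψ _) ⟩
          ∑ (λ y → 𝟙 (elem (from ψ (to ψ y)) ys) * 𝟙 (elem (to ψ y) Z))  ≡⟨ ∑-cong (λ y → cong (λ v → 𝟙 (elem v ys) * 𝟙 (elem (to ψ y) Z)) (from-to ψ y)) ⟩
          ∑ (λ y → 𝟙 (elem y ys) * 𝟙 (elem (to ψ y) Z))      ≡⟨ ∑-elem (x∉ ∷ uxs) _ ⟩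
          used                                               ∎
          where
          ptw : ∀ w b → elem w Z ≡ b → 𝟙 b ≤ 𝟙 (elem (from ψ w) ys) * 𝟙 b
          ptw w false _ = z≤n
          ptw w true  q = ≤-reflexive (cong (λ b → 𝟙 b * 1) (sym (All.lookup all (elem⇒∈ Z q))))
        both : used + free ≡ suc (length xs)
        both = trans (sym (sumL-+ (λ y → 𝟙 (elem (to ψ y) Z)) _ ys)) (trans (sumL-cong ys (λ y _ → 𝟙-not (elem (to ψ y) Z))) (sumL-1 ys))
        free≤ : free ≤ suc (length xs ∸ s)
        free≤ = +-cancelˡ-≤ s _ _ (≤-trans (used≥ ⟨+⟩ ≤-refl) (≤-reflexive (trans both (sym (trans (+-suc s _) (cong suc (m+[n∸m]≡n s≤)))))))
        each : ∀ y → sumL (λ ψ' → 𝟙 (sat ψ' S)) (fy xs (swapB ψ x y)) ≤ c * 𝟙 (not (elem (to ψ y) Z))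
        each y = begin
          sumL (λ ψ' → 𝟙 (sat ψ' S)) (fy xs (swapB ψ x y))
            ≤⟨ fy-mono xs (swapB ψ x y) (λ ψ' fix → ≤-trans (𝟙-mono (λ h → ∧-intro (cong not (∉⇒elem (fresh ψ' fix h))) h)) (≤-reflexive (𝟙-∧ (not (elem (to ψ y) Z)) _))) ⟩
          sumL (λ ψ' → 𝟙 (not (elem (to ψ y) Z)) * 𝟙 (sat ψ' S)) (fy xs (swapB ψ x y))
            ≡⟨ sumL-*ˡ (𝟙 (not (elem (to ψ y) Z))) _ (fy xs (swapB ψ x y)) ⟩
          𝟙 (not (elem (to ψ y) Z)) * sumL (λ ψ' → 𝟙 (sat ψ' S)) (fy xs (swapB ψ x y))
            ≤⟨ 𝟙 (not (elem (to ψ y) Z)) ⊛ fy-count xs (swapB ψ x y) S uxs u₁ u₂ sub' ⟩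
          𝟙 (not (elem (to ψ y) Z)) * c ≡⟨ *-comm (𝟙 (not (elem (to ψ y) Z))) c ⟩
          c * 𝟙 (not (elem (to ψ y) Z)) ∎
          where
          fresh : ∀ ψ' → (∀ z → z ∉ xs → to ψ' z ≡ to (swapB ψ x y) z) → sat ψ' S ≡ true → to ψ y ∉ Z
          fresh ψ' fix h p with seconds-∈ S p
          ... | a , q = x∉S (subst (_∈ firsts S) (to-inj ψ' (trans (sat-elim ψ' S h q) (sym (at-x y {ψ'} fix)))) (∈-firsts q))

  -- The falling factorial k(k - 1)...(k - s + 1) is at least (k/3)^s, by induction using (1 +
  -- 1/k)^s ≤ 3 for s ≤ k.
  factorial-bound : ∀ k s → s ≤ k → k ^ s * (k ∸ s) ! ≤ 3 ^ s * k !
  factorial-bound k       zero    _ = ≤-refl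
  factorial-bound (suc k) (suc s) (s≤s s≤k) = begin
    suc k * suc k ^ s * (k ∸ s) !          ≤⟨ (suc k ⊛ grow k s s≤k) ⟨*⟩ ≤-refl ⟩
    suc k * (3 * k ^ s) * (k ∸ s) !        ≡⟨ r (suc k) (k ^ s) ((k ∸ s) !) ⟩
    3 * suc k * (k ^ s * (k ∸ s) !)        ≤⟨ (3 * suc k) ⊛ factorial-bound k s s≤k ⟩
    3 * suc k * (3 ^ s * k !)              ≡⟨ r' (suc k) (3 ^ s) (k !) ⟩
    3 * 3 ^ s * (suc k * k !)              ∎
    where
    open ≤-Reasoning
    r : ∀ a b c → a * (3 * b) * c ≡ 3 * a * (b * c)
    r = solve-∀
    r' : ∀ a b c → 3 * a * (b * c) ≡ 3 * b * (a * c)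
    r' = solve-∀
    grow : ∀ k s → s ≤ k → suc k ^ s ≤ 3 * k ^ s
    grow zero    .zero z≤n = s≤s z≤n
    grow (suc k) s     h   = *-cancelʳ-≤ _ _ (suc k * suc k) (≤-trans (pow-upper (suc k) s h)
      (≤-trans ((suc k ^ s) ⊛ ((≤-refl {suc k * suc k} ⟨+⟩ h ⟨*⟩ ≤-refl) ⟨+⟩ (h ⟨*⟩ h))) (≤-reflexive (q (suc k ^ s) (suc k)))))
      where
      q : ∀ p k → p * (k * k + k * k + k * k) ≡ 3 * p * (k * k)
      q = solve-∀

  -- The whole random process and its rate.

  -- The full random process: a uniformly random bijection mapping t to v, followed by the strategy.
  module Process {n} (g : ℕ) (Good : Bij n → Set) (t v : Fin n) (xs : List (Fin n)) (ok-xs : Unique xs) (t∉ : t ∉ xs)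
                 (all : ∀ x → x ∈ t ∷ [] ⊎ x ∈ xs) (strategy : ∀ ψ → to ψ t ≡ v → Strategy.Strat g Good xs ψ)
                 (C : ℕ) (0<g : 1 ≤ g) (n≤Cg : n ≤ C * g) (n≤2k : n ≤ 2 * length xs) where
    open Strategy g Good
    open Spread g Good t

    -- The transposition puts t at v, and the shuffle moves only the images of xs, so t stays there.
    base : Bij n
    base = swapB (record { to = id ; from = id ; from-to = λ _ → refl ; to-from = λ _ → refl }) t v

    -- The test recovers the equation for ψ t, which the entries of the shuffled list do not carry
    -- along.
    launch : ∀ ψ → Dec (to ψ t ≡ v) → List (State xs)
    launch ψ (yes e) = state ψ (strategy ψ e) ∷ []
    launch ψ (no _)  = []

    𝒟₀ : List (State xs)
    𝒟₀ = concatMap (λ ψ → launch ψ (to ψ t F.≟ v)) (fy xs base)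

    0<C : 1 ≤ C
    0<C = pos-l C (≤-trans (≤-trans (s≤s z≤n) (F.toℕ<n t)) n≤Cg)

    |𝒟₀|≥ : length xs ! ≤ length 𝒟₀
    |𝒟₀|≥ = begin
      length xs !                                              ≡⟨ sym (fy-length xs base) ⟩
      length (fy xs base)                                      ≡⟨ sym (sumL-1 (fy xs base)) ⟩
      sumL (λ _ → 1) (fy xs base)                              ≤⟨ fy-mono xs base (λ ψ fix → one ψ (to ψ t F.≟ v) (trans (fix t t∉) (sw-l t v))) ⟩
      sumL (λ ψ → sumL (λ _ → 1) (launch ψ (to ψ t F.≟ v))) (fy xs base) ≡⟨ sym (sumL-concatMap (λ _ → 1) _ (fy xs base)) ⟩
      sumL (λ _ → 1) 𝒟₀                                        ≡⟨ sumL-1 𝒟₀ ⟩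
      length 𝒟₀                                                ∎
      where
      open ≤-Reasoning
      one : ∀ ψ d → to ψ t ≡ v → 1 ≤ sumL (λ _ → 1) (launch ψ d)
      one ψ (yes _) e = ≤-refl
      one ψ (no q)  e = ⊥-elim (q e)

    in-xs : ∀ {S} → ValidC t S → ∀ a → a ∈ firsts S → a ∈ xs
    in-xs V a p = [ (λ { (here refl) → ⊥-elim (ValidC.avoid V p) }) , id ]′ (all a)

    -- 6 = 2 · 3, from n ≤ 2k with k = length xs and from the factorial bound. The extra C gives n ≤
    -- 6Cg, the condition under which an exchange costs only 1 + 1/g.
    spreads₀ : Spreads n (6 * C) 𝒟₀
    spreads₀ S V = begin
      occ 𝒟₀ S * n ^ s                              ≤⟨ occ≤ ⟨*⟩ ^-monoˡ-≤ s n≤2k ⟩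
      (k ∸ s) ! * (2 * k) ^ s                       ≡⟨ cong ((k ∸ s) ! *_) (^-dist s 2 k) ⟩
      (k ∸ s) ! * (2 ^ s * k ^ s)                   ≡⟨ r ((k ∸ s) !) (2 ^ s) (k ^ s) ⟩
      2 ^ s * (k ^ s * (k ∸ s) !)                   ≤⟨ (2 ^ s) ⊛ factorial-bound k s s≤k ⟩
      2 ^ s * (3 ^ s * k !)                         ≡⟨ sym (*-assoc (2 ^ s) (3 ^ s) (k !)) ⟩
      2 ^ s * 3 ^ s * k !                           ≡⟨ cong (_* k !) (sym (^-dist s 2 3)) ⟩
      6 ^ s * k !                                   ≤⟨ ^-monoˡ-≤ s (m≤m*n 6 C {{>-nonZero 0<C}}) ⟨*⟩ |𝒟₀|≥ ⟩
      (6 * C) ^ s * length 𝒟₀                       ∎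
      where
      open ≤-Reasoning
      open ValidC V
      s = length S
      k = length xs
      r : ∀ a b c → a * (b * c) ≡ b * (c * a)
      r = solve-∀
      s≤k : s ≤ k
      s≤k = ≤-trans (≤-reflexive (sym (length-firsts S))) (sub-length uniq₁ (in-xs V))
      occ≤ : occ 𝒟₀ S ≤ (k ∸ s) !
      occ≤ = begin
        occ 𝒟₀ S                                                                   ≡⟨ sumL-concatMap _ _ (fy xs base) ⟩
        sumL (λ ψ → sumL (λ st → 𝟙 (sat (bij st) S)) (launch ψ (to ψ t F.≟ v))) (fy xs base) ≤⟨ sumL-mono (fy xs base) (λ ψ _ → one ψ (to ψ t F.≟ v)) ⟩
        sumL (λ ψ → 𝟙 (sat ψ S)) (fy xs base)                                      ≤⟨ fy-count xs base S ok-xs uniq₁ uniq₂ (in-xs V) ⟩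
        (k ∸ s) !                                                                  ∎
        where
        one : ∀ ψ d → sumL (λ st → 𝟙 (sat (bij st) S)) (launch ψ d) ≤ 𝟙 (sat ψ S)
        one ψ (yes _) = ≤-reflexive (+-identityʳ _)
        one ψ (no _)  = z≤n

    outcomes : List (State [])
    outcomes = run xs 𝒟₀

    0<outcomes : 1 ≤ length outcomes
    0<outcomes = length-run xs 𝒟₀ 0<g (≤-trans (1≤n! (length xs)) |𝒟₀|≥)

    -- 6C comes from the start. The exchanges, at most n ≤ Cg in number, multiply it by (1 +
    -- 1/g)^(Cg) ≤ 3^C.
    rate : ℕ
    rate = 6 * C * 3 ^ C

    grow : suc g ^ length xs ≤ 3 ^ C * g ^ length xs
    grow = cancelˡ {g ^ (C * g)} (^-pos (C * g) 0<g) (begin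
      g ^ (C * g) * suc g ^ N               ≡⟨ *-comm _ (suc g ^ N) ⟩
      suc g ^ N * g ^ (C * g)               ≤⟨ pow-ratio g (≤-trans (unique-length ok-xs) n≤Cg) ⟩
      suc g ^ (C * g) * g ^ N               ≤⟨ whole C ⟨*⟩ ≤-refl ⟩
      3 ^ C * g ^ (C * g) * g ^ N           ≡⟨ r (3 ^ C) (g ^ (C * g)) (g ^ N) ⟩
      g ^ (C * g) * (3 ^ C * g ^ N)         ∎)
      where
      open ≤-Reasoning
      N = length xs
      r : ∀ a b c → a * b * c ≡ b * (a * c)
      r = solve-∀
      single : suc g ^ g ≤ 3 * g ^ g
      single = cancelˡ {g * g} (*-pos 0<g 0<g) (≤-trans (≤-reflexive (*-comm (g * g) _)) (≤-trans (pow-upper g g ≤-refl) (≤-reflexive (q (g ^ g) g))))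
        where
        q : ∀ p k → p * (k * k + k * k + k * k) ≡ k * k * (3 * p)
        q = solve-∀
      whole : ∀ C → suc g ^ (C * g) ≤ 3 ^ C * g ^ (C * g)
      whole zero    = ≤-refl
      whole (suc C) = begin
        suc g ^ (g + C * g)                       ≡⟨ ^-distribˡ-+-* (suc g) g (C * g) ⟩
        suc g ^ g * suc g ^ (C * g)               ≤⟨ single ⟨*⟩ whole C ⟩
        3 * g ^ g * (3 ^ C * g ^ (C * g))         ≡⟨ q (g ^ g) (3 ^ C) (g ^ (C * g)) ⟩
        3 * 3 ^ C * (g ^ g * g ^ (C * g))         ≡⟨ cong (3 * 3 ^ C *_) (sym (^-distribˡ-+-* g g (C * g))) ⟩
        3 * 3 ^ C * g ^ (g + C * g)               ∎
        where
        q : ∀ a b c → 3 * a * (b * c) ≡ 3 * b * (a * c)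
        q = solve-∀

    spread : ∀ S → ValidC t S → occ outcomes S * n ^ length S ≤ rate ^ length S * length outcomes
    spread S V = cancelˡ {(g ^ N) ^ s} (^-pos s (^-pos N 0<g)) (begin
      (g ^ N) ^ s * (occ outcomes S * n ^ s)             ≡⟨ r₁ ((g ^ N) ^ s) (occ outcomes S) (n ^ s) ⟩
      occ outcomes S * (n ^ s * (g ^ N) ^ s)             ≡⟨ cong (occ outcomes S *_) (sym (^-dist s n (g ^ N))) ⟩
      occ outcomes S * (n * g ^ N) ^ s                   ≤⟨ run-spreads xs {𝒟₀} {n} {6 * C} (λ x p e → t∉ (subst (_∈ xs) e p)) (≤-trans n≤Cg (*-monoˡ-≤ g (m≤n*m C 6))) spreads₀ S V ⟩
      (6 * C * suc g ^ N) ^ s * length outcomes          ≤⟨ ^-monoˡ-≤ s ((6 * C) ⊛ grow) ⟨*⟩ ≤-refl ⟩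
      (6 * C * (3 ^ C * g ^ N)) ^ s * length outcomes    ≡⟨ cong (λ z → z ^ s * length outcomes) (sym (*-assoc (6 * C) (3 ^ C) (g ^ N))) ⟩
      (rate * g ^ N) ^ s * length outcomes               ≡⟨ cong (_* length outcomes) (^-dist s rate (g ^ N)) ⟩
      rate ^ s * (g ^ N) ^ s * length outcomes           ≡⟨ r₂ (rate ^ s) ((g ^ N) ^ s) (length outcomes) ⟩
      (g ^ N) ^ s * (rate ^ s * length outcomes)         ∎)
      where
      open ≤-Reasoning
      s = length S
      N = length xs
      r₁ : ∀ a b c → a * (b * c) ≡ b * (c * a)
      r₁ = solve-∀
      r₂ : ∀ a b c → a * b * c ≡ b * (a * c)
      r₂ = solve-∀

  -- The constants and the inequalities between them.

  quotient : ∀ n d → 1 ≤ d → d ≤ n → ∃ λ q → d * q ≤ n × n ≤ 2 * d * q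
  quotient n (suc d) _ d≤n = q , le , ge
    where
    q r : ℕ
    q = n / suc d
    r = n % suc d
    n≡ : n ≡ r + q * suc d
    n≡ = m≡m%n+[m/n]*n n (suc d)
    le : suc d * q ≤ n
    le = ≤-trans (m≤n+m _ r) (≤-reflexive (trans (cong (r +_) (*-comm (suc d) q)) (sym n≡)))
    r< : r < suc d
    r< = m%n<n n (suc d)
    0<q : 1 ≤ q
    0<q = go q refl
      where
      go : ∀ x → q ≡ x → 1 ≤ q
      go (suc x) e = ≤-trans (s≤s z≤n) (≤-reflexive (sym e))
      go zero    e = ⊥-elim (<-irrefl refl (≤-trans (≤-trans r< d≤n) (≤-reflexive (trans n≡ (trans (cong (λ x → r + x * suc d) e) (+-identityʳ r))))))
    ge : n ≤ 2 * suc d * q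
    ge = certify (≤-reflexive n≡ ⟨+⟩ <⇒≤ r< ⟨+⟩ suc d ⊛ 0<q) 0 (e n r q d)
      where
      e : ∀ n r q d → n + (r + q * suc d + (suc d + suc d * q)) + 0 ≡ 2 * suc d * q + (n + (r + suc d * 1))
      e = solve-∀

  -- With κ = z b, the factor (1 + 1/κ)^(2n) accumulated over all steps is a small power of 1 + 1/b.
  drift : ∀ z b → 1 ≤ b → suc (z * b) ^ z * (b * b) ≤ (z * b) ^ z * (suc b * suc b)
  drift zero    b 0<b = 1 ⊛ (n≤1+n b ⟨*⟩ n≤1+n b)
  drift (suc z') b 0<b = cancelˡ {z * z} (s≤s z≤n) (begin
    z * z * (suc κ ^ z * (b * b))              ≡⟨ e₁ z b (suc κ ^ z) ⟩
    suc κ ^ z * (κ * κ)                        ≤⟨ pow-upper κ z (m≤m*n z b {{>-nonZero 0<b}}) ⟩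
    κ ^ z * (κ * κ + z * κ + z * z)            ≤⟨ (κ ^ z) ⊛ certify (≤-refl {0}) (z * z * b) (e₂ z b) ⟩
    κ ^ z * (z * z * (suc b * suc b))          ≡⟨ e₃ (κ ^ z) (z * z) (suc b * suc b) ⟩
    z * z * (κ ^ z * (suc b * suc b))          ∎)
    where
    open ≤-Reasoning
    z = suc z'
    κ = z * b
    e₁ : ∀ z b p → z * z * (p * (b * b)) ≡ p * (z * b * (z * b))
    e₁ = solve-∀
    e₂ : ∀ z b → z * b * (z * b) + z * (z * b) + z * z + 0 + z * z * b ≡ z * z * (suc b * suc b) + 0
    e₂ = solve-∀
    e₃ : ∀ p a c → p * (a * c) ≡ a * (p * c)
    e₃ = solve-∀

  ^-swap : ∀ a i j → (a ^ i) ^ j ≡ a ^ (j * i)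
  ^-swap a i j = trans (^-*-assoc a i j) (cong (a ^_) (*-comm i j))

  drift-total : ∀ z b m u → 1 ≤ z → 1 ≤ b → m ≤ z * u → suc (z * b) ^ m * b ^ (2 * u) ≤ (z * b) ^ m * suc b ^ (2 * u)
  drift-total z b m u 0<z 0<b m≤ = cancelˡ {κ ^ (z * u)} (^-pos (z * u) (*-pos 0<z 0<b)) (begin
    κ ^ (z * u) * (suc κ ^ m * b ^ (2 * u))            ≡⟨ e₁ (κ ^ (z * u)) (suc κ ^ m) (b ^ (2 * u)) ⟩
    suc κ ^ m * κ ^ (z * u) * b ^ (2 * u)              ≤⟨ pow-ratio κ m≤ ⟨*⟩ ≤-refl ⟩
    suc κ ^ (z * u) * κ ^ m * b ^ (2 * u)              ≡⟨ e₂ (suc κ ^ (z * u)) (κ ^ m) (b ^ (2 * u)) ⟩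
    suc κ ^ (z * u) * b ^ (2 * u) * κ ^ m              ≤⟨ powered ⟨*⟩ ≤-refl ⟩
    κ ^ (z * u) * suc b ^ (2 * u) * κ ^ m              ≡⟨ e₃ (κ ^ (z * u)) (suc b ^ (2 * u)) (κ ^ m) ⟩
    κ ^ (z * u) * (κ ^ m * suc b ^ (2 * u))            ∎)
    where
    open ≤-Reasoning
    κ = z * b
    sq : ∀ x → (x * x) ^ u ≡ x ^ (2 * u)
    sq x = trans (cong (λ y → (x * y) ^ u) (sym (*-identityʳ x))) (^-*-assoc x 2 u)
    powered : suc κ ^ (z * u) * b ^ (2 * u) ≤ κ ^ (z * u) * suc b ^ (2 * u)
    powered = begin
      suc κ ^ (z * u) * b ^ (2 * u)      ≡⟨ cong₂ _*_ (sym (^-*-assoc (suc κ) z u)) (sym (sq b)) ⟩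
      (suc κ ^ z) ^ u * (b * b) ^ u      ≡⟨ sym (^-dist u (suc κ ^ z) (b * b)) ⟩
      (suc κ ^ z * (b * b)) ^ u          ≤⟨ ^-monoˡ-≤ u (drift z b 0<b) ⟩
      (κ ^ z * (suc b * suc b)) ^ u      ≡⟨ ^-dist u (κ ^ z) (suc b * suc b) ⟩
      (κ ^ z) ^ u * (suc b * suc b) ^ u  ≡⟨ cong₂ _*_ (^-*-assoc κ z u) (sq (suc b)) ⟩
      κ ^ (z * u) * suc b ^ (2 * u)      ∎
    e₁ : ∀ a x y → a * (x * y) ≡ x * a * y
    e₁ = solve-∀
    e₂ : ∀ a x y → a * x * y ≡ a * y * x
    e₂ = solve-∀
    e₃ : ∀ a x y → a * x * y ≡ a * (y * x)
    e₃ = solve-∀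

  -- Four Bernoulli factors (b + 1)^u/b^u ≥ (b + u)/b already beat a cubic polynomial.
  beats-cubic : ∀ b u E n → 1 ≤ b → 1 ≤ n → n ≤ 2 * E * u → 32 * E * E * E * (b * b * (b * b)) ≤ u →
                2 * n * n * suc n * b ^ (4 * u) < suc b ^ (4 * u)
  beats-cubic b u E n 0<b 0<n n≤ u≥ = *-cancelʳ-< (b ^ 4) _ _ (begin-strict
    2 * n * n * suc n * b ^ (4 * u) * b ^ 4            ≡⟨ e₁ (2 * n * n * suc n) (b ^ (4 * u)) (b ^ 4) ⟩
    2 * n * n * suc n * b ^ 4 * b ^ (4 * u)            <⟨ *-monoˡ-< (b ^ (4 * u)) {{>-nonZero (^-pos (4 * u) 0<b)}} poly ⟩
    (b + u) ^ 4 * b ^ (4 * u)                          ≡⟨ trans (cong ((b + u) ^ 4 *_) (sym (^-swap b u 4))) (trans (*-comm ((b + u) ^ 4) _) (sym (^-dist 4 (b ^ u) (b + u)))) ⟩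
    (b ^ u * (b + u)) ^ 4                              ≤⟨ ^-monoˡ-≤ 4 (bernoulli b u) ⟩
    (suc b ^ u * b) ^ 4                                ≡⟨ trans (^-dist 4 (suc b ^ u) b) (cong (_* b ^ 4) (^-swap (suc b) u 4)) ⟩
    suc b ^ (4 * u) * b ^ 4                            ∎)
    where
    open ≤-Reasoning
    e₁ : ∀ a x y → a * x * y ≡ a * y * x
    e₁ = solve-∀
    m = 2 * E * u
    0<b+u : 1 ≤ (b + u) ^ 3
    0<b+u = ^-pos 3 (≤-trans 0<b (m≤m+n b u))
    poly : 2 * n * n * suc n * b ^ 4 < (b + u) ^ 4
    poly = begin-strict
      2 * n * n * suc n * b ^ 4                        ≤⟨ certify ((2 * n * n * b ^ 4) ⊛ 0<n) 0 (e₂ n (b ^ 4)) ⟩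
      4 * (n * n * n) * b ^ 4                          ≤⟨ (4 ⊛ ((n≤ ⟨*⟩ n≤) ⟨*⟩ n≤)) ⟨*⟩ ≤-refl ⟩
      4 * (m * m * m) * b ^ 4                          ≡⟨ e₃ b u E ⟩
      32 * E * E * E * (b * b * (b * b)) * (u * u * u) ≤⟨ u≥ ⟨*⟩ ≤-refl ⟩
      u * (u * u * u)                                  ≡⟨ e₄ u ⟩
      u * u ^ 3                                        ≤⟨ u ⊛ ^-monoˡ-≤ 3 (m≤n+m u b) ⟩
      u * (b + u) ^ 3                                  <⟨ *-monoˡ-< ((b + u) ^ 3) {{>-nonZero 0<b+u}} (+-monoˡ-≤ u 0<b) ⟩
      (b + u) ^ 4                                      ∎
      where
      e₂ : ∀ n q → 2 * n * n * suc n * q + 2 * n * n * q * n + 0 ≡ 4 * (n * n * n) * q + 2 * n * n * q * 1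
      e₂ = solve-∀
      e₃ : ∀ b u E → 4 * (2 * E * u * (2 * E * u) * (2 * E * u)) * (b * (b * (b * (b * 1)))) ≡ 32 * E * E * E * (b * b * (b * b)) * (u * u * u)
      e₃ = solve-∀
      e₄ : ∀ u → u * (u * u * u) ≡ u * (u * (u * (u * 1)))
      e₄ = solve-∀

  -- The exponent 8u is spent as 4u against the polynomial 2n²(n + 1), 2u against the drift (1 +
  -- 1/(zb))^(2n), and 2u against the shallow vertices.
  final-bound : ∀ z b u E n s → 1 ≤ z → 1 ≤ b → 1 ≤ n → n ≤ 2 * E * u → 2 * n ≤ z * u → s ≤ u →
                32 * E * E * E * (b * b * (b * b)) ≤ u →
                2 * n * n * suc n * (suc (z * b) ^ (2 * n) * suc b ^ (2 * s)) * b ^ (8 * u) < suc b ^ (8 * u) * ((z * b) ^ (2 * n) * b ^ (2 * s))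
  final-bound z b u E n s 0<z 0<b 0<n n≤ 2n≤ s≤ u≥ = begin-strict
    P * (A * B) * b ^ (8 * u)                                    ≡⟨ cong (P * (A * B) *_) (split b) ⟩
    P * (A * B) * (b ^ (4 * u) * b ^ (2 * u) * b ^ (2 * u))      ≡⟨ e₁ P A B (b ^ (4 * u)) (b ^ (2 * u)) ⟩
    P * b ^ (4 * u) * (A * b ^ (2 * u) * (B * b ^ (2 * u)))      ≤⟨ (P * b ^ (4 * u)) ⊛ (drift-total z b (2 * n) u 0<z 0<b 2n≤ ⟨*⟩ pow-ratio b (2 ⊛ s≤)) ⟩
    P * b ^ (4 * u) * R                                          <⟨ *-monoˡ-< R {{>-nonZero 0<R}} (beats-cubic b u E n 0<b 0<n n≤ u≥) ⟩
    suc b ^ (4 * u) * R                                          ≡⟨ e₂ (suc b ^ (4 * u)) κn (suc b ^ (2 * u)) bs ⟩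
    suc b ^ (4 * u) * suc b ^ (2 * u) * suc b ^ (2 * u) * (κn * bs) ≡⟨ cong (_* (κn * bs)) (sym (split (suc b))) ⟩
    suc b ^ (8 * u) * (κn * bs)                                  ∎
    where
    open ≤-Reasoning
    P A B κn bs R : ℕ
    P = 2 * n * n * suc n
    A = suc (z * b) ^ (2 * n)
    B = suc b ^ (2 * s)
    κn = (z * b) ^ (2 * n)
    bs = b ^ (2 * s)
    R = κn * suc b ^ (2 * u) * (suc b ^ (2 * u) * bs)
    0<R : 1 ≤ R
    0<R = *-pos (*-pos (^-pos (2 * n) (*-pos 0<z 0<b)) (^-pos (2 * u) (s≤s z≤n))) (*-pos (^-pos (2 * u) (s≤s z≤n)) (^-pos (2 * s) 0<b))
    split : ∀ x → x ^ (8 * u) ≡ x ^ (4 * u) * x ^ (2 * u) * x ^ (2 * u)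
    split x = trans (cong (x ^_) (e u)) (trans (^-distribˡ-+-* x (4 * u + 2 * u) (2 * u)) (cong (_* x ^ (2 * u)) (^-distribˡ-+-* x (4 * u) (2 * u))))
      where
      e : ∀ u → 8 * u ≡ 4 * u + 2 * u + 2 * u
      e = solve-∀
    e₁ : ∀ p a b x y → p * (a * b) * (x * y * y) ≡ p * x * (a * y * (b * y))
    e₁ = solve-∀
    e₂ : ∀ x k y b → x * (k * y * (y * b)) ≡ x * y * y * (k * b)
    e₂ = solve-∀

  module Constants (k Δ : ℕ) (0<k : 1 ≤ k) where
    -- With fewer than n/`ē` vertices left, the end phase destroys at most n/(4c) stars. The unit u
    -- of exponents is about n/`E`, so that `Y₀` = 8u is below N/4 until then, and `z` = 4`E` gives
    -- 2n ≤ zu. Of the 1 + `H'` = 4cEβ levels at most β are bad. `b` dominates the second-order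
    -- terms of a block, and g is about n/`G₁`.
    kk c ℓ' ℓ ē E z A h β H' M X b κ W G₁ u₀ n₀ : ℕ
    kk = 2 * k
    c  = 2 * kk * kk * kk ^ Δ
    ℓ' = 2 * kk * kk * kk ∸ 1
    ℓ  = suc ℓ'
    ē  = 8 * (c * suc Δ)
    E  = 32 * ē
    z  = 4 * E
    A  = 2 * (3 * z) * (2 * k) + 2 * kk * kk
    h  = ℓ' * A
    β  = 2 * h + 2
    H' = 4 * c * E * β ∸ 1
    M  = Σℕ (suc H') (Δ ^_)
    X  = c * M
    b  = suc (3 * z * (k + 2) * X + 3 * z * c * X + X)
    κ  = z * b
    W  = (2 + 8 * kk * kk) * suc κ
    G₁ = 4 * ē * W * c
    u₀ = 32 * E * E * E * (b * b * (b * b)) + 2 * c * (1 + Σℕ (suc (suc (2 * h))) (Δ ^_))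
    n₀ = 2 + E + G₁ + 2 * E * u₀ + ē * (2 * (3 * z) * (2 * k) * M + 4 * k + 2 * W * M)

    0<kk : 1 ≤ kk
    0<kk = *-pos {2} (s≤s z≤n) 0<k

    0<c : 1 ≤ c
    0<c = *-pos (*-pos (*-pos {2} (s≤s z≤n) 0<kk) 0<kk) (^-pos Δ 0<kk)

    0<ē : 1 ≤ ē
    0<ē = *-pos {8} (s≤s z≤n) (*-pos 0<c (s≤s z≤n))

    0<E : 1 ≤ E
    0<E = *-pos {32} (s≤s z≤n) 0<ē

    0<z : 1 ≤ z
    0<z = *-pos {4} (s≤s z≤n) 0<E

    0<W : 1 ≤ W
    0<W = s≤s z≤n

    0<G₁ : 1 ≤ G₁
    0<G₁ = *-pos (*-pos (*-pos {4} (s≤s z≤n) 0<ē) 0<W) 0<c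

    0<ℓ' : 1 ≤ ℓ'
    0<ℓ' = ≤-pred (≤-trans (2 ⊛ *-pos (*-pos 0<kk 0<kk) 0<kk) (≤-reflexive (trans (e kk) (sym (m+[n∸m]≡n (*-pos (*-pos (*-pos {2} (s≤s z≤n) 0<kk) 0<kk) 0<kk))))))
      where
      e : ∀ k → 2 * (k * k * k) ≡ 2 * k * k * k
      e = solve-∀

    -- Bernoulli's inequality with `h` = ℓ'`A`: (1 + 1/ℓ')^h is at least 1 + `A`.
    mixes : A * ℓ' ^ h ≤ ℓ ^ h
    mixes = cancelˡ 0<ℓ' (certify (bernoulli ℓ' h) (ℓ' * ℓ' ^ h) (e ℓ' A (ℓ' ^ h) (ℓ ^ h)))
      where
      e : ∀ l A p q → l * (A * p) + q * l + l * p ≡ l * q + p * (l + l * A)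
      e = solve-∀

    suc-H' : suc H' ≡ 4 * c * E * β
    suc-H' = m+[n∸m]≡n (*-pos (*-pos (*-pos {4} (s≤s z≤n) 0<c) 0<E) (≤-trans (s≤s z≤n) (m≤n+m 2 (2 * h))))

    -- S̄ counts the vertices without full neighbourhood inside their block.
    params : ∀ (n u g S̄ : ℕ) → Params
    params n u g S̄ = record { n = n ; k = k ; Δ = Δ ; h = h ; M = M ; z = z ; b = b ; g = g ; Y₀ = 8 * u ; S̄ = S̄ ; ē = ē }

    module _ {n u g S̄ : ℕ} (n≥ : n₀ ≤ n) (Eu≤ : E * u ≤ n) (n≤ : n ≤ 2 * E * u) (Gg≤ : G₁ * g ≤ n) (cS≤ : c * S̄ ≤ u) where

      module Large where
        N₁ : ℕ
        N₁ = 2 * (3 * z) * (2 * k) * M + 4 * k + 2 * W * M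
        core : ∀ {a x e y} → a + x + y + 2 * E * u₀ + e ≤ n → (2 * E * u₀ ≤ n) × (e ≤ n) × (a ≤ n)
        core {a} {x} {e} {y} h = ≤-trans (m≤n+m _ (a + x + y)) (≤-trans (m≤m+n _ e) h) , ≤-trans (m≤n+m e _) h
          , ≤-trans (≤-trans (≤-trans (≤-trans (m≤m+n a x) (m≤m+n _ y)) (m≤m+n _ _)) (m≤m+n _ e)) h
        parts : (2 * E * u₀ ≤ n) × (ē * N₁ ≤ n) × (2 ≤ n)
        parts = core {2} {E} {ē * N₁} {G₁} n≥

      u₀≤u : u₀ ≤ u
      u₀≤u = cancelˡ {2 * E} (*-pos {2} (s≤s z≤n) 0<E) (≤-trans (proj₁ Large.parts) n≤)

      0<n : 1 ≤ n
      0<n = ≤-trans (s≤s z≤n) (proj₂ (proj₂ Large.parts))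

      valid : Valid (params n u g S̄)
      valid = record
        { 0<k = 0<k ; 0<z = 0<z ; 0<b = s≤s z≤n
        ; X≤b = m≤n⇒m≤1+n (m≤n+m X _)
        ; hr₁ = m≤n⇒m≤1+n (≤-trans (m≤m+n _ _) (m≤m+n _ X))
        ; hr₂ = m≤n⇒m≤1+n (≤-trans (m≤n+m _ (3 * z * (k + 2) * X)) (m≤m+n _ X))
        ; hmix = ≤-trans (*-monoˡ-≤ (ℓ' ^ h) (m≤m+n (2 * (3 * z) * (2 * k)) (2 * kk * kk))) mixes
        ; hmix' = ≤-trans (*-monoˡ-≤ (ℓ' ^ h) (m≤n+m (2 * kk * kk) (2 * (3 * z) * (2 * k)))) mixes
        ; hfin = final-bound z b u E n (c * S̄) 0<z (s≤s z≤n) 0<n n≤ 2n≤ cS≤ (≤-trans (m≤m+n _ _) u₀≤u)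
        ; hN = hN
        ; hend = hend }
        where
        2n≤ : 2 * n ≤ z * u
        2n≤ = ≤-trans (2 ⊛ n≤) (≤-reflexive (e E u))
          where
          e : ∀ E u → 2 * (2 * E * u) ≡ 4 * E * u
          e = solve-∀
        hN : ∀ N → n ≤ ē * N → (1 ≤ N) × (2 * (3 * z) * (2 * k) * M ≤ N) × (8 * u + 2 * k ≤ N) × (2 * g ≤ N) × (W * (g + M) ≤ 4 * kk * N)
        hN N n≤N = ≤-trans 0<k (≤-trans (≤-trans (m≤n*m k 4) (≤-trans (m≤n+m (4 * k) (2 * (3 * z) * (2 * k) * M)) (m≤m+n _ _))) N₁≤)
                 , ≤-trans (≤-trans (m≤m+n _ (4 * k)) (m≤m+n _ (2 * W * M))) N₁≤
                 , cancelˡ {4} (s≤s z≤n) (certify (32u ⟨+⟩ ≤-trans (≤-trans (m≤n+m (4 * k) (2 * (3 * z) * (2 * k) * M)) (m≤m+n _ _)) N₁≤ ⟨+⟩ ≤-trans (≤-trans (m≤n+m (4 * k) (2 * (3 * z) * (2 * k) * M)) (m≤m+n _ _)) N₁≤) N (e₁ u k N))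
                 , ≤-trans (≤-trans (2 ⊛ m≤n*m g (W * c) {{>-nonZero (*-pos 0<W 0<c)}}) (certify (≤-refl {0}) (2 * (W * c * g)) (e₂ (W * c * g)))) 4g
                 , ≤-trans bothW (*-monoˡ-≤ N (*-pos {4} (s≤s z≤n) 0<kk))
          where
          N₁≤ : Large.N₁ ≤ N
          N₁≤ = cancelˡ 0<ē (≤-trans (proj₁ (proj₂ Large.parts)) n≤N)
          32u : 32 * u ≤ N
          32u = cancelˡ 0<ē (≤-trans (≤-trans (≤-reflexive (e ē u)) Eu≤) n≤N)
            where
            e : ∀ a u → a * (32 * u) ≡ 32 * a * u
            e = solve-∀
          4g : 4 * (W * c * g) ≤ N
          4g = cancelˡ 0<ē (≤-trans (≤-trans (≤-reflexive (e ē W c g)) Gg≤) n≤N)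
            where
            e : ∀ a W c g → a * (4 * (W * c * g)) ≡ 4 * a * W * c * g
            e = solve-∀
          bothW : W * (g + M) ≤ 1 * N
          bothW = cancelˡ {2} (s≤s z≤n) (certify (4g ⟨+⟩ (4 * W * g) ⊛ 0<c ⟨+⟩ ≤-trans (m≤n+m (2 * W * M) (2 * (3 * z) * (2 * k) * M + 4 * k)) N₁≤) (2 * W * g) (e W g M c N))
            where
            e : ∀ W g M c N → 2 * (W * (g + M)) + (N + (4 * W * g * c + N)) + 2 * W * g ≡ 2 * (1 * N) + (4 * (W * c * g) + (4 * W * g * 1 + 2 * W * M))
            e = solve-∀
          e₁ : ∀ u k N → 4 * (8 * u + 2 * k) + (N + (N + N)) + N ≡ 4 * N + (32 * u + (4 * k + 4 * k))
          e₁ = solve-∀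
          e₂ : ∀ x → 2 * x + 0 + 2 * x ≡ 4 * x + 0
          e₂ = solve-∀
        -- From 4N ≤ n and 32u ≤ n follows 4c · st ≥ 2n, while 4cg and 4c(2Δ + 2)N = `ē`N are at
        -- most n each.
        hend : ∀ e N st → n ≤ e + N → ē * N < n → e ≤ c * st + 8 * u → g + (2 * Δ + 2) * N ≤ st
        hend e N st n≤eN ēN< e≤ = cancelˡ {4 * c} (*-pos {4} (s≤s z≤n) 0<c)
          (certify (4 ⊛ n≤eN ⟨+⟩ <⇒≤ ēN< ⟨+⟩ 4 ⊛ e≤ ⟨+⟩ u-small ⟨+⟩ g-small ⟨+⟩ N-small) 0 (r c Δ g N e st n u))
          where
          u-small : 32 * u ≤ n
          u-small = ≤-trans (≤-trans (32 ⊛ m≤n*m u ē {{>-nonZero 0<ē}}) (≤-reflexive (r ē u))) Eu≤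
            where
            r : ∀ a u → 32 * (a * u) ≡ 32 * a * u
            r = solve-∀
          g-small : 4 * c * g ≤ n
          g-small = ≤-trans (≤-trans (m≤n*m (4 * c * g) (ē * W) {{>-nonZero (*-pos 0<ē 0<W)}}) (≤-reflexive (r ē W c g))) Gg≤
            where
            r : ∀ a W c g → a * W * (4 * c * g) ≡ 4 * a * W * c * g
            r = solve-∀
          N-small : 4 * N ≤ n
          N-small = ≤-trans (≤-trans (*-monoˡ-≤ N {4} {8} (s≤s (s≤s (s≤s (s≤s z≤n))))) (*-monoˡ-≤ N {8} (8 ⊛ *-pos 0<c (s≤s {0} {Δ} z≤n)))) (<⇒≤ ēN<)
          r : ∀ c Δ g N e st n u → 4 * c * (g + (2 * Δ + 2) * N) + (4 * (e + N) + (n + (4 * (c * st + 8 * u) + (n + (n + n))))) + 0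
              ≡ 4 * c * st + (4 * n + (8 * (c * suc Δ) * N + (4 * e + (32 * u + (4 * c * g + 4 * N)))))
          r = solve-∀

    -- The bad levels hold at most nβ/(4cEβ) ≤ u/(2c) vertices. The root and the vertices near it
    -- also number at most u/(2c), by the second summand of `u₀`.
    shallow-small : ∀ {n u cb B S̄} → suc H' * cb ≤ n * B → B ≤ β → n ≤ 2 * E * u → u₀ ≤ u →
                    S̄ ≤ 1 + cb + Σℕ (suc (suc (2 * h))) (Δ ^_) → c * S̄ ≤ u
    shallow-small {n} {u} {cb} {B} {S̄} levels B≤ n≤ u₀≤ S̄≤ = cancelˡ {2} (s≤s z≤n)
      (certify ((2 * c) ⊛ S̄≤ ⟨+⟩ few ⟨+⟩ ≤-trans (m≤n+m _ (32 * E * E * E * (b * b * (b * b)))) u₀≤) 0 (r c S̄ cb geo u))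
      where
      geo = Σℕ (suc (suc (2 * h))) (Δ ^_)
      r : ∀ c S cb g u → 2 * (c * S) + (2 * c * (1 + cb + g) + (u + u)) + 0 ≡ 2 * u + (2 * c * S + (2 * c * cb + 2 * c * (1 + g)))
      r = solve-∀
      few : 2 * c * cb ≤ u
      few = cancelˡ {2 * E * β} (*-pos (*-pos {2} (s≤s z≤n) 0<E) (≤-trans (s≤s z≤n) (m≤n+m 2 (2 * h)))) (begin
        2 * E * β * (2 * c * cb)  ≡⟨ e c E β cb ⟩
        4 * c * E * β * cb        ≡⟨ cong (_* cb) (sym suc-H') ⟩
        suc H' * cb               ≤⟨ levels ⟩
        n * B                     ≤⟨ n≤ ⟨*⟩ B≤ ⟩
        2 * E * u * β             ≡⟨ e' E u β ⟩
        2 * E * β * u             ∎)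
        where
        open ≤-Reasoning
        e : ∀ c E β x → 2 * E * β * (2 * c * x) ≡ 4 * c * E * β * x
        e = solve-∀
        e' : ∀ E u β → 2 * E * u * β ≡ 2 * E * β * u
        e' = solve-∀

  Σℕ-≤const : ∀ m {f : ℕ → ℕ} → (∀ i → f i ≤ 1) → Σℕ m f ≤ m
  Σℕ-≤const zero    h = z≤n
  Σℕ-≤const (suc m) h = ≤-trans (Σℕ-≤const m h ⟨+⟩ h m) (≤-reflexive (+-comm m 1))

  Σℕ-<ᵇ : ∀ m j → Σℕ m (λ l → 𝟙 (l Data.Nat.<ᵇ j)) ≤ j
  Σℕ-<ᵇ zero    j = z≤n
  Σℕ-<ᵇ (suc m) j with m Data.Nat.<ᵇ j in e
  ... | true  = ≤-trans (Σℕ-≤const m (λ l → 𝟙≤1 (l Data.Nat.<ᵇ j)) ⟨+⟩ ≤-refl {1}) (≤-trans (≤-reflexive (+-comm m 1)) (<ᵇ-true e))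
  ... | false = ≤-trans (≤-reflexive (+-identityʳ _)) (Σℕ-<ᵇ m j)

  Σℕ-≡ᵇ : ∀ m j → Σℕ m (λ l → 𝟙 (l Data.Nat.≡ᵇ j)) ≤ 𝟙 (j Data.Nat.<ᵇ m)
  Σℕ-≡ᵇ zero    j = z≤n
  Σℕ-≡ᵇ (suc m) j with m Data.Nat.≡ᵇ j in e
  ... | true  = ≤-trans (Σℕ-≡ᵇ m j ⟨+⟩ ≤-refl {1}) (≤-trans (≤-reflexive (+-comm (𝟙 (j Data.Nat.<ᵇ m)) 1)) (subst (λ j → suc (𝟙 (j Data.Nat.<ᵇ m)) ≤ 𝟙 (j Data.Nat.<ᵇ suc m)) (≡ᵇ-true {m} e) diag))
    where
    diag : suc (𝟙 (m Data.Nat.<ᵇ m)) ≤ 𝟙 (m Data.Nat.<ᵇ suc m)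
    diag = byCase (m Data.Nat.<ᵇ m) refl
      where
      byCase : ∀ x → (m Data.Nat.<ᵇ m) ≡ x → suc (𝟙 (m Data.Nat.<ᵇ m)) ≤ 𝟙 (m Data.Nat.<ᵇ suc m)
      byCase true  q = ⊥-elim (<-irrefl refl (<ᵇ-true {m} q))
      byCase false q = ≤-reflexive (trans (cong (suc ∘ 𝟙) q) (cong 𝟙 (sym (true-<ᵇ (n<1+n m)))))
  ... | false = ≤-trans (≤-reflexive (+-identityʳ _)) (≤-trans (Σℕ-≡ᵇ m j) (𝟙-mono (λ q → true-<ᵇ (m<n⇒m<1+n (<ᵇ-true {j} q)))))

  Σℕ-badLevel : ∀ m h H' → Σℕ m (λ l → 𝟙 ((l Data.Nat.<ᵇ suc (2 * h)) ∨ (l Data.Nat.≡ᵇ H'))) ≤ 2 * h + 2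
  Σℕ-badLevel m h H' = begin
    Σℕ m (λ l → 𝟙 ((l Data.Nat.<ᵇ suc (2 * h)) ∨ (l Data.Nat.≡ᵇ H')))                  ≤⟨ Σℕ-mono m (λ l → 𝟙-∨ (l Data.Nat.<ᵇ suc (2 * h)) (l Data.Nat.≡ᵇ H')) ⟩
    Σℕ m (λ l → 𝟙 (l Data.Nat.<ᵇ suc (2 * h)) + 𝟙 (l Data.Nat.≡ᵇ H'))                  ≡⟨ Σℕ-+ m _ _ ⟩
    Σℕ m (λ l → 𝟙 (l Data.Nat.<ᵇ suc (2 * h))) + Σℕ m (λ l → 𝟙 (l Data.Nat.≡ᵇ H'))     ≤⟨ Σℕ-<ᵇ m (suc (2 * h)) ⟨+⟩ ≤-trans (Σℕ-≡ᵇ m H') (𝟙≤1 (H' Data.Nat.<ᵇ m)) ⟩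
    suc (2 * h) + 1                                                                    ≡⟨ sym (+-suc (2 * h) 1) ⟩
    2 * h + 2                                                                          ∎
    where
    open ≤-Reasoning
    𝟙-∨ : ∀ a b → 𝟙 (a ∨ b) ≤ 𝟙 a + 𝟙 b
    𝟙-∨ true  b = m≤m+n 1 (𝟙 b)
    𝟙-∨ false b = ≤-refl
    Σℕ-+ : ∀ m f g → Σℕ m (λ l → f l + g l) ≡ Σℕ m f + Σℕ m g
    Σℕ-+ zero    f g = refl
    Σℕ-+ (suc m) f g = trans (cong (_+ (f m + g m)) (Σℕ-+ m f g)) (r (Σℕ m f) (Σℕ m g) (f m) (g m))
      where
      r : ∀ a b x y → a + b + (x + y) ≡ a + x + (b + y)
      r = solve-∀

  -- The initial potential, and the assembly of all phases.

  module Initial (𝒮 : Setting) (n≥ : 1 ≤ Setting.n 𝒮) (δ : ∀ w → (Setting.k 𝒮 + 2) * Setting.n 𝒮 ≤ 2 * Setting.k 𝒮 * cnt (adj (Setting.G 𝒮) w))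
                 (rem : List (Fin (Setting.n 𝒮))) (ordered : Ok (Setting.par 𝒮) (Setting.t 𝒮 ∷ []) rem)
                 (covers : ∀ x → x ∈ Setting.t 𝒮 ∷ [] ⊎ x ∈ rem) where
    open Setting 𝒮
    open Bulk 𝒮
    open Tests G T deep
    open Weight b Q 0<b

    elem-all : ∀ x → elem x (t ∷ rem) ≡ true
    elem-all x = ∈⇒elem {xs = t ∷ rem} ([ (λ { (here e) → here e }) , there ]′ (covers x))

    ∑≤ : ∀ (f : Fin n → ℕ) → ∑ f ≤ f t + sumL f rem
    ∑≤ f = ≤-trans (≤-reflexive (∑-cong (λ x → trans (sym (*-identityˡ (f x))) (cong (λ e → 𝟙 e * f x) (sym (elem-all x)))))) (∑-elem≤ (t ∷ rem) f)

    rem≤n : length rem ≤ n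
    rem≤n = unique-length (Ok-unique ordered)

    n≤rem : n ≤ suc (length rem)
    n≤rem = ≤-trans (≤-reflexive (sym (trans (∑-const n 1) (*-identityʳ n)))) (≤-trans (∑≤ (λ _ → 1)) (≤-reflexive (cong suc (trans (sumL-const 1 rem) (*-identityʳ _)))))

    degTest-0 : ∀ (ψ : Bij n) w → degTest (to ψ) rem w ≡ 0
    degTest-0 ψ w = m≤n⇒m∸n≡0 (≤-trans ((k + 2) ⊛ rem≤n) (≤-trans (δ w) (≤-trans ((2 * k) ⊛ all-hits) (≤-reflexive (r k (hits (to ψ) rem w))))))
      where
      all-hits : cnt (adj G w) ≤ suc (hits (to ψ) rem w)
      all-hits = ≤-trans (≤-reflexive (sym (∑-to ψ (λ a → 𝟙 (adj G w a))))) (≤-trans (∑≤ (λ x → 𝟙 (adj G w (to ψ x)))) (𝟙≤1 (adj G w (to ψ t)) ⟨+⟩ ≤-refl))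
      r : ∀ k h → 2 * k * suc h ≡ 2 * k * h + 2 * k
      r = solve-∀

    -- The single placed vertex counts at most c against c - 1.
    starTest≤1 : ∀ χ u w → starTest χ (t ∷ []) u w ≤ 1
    starTest≤1 χ u w = m≤n+o⇒m∸n≤o _ _ (≤-trans (c ⊛ bads≤ χ (t ∷ []) u w) (≤-reflexive (trans (cong (_* 1) (sym (m+[n∸m]≡n 0<c))) (r (c ∸ 1)))))
      where
      r : ∀ c → (1 + c) * 1 ≡ c * 1 + 1
      r = solve-∀

    0<Q : 1 ≤ Q
    0<Q = *-pos (≤-trans 0<c (m≤n+m c (3 * k + 2))) n≥

    wt≤ : ∀ {y} → y ≤ 1 → wt y ≤ 2 * b ^ Q
    wt≤ z≤n       = ≤-trans (≤-reflexive wt-0) (m≤m+n _ _)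
    wt≤ (s≤s z≤n) = ≤-trans (*-monoˡ-≤ (b ^ (Q ∸ 1)) (≤-trans (≤-reflexive (*-identityʳ (suc b))) (≤-trans (0<b ⟨+⟩ ≤-refl {b}) (≤-reflexive (cong (b +_) (sym (+-identityʳ b)))))))
                       (≤-reflexive (trans (*-assoc 2 b _) (cong (λ q → 2 * b ^ q) (m+[n∸m]≡n 0<Q))))

    Den≤Num : ∀ e s → Den e s ≤ Num e s
    Den≤Num e s = ^-monoˡ-≤ (2 * e) (n≤1+n κ) ⟨*⟩ ^-monoˡ-≤ (2 * (c * s)) (n≤1+n b)

    Φ≤ : ∀ (ψ : Bij n) → Φ (to ψ) (t ∷ []) rem ≤ K * 2 * b ^ Q
    Φ≤ ψ = begin
      Φ (to ψ) (t ∷ []) rem             ≤⟨ ∑-≤const (n * (b ^ Q + 2 * b ^ Q)) (λ u → ∑-≤const (b ^ Q + 2 * b ^ Q) (λ w → ≤-reflexive (trans (cong wt (degTest-0 ψ w)) wt-0) ⟨+⟩ wt≤ (starTest≤1 (to ψ) u w))) ⟩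
      n * (n * (b ^ Q + 2 * b ^ Q))     ≤⟨ certify (≤-refl {0}) (n * n * b ^ Q) (r n (b ^ Q)) ⟩
      2 * n * n * 2 * b ^ Q             ∎
      where
      open ≤-Reasoning
      r : ∀ n q → n * (n * (q + 2 * q)) + 0 + n * n * q ≡ 2 * n * n * 2 * q + 0
      r = solve-∀

    root-only : ∀ {P : Fin n → Set} → (∀ x → x ∈ t ∷ [] → x ≢ t → P x)
    root-only x (here e) q = ⊥-elim (q e)

    initial : ∀ (ψ : Bij n) → to ψ t ≡ v → Inv (t ∷ []) rem ψ
    initial ψ ψt = record
      { t∈ = here refl ; ok = ordered ; uniqS = [] ∷ [] ; all = covers ; closed = root-only ; ψt = ψt ; edges = root-only
      ; deepCl = λ { y (here refl) d → ⊥-elim (true≢false d t-shallow) }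
      ; pot = ≤-trans (Φ≤ ψ ⟨*⟩ Den≤Num 1 (shallow (t ∷ []))) (≤-reflexive (r (K * 2) (b ^ Q) (Num 1 (shallow (t ∷ []))))) }
      where
      r : ∀ a x y → a * x * y ≡ a * y * x
      r = solve-∀

    n≤2rem : 2 ≤ n → n ≤ 2 * length rem
    n≤2rem h = ≤-trans n≤rem (≤-trans (≤-pred (≤-trans h n≤rem) ⟨+⟩ ≤-refl) (≤-reflexive (cong (length rem +_) (sym (+-identityʳ _)))))

  Outcome : ∀ {n} (G T : Graph n) (t v : Fin n) → Set
  Outcome {n} G T t v = Σ (Bij n) λ ψ → (to ψ t ≡ v) × (∀ x y → adj T x y ≡ true → adj G (to ψ x) (to ψ y) ≡ true)

  -- The random embedding is uniform on the list of outcomes, which may contain repetitions.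
  record SpreadFamily {n} (G T : Graph n) (t v : Fin n) (r : ℕ) : Set where
    field
      outcomes : List (Outcome G T t v)
      nonempty : 1 ≤ length outcomes
      spread   : ∀ S → ValidC t S → sumL (λ o → 𝟙 (sat (proj₁ o) S)) outcomes * n ^ length S ≤ r ^ length S * length outcomes

  sumL-map : ∀ {A B : Set} (f : B → ℕ) (g : A → B) xs → sumL f (map g xs) ≡ sumL (f ∘ g) xs
  sumL-map f g []       = refl
  sumL-map f g (x ∷ xs) = cong (f (g x) +_) (sumL-map f g xs)

  module Assemble (k Δ : ℕ) (0<k : 1 ≤ k) where
    private module Con = Constants k Δ 0<k

    rate : ℕ
    rate = 6 * (2 * Con.G₁) * 3 ^ (2 * Con.G₁)

    module _ {n} (n≥ : Con.n₀ ≤ n) (G T : Graph n) (δ : ∀ w → (k + 2) * n ≤ 2 * k * cnt (adj G w)) {t : Fin n} (v : Fin n)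
             (R : Rooted T t) (deg≤ : ∀ x → cnt (adj T x) ≤ Δ) (u g : ℕ)
             (Eu≤ : Con.E * u ≤ n) (n≤ : n ≤ 2 * Con.E * u) (Gg≤ : Con.G₁ * g ≤ n) (n≤g : n ≤ 2 * Con.G₁ * g) where
      open Con using (h; H')
      open Shift R H' (λ l → (l Data.Nat.<ᵇ suc (2 * h)) ∨ (l Data.Nat.≡ᵇ H')) using (good-shift; levelAt; nextℓ)

      σ : ℕ
      σ = proj₁ good-shift

      open Decompose R Δ deg≤ H' σ h (proj₁ (proj₂ good-shift)) hiding (geo)

      same-level : ∀ d → lev d ≡ levelAt σ d
      same-level zero    = refl
      same-level (suc d) = cong nextℓ (same-level d)

      S̄ : ℕ
      S̄ = cnt (λ y → not (deep y))

      u₀≤u : Con.u₀ ≤ u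
      u₀≤u = cancelˡ {2 * Con.E} (*-pos {2} (s≤s z≤n) Con.0<E) (≤-trans (big {2 + Con.E + Con.G₁} n≥) n≤)
        where
        big : ∀ {a x e m} → a + x + e ≤ m → x ≤ m
        big {a} {x} {e} p = ≤-trans (≤-trans (m≤n+m x a) (m≤m+n _ e)) p

      cS̄≤u : Con.c * S̄ ≤ u
      cS̄≤u = Con.shallow-small (subst (λ m → suc H' * m ≤ n * Σℕ (suc H') (λ l → 𝟙 (badLevel l))) (∑-cong (λ x → cong (λ l → 𝟙 (badLevel l)) (sym (same-level (Rooted.depth R x)))))
        (proj₂ (proj₂ good-shift))) (Σℕ-badLevel (suc H') h H') n≤ u₀≤u shallow-count

      2≤n : 2 ≤ n
      2≤n = ≤-trans (m≤m+n 2 (Con.E + Con.G₁ + 2 * Con.E * Con.u₀ + _)) (≤-trans (≤-reflexive (r 2 Con.E Con.G₁ (2 * Con.E * Con.u₀) _)) n≥)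
        where
        r : ∀ a b c d e → a + (b + c + d + e) ≡ a + b + c + d + e
        r = solve-∀

      𝒮 : Setting
      𝒮 = record { params = Con.params n u g S̄ ; valid = Con.valid n≥ Eu≤ n≤ Gg≤ cS̄≤u ; G = G ; T = T ; t = t ; v = v ; R = R ; deg≤ = deg≤
                 ; deep = deep ; t-shallow = deep-t ; |shallow| = ≤-refl }

      open Bulk 𝒮 using (Blocks; []; _∷_; embed)

      blocks : ∀ ρs → (∀ ρ → ρ ∈ ρs → ρ ≢ t × isTop ρ ≡ true) → Blocks (flat ρs)
      blocks []       h = []
      blocks (ρ ∷ ρs) h = block ρ (proj₂ (h ρ (here refl))) (proj₁ (h ρ (here refl))) ∷ blocks ρs (λ r p → h r (there p))

      xs : List (Fin n)
      xs = flat tops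

      private module Init = Initial 𝒮 (≤-trans (s≤s z≤n) 2≤n) δ xs ordering exhaustive
      open Finish G T t v R Δ g deg≤ using (Good)
      open Strategy g Good using (Strat)

      strategy : ∀ ψ → to ψ t ≡ v → Strat xs ψ
      strategy ψ e = embed {t ∷ []} ψ (blocks tops tops-spec) (Init.initial ψ e)

      0<g : 1 ≤ g
      0<g = go g refl
        where
        go : ∀ x → g ≡ x → 1 ≤ g
        go (suc x) e = ≤-trans (s≤s z≤n) (≤-reflexive (sym e))
        go zero    e = ⊥-elim (<-irrefl refl (≤-trans (≤-trans (s≤s z≤n) 2≤n) (≤-trans n≤g (≤-reflexive (trans (cong (2 * Con.G₁ *_) e) (*-zeroʳ (2 * Con.G₁)))))))

      private module Proc = Process g Good t v xs (Ok-unique ordering) (Ok-fresh ordering (here refl)) exhaustive strategy (2 * Con.G₁) 0<g n≤g (Init.n≤2rem 2≤n)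
      open Spread g Good t using (State; bij; strat)

      outcome : State [] → Outcome G T t v
      outcome s = bij s , proj₁ (strat s) , λ x y a → [ (λ { (q , refl) → proj₂ (strat s) x q })
                                                      , (λ { (q , refl) → trans (adj-sym G _ _) (proj₂ (strat s) y q) }) ]′ (Rooted.edge-par R x y a)

      family : SpreadFamily G T t v rate
      family = record
        { outcomes = map outcome Proc.outcomes
        ; nonempty = ≤-trans Proc.0<outcomes (≤-reflexive (sym (length-map outcome Proc.outcomes)))
        ; spread = λ S V → subst₂ (λ a l → a * n ^ length S ≤ rate ^ length S * l) (sym (sumL-map _ outcome Proc.outcomes)) (sym (length-map outcome Proc.outcomes)) (Proc.spread S V) }

  -- From counting to rational probabilities.

  open import Data.Integer using (+_)
  import Data.Integer as ℤ
  import Data.Integer.Properties as ℤₚ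
  open import Data.Rational using (ℚ; 0ℚ; 1ℚ; ½; mkℚ; toℚᵘ)
  import Data.Rational as ℚ
  import Data.Rational.Properties as ℚₚ
  import Data.Rational.Unnormalised as ℚᵘ
  import Data.Rational.Unnormalised.Properties as ℚᵘₚ
  open import Data.Rational.Solver using (module +-*-Solver)
  open import Data.List using (foldr; tabulate)
  open import Data.List.Properties using (length-tabulate; map-tabulate)
  open import Data.List.Relation.Unary.Unique.Propositional.Properties using (tabulate⁺)
  open import Data.List.Membership.Propositional.Properties using (∈-tabulate⁻)
  open import Data.Bool.ListAction using (and)
  open import Relation.Nullary.Decidable using (⌊_⌋)

  ι : ℕ → ℚ
  ι m = + m ℚ./ 1

  ιᵘ : ℕ → ℚᵘ.ℚᵘ
  ιᵘ m = ℚᵘ.mkℚᵘ (+ m) 0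

  toℚᵘ-ι : ∀ m → toℚᵘ (ι m) ℚᵘ.≃ ιᵘ m
  toℚᵘ-ι m = ℚₚ.toℚᵘ-fromℚᵘ (ιᵘ m)

  ι-+ : ∀ a b → ι (a + b) ≡ ι a ℚ.+ ι b
  ι-+ a b = ℚₚ.toℚᵘ-injective (ℚᵘₚ.≃-trans (toℚᵘ-ι (a + b)) (ℚᵘₚ.≃-trans (ℚᵘ.*≡* (cong (ℤ._* + 1) eq))
    (ℚᵘₚ.≃-sym (ℚᵘₚ.≃-trans (ℚₚ.toℚᵘ-homo-+ (ι a) (ι b)) (ℚᵘₚ.+-cong (toℚᵘ-ι a) (toℚᵘ-ι b))))))
    where
    eq : + (a + b) ≡ + a ℤ.* + 1 ℤ.+ + b ℤ.* + 1
    eq = trans (ℤₚ.pos-+ a b) (sym (cong₂ ℤ._+_ (ℤₚ.*-identityʳ (+ a)) (ℤₚ.*-identityʳ (+ b))))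

  ι-* : ∀ a b → ι (a * b) ≡ ι a ℚ.* ι b
  ι-* a b = ℚₚ.toℚᵘ-injective (ℚᵘₚ.≃-trans (toℚᵘ-ι (a * b)) (ℚᵘₚ.≃-trans (ℚᵘ.*≡* (cong (ℤ._* + 1) (ℤₚ.pos-* a b)))
    (ℚᵘₚ.≃-sym (ℚᵘₚ.≃-trans (ℚₚ.toℚᵘ-homo-* (ι a) (ι b)) (ℚᵘₚ.*-cong (toℚᵘ-ι a) (toℚᵘ-ι b))))))

  ι-mono : ∀ {a b} → a ≤ b → ι a ℚ.≤ ι b
  ι-mono {a} {b} h = ℚₚ.toℚᵘ-cancel-≤ (ℚᵘₚ.≤-trans (ℚᵘₚ.≤-reflexive (toℚᵘ-ι a)) (ℚᵘₚ.≤-trans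
    (ℚᵘ.*≤* (ℤₚ.*-monoʳ-≤-nonNeg (+ 1) (ℤ.+≤+ h))) (ℚᵘₚ.≤-reflexive (ℚᵘₚ.≃-sym (toℚᵘ-ι b)))))

  ι-cancel : ∀ {a b} → ι a ℚ.≤ ι b → a ≤ b
  ι-cancel {a} {b} h = go (ℚᵘₚ.≤-trans (ℚᵘₚ.≤-reflexive (ℚᵘₚ.≃-sym (toℚᵘ-ι a))) (ℚᵘₚ.≤-trans (ℚₚ.toℚᵘ-mono-≤ h) (ℚᵘₚ.≤-reflexive (toℚᵘ-ι b))))
    where
    go : ιᵘ a ℚᵘ.≤ ιᵘ b → a ≤ b
    go (ℚᵘ.*≤* p) = ℤₚ.drop‿+≤+ (subst₂ ℤ._≤_ (ℤₚ.*-identityʳ (+ a)) (ℤₚ.*-identityʳ (+ b)) p)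

  ι-nonNeg : ∀ m → ℚ.NonNegative (ι m)
  ι-nonNeg m = ℚₚ.normalize-nonNeg m 1

  recip : ∀ n .{{_ : NonZero n}} → ℚ
  recip n = + 1 ℚ./ n

  recip-nonNeg : ∀ n .{{_ : NonZero n}} → ℚ.NonNegative (recip n)
  recip-nonNeg n = ℚₚ.normalize-nonNeg 1 n

  ι-recip : ∀ n .{{_ : NonZero n}} → ι n ℚ.* recip n ≡ 1ℚ
  ι-recip (suc m) = ℚₚ.toℚᵘ-injective (ℚᵘₚ.≃-trans (ℚₚ.toℚᵘ-homo-* (ι (suc m)) (recip (suc m)))
    (ℚᵘₚ.≃-trans (ℚᵘₚ.*-cong (toℚᵘ-ι (suc m)) (ℚₚ.toℚᵘ-fromℚᵘ (ℚᵘ.mkℚᵘ (+ 1) m)))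
      (ℚᵘ.*≡* (cong +_ (e m)))))
    where
    e : ∀ m → suc m * 1 * 1 ≡ 1 * (1 * suc m)
    e = solve-∀

  ^ℚ-dist : ∀ p q s → (p ℚ.* q) ^ℚ s ≡ (p ^ℚ s) ℚ.* (q ^ℚ s)
  ^ℚ-dist p q zero    = sym (ℚₚ.*-identityˡ 1ℚ)
  ^ℚ-dist p q (suc s) = trans (cong (p ℚ.* q ℚ.*_) (^ℚ-dist p q s))
    (+-*-Solver.solve 4 (λ a b c d → a :* b :* (c :* d) := a :* c :* (b :* d)) refl p q (p ^ℚ s) (q ^ℚ s))
    where open +-*-Solver

  ι-^ : ∀ a s → ι (a ^ s) ≡ ι a ^ℚ s
  ι-^ a zero    = refl
  ι-^ a (suc s) = trans (ι-* a (a ^ s)) (cong (ι a ℚ.*_) (ι-^ a s))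

  1^ℚ : ∀ s → 1ℚ ^ℚ s ≡ 1ℚ
  1^ℚ zero    = refl
  1^ℚ (suc s) = trans (ℚₚ.*-identityˡ _) (1^ℚ s)

  *-nonNeg : ∀ {p q} → 0ℚ ℚ.≤ p → 0ℚ ℚ.≤ q → 0ℚ ℚ.≤ p ℚ.* q
  *-nonNeg {p} {q} hp hq = ℚₚ.≤-trans (ℚₚ.≤-reflexive (sym (ℚₚ.*-zeroˡ q))) (ℚₚ.*-monoʳ-≤-nonNeg q {{ℚ.nonNegative hq}} hp)

  *-mono : ∀ {p q r s} → 0ℚ ℚ.≤ p → 0ℚ ℚ.≤ s → p ℚ.≤ q → r ℚ.≤ s → p ℚ.* r ℚ.≤ q ℚ.* s
  *-mono {p} {q} {r} {s} hp hs pq rs = ℚₚ.≤-trans (ℚₚ.*-monoˡ-≤-nonNeg p {{ℚ.nonNegative hp}} rs) (ℚₚ.*-monoʳ-≤-nonNeg s {{ℚ.nonNegative hs}} pq)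

  ^ℚ-nonNeg : ∀ {p} s → 0ℚ ℚ.≤ p → 0ℚ ℚ.≤ p ^ℚ s
  ^ℚ-nonNeg zero    h = ℚₚ.nonNegative⁻¹ 1ℚ
  ^ℚ-nonNeg (suc s) h = *-nonNeg h (^ℚ-nonNeg s h)

  ^ℚ-mono : ∀ {p q} s → 0ℚ ℚ.≤ p → p ℚ.≤ q → p ^ℚ s ℚ.≤ q ^ℚ s
  ^ℚ-mono zero    h pq = ℚₚ.≤-refl
  ^ℚ-mono (suc s) h pq = *-mono h (^ℚ-nonNeg s (ℚₚ.≤-trans h pq)) pq (^ℚ-mono s h pq)

  isYes-intro : ∀ {P : Set} (d : Dec P) → P → ⌊ d ⌋ ≡ true
  isYes-intro (yes _) _ = refl
  isYes-intro (no ¬p) p = ⊥-elim (¬p p)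

  isYes-elim : ∀ {P : Set} (d : Dec P) → ⌊ d ⌋ ≡ true → P
  isYes-elim (yes p) _ = p

  and-elim : ∀ {A : Set} (p : A → Bool) xs → and (map p xs) ≡ true → ∀ {x} → x ∈ xs → p x ≡ true
  and-elim p (x ∷ xs) h (here refl) = proj₁ (∧-true {p x} h)
  and-elim p (x ∷ xs) h (there q)   = and-elim p xs (proj₂ (∧-true {p x} h)) q

  deg-cnt : ∀ {n} (G : Graph n) v → deg G v ≡ cnt (adj G v)
  deg-cnt {n} G v = trans (go (allFin n)) (sumL-allFin _)
    where
    go : ∀ xs → countTrue (map (adj G v) xs) ≡ sumL (λ x → 𝟙 (adj G v x)) xs
    go []       = refl
    go (x ∷ xs) = trans (one (adj G v x)) (cong (_+_ (𝟙 (adj G v x))) (go xs))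
      where
      one : ∀ b → countTrue (b ∷ map (adj G v) xs) ≡ 𝟙 b + countTrue (map (adj G v) xs)
      one true  = refl
      one false = refl

  -- k is the denominator of α, and the numerator a is at least 1; so 1/k serves as an integral
  -- measure of the surplus α.
  positive-fraction : ∀ α → 0ℚ ℚ.< α → ∃ λ k → ∃ λ a → 1 ≤ k × 1 ≤ a × ι k ℚ.* α ≡ ι a
  positive-fraction α@(mkℚ (+ zero) d _) (ℚ.*<* (ℤ.+<+ ()))
  positive-fraction α@(mkℚ (+ suc p) d _) h = suc d , suc p , s≤s z≤n , s≤s z≤n ,
    ℚₚ.toℚᵘ-injective (ℚᵘₚ.≃-trans (ℚₚ.toℚᵘ-homo-* (ι (suc d)) α) (ℚᵘₚ.≃-trans (ℚᵘₚ.*-cong (toℚᵘ-ι (suc d)) (ℚᵘₚ.≃-refl {toℚᵘ α}))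
      (ℚᵘₚ.≃-trans (ℚᵘ.*≡* (cong +_ (e d p))) (ℚᵘₚ.≃-sym (toℚᵘ-ι (suc p))))))
    where
    e : ∀ d p → suc d * suc p * 1 ≡ suc p * (1 * suc d)
    e = solve-∀
  positive-fraction α@(mkℚ ℤ.-[1+ _ ] d _) (ℚ.*<* ())

  -- Multiplication by 2k clears the fractions: 2k(1/2 + α) = k + 2a ≥ k + 2.
  degree-bound : ∀ {n} (G : Graph n) α k a → 1 ≤ a → ι k ℚ.* α ≡ ι a → MinDegreeAtLeast G ((½ ℚ.+ α) ℚ.* (+ n ℚ./ 1)) →
                 ∀ w → (k + 2) * n ≤ 2 * k * cnt (adj G w)
  degree-bound {n} G α k a 0<a kα mindeg w = ≤-trans (*-monoˡ-≤ n (≤-refl {k} ⟨+⟩ 2 ⊛ 0<a))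
    (≤-trans (ι-cancel (ℚₚ.≤-trans (ℚₚ.≤-reflexive left) (ℚₚ.≤-trans (ℚₚ.*-monoˡ-≤-nonNeg (ι (2 * k)) {{ι-nonNeg (2 * k)}} (mindeg w)) (ℚₚ.≤-reflexive (sym (ι-* (2 * k) (deg G w)))))))
      (≤-reflexive (cong (2 * k *_) (deg-cnt G w))))
    where
    open ≡-Reasoning
    left : ι ((k + 2 * a) * n) ≡ ι (2 * k) ℚ.* ((½ ℚ.+ α) ℚ.* ι n)
    left = begin
      ι ((k + 2 * a) * n)                                          ≡⟨ trans (ι-* (k + 2 * a) n) (cong (ℚ._* ι n) (trans (ι-+ k (2 * a)) (cong (ℚ._+_ (ι k)) (trans (ι-* 2 a) (cong (ι 2 ℚ.*_) (sym kα)))))) ⟩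
      (ι k ℚ.+ ι 2 ℚ.* (ι k ℚ.* α)) ℚ.* ι n                        ≡⟨ cong (λ x → (x ℚ.+ ι 2 ℚ.* (ι k ℚ.* α)) ℚ.* ι n) (sym (trans (cong (ι k ℚ.*_) two-halves) (ℚₚ.*-identityʳ (ι k)))) ⟩
      (ι k ℚ.* (ι 2 ℚ.* ½) ℚ.+ ι 2 ℚ.* (ι k ℚ.* α)) ℚ.* ι n        ≡⟨ +-*-Solver.solve 5 (λ k t h α n → (k :* (t :* h) :+ t :* (k :* α)) :* n := t :* k :* ((h :+ α) :* n)) refl (ι k) (ι 2) ½ α (ι n) ⟩
      ι 2 ℚ.* ι k ℚ.* ((½ ℚ.+ α) ℚ.* ι n)                          ≡⟨ cong (ℚ._* ((½ ℚ.+ α) ℚ.* ι n)) (sym (ι-* 2 k)) ⟩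
      ι (2 * k) ℚ.* ((½ ℚ.+ α) ℚ.* ι n)                            ∎
      where
      open +-*-Solver
      two-halves : ι 2 ℚ.* ½ ≡ 1ℚ
      two-halves = refl

  module Uniform {n} .{{nz : NonZero n}} (G T : Graph n) (t v : Fin n) (r : ℕ) (ℱ : SpreadFamily G T t v r) where
    open SpreadFamily ℱ

    W : ℕ
    W = length outcomes

    instance
      W-nonZero : NonZero W
      W-nonZero = >-nonZero nonempty

    weight : ℚ
    weight = recip W

    weight-nonNeg : 0ℚ ℚ.≤ weight
    weight-nonNeg = ℚₚ.nonNegative⁻¹ weight {{recip-nonNeg W}}

    embedding : Outcome G T t v → Embedding T G
    embedding (ψ , _ , edges) = to ψ , to-inj ψ , edges

    atoms : List (Outcome G T t v) → List (Embedding T G × ℚ)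
    atoms = map (λ o → embedding o , weight)

    one-more : ∀ m → weight ℚ.+ ι m ℚ.* weight ≡ ι (suc m) ℚ.* weight
    one-more m = trans (cong (ℚ._+ ι m ℚ.* weight) (sym (ℚₚ.*-identityˡ weight)))
      (trans (sym (ℚₚ.*-distribʳ-+ weight 1ℚ (ι m))) (cong (ℚ._* weight) (sym (ι-+ 1 m))))

    mass : ∀ os → foldr (λ p s → proj₂ p ℚ.+ s) 0ℚ (atoms os) ≡ ι (length os) ℚ.* weight
    mass []       = sym (ℚₚ.*-zeroˡ weight)
    mass (o ∷ os) = trans (cong (weight ℚ.+_) (mass os)) (one-more (length os))

    uniform : Distribution (Embedding T G)
    uniform = record
      { support = atoms outcomes
      ; nonneg  = weights≥0 outcomes
      ; total   = trans (mass outcomes) (ι-recip W) }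
      where
      weights≥0 : ∀ os → All (λ p → 0ℚ ℚ.≤ proj₂ p) (atoms os)
      weights≥0 []       = []
      weights≥0 (o ∷ os) = weight-nonNeg ∷ weights≥0 os

    Pr-count : ∀ (E : Embedding T G → Bool) → Pr uniform E ≡ ι (sumL (λ o → 𝟙 (E (embedding o))) outcomes) ℚ.* weight
    Pr-count E = go outcomes
      where
      go : ∀ os → foldr (λ p s → (if E (proj₁ p) then proj₂ p else 0ℚ) ℚ.+ s) 0ℚ (atoms os) ≡ ι (sumL (λ o → 𝟙 (E (embedding o))) os) ℚ.* weight
      go []       = sym (ℚₚ.*-zeroˡ weight)
      go (o ∷ os) = trans (cong ((if E (embedding o) then weight else 0ℚ) ℚ.+_) (go os)) (one (E (embedding o)))
        where
        m = sumL (λ o → 𝟙 (E (embedding o))) os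
        one : ∀ b → (if b then weight else 0ℚ) ℚ.+ ι m ℚ.* weight ≡ ι (𝟙 b + m) ℚ.* weight
        one true  = one-more m
        one false = ℚₚ.+-identityˡ _

    rooted : MapsWithProbOne T G uniform t v
    rooted = trans (Pr-count (λ e → ⌊ proj₁ e t F.≟ v ⌋))
      (trans (cong (λ m → ι m ℚ.* weight) (trans (sumL-cong outcomes (λ o _ → cong 𝟙 (isYes-intro (to (proj₁ o) t F.≟ v) (proj₁ (proj₂ o))))) (sumL-1 outcomes))) (ι-recip W))

    -- Dividing the counting bound by `W` n^s gives (r/n)^s, and any q above r follows by
    -- monotonicity; so the bound on n need not grow with the constant.
    spread-away : ∀ q → ι r ℚ.≤ q → SpreadAway T G uniform t (q ℚ.* (+ 1 ℚ./ n))
    spread-away q r≤q s xs ys xs-inj xs≢t ys-inj = begin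
      Pr uniform (λ e → AllMapped xs ys (proj₁ e))            ≡⟨ Pr-count (λ e → AllMapped xs ys (proj₁ e)) ⟩
      ι hits ℚ.* weight                                       ≤⟨ ℚₚ.*-monoʳ-≤-nonNeg weight {{recip-nonNeg W}} (ι-mono hits≤) ⟩
      ι occ ℚ.* weight                                        ≡⟨ trans (sym (ℚₚ.*-identityʳ _)) (cong (ι occ ℚ.* weight ℚ.*_) (sym (trans (cong (_^ℚ s) (ι-recip n)) (1^ℚ s)))) ⟩
      ι occ ℚ.* weight ℚ.* ((ι n ℚ.* recip n) ^ℚ s)           ≡⟨ cong (ι occ ℚ.* weight ℚ.*_) (trans (^ℚ-dist (ι n) (recip n) s) (cong (ℚ._* (recip n ^ℚ s)) (sym (ι-^ n s)))) ⟩
      ι occ ℚ.* weight ℚ.* (ι (n ^ s) ℚ.* (recip n ^ℚ s))     ≡⟨ +-*-Solver.solve 4 (λ a b c d → a :* b :* (c :* d) := a :* c :* (b :* d)) refl (ι occ) weight (ι (n ^ s)) (recip n ^ℚ s) ⟩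
      ι occ ℚ.* ι (n ^ s) ℚ.* (weight ℚ.* (recip n ^ℚ s))     ≤⟨ ℚₚ.*-monoʳ-≤-nonNeg (weight ℚ.* (recip n ^ℚ s)) {{ℚ.nonNegative (*-nonNeg weight-nonNeg (^ℚ-nonNeg s recip≥0))}} bound ⟩
      ι (r ^ s) ℚ.* ι W ℚ.* (weight ℚ.* (recip n ^ℚ s))       ≡⟨ +-*-Solver.solve 4 (λ a b c d → a :* b :* (c :* d) := b :* c :* (a :* d)) refl (ι (r ^ s)) (ι W) weight (recip n ^ℚ s) ⟩
      ι W ℚ.* weight ℚ.* (ι (r ^ s) ℚ.* (recip n ^ℚ s))       ≡⟨ trans (cong (ℚ._* (ι (r ^ s) ℚ.* (recip n ^ℚ s))) (ι-recip W)) (ℚₚ.*-identityˡ _) ⟩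
      ι (r ^ s) ℚ.* (recip n ^ℚ s)                            ≡⟨ trans (cong (ℚ._* (recip n ^ℚ s)) (ι-^ r s)) (sym (^ℚ-dist (ι r) (recip n) s)) ⟩
      (ι r ℚ.* recip n) ^ℚ s                                  ≤⟨ ^ℚ-mono s (*-nonNeg (ℚₚ.nonNegative⁻¹ (ι r) {{ι-nonNeg r}}) recip≥0) (ℚₚ.*-monoʳ-≤-nonNeg (recip n) {{recip-nonNeg n}} r≤q) ⟩
      (q ℚ.* recip n) ^ℚ s                                    ∎
      where
      open ℚₚ.≤-Reasoning
      open +-*-Solver using (_:*_; _:=_)
      recip≥0 : 0ℚ ℚ.≤ recip n
      recip≥0 = ℚₚ.nonNegative⁻¹ (recip n) {{recip-nonNeg n}}
      S : Constraint n
      S = tabulate (λ i → xs i , ys i)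
      V : ValidC t S
      V = record
        { uniq₁ = subst Unique (sym (map-tabulate (λ i → xs i , ys i) proj₁)) (tabulate⁺ xs-inj)
        ; uniq₂ = subst Unique (sym (map-tabulate (λ i → xs i , ys i) proj₂)) (tabulate⁺ ys-inj)
        ; avoid = λ p → avoids (∈-tabulate⁻ (subst (t ∈_) (map-tabulate (λ i → xs i , ys i) proj₁) p)) }
        where
        avoids : (∃ λ i → t ≡ xs i) → ⊥
        avoids (i , e) = xs≢t i (sym e)
      hits occ : ℕ
      hits = sumL (λ o → 𝟙 (AllMapped xs ys (to (proj₁ o)))) outcomes
      occ  = sumL (λ o → 𝟙 (sat (proj₁ o) S)) outcomes
      hits≤ : hits ≤ occ
      hits≤ = sumL-mono outcomes (λ o _ → 𝟙-mono (λ h → sat-intro (proj₁ o) S (λ p → met (proj₁ o) h (∈-tabulate⁻ p))))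
        where
        met : ∀ ψ → AllMapped xs ys (to ψ) ≡ true → ∀ {a w} → (∃ λ i → (a , w) ≡ (xs i , ys i)) → to ψ a ≡ w
        met ψ h (i , refl) = isYes-elim (to ψ (xs i) F.≟ ys i) (and-elim (λ i → ⌊ to ψ (xs i) F.≟ ys i ⌋) (allFin s) h (∈-allFin i))
      bound : ι occ ℚ.* ι (n ^ s) ℚ.≤ ι (r ^ s) ℚ.* ι W
      bound = ℚₚ.≤-trans (ℚₚ.≤-reflexive (sym (ι-* occ (n ^ s)))) (ℚₚ.≤-trans (ι-mono (subst (λ l → occ * n ^ l ≤ r ^ l * W) (length-tabulate (λ i → xs i , ys i)) (spread S V))) (ℚₚ.≤-reflexive (ι-* (r ^ s) W)))

  module Main (α : ℚ) (0<α : 0ℚ ℚ.< α) (Δ : ℕ) where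
    k a : ℕ
    k = proj₁ (positive-fraction α 0<α)
    a = proj₁ (proj₂ (positive-fraction α 0<α))

    kα : 1 ≤ k × 1 ≤ a × ι k ℚ.* α ≡ ι a
    kα = proj₂ (proj₂ (positive-fraction α 0<α))

    open Constants k Δ (proj₁ kα) using (E; G₁; 0<E; 0<G₁; u₀)
    open Constants k Δ (proj₁ kα) using (n₀) public
    open Assemble k Δ (proj₁ kα) using (family)
    open Assemble k Δ (proj₁ kα) using (rate) public

    module _ {n : ℕ} (n≥ : n₀ ≤ n) (G T : Graph n) (δ : MinDegreeAtLeast G ((½ ℚ.+ α) ℚ.* (+ n ℚ./ 1)))
             (tree : IsTree T) (Δ≤ : MaxDegreeAtMost T Δ) (t v : Fin n) where

      E≤n : E ≤ n
      E≤n = ≤-trans (≤-trans (≤-trans (≤-trans (m≤n+m E 2) (m≤m+n _ G₁)) (m≤m+n _ (2 * E * u₀))) (m≤m+n _ _)) n≥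

      G₁≤n : G₁ ≤ n
      G₁≤n = ≤-trans (≤-trans (≤-trans (m≤n+m G₁ (2 + E)) (m≤m+n _ (2 * E * u₀))) (m≤m+n _ _)) n≥

      ℱ : SpreadFamily G T t v rate
      ℱ = split (quotient n E 0<E E≤n) (quotient n G₁ 0<G₁ G₁≤n)
        where
        split : (∃ λ u → E * u ≤ n × n ≤ 2 * E * u) → (∃ λ g → G₁ * g ≤ n × n ≤ 2 * G₁ * g) → SpreadFamily G T t v rate
        split (u , Eu≤ , n≤) (g , Gg≤ , n≤g) = family n≥ G T (degree-bound G α k a (proj₁ (proj₂ kα)) (proj₂ (proj₂ kα)) δ) v
          (TreeRoot.rooted T (proj₁ tree) (proj₂ tree) t) (λ x → ≤-trans (≤-reflexive (sym (deg-cnt T x))) (Δ≤ x)) u g Eu≤ n≤ Gg≤ n≤g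

open import Defs
open import Data.Nat using (ℕ; _≥_; NonZero)
open import Data.Fin using (Fin)
open import Data.Product using (Σ; _×_; _,_; ∃-syntax)
open import Data.Integer using (+_)
open import Data.Rational using (ℚ; 0ℚ; ½; _<_; _≤_; _+_; _*_; _/_)

theorem3p3 : ∀ (α : ℚ) → 0ℚ < α → ∀ (Δ : ℕ) →
    ∃[ C₀ ] (∀ (C* : ℚ) → C₀ ≤ C* →
    ∃[ n₀ ] (∀ (n : ℕ) → .{{_ : NonZero n}} → n ≥ n₀ →
    ∀ (G T : Graph n) →
    MinDegreeAtLeast G ((½ + α) * (+ n / 1)) →
    IsTree T → MaxDegreeAtMost T Δ →
    ∀ (t v : Fin n) →
    Σ (Distribution (Embedding T G)) (λ D →
    MapsWithProbOne T G D t v × SpreadAway T G D t (C* * (+ 1 / n)))))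
theorem3p3 α 0<α Δ = Development.ι C.rate , λ C* C₀≤C* → C.n₀ , λ n n≥ G T δ tree Δ≤ t v →
  let ℱ = C.ℱ n≥ G T δ tree Δ≤ t v
  in Development.Uniform.uniform G T t v C.rate ℱ , Development.Uniform.rooted G T t v C.rate ℱ , Development.Uniform.spread-away G T t v C.rate ℱ C* C₀≤C*
  where module C = Development.Main α 0<α Δ
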